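{- Let $p$ be a prime. Then \[ \deg ss^{(2*)}_{p}(X) = L^{(2*)}(p) \iff p\mid \# \mathbb{B},\qquad \deg ss^{(3*)}_{p}(X) = L^{(3*)}(p) \iff p\mid \# Fi^{\prime}_{24},\] where $\#\mathbb{B}=2^{41}\cdot 3^{13}\cdot 5^{6} \cdot 7^{2} \cdot 11\cdot 13 \cdot 17 \cdot 19 \cdot 23 \cdot 31 \cdot 47$ is the order of the Baby Monster group and $\#Fi'_{24}=2^{21}\cdot 3^{16}\cdot 5^{2}\cdot 7^{3}\cdot 11\cdot 13\cdot 17\cdot 23\cdot 29$ is the order of the Fischer group $Fi'_{24}$.
   Context: For a prime $p\ge5$ let $\nu=\tfrac12(1-(\tfrac{ -2}{p}))$, $\delta=\tfrac12(1-(\tfrac{ -3}{p}))$, $\varepsilon=\tfrac12(1-(\tfrac{ -1}{p}))$ (Legendre symbols), $m_2=[p/8]$, $m_3=[p/6]$, and define in $\mathbb{F}_p[X]$ $ss^{(2*)}_{p} (X) = X^{m_{2}+\varepsilon} (X-256)^{\nu } {}_{2}F_{1}( -m_{2} ,\tfrac{3}{8}-\tfrac{\varepsilon-2\nu}{4};1;\tfrac{256}{X} ) \bmod p$ and $ss^{(3*)}_{p} (X) = X^{m_{3}+\delta} (X-108)^{\delta } {}_{2}F_{1}( -m_{3} ,\tfrac{1}{3}+\tfrac{\delta}{3};1;\tfrac{108}{X} ) \bmod p$, where ${}_2F_1(-m,\beta;1;x)=\sum_{n=0}^{m}\frac{(-m)_n(\beta)_n}{(n!)^2}x^n$ with Pochhammer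 symbols $(a)_n=a(a+1)\cdots(a+n-1)$, and "$\bmod p$" means reducing the (p-integral rational) coefficients into $\mathbb{F}_p$. For $p\in\{2,3\}$ and $N\in\{2,3\}$ one sets $ss^{(N*)}_p(X)=X\in\mathbb{F}_p[X]$. For $N\in\{2,3\}$, $L^{(N*)}(p)$ denotes the number of linear factors of $ss^{(N*)}_p(X)$ in its factorization into irreducibles in $\mathbb{F}_p[X]$. -}

module Defs where

open import Data.Nat as ℕ using (ℕ; zero; suc; _+_; _*_; _∸_; _^_; _!)
open import Data.Nat.DivMod as DM using ()
open import Data.Integer as ℤ using (ℤ; +_)
open import Data.Rational as ℚ using (ℚ; ↥_; ↧ₙ_)
open import Data.Bool using (Bool; true; false; if_then_else_; _∨_)
open import Data.Bool.ListAction using (any)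
open import Data.List using (List; []; _∷_; length; upTo; foldr; replicate; map; filter; sum; applyUpTo)
open import Data.List.Relation.Unary.All using (All)
open import Relation.Binary.PropositionalEquality using (_≡_)
open import Relation.Nullary using (¬_)
open import Data.Product using (_×_)
open import Data.Sum using (_⊎_)

-- Arithmetic in F_p, elements represented by natural numbers, with
-- reduction  x ↦ x mod p  (p = 0 never occurs for primes; the zero
-- branch is only there to avoid carrying NonZero instances around).

modp : ℕ → ℕ → ℕ
modp zero    x = x
modp (suc q) x = x DM.% suc q

modpℤ : ℕ → ℤ → ℕ
modpℤ zero    z = ℤ.∣ z ∣
modpℤ (suc q) z = z ℤ.%ℕ suc q

-- inverse in F_p (for p prime and p ∤ d):  d^(p-2) mod p  (Fermat)
invp : ℕ → ℕ → ℕ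
invp p d = modp p (d ^ (p ∸ 2))

-- reduction mod p of a p-integral rational a/b (lowest terms, p ∤ b):
-- the element  a · b⁻¹  of F_p
redℚ : ℕ → ℚ → ℕ
redℚ p q = modp p (modpℤ p (↥ q) * invp p (↧ₙ q))

isSquare : ℕ → ℕ → Bool
isSquare p a = any (λ x → modp p (x * x) ℕ.≡ᵇ modp p a) (upTo p)

-- (1 - (a/p)) / 2  for a ≢ 0 mod p :  0 if a is a square mod p, 1 otherwise.
-- Here a is given as a natural number representative of the residue
-- (e.g. -1 is represented by p ∸ 1).
halfOneMinusLegendre : ℕ → ℕ → ℕ
halfOneMinusLegendre p a = if isSquare p a then 0 else 1

ν : ℕ → ℕ
ν p = halfOneMinusLegendre p (p ∸ 2)

δ : ℕ → ℕ
δ p = halfOneMinusLegendre p (p ∸ 3)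

ε : ℕ → ℕ
ε p = halfOneMinusLegendre p (p ∸ 1)

m₂ : ℕ → ℕ
m₂ p = p DM./ 8

m₃ : ℕ → ℕ
m₃ p = p DM./ 6

poch : ℚ → ℕ → ℚ
poch a zero    = ℚ.1ℚ
poch a (suc n) = poch a n ℚ.* (a ℚ.+ (+ n ℚ./ 1))

-- 1/k in ℚ (only used for k = (n!)^2 ≠ 0)
recipℕ : ℕ → ℚ
recipℕ zero    = ℚ.0ℚ
recipℕ (suc k) = + 1 ℚ./ suc k

ℕtoℚ : ℕ → ℚ
ℕtoℚ k = + k ℚ./ 1

-- n-th term coefficient of 2F1(-m, β; 1; x):  (-m)_n (β)_n / (n!)^2
hgCoeff : ℕ → ℚ → ℕ → ℚ
hgCoeff m β n = poch (ℚ.- ℕtoℚ m) n ℚ.* poch β n ℚ.* recipℕ (n ! * n !)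

-- Polynomials over F_p as ascending coefficient lists of naturals,
-- compared modulo p.

Poly : Set
Poly = List ℕ

coeff : Poly → ℕ → ℕ
coeff []       _       = 0
coeff (a ∷ f)  zero    = a
coeff (a ∷ f)  (suc i) = coeff f i

_≈[_]_ : Poly → ℕ → Poly → Set
f ≈[ p ] g = ∀ i → modp p (coeff f i) ≡ modp p (coeff g i)

addP : Poly → Poly → Poly
addP []      g       = g
addP f       []      = f
addP (a ∷ f) (b ∷ g) = (a + b) ∷ addP f g

scaleP : ℕ → Poly → Poly
scaleP c = map (c *_)

mulP : Poly → Poly → Poly
mulP []      g = []
mulP (a ∷ f) g = addP (scaleP a g) (0 ∷ mulP f g)

oneP : Poly
oneP = 1 ∷ []

XP : Poly
XP = 0 ∷ 1 ∷ []

prodP : List Poly → Poly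
prodP = foldr mulP oneP

powP : Poly → ℕ → Poly
powP f zero    = oneP
powP f (suc n) = mulP f (powP f n)

monomial : ℕ → ℕ → Poly
monomial c k = replicate k 0 ++' (c ∷ [])
  where
  _++'_ : List ℕ → List ℕ → List ℕ
  []      ++' ys = ys
  (x ∷ xs) ++' ys = x ∷ (xs ++' ys)

XminusP : ℕ → ℕ → Poly
XminusP p a = (p ∸ modp p a) ∷ 1 ∷ []

-- degree of a polynomial in F_p[X] (trailing coefficients ≡ 0 mod p are
-- ignored); the zero polynomial gets degree 0 by convention.
stripP : ℕ → Poly → Poly
stripP p []      = []
stripP p (a ∷ f) with stripP p f
... | []    = if modp p a ℕ.≡ᵇ 0 then [] else (a ∷ [])
... | g     = a ∷ g

deg : ℕ → Poly → ℕ
deg p f = length (stripP p f) ∸ 1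

Irreducible : ℕ → Poly → Set
Irreducible p f =
  (1 ℕ.≤ deg p f) ×
  (∀ g h → f ≈[ p ] mulP g h → (deg p g ≡ 0) ⊎ (deg p h ≡ 0))

-- fs is a factorization of f into irreducibles in F_p[X]
-- (constants are absorbed into the factors)
IsFactorization : ℕ → Poly → List Poly → Set
IsFactorization p f fs = All (Irreducible p) fs × (f ≈[ p ] prodP fs)

linearCount : ℕ → List Poly → ℕ
linearCount p fs = length (filter (λ g → deg p g ℕ.≟ 1) fs)

-- X^{m+e} · (X - c)^{nu} · 2F1(-m, β; 1; c/X)  mod p
--   = (X - c)^{nu} · Σ_{n=0}^{m} red((-m)_n (β)_n/(n!)^2 · c^n) X^{m+e-n}
ssGeneric : ℕ → (m e nu c : ℕ) → ℚ → Poly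
ssGeneric p m e nu c β =
  mulP (powP (XminusP p c) nu)
       (foldr addP []
          (applyUpTo (λ n → monomial (redℚ p (hgCoeff m β n ℚ.* ℕtoℚ (c ^ n)))
                                     (m + e ∸ n))
                     (suc m)))

isSmall : ℕ → Bool
isSmall p = (p ℕ.≡ᵇ 2) ∨ (p ℕ.≡ᵇ 3)

β₂ : ℕ → ℚ
β₂ p = (+ 3 ℚ./ 8) ℚ.- ((ℤ.+ ε p ℤ.- ℤ.+ (2 * ν p)) ℚ./ 4)

β₃ : ℕ → ℚ
β₃ p = (+ 1 ℚ./ 3) ℚ.+ (+ δ p ℚ./ 3)

ss2 : ℕ → Poly
ss2 p = if isSmall p then XP else ssGeneric p (m₂ p) (ε p) (ν p) 256 (β₂ p)

ss3 : ℕ → Poly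
ss3 p = if isSmall p then XP else ssGeneric p (m₃ p) (δ p) (δ p) 108 (β₃ p)

orderBabyMonster : ℕ
orderBabyMonster =
  2 ^ 41 * 3 ^ 13 * 5 ^ 6 * 7 ^ 2 * 11 * 13 * 17 * 19 * 23 * 31 * 47

orderFi24' : ℕ
orderFi24' =
  2 ^ 21 * 3 ^ 16 * 5 ^ 2 * 7 ^ 3 * 11 * 13 * 17 * 23 * 29

{-# OPTIONS --safe #-}
-- Write r for 2 or 3 (the level) and κ for 256 or 108.  The roots X ≠ 0, κ of the polynomial correspond through z = κ/X to the
-- zeros of a truncated hypergeometric polynomial φ(z), and by the quadratic transformation of Gauss to the zeros of a
-- polynomial ψ(u) with 4u(1 - u) = z.  The hypergeometric equation shows that these roots are simple and that the zero set of
-- ψ(v^r), in any 𝔽_p-algebra, is stable under the involution v ↦ (1 - v)/(1 + cv), with c = 3 for r = 2 and c = 2 for r = 3.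
--
-- If the polynomial splits over 𝔽_p, then each of its zeros x in any 𝔽_p-algebra satisfies x^p = x.  Apply this, for a root z,
-- to the image of v under the involution in 𝔽_p[√(1 - z)][v], where v^r = u: comparing the components of the Frobenius shows
-- that 1 - z is a square, hence u ∈ 𝔽_p, and for r = 2 that also u and 1 - u are squares, unless z is a zero of one of a few
-- fixed polynomials.  This is contradictory.  For r = 2 and p ≡ 1 mod 4, or r = 3 and p ≡ 1 mod 3, the curves
-- y² = x(x² + 2x + u) and xyz = u/27, x + y + z = 1 have a number of points which is known from ψ(u) = 0 and incompatible with
-- their automorphisms; in the other cases the involution once more makes -1, respectively -3, a square.
--
-- At most 10, respectively 12, roots z are exceptional, so p < 88, respectively p < 78, and for these primes the roots are counted.

module Submission where
open import Level using (0ℓ)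
open import Algebra.Bundles using (CommutativeRing; RawRing)
open import Algebra.Structures using (IsCommutativeRing)
import Algebra.Properties.Semiring.Exp as Exp
import Algebra.Properties.Semiring.Sum as Sums
import Algebra.Properties.CommutativeMonoid.Sum as MonoidSums
import Algebra.Properties.CommutativeSemiring.Binomial as Binomial
open import Algebra.Solver.Ring.AlmostCommutativeRing using (fromCommutativeRing; _-Raw-AlmostCommutative⟶_)
import Algebra.Solver.Ring as RingSolver
open import Data.Nat as ℕ using (ℕ; zero; suc; NonZero)
import Data.Nat.Properties as ℕₚ
open import Data.Nat.Properties using (≤-trans; ≤-reflexive; ≤-refl; <⇒≤; <⇒≱; m≤m+n; m≤n+m; ≮⇒≥; ≤-<-trans; <-≤-trans; <-trans; ≤-antisym; <⇒≢; n<1+n; suc-injective; 1+n≢0; m+[n∸m]≡n; m∸n≤m; +-mono-≤)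
open import Data.Nat.DivMod as DM using (_%_)
open import Data.Nat.Divisibility using (_∣_; divides; ∣⇒≤; m%n≡0⇒n∣m)
open import Data.Nat.Primality using (Prime; euclidsLemma; prime⇒nonZero; ¬prime[1])
open import Data.Nat.Combinatorics using (nCn≡1; nC1≡n; nCk+nC[k+1]≡[n+1]C[k+1]) renaming (_C_ to _choose_)
open import Data.Nat.Combinatorics.Specification using (k>n⇒nCk≡0)
open import Data.Integer as ℤ using (ℤ; -[1+_])
import Data.Integer.Properties as ℤₚ
open import Data.Fin using (Fin; zero; suc; toℕ; fromℕ; fromℕ<; inject₁)
import Data.Fin.Properties as Finₚ
open import Data.Fin.Permutation using (permutation)
open import Data.List using (List; []; _∷_; map; foldr; length; filter; _++_; replicate; upTo; applyUpTo; allFin)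
open import Data.List.Membership.Propositional using (_∈_)
open import Data.List.Membership.Propositional.Properties using (∈-filter⁺; ∈-allFin; ∈-++⁺ˡ; ∈-++⁺ʳ; ∈-map⁺)
open import Data.List.Relation.Unary.Any using (here; there)
open import Data.List.Relation.Unary.All.Properties using (all-filter)
import Data.List.Relation.Unary.Unique.Propositional.Properties as Uniqueₚ
import Data.List.Properties as Listₚ
import Data.List.Membership.DecPropositional
open import Data.List.Relation.Unary.All as All using (All; []; _∷_)
open import Data.List.Relation.Unary.AllPairs using ([]; _∷_)
open import Data.List.Relation.Unary.Unique.Propositional using (Unique)
open import Data.Maybe using (Maybe; just; nothing)
open import Data.Product using (_×_; _,_; proj₁; proj₂; ∃; Σ)
open import Data.Sum using (_⊎_; inj₁; inj₂)
open import Data.Empty using (⊥; ⊥-elim)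
open import Data.Vec using (Vec; lookup)
open import Relation.Nullary using (¬_; Dec; yes; no)
open import Relation.Binary.PropositionalEquality as ≡ using (_≡_; refl)
import Relation.Binary.Reasoning.Setoid as SetoidReasoning
import Relation.Binary.Reflection as Reflection
import Relation.Nullary.Decidable as Decidable
open import Relation.Binary.Definitions using (Tri; tri<; tri≈; tri>)
open import Defs hiding (ν; ε; δ)
open import Data.Rational as ℚ using (ℚ; ↥_; ↧_; ↧ₙ_)
import Data.Rational.Properties as ℚₚ
import Data.Integer.DivMod as ℤDM
import Data.Integer.GCD
open import Data.Nat using (_!)
open import Data.Bool using (Bool; true; false; if_then_else_)
import Data.Unit
import Data.List.Relation.Unary.Any.Properties as Anyₚ
import Data.List.Relation.Unary.Any as Any
import Data.List.Membership.Propositional.Properties as ∈ₚ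
open import Data.Nat.Primality using (prime⇒irreducible)
import Data.Nat.Solver
import Data.Bool.Properties
open import Function.Bundles using (Equivalence; _⇔_; mk⇔)
open import Data.Nat.Primality using (prime?)
open import Data.Bool using (not; _∨_)
import Data.List.Relation.Unary.All.Properties as Allₚ

-- Modulo p, ψ is a truncation of ₂F₁(1/4, 3/4; 1; u) for r = 2 and of ₂F₁(1/3, 2/3; 1; u) for r =
-- 3, a Hasse invariant. The involution comes from Ramanujan's quadratic and the Borweins' cubic
-- transformation of these series, that is, from an isogeny of degree r; modulo p it is obtained
-- from the uniqueness of solutions of degree below p of one differential equation. The obstacle is
-- that for a rational z neither √(1 - z) nor u nor v need be rational. No case distinction is made:
-- the missing roots are adjoined formally, in quotients that may have zero divisors, which is why
-- zeros in arbitrary algebras are considered. A product of distinct factors X - a divides X^p - X,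
-- so x^p = x holds for its zeros in all these quotients alike, and one coordinate of this equation
-- is Euler's criterion for the adjoined root. A value z is exceptional when that coordinate or a
-- denominator vanishes. The degrees of these conditions bound p, since the number of roots z is
-- [p/8] or [p/6].

Ring₀ : Set₁
Ring₀ = CommutativeRing 0ℓ 0ℓ

-- Numerals in a commutative ring and a ring solver with integer coefficients.

module NumeralsProofs (R : Ring₀) where
  open import Data.Integer using (+_)
  open CommutativeRing R hiding (zero)
  open import Algebra.Properties.Ring ring using (-0#≈0#; -‿involutive; -‿+-comm; -‿distribˡ-*; -‿distribʳ-*)
  open import Relation.Binary.Reasoning.Setoid setoid

  abstract
    -- Abstract, so that a numeral such as `nat 16929` is never unfolded into a sum of ones; only
    -- its two defining equations are visible.
    nat : ℕ → Carrier
    nat zero = 0#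
    nat (suc n) = 1# + nat n

    nat-0 : nat 0 ≈ 0#
    nat-0 = CommutativeRing.refl R

    nat-suc : ∀ n → nat (suc n) ≈ 1# + nat n
    nat-suc n = CommutativeRing.refl R

  nat-1 : nat 1 ≈ 1#
  nat-1 = trans (nat-suc 0) (trans (+-congˡ nat-0) (+-identityʳ 1#))

  nat-+ : ∀ m n → nat (m ℕ.+ n) ≈ nat m + nat n
  nat-+ zero n = sym (trans (+-congʳ nat-0) (+-identityˡ _))
  nat-+ (suc m) n = begin
    nat (suc (m ℕ.+ n)) ≈⟨ nat-suc _ ⟩
    1# + nat (m ℕ.+ n) ≈⟨ +-congˡ (nat-+ m n) ⟩
    1# + (nat m + nat n) ≈⟨ +-assoc _ _ _ ⟨
    1# + nat m + nat n ≈⟨ +-congʳ (nat-suc m) ⟨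
    nat (suc m) + nat n ∎

  nat-* : ∀ m n → nat (m ℕ.* n) ≈ nat m * nat n
  nat-* zero n = trans nat-0 (sym (trans (*-congʳ nat-0) (zeroˡ _)))
  nat-* (suc m) n = begin
    nat (n ℕ.+ m ℕ.* n) ≈⟨ nat-+ n _ ⟩
    nat n + nat (m ℕ.* n) ≈⟨ +-cong (sym (*-identityˡ _)) (nat-* m n) ⟩
    1# * nat n + nat m * nat n ≈⟨ distribʳ _ _ _ ⟨
    (1# + nat m) * nat n ≈⟨ *-congʳ (nat-suc m) ⟨
    nat (suc m) * nat n ∎

  int₀ : ℤ → Carrier
  int₀ (+ n) = nat n
  int₀ -[1+ n ] = - nat (suc n)

  private
    int₀-⊖ : ∀ m n → int₀ (m ℤ.⊖ n) ≈ nat m - nat n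
    int₀-⊖ m zero = begin
      nat m ≈⟨ +-identityʳ _ ⟨
      nat m + 0# ≈⟨ +-congˡ (trans (-‿cong nat-0) -0#≈0#) ⟨
      nat m - nat 0 ∎
    int₀-⊖ zero (suc n) = sym (trans (+-congʳ nat-0) (+-identityˡ _))
    int₀-⊖ (suc m) (suc n) = begin
      int₀ (suc m ℤ.⊖ suc n) ≡⟨ ≡.cong int₀ (ℤₚ.[1+m]⊖[1+n]≡m⊖n m n) ⟩
      int₀ (m ℤ.⊖ n) ≈⟨ int₀-⊖ m n ⟩
      nat m - nat n ≈⟨ +-identityˡ _ ⟨
      0# + (nat m - nat n) ≈⟨ +-congʳ (-‿inverseʳ 1#) ⟨
      1# - 1# + (nat m - nat n) ≈⟨ +-assoc _ _ _ ⟩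
      1# + (- 1# + (nat m - nat n)) ≈⟨ +-congˡ (trans (sym (+-assoc _ _ _)) (trans (+-congʳ (+-comm _ _)) (+-assoc _ _ _))) ⟩
      1# + (nat m + (- 1# - nat n)) ≈⟨ +-assoc _ _ _ ⟨
      1# + nat m + (- 1# - nat n) ≈⟨ +-cong (sym (nat-suc m)) (-‿+-comm 1# (nat n)) ⟩
      nat (suc m) - (1# + nat n) ≈⟨ +-congˡ (-‿cong (nat-suc n)) ⟨
      nat (suc m) - nat (suc n) ∎

  int₀-neg : ∀ z → int₀ (ℤ.- z) ≈ - int₀ z
  int₀-neg (+ zero) = trans nat-0 (sym (trans (-‿cong nat-0) -0#≈0#))
  int₀-neg (+ suc n) = CommutativeRing.refl R
  int₀-neg -[1+ n ] = sym (-‿involutive _)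

  int₀-+ : ∀ x y → int₀ (x ℤ.+ y) ≈ int₀ x + int₀ y
  int₀-+ (+ m) (+ n) = nat-+ m n
  int₀-+ (+ m) -[1+ n ] = int₀-⊖ m (suc n)
  int₀-+ -[1+ m ] (+ n) = trans (int₀-⊖ n (suc m)) (+-comm _ _)
  int₀-+ -[1+ m ] -[1+ n ] = begin
    - nat (suc (suc (m ℕ.+ n))) ≡⟨ ≡.cong (λ k → - nat (suc k)) (ℕₚ.+-suc m n) ⟨
    - nat (suc m ℕ.+ suc n) ≈⟨ -‿cong (nat-+ (suc m) (suc n)) ⟩
    - (nat (suc m) + nat (suc n)) ≈⟨ -‿+-comm _ _ ⟨
    - nat (suc m) - nat (suc n) ∎

  private
    int₀-*⁺ : ∀ m y → int₀ (+ m ℤ.* y) ≈ nat m * int₀ y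
    int₀-*⁺ m (+ n) = trans (reflexive (≡.cong int₀ (≡.sym (ℤₚ.pos-* m n)))) (nat-* m n)
    int₀-*⁺ m -[1+ n ] = begin
      int₀ (+ m ℤ.* -[1+ n ]) ≡⟨ ≡.cong int₀ (≡.sym (ℤₚ.neg-distribʳ-* (+ m) (+ suc n))) ⟩
      int₀ (ℤ.- (+ m ℤ.* + suc n)) ≈⟨ int₀-neg (+ m ℤ.* + suc n) ⟩
      - int₀ (+ m ℤ.* + suc n) ≈⟨ -‿cong (int₀-*⁺ m (+ suc n)) ⟩
      - (nat m * nat (suc n)) ≈⟨ -‿distribʳ-* _ _ ⟩
      nat m * - nat (suc n) ∎

  int₀-* : ∀ x y → int₀ (x ℤ.* y) ≈ int₀ x * int₀ y
  int₀-* (+ m) y = int₀-*⁺ m y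
  int₀-* -[1+ m ] y = begin
    int₀ (-[1+ m ] ℤ.* y) ≡⟨ ≡.cong int₀ (≡.sym (ℤₚ.neg-distribˡ-* (+ suc m) y)) ⟩
    int₀ (ℤ.- (+ suc m ℤ.* y)) ≈⟨ int₀-neg (+ suc m ℤ.* y) ⟩
    - int₀ (+ suc m ℤ.* y) ≈⟨ -‿cong (int₀-*⁺ (suc m) y) ⟩
    - (nat (suc m) * int₀ y) ≈⟨ -‿distribˡ-* _ _ ⟩
    - nat (suc m) * int₀ y ∎

  -- int (+ 0) and int (+ 1) reduce to 0# and 1#, so that the solver constants match these.
  int : ℤ → Carrier
  int (+ 0) = 0#
  int (+ 1) = 1#
  int z = int₀ z

  private
    int≈int₀ : ∀ z → int z ≈ int₀ z
    int≈int₀ (+ 0) = sym nat-0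
    int≈int₀ (+ 1) = sym nat-1
    int≈int₀ (+ suc (suc n)) = CommutativeRing.refl R
    int≈int₀ -[1+ n ] = CommutativeRing.refl R

  int-neg : ∀ z → int (ℤ.- z) ≈ - int z
  int-neg z = trans (int≈int₀ (ℤ.- z)) (trans (int₀-neg z) (-‿cong (sym (int≈int₀ z))))

  int-+ : ∀ x y → int (x ℤ.+ y) ≈ int x + int y
  int-+ x y = trans (int≈int₀ (x ℤ.+ y)) (trans (int₀-+ x y) (+-cong (sym (int≈int₀ x)) (sym (int≈int₀ y))))

  int-* : ∀ x y → int (x ℤ.* y) ≈ int x * int y
  int-* x y = trans (int≈int₀ (x ℤ.* y)) (trans (int₀-* x y) (*-cong (sym (int≈int₀ x)) (sym (int≈int₀ y))))

infix 10 #_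
infixr 9 _:^_
infix 8 :-_
infixl 7 _:*_
infixl 6 _:+_ _:-_
infix 4 _:=_

-- The constructors do not mention a ring, so the solvers of the prime field, of the polynomial ring
-- and of all the extensions share one syntax.
data Expr (n : ℕ) : Set where
  var : Fin n → Expr n
  #_ : ℕ → Expr n
  _:+_ _:*_ : Expr n → Expr n → Expr n
  :-_ : Expr n → Expr n
  _:^_ : Expr n → ℕ → Expr n

_:-_ : ∀ {n} → Expr n → Expr n → Expr n
e :- e' = e :+ :- e'

_:=_ : ∀ {n} → Expr n → Expr n → Expr n × Expr n
_:=_ = _,_

module Numerals (R : Ring₀) where
  open CommutativeRing R using (Carrier)

  nat : ℕ → Carrier
  nat = NumeralsProofs.nat R

  nat-0 = NumeralsProofs.nat-0 R
  nat-1 = NumeralsProofs.nat-1 R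
  nat-suc = NumeralsProofs.nat-suc R
  nat-+ = NumeralsProofs.nat-+ R
  nat-* = NumeralsProofs.nat-* R

module IntSolver (R : Ring₀) where
  open import Data.Integer using (+_)
  open CommutativeRing R hiding (zero)
  open NumeralsProofs R
  open Exp semiring using (_^_; ^-congˡ)

  private
    ℤ-rawRing : RawRing 0ℓ 0ℓ
    ℤ-rawRing = record { Carrier = ℤ ; _≈_ = _≡_ ; _+_ = ℤ._+_ ; _*_ = ℤ._*_ ; -_ = ℤ.-_ ; 0# = + 0 ; 1# = + 1 }

    morphism : ℤ-rawRing -Raw-AlmostCommutative⟶ fromCommutativeRing R
    morphism = record { ⟦_⟧ = int ; +-homo = int-+ ; *-homo = int-* ; -‿homo = int-neg ; 0-homo = CommutativeRing.refl R ; 1-homo = CommutativeRing.refl R }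

    _coeff≟_ : ∀ x y → Maybe (int x ≈ int y)
    x coeff≟ y with x ℤ.≟ y
    ... | yes eq = just (reflexive (≡.cong int eq))
    ... | no _ = nothing

    module S = RingSolver ℤ-rawRing (fromCommutativeRing R) morphism _coeff≟_

    translate : ∀ {n} → Expr n → S.Polynomial n
    translate (var i) = S.var i
    translate (# k) = S.con (+ k)
    translate (e :+ e') = translate e S.:+ translate e'
    translate (e :* e') = translate e S.:* translate e'
    translate (:- e) = S.:- translate e
    translate (e :^ k) = translate e S.:^ k

    ⟦_⟧ : ∀ {n} → Expr n → Vec Carrier n → Carrier
    ⟦ var i ⟧ ρ = lookup ρ i
    ⟦ # k ⟧ ρ = int (+ k)
    ⟦ e :+ e' ⟧ ρ = ⟦ e ⟧ ρ + ⟦ e' ⟧ ρ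
    ⟦ e :* e' ⟧ ρ = ⟦ e ⟧ ρ * ⟦ e' ⟧ ρ
    ⟦ :- e ⟧ ρ = - ⟦ e ⟧ ρ
    ⟦ e :^ k ⟧ ρ = ⟦ e ⟧ ρ ^ k

    ⟦_⇓⟧ : ∀ {n} → Expr n → Vec Carrier n → Carrier
    ⟦ e ⇓⟧ = S.⟦ translate e ⟧↓

    translate-sound : ∀ {n} (e : Expr n) ρ → S.⟦ translate e ⟧ ρ ≈ ⟦ e ⟧ ρ
    translate-sound (var i) ρ = CommutativeRing.refl R
    translate-sound (# k) ρ = CommutativeRing.refl R
    translate-sound (e :+ e') ρ = +-cong (translate-sound e ρ) (translate-sound e' ρ)
    translate-sound (e :* e') ρ = *-cong (translate-sound e ρ) (translate-sound e' ρ)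
    translate-sound (:- e) ρ = -‿cong (translate-sound e ρ)
    translate-sound (e :^ k) ρ = ^-congˡ k (translate-sound e ρ)

  open Reflection setoid var ⟦_⟧ ⟦_⇓⟧ (λ e ρ → trans (S.correct (translate e) ρ) (translate-sound e ρ)) public using (solve)

-- Binomial coefficients modulo p and additivity of Frobenius.

[1+k]*[1+n]C[1+k]≡[1+n]*nCk : ∀ n k → suc k ℕ.* (suc n choose suc k) ≡ suc n ℕ.* (n choose k)
[1+k]*[1+n]C[1+k]≡[1+n]*nCk zero zero = refl
[1+k]*[1+n]C[1+k]≡[1+n]*nCk zero (suc k) = ≡.trans (≡.cong (suc (suc k) ℕ.*_) (k>n⇒nCk≡0 {1} {suc (suc k)} (ℕ.s≤s (ℕ.s≤s ℕ.z≤n)))) (≡.trans (ℕₚ.*-zeroʳ k) (≡.sym (≡.cong (1 ℕ.*_) (k>n⇒nCk≡0 {0} {suc k} (ℕ.s≤s ℕ.z≤n)))))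
[1+k]*[1+n]C[1+k]≡[1+n]*nCk (suc n) zero = ≡.trans (ℕₚ.*-identityˡ _) (≡.trans (nC1≡n (suc (suc n))) (≡.sym (ℕₚ.*-identityʳ _)))
[1+k]*[1+n]C[1+k]≡[1+n]*nCk (suc n) (suc k) = begin
  suc (suc k) ℕ.* (suc (suc n) choose suc (suc k)) ≡⟨ ≡.cong (suc (suc k) ℕ.*_) (nCk+nC[k+1]≡[n+1]C[k+1] (suc n) (suc k)) ⟨
  suc (suc k) ℕ.* (A ℕ.+ B) ≡⟨ ℕₚ.*-distribˡ-+ (suc (suc k)) A B ⟩
  A ℕ.+ suc k ℕ.* A ℕ.+ suc (suc k) ℕ.* B ≡⟨ ≡.cong₂ (λ a b → A ℕ.+ a ℕ.+ b) ([1+k]*[1+n]C[1+k]≡[1+n]*nCk n k) ([1+k]*[1+n]C[1+k]≡[1+n]*nCk n (suc k)) ⟩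
  A ℕ.+ suc n ℕ.* (n choose k) ℕ.+ suc n ℕ.* (n choose suc k) ≡⟨ ℕₚ.+-assoc A _ _ ⟩
  A ℕ.+ (suc n ℕ.* (n choose k) ℕ.+ suc n ℕ.* (n choose suc k)) ≡⟨ ≡.cong (A ℕ.+_) (ℕₚ.*-distribˡ-+ (suc n) (n choose k) (n choose suc k)) ⟨
  A ℕ.+ suc n ℕ.* (n choose k ℕ.+ n choose suc k) ≡⟨ ≡.cong (λ a → A ℕ.+ suc n ℕ.* a) (nCk+nC[k+1]≡[n+1]C[k+1] n k) ⟩
  A ℕ.+ suc n ℕ.* A ∎
  where
  open ≡.≡-Reasoning
  A = suc n choose suc k
  B = suc n choose suc (suc k)

-- By absorption k C(p, k) = p C(p - 1, k - 1), and p does not divide k.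
prime∣pCk : ∀ {p k} → Prime p → 0 ℕ.< k → k ℕ.< p → p ∣ p choose k
prime∣pCk {suc q} {suc k} pp _ k<p with euclidsLemma (suc k) (suc q choose suc k) pp (divides (q choose k) (≡.trans ([1+k]*[1+n]C[1+k]≡[1+n]*nCk q k) (ℕₚ.*-comm (suc q) _)))
... | inj₁ p∣k = ⊥-elim (<⇒≱ k<p (∣⇒≤ p∣k))
... | inj₂ p∣C = p∣C

module RingLemmasProofs (R : Ring₀) where
  open CommutativeRing R hiding (zero)
  open Numerals R
  private solve = IntSolver.solve R
  open Exp semiring
  open Sums semiring using (sum; sum-cong-≋; sum-replicate-zero; sum-init-last)
  open import Algebra.Properties.Monoid.Mult +-monoid using () renaming (_×_ to _×ₙ_)
  open Binomial commutativeSemiring using (binomialTerm) renaming (theorem to binomial-theorem)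
  open import Relation.Binary.Reasoning.Setoid setoid

  ×≈nat* : ∀ n x → n ×ₙ x ≈ nat n * x
  ×≈nat* zero x = sym (trans (*-congʳ nat-0) (zeroˡ x))
  ×≈nat* (suc n) x = begin
    x + n ×ₙ x ≈⟨ +-cong (sym (*-identityˡ x)) (×≈nat* n x) ⟩
    1# * x + nat n * x ≈⟨ distribʳ _ _ _ ⟨
    (1# + nat n) * x ≈⟨ *-congʳ (nat-suc n) ⟨
    nat (suc n) * x ∎

  1^n≈1 : ∀ n → 1# ^ n ≈ 1#
  1^n≈1 zero = CommutativeRing.refl R
  1^n≈1 (suc n) = trans (*-identityˡ _) (1^n≈1 n)

  0^[1+n]≈0 : ∀ n → 0# ^ suc n ≈ 0#
  0^[1+n]≈0 n = zeroˡ _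

  ^-distrib-* : ∀ x y n → (x * y) ^ n ≈ x ^ n * y ^ n
  ^-distrib-* x y zero = sym (*-identityˡ _)
  ^-distrib-* x y (suc n) = trans (*-congˡ (^-distrib-* x y n)) (solve 4 (λ x y a b → x :* y :* (a :* b) := x :* a :* (y :* b)) (CommutativeRing.refl R) x y (x ^ n) (y ^ n))

  private
    sum-zero : ∀ {n} (f : Fin n → Carrier) → (∀ i → f i ≈ 0#) → sum f ≈ 0#
    sum-zero {n} f f≈0 = trans (sum-cong-≋ f≈0) (sum-replicate-zero n)

  -- The upper bound is included and the last term is split off, because the telescoping arguments
  -- are inductions over partial sums.
  Σ≤ : ℕ → (ℕ → Carrier) → Carrier
  Σ≤ zero t = t 0
  Σ≤ (suc k) t = Σ≤ k t + t (suc k)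

  Σ≤-cong : ∀ k {s t : ℕ → Carrier} → (∀ i → i ℕ.≤ k → s i ≈ t i) → Σ≤ k s ≈ Σ≤ k t
  Σ≤-cong zero e = e 0 ℕ.z≤n
  Σ≤-cong (suc k) e = +-cong (Σ≤-cong k (λ i i≤k → e i (ℕₚ.m≤n⇒m≤1+n i≤k))) (e (suc k) ≤-refl)

  *-distribˡ-Σ≤ : ∀ k x t → x * Σ≤ k t ≈ Σ≤ k (λ i → x * t i)
  *-distribˡ-Σ≤ zero x t = CommutativeRing.refl R
  *-distribˡ-Σ≤ (suc k) x t = trans (distribˡ x _ _) (+-congʳ (*-distribˡ-Σ≤ k x t))

  frobenius-+ : ∀ {p} → Prime p → nat p ≈ 0# → ∀ x y → (x + y) ^ p ≈ x ^ p + y ^ p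
  frobenius-+ {suc zero} pp _ x y = ⊥-elim (¬prime[1] pp)
  frobenius-+ {suc (suc q)} pp p≈0 x y = begin
    (x + y) ^ p ≈⟨ binomial-theorem p x y ⟩
    T zero + sum (λ i → T (suc i)) ≈⟨ +-cong T₀ (sum-init-last (λ i → T (suc i))) ⟩
    y ^ p + (sum (λ i → T (suc (inject₁ i))) + T (suc (fromℕ (suc q)))) ≈⟨ +-congˡ (+-cong (sum-zero _ mid) Tₚ) ⟩
    y ^ p + (0# + x ^ p) ≈⟨ solve 2 (λ a b → b :+ (# 0 :+ a) := a :+ b) (CommutativeRing.refl R) (x ^ p) (y ^ p) ⟩
    x ^ p + y ^ p ∎
    where
    p = suc (suc q)
    T = binomialTerm x y p

    T₀ : T zero ≈ y ^ p
    T₀ = trans (×≈nat* 1 _) (trans (*-congʳ nat-1) (trans (*-identityˡ _) (*-identityˡ _)))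

    Tₚ : T (suc (fromℕ (suc q))) ≈ x ^ p
    Tₚ = begin
      T (suc (fromℕ (suc q))) ≡⟨ ≡.cong (λ k → (p choose suc k) ×ₙ (x ^ suc k * y ^ (p ℕ.∸ suc k))) (Finₚ.toℕ-fromℕ (suc q)) ⟩
      (p choose p) ×ₙ (x ^ p * y ^ (p ℕ.∸ p)) ≡⟨ ≡.cong₂ (λ a b → a ×ₙ (x ^ p * y ^ b)) (nCn≡1 p) (ℕₚ.n∸n≡0 p) ⟩
      1 ×ₙ (x ^ p * 1#) ≈⟨ +-identityʳ _ ⟩
      x ^ p * 1# ≈⟨ *-identityʳ _ ⟩
      x ^ p ∎

    mid : ∀ i → T (suc (inject₁ i)) ≈ 0#
    mid i with prime∣pCk {p} {toℕ (suc (inject₁ i))} pp (ℕ.s≤s ℕ.z≤n) (ℕ.s≤s (≡.subst (ℕ._< suc q) (≡.sym (Finₚ.toℕ-inject₁ i)) (Finₚ.toℕ<n i)))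
    ... | divides k eq = begin
      (p choose suc (toℕ (inject₁ i))) ×ₙ M ≡⟨ ≡.cong (_×ₙ M) eq ⟩
      (k ℕ.* p) ×ₙ M ≈⟨ ×≈nat* (k ℕ.* p) M ⟩
      nat (k ℕ.* p) * M ≈⟨ *-congʳ (trans (nat-* k p) (trans (*-congˡ p≈0) (zeroʳ _))) ⟩
      0# * M ≈⟨ zeroˡ _ ⟩
      0# ∎
      where M = x ^ suc (toℕ (inject₁ i)) * y ^ (p ℕ.∸ suc (toℕ (inject₁ i)))

-- Polynomial identities behind the involution for r = 2.

module RingIdentities (R : Ring₀) where
  open CommutativeRing R hiding (zero)
  open Numerals R using (nat)
  open Exp semiring using (_^_; ^-congˡ)
  open SetoidReasoning setoid
  private
    solve = IntSolver.solve R

    rfl : ∀ {x} → x ≈ x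
    rfl = CommutativeRing.refl R

  [xv]² : ∀ x v → x * v * (x * v) ≈ (x * x) * (v * v)
  [xv]² = solve 2 (λ x v → x :* v :* (x :* v) := (x :* x) :* (v :* v)) rfl

  [xv²]² : ∀ x v → x * (v * v) * (x * (v * v)) ≈ x * x * (v ^ 3) * v
  [xv²]² = solve 2 (λ x v → x :* (v :* v) :* (x :* (v :* v)) := x :* x :* v :^ 3 :* v) rfl

  a[bc]≈acb : ∀ a b c → a * (b * c) ≈ a * c * b
  a[bc]≈acb = solve 3 (λ a b c → a :* (b :* c) := a :* c :* b) rfl

  a[bc]≈b[ac] : ∀ a b c → a * (b * c) ≈ b * (a * c)
  a[bc]≈b[ac] = solve 3 (λ a b c → a :* (b :* c) := b :* (a :* c)) rfl

  [1+3v][1-3v] : ∀ v j → (1# + nat 3 * v) * ((1# - nat 3 * v) * j) ≈ (1# - nat 9 * (v * v)) * j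
  [1+3v][1-3v] = solve 2 (λ v j → (# 1 :+ # 3 :* v) :* ((# 1 :- # 3 :* v) :* j) := (# 1 :- # 9 :* (v :* v)) :* j) rfl

  4u[1-u] : ∀ u s → nat 2 * u ≈ 1# - s → nat 4 * (u * (1# - u)) ≈ 1# - s * s
  4u[1-u] u s e = trans (solve 1 (λ u → # 4 :* (u :* (# 1 :- u)) := (# 2 :* u) :* (# 2 :- # 2 :* u)) rfl u) (trans (*-cong e (+-congˡ (-‿cong e))) (solve 1 (λ s → (# 1 :- s) :* (# 2 :- (# 1 :- s)) := # 1 :- s :* s) rfl s))

  v[vd] : ∀ v d → v * (v * d) ≈ d * (v * v)
  v[vd] = solve 2 (λ v d → v :* (v :* d) := d :* (v :* v)) rfl

  -- The value at v' = (1 - v)/(1 + 3v), w = 1/(1 + 3v), of the modular parameter 1/(4v'²(1 - v'²)), up to 2z².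
  h₂ : Carrier → Carrier
  h₂ v = v ^ 3 * (1# + v) * (1# + nat 3 * v) ^ 4

  -- Here 1 - v'² = 8v(1 + v)w², so 4v'²(1 - v'²) = 32v(1 + v)(1 - v)²w⁴. The factor v³(1 + v) of
  -- `h₂ v` completes this to 32v⁴(1 - v²)² = 2z², and its fourth power of 1 + 3v cancels w⁴. The
  -- reciprocal parameter thus gets the denominator 2z², which is rational as soon as z is.
  h₂-inverse : ∀ v w i → (1# + nat 3 * v) * w ≈ 1# → let u' = ((1# - v) * w) ^ 2 ; z = nat 4 * ((v * v) * (1# - v * v)) in
    nat 4 * (u' * (1# - u')) * (i * h₂ v) ≈ i * (nat 2 * (z * z))
  h₂-inverse v w i bw = begin
    nat 4 * (u' * (1# - u')) * (i * h₂ v)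
      ≈⟨ *-congʳ (*-congˡ (*-congˡ (+-congʳ (trans (sym (*-identityˡ 1#)) (*-cong (sym bw) (sym bw)))))) ⟩
    nat 4 * (u' * (b * w * (b * w) - u')) * (i * h₂ v)
      ≈⟨ solve 3 (λ v w i → let a = # 1 :- v ; b = # 1 :+ # 3 :* v ; u' = (a :* w) :^ 2 ; z = # 4 :* ((v :* v) :* (# 1 :- v :* v)) in
           # 4 :* (u' :* (b :* w :* (b :* w) :- u')) :* (i :* (v :^ 3 :* (# 1 :+ v) :* b :^ 4)) := (b :* w) :^ 4 :* (i :* (# 2 :* (z :* z)))) rfl v w i ⟩
    (b * w) ^ 4 * (i * (nat 2 * (z * z)))
      ≈⟨ *-congʳ (trans (^-congˡ 4 bw) (solve 0 (# 1 :^ 4 := # 1) rfl)) ⟩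
    1# * (i * (nat 2 * (z * z))) ≈⟨ *-identityˡ _ ⟩
    i * (nat 2 * (z * z)) ∎
    where
    b u' z : Carrier
    b = 1# + nat 3 * v
    u' = ((1# - v) * w) ^ 2
    z = nat 4 * ((v * v) * (1# - v * v))

  -- The coordinates of `h₂ v` with respect to 1 and v; Frobenius will be compared on them in the
  -- ring with v² = u.
  h₂-even-odd : ∀ v u → v * v ≈ u → h₂ v ≈ (nat 13 * (u * u) + nat 162 * (u * u * u) + nat 81 * (u * u * (u * u))) + (u + nat 66 * (u * u) + nat 189 * (u * u * u)) * v
  h₂-even-odd v u e = trans
    (solve 1 (λ v → let u = v :* v in v :^ 3 :* (# 1 :+ v) :* (# 1 :+ # 3 :* v) :^ 4 := (# 13 :* (u :* u) :+ # 162 :* (u :* u :* u) :+ # 81 :* (u :* u :* (u :* u))) :+ (u :+ # 66 :* (u :* u) :+ # 189 :* (u :* u :* u)) :* v) rfl v)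
    (+-cong (+-cong (+-cong (*-congˡ ee) (*-congˡ eee)) (*-congˡ (*-cong ee ee))) (*-congʳ (+-cong (+-cong e (*-congˡ ee)) (*-congˡ eee))))
    where
    ee = *-cong e e
    eee = *-cong ee e

  -- The even part has degree 4 in u = (1 - s)/2, so the factor 16 clears all denominators; on the
  -- right stand its coordinates with respect to 1 and s.
  h₂-even-s : ∀ u s t → nat 2 * u ≈ 1# - s → s * s ≈ t →
    nat 16 * (nat 13 * (u * u) + nat 162 * (u * u * u) + nat 81 * (u * u * (u * u))) ≈ (nat 457 + nat 1510 * t + nat 81 * (t * t)) + - (nat 8 * (nat 175 + nat 81 * t)) * s
  h₂-even-s u s t 2u ss = trans
    (solve 1 (λ u → # 16 :* (# 13 :* (u :* u) :+ # 162 :* (u :* u :* u) :+ # 81 :* (u :* u :* (u :* u))) := let y = # 2 :* u in # 52 :* (y :* y) :+ # 324 :* (y :* y :* y) :+ # 81 :* (y :* y :* (y :* y))) rfl u)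
    (trans (+-cong (+-cong (*-congˡ (*-cong 2u 2u)) (*-congˡ (*-cong (*-cong 2u 2u) 2u))) (*-congˡ (*-cong (*-cong 2u 2u) (*-cong 2u 2u))))
    (trans (solve 1 (λ s → let y = # 1 :- s ; t = s :* s in # 52 :* (y :* y) :+ # 324 :* (y :* y :* y) :+ # 81 :* (y :* y :* (y :* y)) := (# 457 :+ # 1510 :* t :+ # 81 :* (t :* t)) :+ (:- (# 8 :* (# 175 :+ # 81 :* t))) :* s) rfl s)
    (+-cong (+-cong (+-congˡ (*-congˡ ss)) (*-congˡ (*-cong ss ss))) (*-congʳ (-‿cong (*-congˡ (+-congˡ (*-congˡ ss))))))))

module RingLemmas (R : Ring₀) where
  open CommutativeRing R using (Carrier)

  Σ≤ : ℕ → (ℕ → Carrier) → Carrier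
  Σ≤ = RingLemmasProofs.Σ≤ R

  ×≈nat* = RingLemmasProofs.×≈nat* R
  1^n≈1 = RingLemmasProofs.1^n≈1 R
  0^[1+n]≈0 = RingLemmasProofs.0^[1+n]≈0 R
  ^-distrib-* = RingLemmasProofs.^-distrib-* R
  *-distribˡ-Σ≤ = RingLemmasProofs.*-distribˡ-Σ≤ R

  Σ≤-cong : ∀ k {s t : ℕ → Carrier} → _
  Σ≤-cong k {s} {t} = RingLemmasProofs.Σ≤-cong R k {s} {t}

  frobenius-+ : ∀ {p} → Prime p → _
  frobenius-+ {p} = RingLemmasProofs.frobenius-+ R {p}

-- Formal adjunction of square roots and cube roots.

-- R[v]/(v² - d), with (a , b) standing for a + b v.  The operations are opaque to keep towers of such extensions tractable.
module Quadratic (R : Ring₀) (d : CommutativeRing.Carrier R) where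
  open CommutativeRing R hiding (zero)
  private
    module R = CommutativeRing R
    solve = IntSolver.solve R
    Q = Carrier × Carrier
    _≈₂_ : Q → Q → Set
    (a , b) ≈₂ (a' , b') = a ≈ a' × b ≈ b'

  opaque
    _⊞_ _⊠_ : Q → Q → Q
    (a , b) ⊞ (a' , b') = a + a' , b + b'
    (a , b) ⊠ (a' , b') = a * a' + d * (b * b') , a * b' + b * a'

    ⊟_ : Q → Q
    ⊟ (a , b) = - a , - b

    isCommutativeRing₂ : IsCommutativeRing _≈₂_ _⊞_ _⊠_ ⊟_ (0# , 0#) (1# , 0#)
    isCommutativeRing₂ = record
      { isRing = record
        { +-isAbelianGroup = record
          { isGroup = record
            { isMonoid = record
              { isSemigroup = record
                { isMagma = record
                  { isEquivalence = record
                    { refl = R.refl , R.refl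
                    ; sym = λ (e , e') → sym e , sym e'
                    ; trans = λ (e , e') (f , f') → trans e f , trans e' f' }
                  ; ∙-cong = λ (e , e') (f , f') → +-cong e f , +-cong e' f' }
                ; assoc = λ _ _ _ → +-assoc _ _ _ , +-assoc _ _ _ }
              ; identity = (λ _ → +-identityˡ _ , +-identityˡ _) , (λ _ → +-identityʳ _ , +-identityʳ _) }
            ; inverse = (λ _ → -‿inverseˡ _ , -‿inverseˡ _) , (λ _ → -‿inverseʳ _ , -‿inverseʳ _)
            ; ⁻¹-cong = λ (e , e') → -‿cong e , -‿cong e' }
          ; comm = λ _ _ → +-comm _ _ , +-comm _ _ }
        ; *-cong = λ (e , e') (f , f') → +-cong (*-cong e f) (*-congˡ (*-cong e' f')) , +-cong (*-cong e f') (*-cong e' f)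
        ; *-assoc = λ (a , b) (a' , b') (a″ , b″) →
              solve 7 (λ d a b a' b' x y → (a :* a' :+ d :* (b :* b')) :* x :+ d :* ((a :* b' :+ b :* a') :* y) := a :* (a' :* x :+ d :* (b' :* y)) :+ d :* (b :* (a' :* y :+ b' :* x))) R.refl d a b a' b' a″ b″
            , solve 7 (λ d a b a' b' x y → (a :* a' :+ d :* (b :* b')) :* y :+ (a :* b' :+ b :* a') :* x := a :* (a' :* y :+ b' :* x) :+ b :* (a' :* x :+ d :* (b' :* y))) R.refl d a b a' b' a″ b″
        ; *-identity = (λ (a , b) → one d a b , trans (+-cong (*-identityˡ b) (zeroˡ a)) (+-identityʳ b))
                     , (λ (a , b) → trans (+-cong (*-identityʳ a) (trans (*-congˡ (zeroʳ b)) (zeroʳ d))) (+-identityʳ a) , trans (+-cong (zeroʳ a) (*-identityʳ b)) (+-identityˡ b))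
        ; distrib = (λ (x , y) (a , b) (a' , b') →
              solve 7 (λ d x y a b a' b' → x :* (a :+ a') :+ d :* (y :* (b :+ b')) := (x :* a :+ d :* (y :* b)) :+ (x :* a' :+ d :* (y :* b'))) R.refl d x y a b a' b'
            , solve 6 (λ x y a b a' b' → x :* (b :+ b') :+ y :* (a :+ a') := (x :* b :+ y :* a) :+ (x :* b' :+ y :* a')) R.refl x y a b a' b')
          , (λ (x , y) (a , b) (a' , b') →
              solve 7 (λ d x y a b a' b' → (a :+ a') :* x :+ d :* ((b :+ b') :* y) := (a :* x :+ d :* (b :* y)) :+ (a' :* x :+ d :* (b' :* y))) R.refl d x y a b a' b'
            , solve 6 (λ x y a b a' b' → (a :+ a') :* y :+ (b :+ b') :* x := (a :* y :+ b :* x) :+ (a' :* y :+ b' :* x)) R.refl x y a b a' b') }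
      ; *-comm = λ (a , b) (a' , b') →
              solve 5 (λ d a b a' b' → a :* a' :+ d :* (b :* b') := a' :* a :+ d :* (b' :* b)) R.refl d a b a' b'
            , solve 4 (λ a b a' b' → a :* b' :+ b :* a' := a' :* b :+ b' :* a) R.refl a b a' b' }
      where
      one : ∀ d a b → 1# * a + d * (0# * b) ≈ a
      one d a b = trans (+-cong (*-identityˡ a) (trans (*-congˡ (zeroˡ b)) (zeroʳ d))) (+-identityʳ a)

  quad : Ring₀
  quad = record { isCommutativeRing = isCommutativeRing₂ }

  emb : Carrier → Q
  emb a = a , 0#

  v : Q
  v = 0# , 1#

  opaque
    unfolding _⊞_

    ⊠-components : ∀ a b a' b' → ((a , b) ⊠ (a' , b')) ≈₂ (a * a' + d * (b * b') , a * b' + b * a')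
    ⊠-components a b a' b' = R.refl , R.refl

    emb-+ : ∀ a b → emb (a + b) ≈₂ (emb a ⊞ emb b)
    emb-+ a b = R.refl , sym (+-identityˡ 0#)

    emb-* : ∀ a b → emb (a * b) ≈₂ (emb a ⊠ emb b)
    emb-* a b = solve 3 (λ a b d → a :* b := a :* b :+ d :* (# 0 :* # 0)) R.refl a b d , solve 2 (λ a b → # 0 := a :* # 0 :+ # 0 :* b) R.refl a b

    emb-neg : ∀ a → emb (- a) ≈₂ (⊟ emb a)
    emb-neg a = R.refl , solve 0 (# 0 := :- # 0) R.refl

    v*v : (v ⊠ v) ≈₂ emb d
    v*v = solve 1 (λ d → # 0 :* # 0 :+ d :* (# 1 :* # 1) := d) R.refl d , solve 0 (# 0 :* # 1 :+ # 1 :* # 0 := # 0) R.refl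

    pair : ∀ a b → (a , b) ≈₂ (emb a ⊞ (emb b ⊠ v))
    pair a b = solve 3 (λ a b d → a := a :+ (b :* # 0 :+ d :* (# 0 :* # 1))) R.refl a b d , solve 1 (λ b → b := # 0 :+ (b :* # 1 :+ # 0 :* # 0)) R.refl b

    emb-pair : ∀ k a b → (emb k ⊠ (a , b)) ≈₂ (k * a , k * b)
    emb-pair k a b = solve 4 (λ k a b d → k :* a :+ d :* (# 0 :* b) := k :* a) R.refl k a b d , solve 3 (λ k a b → k :* b :+ # 0 :* a := k :* b) R.refl k a b

-- R[v]/(v³ - d), with (a , b , c) standing for a + b v + c v².
module Cubic (R : Ring₀) (d : CommutativeRing.Carrier R) where
  open CommutativeRing R hiding (zero)
  private solve = IntSolver.solve R
  private
    module R = CommutativeRing R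
    T = Carrier × Carrier × Carrier
    _≈₃_ : T → T → Set
    (a , b , c) ≈₃ (a' , b' , c') = a ≈ a' × b ≈ b' × c ≈ c'

    infixl 6 _:⊞_
    P : ℕ → Set
    P n = Expr n × Expr n × Expr n
    _:⊞_ : ∀ {n} → P n → P n → P n
    (a , b , c) :⊞ (a' , b' , c') = a :+ a' , b :+ b' , c :+ c'
    -- The product formula once more, on solver expressions, so that each coordinate of a ring law
    -- is a single goal for the solver.
    mulS : ∀ {n} → Expr n → P n → P n → P n
    mulS d (a , b , c) (a' , b' , c') = a :* a' :+ d :* (b :* c' :+ c :* b') , a :* b' :+ b :* a' :+ d :* (c :* c') , a :* c' :+ b :* b' :+ c :* a'

  opaque
    _⊞_ _⊡_ : T → T → T
    (a , b , c) ⊞ (a' , b' , c') = a + a' , b + b' , c + c'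
    (a , b , c) ⊡ (a' , b' , c') = a * a' + d * (b * c' + c * b') , a * b' + b * a' + d * (c * c') , a * c' + b * b' + c * a'

    ⊡-comm : ∀ x y → (x ⊡ y) ≈₃ (y ⊡ x)
    ⊡-comm (a , b , c) (a' , b' , c') =
        solve 7 (λ d a b c x y z → proj₁ (mulS d (a , b , c) (x , y , z)) := proj₁ (mulS d (x , y , z) (a , b , c))) R.refl d a b c a' b' c'
      , solve 7 (λ d a b c x y z → proj₁ (proj₂ (mulS d (a , b , c) (x , y , z))) := proj₁ (proj₂ (mulS d (x , y , z) (a , b , c)))) R.refl d a b c a' b' c'
      , solve 7 (λ d a b c x y z → proj₂ (proj₂ (mulS d (a , b , c) (x , y , z))) := proj₂ (proj₂ (mulS d (x , y , z) (a , b , c)))) R.refl d a b c a' b' c'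

    ⊡-assoc : ∀ x y z → ((x ⊡ y) ⊡ z) ≈₃ (x ⊡ (y ⊡ z))
    ⊡-assoc (a , b , c) (a' , b' , c') (a″ , b″ , c″) =
        solve 10 (λ d a b c x y z u v w → proj₁ (l d a b c x y z u v w) := proj₁ (r d a b c x y z u v w)) R.refl d a b c a' b' c' a″ b″ c″
      , solve 10 (λ d a b c x y z u v w → proj₁ (proj₂ (l d a b c x y z u v w)) := proj₁ (proj₂ (r d a b c x y z u v w))) R.refl d a b c a' b' c' a″ b″ c″
      , solve 10 (λ d a b c x y z u v w → proj₂ (proj₂ (l d a b c x y z u v w)) := proj₂ (proj₂ (r d a b c x y z u v w))) R.refl d a b c a' b' c' a″ b″ c″
      where
      l r : ∀ {n} (d a b c x y z u v w : Expr n) → P n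
      l d a b c x y z u v w = mulS d (mulS d (a , b , c) (x , y , z)) (u , v , w)
      r d a b c x y z u v w = mulS d (a , b , c) (mulS d (x , y , z) (u , v , w))

    ⊡-distribˡ : ∀ x y z → (x ⊡ (y ⊞ z)) ≈₃ ((x ⊡ y) ⊞ (x ⊡ z))
    ⊡-distribˡ (a , b , c) (a' , b' , c') (a″ , b″ , c″) =
        solve 10 (λ d a b c x y z u v w → proj₁ (l d a b c x y z u v w) := proj₁ (r d a b c x y z u v w)) R.refl d a b c a' b' c' a″ b″ c″
      , solve 10 (λ d a b c x y z u v w → proj₁ (proj₂ (l d a b c x y z u v w)) := proj₁ (proj₂ (r d a b c x y z u v w))) R.refl d a b c a' b' c' a″ b″ c″
      , solve 10 (λ d a b c x y z u v w → proj₂ (proj₂ (l d a b c x y z u v w)) := proj₂ (proj₂ (r d a b c x y z u v w))) R.refl d a b c a' b' c' a″ b″ c″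
      where
      l r : ∀ {n} (d a b c x y z u v w : Expr n) → P n
      l d a b c x y z u v w = mulS d (a , b , c) ((x , y , z) :⊞ (u , v , w))
      r d a b c x y z u v w = mulS d (a , b , c) (x , y , z) :⊞ mulS d (a , b , c) (u , v , w)

    ⊡-identityˡ : ∀ x → ((1# , 0# , 0#) ⊡ x) ≈₃ x
    ⊡-identityˡ (a , b , c) =
        trans (+-cong (*-identityˡ a) (trans (*-congˡ (trans (+-cong (zeroˡ c) (zeroˡ b)) (+-identityˡ 0#))) (zeroʳ d))) (+-identityʳ a)
      , trans (+-cong (trans (+-cong (*-identityˡ b) (zeroˡ a)) (+-identityʳ b)) (trans (*-congˡ (zeroˡ c)) (zeroʳ d))) (+-identityʳ b)
      , trans (+-cong (trans (+-cong (*-identityˡ c) (zeroˡ b)) (+-identityʳ c)) (zeroˡ a)) (+-identityʳ c)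

    trans₃ : ∀ {x y z} → x ≈₃ y → y ≈₃ z → x ≈₃ z
    trans₃ (e , e' , e″) (f , f' , f″) = trans e f , trans e' f' , trans e″ f″

  opaque
    unfolding _⊞_

    ⊟_ : T → T
    ⊟ (a , b , c) = - a , - b , - c

    isCommutativeRing₃ : IsCommutativeRing _≈₃_ _⊞_ _⊡_ ⊟_ (0# , 0# , 0#) (1# , 0# , 0#)
    isCommutativeRing₃ = record
      { isRing = record
        { +-isAbelianGroup = record
          { isGroup = record
            { isMonoid = record
              { isSemigroup = record
                { isMagma = record
                  { isEquivalence = record
                    { refl = R.refl , R.refl , R.refl
                    ; sym = λ (e , e' , e″) → sym e , sym e' , sym e″
                    ; trans = trans₃ }
                  ; ∙-cong = λ (e , e' , e″) (f , f' , f″) → +-cong e f , +-cong e' f' , +-cong e″ f″ }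
                ; assoc = λ _ _ _ → +-assoc _ _ _ , +-assoc _ _ _ , +-assoc _ _ _ }
              ; identity = (λ _ → +-identityˡ _ , +-identityˡ _ , +-identityˡ _) , (λ _ → +-identityʳ _ , +-identityʳ _ , +-identityʳ _) }
            ; inverse = (λ _ → -‿inverseˡ _ , -‿inverseˡ _ , -‿inverseˡ _) , (λ _ → -‿inverseʳ _ , -‿inverseʳ _ , -‿inverseʳ _)
            ; ⁻¹-cong = λ (e , e' , e″) → -‿cong e , -‿cong e' , -‿cong e″ }
          ; comm = λ _ _ → +-comm _ _ , +-comm _ _ , +-comm _ _ }
        ; *-cong = λ (e , e' , e″) (f , f' , f″) →
            +-cong (*-cong e f) (*-congˡ (+-cong (*-cong e' f″) (*-cong e″ f'))) , +-cong (+-cong (*-cong e f') (*-cong e' f)) (*-congˡ (*-cong e″ f″)) , +-cong (+-cong (*-cong e f″) (*-cong e' f')) (*-cong e″ f)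
        ; *-assoc = ⊡-assoc
        ; *-identity = ⊡-identityˡ , (λ x → trans₃ (⊡-comm x _) (⊡-identityˡ x))
        ; distrib = ⊡-distribˡ , (λ x y z → trans₃ (⊡-comm (y ⊞ z) x) (trans₃ (⊡-distribˡ x y z) (let (e , e' , e″) = ⊡-comm x y ; (f , f' , f″) = ⊡-comm x z in +-cong e f , +-cong e' f' , +-cong e″ f″))) }
      ; *-comm = ⊡-comm }

  cubic : Ring₀
  cubic = record { isCommutativeRing = isCommutativeRing₃ }

  emb : Carrier → T
  emb a = a , 0# , 0#

  v : T
  v = 0# , 1# , 0#

  opaque
    unfolding _⊞_ ⊟_

    emb-+ : ∀ a b → emb (a + b) ≈₃ (emb a ⊞ emb b)
    emb-+ a b = R.refl , R.sym (R.+-identityˡ R.0#) , R.sym (R.+-identityˡ R.0#)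

    emb-* : ∀ a b → emb (a * b) ≈₃ (emb a ⊡ emb b)
    emb-* a b = solve 3 (λ a b d → a :* b := a :* b :+ d :* (# 0 :* # 0 :+ # 0 :* # 0)) R.refl a b d , solve 3 (λ a b d → # 0 := a :* # 0 :+ # 0 :* b :+ d :* (# 0 :* # 0)) R.refl a b d , solve 2 (λ a b → # 0 := a :* # 0 :+ # 0 :* # 0 :+ # 0 :* b) R.refl a b

    emb-neg : ∀ a → emb (- a) ≈₃ (⊟ emb a)
    emb-neg a = R.refl , solve 0 (# 0 := :- # 0) R.refl , solve 0 (# 0 := :- # 0) R.refl

    v*v : (v ⊡ v) ≈₃ (0# , 0# , 1#)
    v*v = solve 1 (λ d → # 0 :* # 0 :+ d :* (# 1 :* # 0 :+ # 0 :* # 1) := # 0) R.refl d , solve 1 (λ d → # 0 :* # 1 :+ # 1 :* # 0 :+ d :* (# 0 :* # 0) := # 0) R.refl d , solve 0 (# 0 :* # 0 :+ # 1 :* # 1 :+ # 0 :* # 0 := # 1) R.refl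

    v*vv : (v ⊡ (0# , 0# , 1#)) ≈₃ emb d
    v*vv = solve 1 (λ d → # 0 :* # 0 :+ d :* (# 1 :* # 1 :+ # 0 :* # 0) := d) R.refl d , solve 1 (λ d → # 0 :* # 0 :+ # 1 :* # 0 :+ d :* (# 0 :* # 1) := # 0) R.refl d , solve 0 (# 0 :* # 1 :+ # 1 :* # 0 :+ # 0 :* # 0 := # 0) R.refl

    triple₀ : ∀ a b c → (a , b , c) ≈₃ (emb a ⊞ ((emb b ⊡ v) ⊞ (emb c ⊡ (0# , 0# , 1#))))
    triple₀ a b c = solve 4 (λ a b c d → a := a :+ ((b :* # 0 :+ d :* (# 0 :* # 0 :+ # 0 :* # 1)) :+ (c :* # 0 :+ d :* (# 0 :* # 1 :+ # 0 :* # 0)))) R.refl a b c d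
                  , solve 4 (λ a b c d → b := # 0 :+ ((b :* # 1 :+ # 0 :* # 0 :+ d :* (# 0 :* # 0)) :+ (c :* # 0 :+ # 0 :* # 0 :+ d :* (# 0 :* # 1)))) R.refl a b c d
                  , solve 2 (λ b c → c := # 0 :+ ((b :* # 0 :+ # 0 :* # 1 :+ # 0 :* # 0) :+ (c :* # 1 :+ # 0 :* # 0 :+ # 0 :* # 0))) R.refl b c

    first-+ : ∀ x y → proj₁ (x ⊞ y) ≈ proj₁ x + proj₁ y
    first-+ x y = R.refl

    first-v : ∀ a → proj₁ (emb a ⊡ v) ≈ 0#
    first-v a = solve 2 (λ a d → a :* # 0 :+ d :* (# 0 :* # 0 :+ # 0 :* # 1) := # 0) R.refl a d

    first-vv₀ : ∀ a → proj₁ (emb a ⊡ (0# , 0# , 1#)) ≈ 0#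
    first-vv₀ a = solve 2 (λ a d → a :* # 0 :+ d :* (# 0 :* # 1 :+ # 0 :* # 0) := # 0) R.refl a d

-- Polynomial identities behind the involution for r = 3.

cs₀ cs₁ cs₂ : List ℕ
cs₀ = 224 ∷ 12240 ∷ 21504 ∷ 1024 ∷ []
cs₁ = 1392 ∷ 20544 ∷ 13056 ∷ []
cs₂ = 16 ∷ 5088 ∷ 24768 ∷ 5120 ∷ []

module RingIdentities₃ (R : Ring₀) where
  open CommutativeRing R hiding (zero)
  open Numerals R using (nat)
  open Exp semiring using (_^_; ^-congˡ)
  private
    solve = IntSolver.solve R

    rfl : ∀ {x} → x ≈ x
    rfl = CommutativeRing.refl R

  horner : List ℕ → Carrier → Carrier
  horner [] x = 0#
  horner (c ∷ cs) x = nat c + x * horner cs x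

  horner-cong : ∀ cs {x y} → x ≈ y → horner cs x ≈ horner cs y
  horner-cong [] e = rfl
  horner-cong (c ∷ cs) e = +-congˡ (*-cong e (horner-cong cs e))

  -- The value at v' = (1 - v)/(1 + 2v), w = 1/(1 + 2v), of the modular parameter 1/(4v'³(1 - v'³)), up to 9z³.
  h₃ : Carrier → Carrier
  h₃ v = nat 16 * (v ^ 8 * (1# + v + v * v) ^ 2 * (1# + nat 2 * v) ^ 6)

  -- Here 1 - v'³ = 9v(1 + v + v²)w³, so 4v'³(1 - v'³) = 36v(1 - v)³(1 + v + v²)w⁶. The factor v⁸(1
  -- + v + v²)² of `h₃ v` completes this to v⁹(1 - v³)³, and 36 · 16 = 9 · 4³ explains the constant
  -- 16.
  h₃-inverse : ∀ v w i → (1# + nat 2 * v) * w ≈ 1# → let u' = ((1# - v) * w) ^ 3 ; z = nat 4 * (v ^ 3 * (1# - v ^ 3)) in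
    nat 4 * (u' * (1# - u')) * (i * h₃ v) ≈ i * (nat 9 * (z * (z * z)))
  h₃-inverse v w i bw = trans (*-congʳ (*-congˡ (*-congˡ (+-congʳ (sym bw³)))))
    (trans (solve 3 (λ v w i → let a = # 1 :- v ; b = # 1 :+ # 2 :* v ; u' = (a :* w) :^ 3 ; z = # 4 :* (v :^ 3 :* (# 1 :- v :^ 3)) in
           # 4 :* (u' :* ((b :* w) :^ 3 :- u')) :* (i :* (# 16 :* (v :^ 8 :* (# 1 :+ v :+ v :* v) :^ 2 :* b :^ 6))) := (b :* w) :^ 6 :* (i :* (# 9 :* (z :* (z :* z))))) rfl v w i)
    (trans (*-congʳ (trans (^-congˡ 6 bw) (solve 0 (# 1 :^ 6 := # 1) rfl))) (*-identityˡ _)))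
    where
    bw³ : ((1# + nat 2 * v) * w) ^ 3 ≈ 1#
    bw³ = trans (^-congˡ 3 bw) (solve 0 (# 1 :^ 3 := # 1) rfl)

  -- The coordinates of `h₃ v` with respect to 1, v and v² when v³ = u. The lowest term of `h₃ v` is
  -- 16v⁸ = 16u²v², hence the leading powers u³, u³ and u².
  part₀ part₁ part₂ : Carrier → Carrier
  part₀ u = u ^ 3 * horner cs₀ u
  part₁ u = u ^ 3 * horner cs₁ u
  part₂ u = u ^ 2 * horner cs₂ u

  h₃-parts : ∀ v u → v ^ 3 ≈ u → h₃ v ≈ part₀ u + (part₁ u * v + part₂ u * (v * v))
  h₃-parts v u e = trans
    (solve 1 (λ v → let u = v :^ 3 in # 16 :* (v :^ 8 :* (# 1 :+ v :+ v :* v) :^ 2 :* (# 1 :+ # 2 :* v) :^ 6) :=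
        u :^ 3 :* (# 224 :+ u :* (# 12240 :+ u :* (# 21504 :+ u :* (# 1024 :+ u :* # 0))))
        :+ (u :^ 3 :* (# 1392 :+ u :* (# 20544 :+ u :* (# 13056 :+ u :* # 0))) :* v
        :+ u :^ 2 :* (# 16 :+ u :* (# 5088 :+ u :* (# 24768 :+ u :* (# 5120 :+ u :* # 0)))) :* (v :* v))) rfl v)
    (+-cong (*-cong (^-congˡ 3 e) (horner-cong cs₀ e)) (+-cong (*-congʳ (*-cong (^-congˡ 3 e) (horner-cong cs₁ e))) (*-congʳ (*-cong (^-congˡ 2 e) (horner-cong cs₂ e)))))

  part₀-s : ∀ u s t → nat 2 * u ≈ 1# - s → s * s ≈ t →
    part₀ u ≈ horner (1481 ∷ 11634 ∷ 4365 ∷ 16 ∷ []) t + - (nat 24 * horner (275 ∷ 422 ∷ 32 ∷ []) t) * s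
  part₀-s u s t 2u ss = trans
    (solve 1 (λ u → let y = # 2 :* u in u :^ 3 :* (# 224 :+ u :* (# 12240 :+ u :* (# 21504 :+ u :* (# 1024 :+ u :* # 0)))) := y :^ 3 :* (# 28 :+ y :* (# 765 :+ y :* (# 672 :+ y :* (# 16 :+ y :* # 0))))) rfl u)
    (trans (*-cong (^-congˡ 3 2u) (horner-cong (28 ∷ 765 ∷ 672 ∷ 16 ∷ []) 2u))
    (trans (solve 1 (λ s → let y = # 1 :- s ; t = s :* s in y :^ 3 :* (# 28 :+ y :* (# 765 :+ y :* (# 672 :+ y :* (# 16 :+ y :* # 0)))) := (# 1481 :+ t :* (# 11634 :+ t :* (# 4365 :+ t :* (# 16 :+ t :* # 0)))) :+ (:- (# 24 :* (# 275 :+ t :* (# 422 :+ t :* (# 32 :+ t :* # 0))))) :* s) rfl s)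
    (+-cong (horner-cong (1481 ∷ 11634 ∷ 4365 ∷ 16 ∷ []) ss) (*-congʳ (-‿cong (*-congˡ (horner-cong (275 ∷ 422 ∷ 32 ∷ []) ss)))))))

  neg-neg : ∀ x → - - x ≈ x
  neg-neg = solve 1 (λ x → :- (:- x) := x) rfl

  -- Replaces ω² by -1 - ω; x will be a rational cube root of u and ωx its conjugate.
  reduce-ω : ∀ a b c x w → w * w + w + 1# ≈ 0# → a + (b * (w * x) + c * (w * x * (w * x))) ≈ a - c * (x * x) + (b * x - c * (x * x)) * w
  reduce-ω a b c x w e = trans (solve 5 (λ a b c x w → a :+ (b :* (w :* x) :+ c :* (w :* x :* (w :* x))) := a :- c :* (x :* x) :+ (b :* x :- c :* (x :* x)) :* w :+ c :* (x :* x) :* (w :* w :+ w :+ # 1)) rfl a b c x w) (trans (+-congˡ (trans (*-congˡ e) (zeroʳ _))) (+-identityʳ _))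

  a[b+cd] : ∀ a b c d → a * (b + c * d) ≈ a * c * d - - (a * b)
  a[b+cd] = solve 4 (λ a b c d → a :* (b :+ c :* d) := a :* c :* d :- (:- (a :* b))) rfl

  [1+2v][1-2v+4v²] : ∀ v j → (1# + nat 2 * v) * ((1# - nat 2 * v + nat 4 * (v * v)) * j) ≈ (1# + nat 8 * v ^ 3) * j
  [1+2v][1-2v+4v²] = solve 2 (λ v j → (# 1 :+ # 2 :* v) :* ((# 1 :- # 2 :* v :+ # 4 :* (v :* v)) :* j) := (# 1 :+ # 8 :* v :^ 3) :* j) rfl

module HornerHomomorphism (R S : Ring₀) (e : CommutativeRing.Carrier R → CommutativeRing.Carrier S) where
  private
    module R = CommutativeRing R
    module S = CommutativeRing S
    module RN = Numerals R
    module SN = Numerals S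
    module RI = RingIdentities₃ R
    module SI = RingIdentities₃ S

  hom-horner : e R.0# S.≈ S.0# → (∀ a b → e (a R.+ b) S.≈ e a S.+ e b) → (∀ a b → e (a R.* b) S.≈ e a S.* e b) → (∀ k → e (RN.nat k) S.≈ SN.nat k) →
    ∀ cs x → e (RI.horner cs x) S.≈ SI.horner cs (e x)
  hom-horner e-0 e-+ e-* e-nat [] x = e-0
  hom-horner e-0 e-+ e-* e-nat (c ∷ cs) x = S.trans (e-+ (RN.nat c) (x R.* RI.horner cs x)) (S.+-cong (e-nat c) (S.trans (e-* x (RI.horner cs x)) (S.*-congˡ {e x} (hom-horner e-0 e-+ e-* e-nat cs x))))

-- The type of append is found by unification: it is about the local append function in the definition of monomial.
mutual
  append : ∀ c k (xs : List ℕ) → _ ≡ xs ++ (c ∷ [])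

  monomial≡ : ∀ c k → monomial c k ≡ replicate k 0 ++ (c ∷ [])
  monomial≡ c k with replicate k 0
  ... | xs = append c k xs

  append c k [] = refl
  append c k (x ∷ xs) = ≡.cong (x ∷_) (append c k xs)

-- Computation for the small primes.

evalMod : ℕ → Poly → ℕ → ℕ
evalMod p [] x = 0
evalMod p (a ∷ f) x = modp p (a ℕ.+ x ℕ.* evalMod p f x)

rootsMod : ℕ → Poly → List ℕ
rootsMod p f = filter (λ x → modp p (evalMod p f x) ℕ.≟ 0) (upTo p)

rootCount : ℕ → Poly → ℕ
rootCount p f = length (rootsMod p f)

-- Composite numbers pass vacuously. For a prime of the range a count of distinct roots is enough to
-- detect splitting, since a split member of the family has simple roots only; `total` is its
-- degree.
agrees : ℕ → Poly → ℕ → ℕ → Bool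
agrees order f total p = not (Decidable.does (prime? p)) ∨ Decidable.isYes ((modp p order ℕ.≡ᵇ 0) Data.Bool.≟ (rootCount p (map (modp p) f) ℕ.≡ᵇ total))

agrees₂ agrees₃ : ℕ → Bool
agrees₂ p = agrees orderBabyMonster (ss2 p) (m₂ p ℕ.+ Defs.ε p ℕ.+ Defs.ν p) p
agrees₃ p = agrees orderFi24' (ss3 p) (m₃ p ℕ.+ Defs.δ p ℕ.+ Defs.δ p) p

-- The range is 5 ≤ p < 88. From 88 = 8 · 11 on, [p/8] exceeds the number 10 of exceptional zeros.
range₂ : All (λ k → Data.Bool.T (agrees₂ (5 ℕ.+ k))) (upTo 83)
range₂ = Decidable.toWitness {a? = All.all? (λ k → Data.Bool.Properties.T? (agrees₂ (5 ℕ.+ k))) (upTo 83)} Data.Unit.tt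

-- The range is 5 ≤ p < 78. From 78 = 6 · 13 on, [p/6] exceeds the number 12 of exceptional zeros.
range₃ : All (λ k → Data.Bool.T (agrees₃ (5 ℕ.+ k))) (upTo 73)
range₃ = Decidable.toWitness {a? = All.all? (λ k → Data.Bool.Properties.T? (agrees₃ (5 ℕ.+ k))) (upTo 73)} Data.Unit.tt

-- The product of each list evaluates to the group order, so a prime dividing the order is at most
-- the largest entry.
babyMonsterFactors fischerFactors : List ℕ
babyMonsterFactors = replicate 41 2 ++ replicate 13 3 ++ replicate 6 5 ++ 7 ∷ 7 ∷ 11 ∷ 13 ∷ 17 ∷ 19 ∷ 23 ∷ 31 ∷ 47 ∷ []
fischerFactors = replicate 21 2 ++ replicate 16 3 ++ 5 ∷ 5 ∷ 7 ∷ 7 ∷ 7 ∷ 11 ∷ 13 ∷ 17 ∷ 23 ∷ 29 ∷ []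

babyMonsterFactors≤47 : All (λ a → 0 ℕ.< a × a ℕ.≤ 47) babyMonsterFactors
babyMonsterFactors≤47 = Decidable.toWitness {a? = All.all? (λ a → (0 ℕ.<? a) Decidable.×-dec (a ℕ.≤? 47)) babyMonsterFactors} Data.Unit.tt

fischerFactors≤29 : All (λ a → 0 ℕ.< a × a ℕ.≤ 29) fischerFactors
fischerFactors≤29 = Decidable.toWitness {a? = All.all? (λ a → (0 ℕ.<? a) Decidable.×-dec (a ℕ.≤? 29)) fischerFactors} Data.Unit.tt

open ≡ using (_≢_)

-- Restricted to Set: each level argument left to inference in the many thousands of uses costs memory.
sym : {A : Set} {x y : A} → x ≡ y → y ≡ x
sym refl = refl

trans : {A : Set} {x y z : A} → x ≡ y → y ≡ z → x ≡ z
trans refl e = e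

cong : {A B : Set} (f : A → B) {x y : A} → x ≡ y → f x ≡ f y
cong f refl = refl

cong₂ : {A B C : Set} (f : A → B → C) {x y : A} {u v : B} → x ≡ y → u ≡ v → f x u ≡ f y v
cong₂ f refl refl = refl

subst : {A : Set} (P : A → Set) {x y : A} → x ≡ y → P x → P y
subst P refl z = z

[_,_]′ : {A B C : Set} → (A → C) → (B → C) → A ⊎ B → C
[ f , g ]′ (inj₁ x) = f x
[ f , g ]′ (inj₂ y) = g y

-- The prime field.

module Main (p : ℕ) (pp : Prime p) where
 instance
   p≢0 : NonZero p
   p≢0 = prime⇒nonZero pp

 F : Set
 F = Fin p

 infix 4 _≟F_
 _≟F_ : (x y : F) → Dec (x ≡ y)
 _≟F_ = Finₚ._≟_

 ι : ℕ → F
 ι n = fromℕ< (DM.m%n<n n p)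

 toℕ-ι : ∀ n → toℕ (ι n) ≡ n % p
 toℕ-ι n = Finₚ.toℕ-fromℕ< _

 ι-cong : ∀ {m n} → m % p ≡ n % p → ι m ≡ ι n
 ι-cong {m} {n} eq = Finₚ.toℕ-injective (trans (toℕ-ι m) (trans eq (sym (toℕ-ι n))))

 ι-injective : ∀ {m n} → ι m ≡ ι n → m % p ≡ n % p
 ι-injective {m} {n} eq = trans (sym (toℕ-ι m)) (trans (cong toℕ eq) (toℕ-ι n))

 ι-toℕ : ∀ x → ι (toℕ x) ≡ x
 ι-toℕ x = Finₚ.toℕ-injective (trans (toℕ-ι _) (DM.m<n⇒m%n≡m (Finₚ.toℕ<n x)))

 abstract
   _+F_ _*F_ : F → F → F
   x +F y = ι (toℕ x ℕ.+ toℕ y)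
   x *F y = ι (toℕ x ℕ.* toℕ y)

   -F_ : F → F
   -F x = ι (p ℕ.∸ toℕ x)

   0F 1F : F
   0F = ι 0
   1F = ι 1

   ι-+ : ∀ m n → ι (m ℕ.+ n) ≡ ι m +F ι n
   ι-+ m n = ι-cong (trans (DM.%-distribˡ-+ m n p) (cong₂ (λ a b → (a ℕ.+ b) % p) (sym (toℕ-ι m)) (sym (toℕ-ι n))))

   ι-* : ∀ m n → ι (m ℕ.* n) ≡ ι m *F ι n
   ι-* m n = ι-cong (trans (DM.%-distribˡ-* m n p) (cong₂ (λ a b → (a ℕ.* b) % p) (sym (toℕ-ι m)) (sym (toℕ-ι n))))

   ι-0 : ι 0 ≡ 0F
   ι-0 = refl

   ι-1 : ι 1 ≡ 1F
   ι-1 = refl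

   neg-def : ∀ x → -F x ≡ ι (p ℕ.∸ toℕ x)
   neg-def x = refl

 ι-p≡0 : ι p ≡ 0F
 ι-p≡0 = trans (ι-cong (trans (DM.n%n≡0 p) (sym (DM.m<n⇒m%n≡m (ℕ.>-nonZero⁻¹ p))))) ι-0

 private
   -- Since `ι` is onto, an identity between operations that commute with `ι` descends from the
   -- natural numbers.
   lift₂ : ∀ {f : ℕ → ℕ → ℕ} {g : ℕ → ℕ → ℕ} {f' g' : F → F → F} →
           (∀ m n → ι (f m n) ≡ f' (ι m) (ι n)) → (∀ m n → ι (g m n) ≡ g' (ι m) (ι n)) →
           (∀ m n → f m n ≡ g m n) → ∀ x y → f' x y ≡ g' x y
   lift₂ {f} {g} {f'} {g'} hf hg eq x y = begin
     f' x y ≡⟨ cong₂ f' (sym (ι-toℕ x)) (sym (ι-toℕ y)) ⟩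
     f' (ι (toℕ x)) (ι (toℕ y)) ≡⟨ hf _ _ ⟨
     ι (f (toℕ x) (toℕ y)) ≡⟨ cong ι (eq _ _) ⟩
     ι (g (toℕ x) (toℕ y)) ≡⟨ hg _ _ ⟩
     g' (ι (toℕ x)) (ι (toℕ y)) ≡⟨ cong₂ g' (ι-toℕ x) (ι-toℕ y) ⟩
     g' x y ∎
     where open ≡.≡-Reasoning

   lift₃ : ∀ {f g : ℕ → ℕ → ℕ → ℕ} {f' g' : F → F → F → F} →
           (∀ m n o → ι (f m n o) ≡ f' (ι m) (ι n) (ι o)) → (∀ m n o → ι (g m n o) ≡ g' (ι m) (ι n) (ι o)) →
           (∀ m n o → f m n o ≡ g m n o) → ∀ x y z → f' x y z ≡ g' x y z
   lift₃ {f} {g} {f'} {g'} hf hg eq x y z = begin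
     f' x y z ≡⟨ cong₂ (λ a b → f' a b z) (sym (ι-toℕ x)) (sym (ι-toℕ y)) ⟩
     f' (ι (toℕ x)) (ι (toℕ y)) z ≡⟨ cong (f' _ _) (sym (ι-toℕ z)) ⟩
     f' (ι (toℕ x)) (ι (toℕ y)) (ι (toℕ z)) ≡⟨ hf _ _ _ ⟨
     ι (f (toℕ x) (toℕ y) (toℕ z)) ≡⟨ cong ι (eq _ _ _) ⟩
     ι (g (toℕ x) (toℕ y) (toℕ z)) ≡⟨ hg _ _ _ ⟩
     g' (ι (toℕ x)) (ι (toℕ y)) (ι (toℕ z)) ≡⟨ cong (g' _ _) (ι-toℕ z) ⟩
     g' (ι (toℕ x)) (ι (toℕ y)) z ≡⟨ cong₂ (λ a b → g' a b z) (ι-toℕ x) (ι-toℕ y) ⟩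
     g' x y z ∎
     where open ≡.≡-Reasoning

   +-comm' : ∀ x y → x +F y ≡ y +F x
   +-comm' = lift₂ ι-+ (λ m n → ι-+ n m) ℕₚ.+-comm

   *-comm' : ∀ x y → x *F y ≡ y *F x
   *-comm' = lift₂ ι-* (λ m n → ι-* n m) ℕₚ.*-comm

   +-assoc' : ∀ x y z → (x +F y) +F z ≡ x +F (y +F z)
   +-assoc' = lift₃ (λ m n o → trans (ι-+ (m ℕ.+ n) o) (cong (_+F ι o) (ι-+ m n))) (λ m n o → trans (ι-+ m (n ℕ.+ o)) (cong (ι m +F_) (ι-+ n o))) ℕₚ.+-assoc

   *-assoc' : ∀ x y z → (x *F y) *F z ≡ x *F (y *F z)
   *-assoc' = lift₃ (λ m n o → trans (ι-* (m ℕ.* n) o) (cong (_*F ι o) (ι-* m n))) (λ m n o → trans (ι-* m (n ℕ.* o)) (cong (ι m *F_) (ι-* n o))) ℕₚ.*-assoc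

   distribˡ' : ∀ x y z → x *F (y +F z) ≡ (x *F y) +F (x *F z)
   distribˡ' = lift₃ (λ m n o → trans (ι-* m (n ℕ.+ o)) (cong (ι m *F_) (ι-+ n o))) (λ m n o → trans (ι-+ (m ℕ.* n) (m ℕ.* o)) (cong₂ _+F_ (ι-* m n) (ι-* m o))) ℕₚ.*-distribˡ-+

   +-idˡ : ∀ x → 0F +F x ≡ x
   +-idˡ x = trans (cong₂ _+F_ (sym ι-0) (sym (ι-toℕ x))) (trans (sym (ι-+ 0 (toℕ x))) (ι-toℕ x))

   *-idˡ : ∀ x → 1F *F x ≡ x
   *-idˡ x = trans (cong₂ _*F_ (sym ι-1) (sym (ι-toℕ x))) (trans (sym (ι-* 1 (toℕ x))) (trans (cong ι (ℕₚ.*-identityˡ _)) (ι-toℕ x)))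

   inverseʳ' : ∀ x → x +F (-F x) ≡ 0F
   inverseʳ' x = begin
     x +F (-F x) ≡⟨ cong₂ _+F_ (sym (ι-toℕ x)) (neg-def x) ⟩
     ι (toℕ x) +F ι (p ℕ.∸ toℕ x) ≡⟨ ι-+ (toℕ x) (p ℕ.∸ toℕ x) ⟨
     ι (toℕ x ℕ.+ (p ℕ.∸ toℕ x)) ≡⟨ cong ι (m+[n∸m]≡n (<⇒≤ (Finₚ.toℕ<n x))) ⟩
     ι p ≡⟨ ι-p≡0 ⟩
     0F ∎
     where open ≡.≡-Reasoning

 𝔽 : Ring₀
 𝔽 = record
   { Carrier = F ; _≈_ = _≡_ ; _+_ = _+F_ ; _*_ = _*F_ ; -_ = -F_ ; 0# = 0F ; 1# = 1F
   ; isCommutativeRing = record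
     { isRing = record
       { +-isAbelianGroup = record
         { isGroup = record
           { isMonoid = record
             { isSemigroup = record
               { isMagma = record { isEquivalence = ≡.isEquivalence ; ∙-cong = cong₂ _+F_ }
               ; assoc = +-assoc' }
             ; identity = +-idˡ , (λ x → trans (+-comm' x 0F) (+-idˡ x)) }
           ; inverse = (λ x → trans (+-comm' _ x) (inverseʳ' x)) , inverseʳ'
           ; ⁻¹-cong = cong -F_ }
         ; comm = +-comm' }
       ; *-cong = cong₂ _*F_
       ; *-assoc = *-assoc'
       ; *-identity = *-idˡ , (λ x → trans (*-comm' x 1F) (*-idˡ x))
       ; distrib = distribˡ' , (λ x y z → trans (*-comm' _ x) (trans (distribˡ' x y z) (cong₂ _+F_ (*-comm' x y) (*-comm' x z)))) }
     ; *-comm = *-comm' } }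

 open CommutativeRing 𝔽 public using (_+_; _*_; -_; _-_; 0#; 1#; semiring; +-identityˡ; +-identityʳ; *-identityˡ; *-identityʳ; zeroˡ; zeroʳ; +-comm; *-comm; +-assoc; *-assoc; distribˡ; distribʳ; -‿inverseʳ)
 open Numerals 𝔽 public
 solve = IntSolver.solve 𝔽
 open RingLemmas 𝔽 public

 infixr 8 _^_
 _^_ : F → ℕ → F
 _^_ = Exp._^_ semiring

 ^-homo-* = Exp.^-homo-* semiring
 ^-assocʳ = Exp.^-assocʳ semiring

 0^ : ∀ {k} → 0 ℕ.< k → 0# ^ k ≡ 0#
 0^ {suc k} _ = zeroˡ _

 ι≡nat : ∀ n → ι n ≡ nat n
 ι≡nat zero = trans ι-0 (sym nat-0)
 ι≡nat (suc n) = trans (ι-+ 1 n) (trans (cong₂ _+F_ ι-1 (ι≡nat n)) (sym (nat-suc n)))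

 nat-p : nat p ≡ 0#
 nat-p = trans (sym (ι≡nat p)) ι-p≡0

 nat-toℕ : ∀ x → nat (toℕ x) ≡ x
 nat-toℕ x = trans (sym (ι≡nat _)) (ι-toℕ x)

 nat≡0⇒p∣ : ∀ {n} → nat n ≡ 0# → p ∣ n
 nat≡0⇒p∣ {n} eq = m%n≡0⇒n∣m n p (trans (ι-injective (trans (ι≡nat n) (trans eq (sym ι-0)))) (DM.m<n⇒m%n≡m (ℕ.>-nonZero⁻¹ p)))

 p∣⇒nat≡0 : ∀ {n} → p ∣ n → nat n ≡ 0#
 p∣⇒nat≡0 (divides q refl) = trans (nat-* q p) (trans (cong (nat q *_) nat-p) (zeroʳ _))

 nat≢0 : ∀ {n} → 0 ℕ.< n → n ℕ.< p → nat n ≢ 0#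
 nat≢0 {n} 0<n n<p eq = <⇒≱ n<p (∣⇒≤ {{ℕ.>-nonZero 0<n}} (nat≡0⇒p∣ eq))

 nat-injective : ∀ {m n} → m ℕ.< p → n ℕ.< p → nat m ≡ nat n → m ≡ n
 nat-injective {m} {n} m<p n<p eq = trans (sym (DM.m<n⇒m%n≡m m<p)) (trans (ι-injective (trans (ι≡nat m) (trans eq (sym (ι≡nat n))))) (DM.m<n⇒m%n≡m n<p))

 1<p : 1 ℕ.< p
 1<p = ℕₚ.≤∧≢⇒< (ℕ.>-nonZero⁻¹ p) (λ e → ¬prime[1] (subst Prime (sym e) pp))

 1≢0 : 1# ≢ 0#
 1≢0 eq = nat≢0 {1} (ℕ.s≤s ℕ.z≤n) 1<p (trans nat-1 eq)

 x*y≡0 : ∀ {x y} → x * y ≡ 0# → x ≡ 0# ⊎ y ≡ 0#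
 x*y≡0 {x} {y} eq with euclidsLemma (toℕ x) (toℕ y) pp (nat≡0⇒p∣ (trans (nat-* _ _) (trans (cong₂ _*_ (nat-toℕ x) (nat-toℕ y)) eq)))
 ... | inj₁ d = inj₁ (trans (sym (nat-toℕ x)) (p∣⇒nat≡0 d))
 ... | inj₂ d = inj₂ (trans (sym (nat-toℕ y)) (p∣⇒nat≡0 d))

 x*y≢0 : ∀ {x y} → x ≢ 0# → y ≢ 0# → x * y ≢ 0#
 x*y≢0 x≢0 y≢0 eq with x*y≡0 eq
 ... | inj₁ e = x≢0 e
 ... | inj₂ e = y≢0 e

 x^n≢0 : ∀ {x} → x ≢ 0# → ∀ n → x ^ n ≢ 0#
 x^n≢0 x≢0 zero = 1≢0
 x^n≢0 x≢0 (suc n) = x*y≢0 x≢0 (x^n≢0 x≢0 n)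

 x-y≡0⇒x≡y : ∀ {x y} → x - y ≡ 0# → x ≡ y
 x-y≡0⇒x≡y {x} {y} eq = trans (solve 2 (λ x y → x := (x :- y) :+ y) refl x y) (trans (cong (_+ y) eq) (+-identityˡ y))

 *-cancelˡ : ∀ {c x y} → c ≢ 0# → c * x ≡ c * y → x ≡ y
 *-cancelˡ {c} {x} {y} c≢0 eq = [ (λ e → ⊥-elim (c≢0 e)) , x-y≡0⇒x≡y ]′ (x*y≡0 {c} {x - y} c[x-y]≡0)
   where
   c[x-y]≡0 : c * (x - y) ≡ 0#
   c[x-y]≡0 = trans (solve 3 (λ c x y → c :* (x :- y) := c :* x :- c :* y) refl c x y) (trans (cong (_- c * y) eq) (-‿inverseʳ _))

 -- Induction over the representative: (1 + n)^p = 1 + n^p by additivity of Frobenius.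
 fermat : ∀ x → x ^ p ≡ x
 fermat x = subst (λ y → y ^ p ≡ y) (nat-toℕ x) (go (toℕ x))
   where
   go : ∀ n → nat n ^ p ≡ nat n
   go zero = trans (cong (_^ p) nat-0) (trans (0^p (ℕ.>-nonZero⁻¹ p)) (sym nat-0))
     where
     0^p : ∀ {q} → 0 ℕ.< q → 0# ^ q ≡ 0#
     0^p {suc q} _ = 0^[1+n]≈0 q
   go (suc n) = begin
     nat (suc n) ^ p ≡⟨ cong (_^ p) (nat-suc n) ⟩
     (1# + nat n) ^ p ≡⟨ frobenius-+ pp nat-p 1# (nat n) ⟩
     1# ^ p + nat n ^ p ≡⟨ cong₂ _+_ (1^n≈1 p) (go n) ⟩
     1# + nat n ≡⟨ nat-suc n ⟨
     nat (suc n) ∎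
     where open ≡.≡-Reasoning

 suc-pred-p : suc (p ℕ.∸ 1) ≡ p
 suc-pred-p = m+[n∸m]≡n (ℕ.>-nonZero⁻¹ p)

 fermat′ : ∀ {x} → x ≢ 0# → x ^ (p ℕ.∸ 1) ≡ 1#
 fermat′ {x} x≢0 = *-cancelˡ x≢0 (trans (cong (x ^_) suc-pred-p) (trans (fermat x) (sym (*-identityʳ x))))

 -- The inverse by Fermat's theorem is a total function. For odd p it maps 0 to 0, so that x ↦ b/x
 -- with b ≠ 0 is an involution of the whole field.
 inv : F → F
 inv x = x ^ (p ℕ.∸ 2)

 *-inv : ∀ {x} → x ≢ 0# → x * inv x ≡ 1#
 *-inv {x} x≢0 = trans (cong (x ^_) (sym (ℕₚ.+-∸-assoc 1 1<p))) (fermat′ x≢0)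

 -- The polynomial ring over the prime field.

 Pl : Set
 Pl = List F

 cf : Pl → ℕ → F
 cf [] _ = 0#
 cf (a ∷ f) zero = a
 cf (a ∷ f) (suc i) = cf f i

 infix 4 _≋_
 -- Lists with different numbers of trailing zeros are to be equal. The record keeps the two
 -- polynomials visible to unification, which a bare function type would not.
 record _≋_ (f g : Pl) : Set where
   constructor coeffwise
   field at : ∀ i → cf f i ≡ cf g i
 open _≋_ public

 infixl 6 _⊕_
 infixl 7 _⊗_
 infix 8 ⊝_

 _⊕_ : Pl → Pl → Pl
 [] ⊕ g = g
 (a ∷ f) ⊕ [] = a ∷ f
 (a ∷ f) ⊕ (b ∷ g) = a + b ∷ f ⊕ g

 ⊝_ : Pl → Pl
 ⊝_ = map (λ a → - a)

 scl : F → Pl → Pl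
 scl a = map (a *_)

 _⊗_ : Pl → Pl → Pl
 [] ⊗ g = []
 (a ∷ f) ⊗ g = scl a g ⊕ (0# ∷ f ⊗ g)

 -- Opaque, so that products with concrete polynomials are not unfolded.
 opaque
   C : F → Pl
   C a = a ∷ []

   X : Pl
   X = 0# ∷ 1# ∷ []

   lin : F → Pl
   lin a = - a ∷ 1# ∷ []

 cf-⊕ : ∀ f g i → cf (f ⊕ g) i ≡ cf f i + cf g i
 cf-⊕ [] g i = sym (+-identityˡ _)
 cf-⊕ (a ∷ f) [] i = sym (+-identityʳ _)
 cf-⊕ (a ∷ f) (b ∷ g) zero = refl
 cf-⊕ (a ∷ f) (b ∷ g) (suc i) = cf-⊕ f g i

 cf-scl : ∀ a f i → cf (scl a f) i ≡ a * cf f i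
 cf-scl a [] i = sym (zeroʳ a)
 cf-scl a (b ∷ f) zero = refl
 cf-scl a (b ∷ f) (suc i) = cf-scl a f i

 cf-⊝ : ∀ f i → cf (⊝ f) i ≡ - cf f i
 cf-⊝ [] i = solve 0 (# 0 := :- # 0) refl
 cf-⊝ (b ∷ f) zero = refl
 cf-⊝ (b ∷ f) (suc i) = cf-⊝ f i

 private
   ≋-refl : ∀ {f} → f ≋ f
   ≋-refl = coeffwise λ i → refl

   ≋-sym : ∀ {f g} → f ≋ g → g ≋ f
   ≋-sym e = coeffwise λ i → sym (at e i)

   ≋-trans : ∀ {f g h} → f ≋ g → g ≋ h → f ≋ h
   ≋-trans e e' = coeffwise λ i → trans (at e i) (at e' i)

   ⊕-cong : ∀ {f f' g g'} → f ≋ f' → g ≋ g' → f ⊕ g ≋ f' ⊕ g'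
   ⊕-cong {f} {f'} {g} {g'} e e' = coeffwise λ i → trans (cf-⊕ f g i) (trans (cong₂ _+_ (at e i) (at e' i)) (sym (cf-⊕ f' g' i)))

   ⊕-assoc : ∀ f g h → (f ⊕ g) ⊕ h ≋ f ⊕ (g ⊕ h)
   ⊕-assoc f g h = coeffwise λ i → trans (cf-⊕ (f ⊕ g) h i) (trans (cong (_+ cf h i) (cf-⊕ f g i)) (trans (+-assoc _ _ _) (trans (cong (cf f i +_) (sym (cf-⊕ g h i))) (sym (cf-⊕ f (g ⊕ h) i)))))

   ⊕-comm : ∀ f g → f ⊕ g ≋ g ⊕ f
   ⊕-comm f g = coeffwise λ i → trans (cf-⊕ f g i) (trans (+-comm _ _) (sym (cf-⊕ g f i)))

   ⊕-identityʳ : ∀ f → f ⊕ [] ≋ f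
   ⊕-identityʳ f = coeffwise λ i → trans (cf-⊕ f [] i) (+-identityʳ _)

   ⊝-inverseʳ : ∀ f → f ⊕ ⊝ f ≋ []
   ⊝-inverseʳ f = coeffwise λ i → trans (cf-⊕ f (⊝ f) i) (trans (cong (λ a → cf f i + a) (cf-⊝ f i)) (-‿inverseʳ (cf f i)))

   ⊝-cong : ∀ {f g} → f ≋ g → ⊝ f ≋ ⊝ g
   ⊝-cong {f} {g} e = coeffwise λ i → trans (cf-⊝ f i) (trans (cong (λ a → - a) (at e i)) (sym (cf-⊝ g i)))

   ∷-cong : ∀ {a b f g} → a ≡ b → f ≋ g → a ∷ f ≋ b ∷ g
   ∷-cong e e' = coeffwise λ { zero → e ; (suc i) → at e' i }

   scl-cong : ∀ a {f g} → f ≋ g → scl a f ≋ scl a g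
   scl-cong a {f} {g} e = coeffwise λ i → trans (cf-scl a f i) (trans (cong (a *_) (at e i)) (sym (cf-scl a g i)))

   0∷[]≋[] : 0# ∷ [] ≋ []
   0∷[]≋[] = coeffwise λ { zero → refl ; (suc i) → refl }

   interchange : ∀ f g h k → (f ⊕ g) ⊕ (h ⊕ k) ≋ (f ⊕ h) ⊕ (g ⊕ k)
   interchange f g h k = coeffwise λ i → begin
     cf ((f ⊕ g) ⊕ (h ⊕ k)) i ≡⟨ cf-⊕ (f ⊕ g) (h ⊕ k) i ⟩
     cf (f ⊕ g) i + cf (h ⊕ k) i ≡⟨ cong₂ _+_ (cf-⊕ f g i) (cf-⊕ h k i) ⟩
     (cf f i + cf g i) + (cf h i + cf k i) ≡⟨ solve 4 (λ a b c d → (a :+ b) :+ (c :+ d) := (a :+ c) :+ (b :+ d)) refl (cf f i) (cf g i) (cf h i) (cf k i) ⟩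
     (cf f i + cf h i) + (cf g i + cf k i) ≡⟨ cong₂ _+_ (cf-⊕ f h i) (cf-⊕ g k i) ⟨
     cf (f ⊕ h) i + cf (g ⊕ k) i ≡⟨ cf-⊕ (f ⊕ h) (g ⊕ k) i ⟨
     cf ((f ⊕ h) ⊕ (g ⊕ k)) i ∎
     where open ≡.≡-Reasoning

   ⊗-congˡ : ∀ f {g g'} → g ≋ g' → f ⊗ g ≋ f ⊗ g'
   ⊗-congˡ [] e = ≋-refl
   ⊗-congˡ (a ∷ f) e = ⊕-cong (scl-cong a e) (∷-cong refl (⊗-congˡ f e))

   ⊗-zeroʳ : ∀ f → f ⊗ [] ≋ []
   ⊗-zeroʳ [] = ≋-refl
   ⊗-zeroʳ (a ∷ f) = ≋-trans (∷-cong refl (⊗-zeroʳ f)) 0∷[]≋[]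

   ⊗-∷ʳ : ∀ f b g → f ⊗ (b ∷ g) ≋ scl b f ⊕ (0# ∷ f ⊗ g)
   ⊗-∷ʳ [] b g = ≋-sym 0∷[]≋[]
   ⊗-∷ʳ (a ∷ f) b g = ∷-cong (cong (_+ 0#) (*-comm a b)) tail-eq
     where
     tail-eq : scl a g ⊕ (f ⊗ (b ∷ g)) ≋ scl b f ⊕ (scl a g ⊕ (0# ∷ f ⊗ g))
     tail-eq = ≋-trans (⊕-cong (≋-refl {scl a g}) (⊗-∷ʳ f b g)) (≋-trans (≋-sym (⊕-assoc (scl a g) (scl b f) _)) (≋-trans (⊕-cong (⊕-comm (scl a g) (scl b f)) ≋-refl) (⊕-assoc (scl b f) (scl a g) _)))

   ⊗-comm : ∀ f g → f ⊗ g ≋ g ⊗ f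
   ⊗-comm [] g = ≋-sym (⊗-zeroʳ g)
   ⊗-comm (a ∷ f) g = ≋-trans (⊕-cong (≋-refl {scl a g}) (∷-cong refl (⊗-comm f g))) (≋-sym (⊗-∷ʳ g a f))

   ⊗-cong : ∀ {f f' g g'} → f ≋ f' → g ≋ g' → f ⊗ g ≋ f' ⊗ g'
   ⊗-cong {f} {f'} {g} {g'} e e' = ≋-trans (⊗-congˡ f e') (≋-trans (⊗-comm f g') (≋-trans (⊗-congˡ g' e) (⊗-comm g' f')))

   scl-⊕ : ∀ a f g → scl a (f ⊕ g) ≋ scl a f ⊕ scl a g
   scl-⊕ a f g = coeffwise λ i → trans (cf-scl a (f ⊕ g) i) (trans (cong (a *_) (cf-⊕ f g i)) (trans (distribˡ a _ _) (trans (cong₂ _+_ (sym (cf-scl a f i)) (sym (cf-scl a g i))) (sym (cf-⊕ (scl a f) (scl a g) i)))))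

   ⊗-distribˡ : ∀ f g h → f ⊗ (g ⊕ h) ≋ f ⊗ g ⊕ f ⊗ h
   ⊗-distribˡ [] g h = ≋-refl
   ⊗-distribˡ (a ∷ f) g h = ≋-trans (⊕-cong (scl-⊕ a g h) (∷-cong (sym (+-identityˡ 0#)) (⊗-distribˡ f g h))) (interchange (scl a g) (scl a h) (0# ∷ f ⊗ g) (0# ∷ f ⊗ h))

   ⊗-distribʳ : ∀ f g h → (g ⊕ h) ⊗ f ≋ g ⊗ f ⊕ h ⊗ f
   ⊗-distribʳ f g h = ≋-trans (⊗-comm (g ⊕ h) f) (≋-trans (⊗-distribˡ f g h) (⊕-cong (⊗-comm f g) (⊗-comm f h)))

   scl² : ∀ a b h → scl (a * b) h ≋ scl a (scl b h)
   scl² a b h = coeffwise λ i → trans (cf-scl (a * b) h i) (trans (*-assoc a b _) (trans (cong (a *_) (sym (cf-scl b h i))) (sym (cf-scl a (scl b h) i))))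

   scl-⊗ : ∀ a g h → scl a g ⊗ h ≋ scl a (g ⊗ h)
   scl-⊗ a [] h = ≋-refl
   scl-⊗ a (b ∷ g) h = ≋-trans (⊕-cong (scl² a b h) (∷-cong (sym (zeroʳ a)) (scl-⊗ a g h))) (≋-sym (scl-⊕ a (scl b h) (0# ∷ g ⊗ h)))

   scl-0 : ∀ f → scl 0# f ≋ []
   scl-0 f = coeffwise λ i → trans (cf-scl 0# f i) (zeroˡ _)

   shift-⊗ : ∀ f h → (0# ∷ f) ⊗ h ≋ 0# ∷ f ⊗ h
   shift-⊗ f h = ⊕-cong (scl-0 h) ≋-refl

   ⊗-assoc : ∀ f g h → (f ⊗ g) ⊗ h ≋ f ⊗ (g ⊗ h)
   ⊗-assoc [] g h = ≋-refl
   ⊗-assoc (a ∷ f) g h = ≋-trans (⊗-distribʳ h (scl a g) (0# ∷ f ⊗ g)) (⊕-cong (scl-⊗ a g h) (≋-trans (shift-⊗ (f ⊗ g) h) (∷-cong refl (⊗-assoc f g h))))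

   opaque
    unfolding C
    ⊗-identityˡ : ∀ f → C 1# ⊗ f ≋ f
    ⊗-identityˡ f = ≋-trans (⊕-cong {scl 1# f} {f} (coeffwise λ i → trans (cf-scl 1# f i) (*-identityˡ _)) 0∷[]≋[]) (⊕-identityʳ f)

 polyRing : Ring₀
 polyRing = record
   { Carrier = Pl ; _≈_ = _≋_ ; _+_ = _⊕_ ; _*_ = _⊗_ ; -_ = ⊝_ ; 0# = [] ; 1# = C 1#
   ; isCommutativeRing = record
     { isRing = record
       { +-isAbelianGroup = record
         { isGroup = record
           { isMonoid = record
             { isSemigroup = record
               { isMagma = record
                 { isEquivalence = record { refl = ≋-refl ; sym = ≋-sym ; trans = ≋-trans }
                 ; ∙-cong = ⊕-cong }
               ; assoc = ⊕-assoc }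
             ; identity = (λ f → ≋-refl) , ⊕-identityʳ }
           ; inverse = (λ f → ≋-trans (⊕-comm (⊝ f) f) (⊝-inverseʳ f)) , ⊝-inverseʳ
           ; ⁻¹-cong = ⊝-cong }
         ; comm = ⊕-comm }
       ; *-cong = ⊗-cong
       ; *-assoc = ⊗-assoc
       ; *-identity = ⊗-identityˡ , (λ f → ≋-trans (⊗-comm f _) (⊗-identityˡ f))
       ; distrib = ⊗-distribˡ , ⊗-distribʳ }
     ; *-comm = ⊗-comm } }

 module P = CommutativeRing polyRing
 module PN = Numerals polyRing
 solveP = IntSolver.solve polyRing
 module PL = RingLemmas polyRing

 infixr 8 _^P_
 _^P_ : List F → ℕ → List F
 _^P_ = Exp._^_ P.semiring

 ^P-homo-* = Exp.^-homo-* P.semiring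

 C-cong : ∀ {a b} → a ≡ b → C a ≋ C b
 C-cong refl = P.refl

 opaque
   unfolding C

   cf-C-0 : ∀ a → cf (C a) 0 ≡ a
   cf-C-0 a = refl

   C-+ : ∀ a b → C (a + b) ≋ C a ⊕ C b
   C-+ a b = P.refl

   C-* : ∀ a b → C (a * b) ≋ C a ⊗ C b
   C-* a b = coeffwise λ { zero → sym (+-identityʳ _) ; (suc i) → refl }

   C-0 : C 0# ≋ []
   C-0 = 0∷[]≋[]

   scl≋C⊗ : ∀ a f → scl a f ≋ C a ⊗ f
   scl≋C⊗ a f = P.trans (P.sym (P.+-identityʳ (scl a f))) (P.+-congˡ {scl a f} (P.sym 0∷[]≋[]))

   C-neg : ∀ a → C (- a) ≋ ⊝ C a
   C-neg a = P.refl

   length-C : ∀ a → length (C a) ≡ 1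
   length-C a = refl

   C⊕0∷ : ∀ a f → a ∷ f ≋ C a ⊕ (0# ∷ f)
   C⊕0∷ a f = coeffwise λ { zero → sym (+-identityʳ a) ; (suc i) → refl }

 opaque
   unfolding X

   X⊗ : ∀ f → X ⊗ f ≋ 0# ∷ f
   X⊗ f = P.trans (shift-⊗ (1# ∷ []) f) (∷-cong refl (≋-trans (⊕-cong {scl 1# f} {f} (coeffwise λ i → trans (cf-scl 1# f i) (*-identityˡ _)) 0∷[]≋[]) (⊕-identityʳ f)))

   length-X : length X ≡ 2
   length-X = refl

 opaque
   unfolding lin C X

   lin≋ : ∀ a → lin a ≋ X ⊕ ⊝ C a
   lin≋ a = coeffwise λ { zero → sym (+-identityˡ _) ; (suc zero) → refl ; (suc (suc i)) → refl }

 C-nat : ∀ n → C (nat n) ≋ PN.nat n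
 C-nat zero = P.trans (C-cong nat-0) (P.trans C-0 (P.sym PN.nat-0))
 C-nat (suc n) = P.trans (C-cong (nat-suc n)) (P.trans (C-+ 1# (nat n)) (P.trans (P.+-congˡ {C 1#} (C-nat n)) (P.sym (PN.nat-suc n))))

 cf-C⊗ : ∀ a f i → cf (C a ⊗ f) i ≡ a * cf f i
 cf-C⊗ a f i = trans (sym (at (scl≋C⊗ a f) i)) (cf-scl a f i)

 cf-length : ∀ f {i} → length f ℕ.≤ i → cf f i ≡ 0#
 cf-length [] _ = refl
 cf-length (a ∷ f) (ℕ.s≤s len) = cf-length f len

 Π : List F → Pl
 Π = foldr (λ a f → lin a ⊗ f) (C 1#)

 -- Evaluation of polynomials in algebras over the prime field.

 record Algebra : Set₁ where
   field
     ring : Ring₀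
   open CommutativeRing ring using (Carrier; _≈_) renaming (_+_ to _+R_; _*_ to _*R_; 0# to 0R; 1# to 1R)
   field
     ρ : F → Carrier
     ρ-+ : ∀ a b → ρ (a + b) ≈ ρ a +R ρ b
     ρ-* : ∀ a b → ρ (a * b) ≈ ρ a *R ρ b
     ρ-0 : ρ 0# ≈ 0R
     ρ-1 : ρ 1# ≈ 1R

 module Evaluation (A : Algebra) where
   open Algebra A
   open CommutativeRing ring renaming (_+_ to _+R_; _*_ to _*R_; -_ to -R_; _-_ to _-R_; 0# to 0R; 1# to 1R; refl to ≈-refl; sym to ≈-sym; trans to ≈-trans; zeroʳ to zeroʳR; zeroˡ to zeroˡR; +-identityʳ to +R-identityʳ; +-identityˡ to +R-identityˡ) hiding (zero; ring; semiring)
   private solveR = IntSolver.solve ring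
   module N = Numerals ring
   module L = RingLemmas ring

   infixr 8 _^R_
   _^R_ : Carrier → ℕ → Carrier
   _^R_ = Exp._^_ (CommutativeRing.semiring ring)
   open import Relation.Binary.Reasoning.Setoid setoid

   ev : Pl → Carrier → Carrier
   ev [] x = 0R
   ev (a ∷ f) x = ρ a +R x *R ev f x

   ρ-cong : ∀ {a b} → a ≡ b → ρ a ≈ ρ b
   ρ-cong refl = ≈-refl

   ev-zero : ∀ f x → f ≋ [] → ev f x ≈ 0R
   ev-zero [] x e = ≈-refl
   ev-zero (a ∷ f) x e = begin
     ρ a +R x *R ev f x ≈⟨ +-cong (≈-trans (ρ-cong (at e 0)) ρ-0) (*-congˡ (ev-zero f x (coeffwise λ i → at e (suc i)))) ⟩
     0R +R x *R 0R ≈⟨ solveR 1 (λ x → # 0 :+ x :* # 0 := # 0) ≈-refl x ⟩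
     0R ∎

   ev-cong : ∀ {f g} x → f ≋ g → ev f x ≈ ev g x
   ev-cong {[]} {g} x e = ≈-sym (ev-zero g x (P.sym e))
   ev-cong {a ∷ f} {[]} x e = ev-zero (a ∷ f) x e
   ev-cong {a ∷ f} {b ∷ g} x e = +-cong (ρ-cong (at e 0)) (*-congˡ (ev-cong {f} {g} x (coeffwise λ i → at e (suc i))))

   ev-⊕ : ∀ f g x → ev (f ⊕ g) x ≈ ev f x +R ev g x
   ev-⊕ [] g x = ≈-sym (+R-identityˡ _)
   ev-⊕ (a ∷ f) [] x = ≈-sym (+R-identityʳ _)
   ev-⊕ (a ∷ f) (b ∷ g) x = begin
     ρ (a + b) +R x *R ev (f ⊕ g) x ≈⟨ +-cong (ρ-+ a b) (*-congˡ (ev-⊕ f g x)) ⟩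
     (ρ a +R ρ b) +R x *R (ev f x +R ev g x) ≈⟨ solveR 5 (λ a b x f g → (a :+ b) :+ x :* (f :+ g) := (a :+ x :* f) :+ (b :+ x :* g)) ≈-refl (ρ a) (ρ b) x (ev f x) (ev g x) ⟩
     (ρ a +R x *R ev f x) +R (ρ b +R x *R ev g x) ∎

   ev-scl : ∀ a f x → ev (scl a f) x ≈ ρ a *R ev f x
   ev-scl a [] x = ≈-sym (zeroʳR _)
   ev-scl a (b ∷ f) x = begin
     ρ (a * b) +R x *R ev (scl a f) x ≈⟨ +-cong (ρ-* a b) (*-congˡ (ev-scl a f x)) ⟩
     ρ a *R ρ b +R x *R (ρ a *R ev f x) ≈⟨ solveR 4 (λ a b x f → a :* b :+ x :* (a :* f) := a :* (b :+ x :* f)) ≈-refl (ρ a) (ρ b) x (ev f x) ⟩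
     ρ a *R (ρ b +R x *R ev f x) ∎

   ev-⊗ : ∀ f g x → ev (f ⊗ g) x ≈ ev f x *R ev g x
   ev-⊗ [] g x = ≈-sym (zeroˡR _)
   ev-⊗ (a ∷ f) g x = begin
     ev (scl a g ⊕ (0# ∷ f ⊗ g)) x ≈⟨ ev-⊕ (scl a g) _ x ⟩
     ev (scl a g) x +R (ρ 0# +R x *R ev (f ⊗ g) x) ≈⟨ +-cong (ev-scl a g x) (+-cong ρ-0 (*-congˡ (ev-⊗ f g x))) ⟩
     ρ a *R ev g x +R (0R +R x *R (ev f x *R ev g x)) ≈⟨ solveR 4 (λ a g x f → a :* g :+ (# 0 :+ x :* (f :* g)) := (a :+ x :* f) :* g) ≈-refl (ρ a) (ev g x) x (ev f x) ⟩
     (ρ a +R x *R ev f x) *R ev g x ∎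

   opaque
    unfolding C
    ev-C : ∀ a x → ev (C a) x ≈ ρ a
    ev-C a x = ≈-trans (+-congˡ (zeroʳR x)) (+R-identityʳ _)

   ev-1 : ∀ x → ev (C 1#) x ≈ 1R
   ev-1 x = ≈-trans (ev-C 1# x) ρ-1

   opaque
    unfolding X
    ev-X : ∀ x → ev X x ≈ x
    ev-X x = begin
      ρ 0# +R x *R (ρ 1# +R x *R 0R) ≈⟨ +-cong ρ-0 (*-congˡ (+-congʳ ρ-1)) ⟩
      0R +R x *R (1R +R x *R 0R) ≈⟨ solveR 1 (λ x → # 0 :+ x :* (# 1 :+ x :* # 0) := x) ≈-refl x ⟩
      x ∎

   ev-⊝ : ∀ f x → ev (⊝ f) x ≈ -R ev f x
   ev-⊝ f x = begin
     ev (⊝ f) x ≈⟨ solveR 2 (λ a b → a := (b :+ a) :- b) ≈-refl (ev (⊝ f) x) (ev f x) ⟩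
     (ev f x +R ev (⊝ f) x) -R ev f x ≈⟨ +-congʳ (≈-trans (≈-sym (ev-⊕ f (⊝ f) x)) (ev-zero (f ⊕ ⊝ f) x (P.-‿inverseʳ f))) ⟩
     0R -R ev f x ≈⟨ +R-identityˡ _ ⟩
     -R ev f x ∎

   ev-^ : ∀ f n x → ev (f ^P n) x ≈ ev f x ^R n
   ev-^ f zero x = ev-1 x
   ev-^ f (suc n) x = ≈-trans (ev-⊗ f (f ^P n) x) (*-congˡ (ev-^ f n x))

   ρ-nat : ∀ n → ρ (nat n) ≈ N.nat n
   ρ-nat zero = ≈-trans (ρ-cong nat-0) (≈-trans ρ-0 (≈-sym N.nat-0))
   ρ-nat (suc n) = ≈-trans (ρ-cong (nat-suc n)) (≈-trans (ρ-+ 1# (nat n)) (≈-trans (+-cong ρ-1 (ρ-nat n)) (≈-sym (N.nat-suc n))))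

   ρ-^ : ∀ a n → ρ (a ^ n) ≈ ρ a ^R n
   ρ-^ a zero = ρ-1
   ρ-^ a (suc n) = ≈-trans (ρ-* a _) (*-congˡ (ρ-^ a n))

   char-p : N.nat p ≈ 0R
   char-p = ≈-trans (≈-sym (ρ-nat p)) (≈-trans (ρ-cong nat-p) ρ-0)

   frobenius : ∀ x y → (x +R y) ^R p ≈ x ^R p +R y ^R p
   frobenius = L.frobenius-+ pp char-p

   ρ-fermat : ∀ a → ρ a ^R p ≈ ρ a
   ρ-fermat a = ≈-trans (≈-sym (ρ-^ a p)) (ρ-cong (fermat a))

   ev-lin : ∀ a x → ev (lin a) x ≈ x -R ρ a
   ev-lin a x = begin
     ev (lin a) x ≈⟨ ev-cong {lin a} {X ⊕ ⊝ C a} x (lin≋ a) ⟩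
     ev (X ⊕ ⊝ C a) x ≈⟨ ev-⊕ X (⊝ C a) x ⟩
     ev X x +R ev (⊝ C a) x ≈⟨ +-cong (ev-X x) (≈-trans (ev-⊝ (C a) x) (-‿cong (ev-C a x))) ⟩
     x -R ρ a ∎

 self : Algebra
 self = record { ring = 𝔽 ; ρ = λ a → a ; ρ-+ = λ _ _ → refl ; ρ-* = λ _ _ → refl ; ρ-0 = refl ; ρ-1 = refl }

 module E = Evaluation self

 quadAlgebra : (A : Algebra) → CommutativeRing.Carrier (Algebra.ring A) → Algebra
 quadAlgebra A d = record
   { ring = Quadratic.quad ring d
   ; ρ = λ a → ρ a , R.0#
   ; ρ-+ = λ a b → S.trans (ρ-+ a b , R.refl) (Quadratic.emb-+ ring d (ρ a) (ρ b))
   ; ρ-* = λ a b → S.trans (ρ-* a b , R.refl) (Quadratic.emb-* ring d (ρ a) (ρ b))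
   ; ρ-0 = ρ-0 , R.refl
   ; ρ-1 = ρ-1 , R.refl }
   where
   open Algebra A
   module R = CommutativeRing ring
   module S = CommutativeRing (Quadratic.quad ring d)

 cubicAlgebra : (A : Algebra) → CommutativeRing.Carrier (Algebra.ring A) → Algebra
 cubicAlgebra A d = record
   { ring = Cubic.cubic ring d
   ; ρ = λ a → ρ a , R.0# , R.0#
   ; ρ-+ = λ a b → S.trans (ρ-+ a b , R.refl , R.refl) (Cubic.emb-+ ring d (ρ a) (ρ b))
   ; ρ-* = λ a b → S.trans (ρ-* a b , R.refl , R.refl) (Cubic.emb-* ring d (ρ a) (ρ b))
   ; ρ-0 = ρ-0 , R.refl , R.refl
   ; ρ-1 = ρ-1 , R.refl , R.refl }
   where
   open Algebra A
   module R = CommutativeRing ring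
   module S = CommutativeRing (Cubic.cubic ring d)

 open SetoidReasoning P.setoid

 -- Cancellation, division by linear factors and roots.

 ∷≋ : ∀ c g → c ∷ g ≋ C c ⊕ X ⊗ g
 ∷≋ c g = P.trans (C⊕0∷ c g) (P.+-congˡ {C c} (P.sym (X⊗ g)))

 cf-1+ : ∀ c g i → cf ((C 1# ⊕ C c ⊗ X) ⊗ g) (suc i) ≡ cf g (suc i) + c * cf g i
 cf-1+ c g i = trans (at (solveP 3 (λ c x g → (# 1 :+ c :* x) :* g := g :+ c :* (x :* g)) P.refl (C c) X g) (suc i))
   (trans (cf-⊕ g (C c ⊗ (X ⊗ g)) (suc i)) (cong (cf g (suc i) +_) (trans (cf-C⊗ c (X ⊗ g) (suc i)) (cong (c *_) (at (X⊗ g) (suc i))))))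

 cf-1+-0 : ∀ c g → cf ((C 1# ⊕ C c ⊗ X) ⊗ g) 0 ≡ cf g 0
 cf-1+-0 c g = trans (at (solveP 3 (λ c x g → (# 1 :+ c :* x) :* g := g :+ x :* (c :* g)) P.refl (C c) X g) 0)
   (trans (cf-⊕ g (X ⊗ (C c ⊗ g)) 0) (trans (cong (cf g 0 +_) (at (X⊗ (C c ⊗ g)) 0)) (+-identityʳ _)))

 -- The constant coefficient of 1 + cX is a unit, so the coefficients of `g` vanish one after the
 -- other from the bottom up.
 cancel-1+ : ∀ c g → (C 1# ⊕ C c ⊗ X) ⊗ g ≋ [] → g ≋ []
 cancel-1+ c g e = coeffwise go
   where
   go : ∀ i → cf g i ≡ 0#
   go zero = trans (sym (cf-1+-0 c g)) (at e 0)
   go (suc i) = trans (trans (sym (+-identityʳ _)) (cong (cf g (suc i) +_) (sym (trans (cong (c *_) (go i)) (zeroʳ c))))) (trans (sym (cf-1+ c g i)) (at e (suc i)))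

 cf-lin : ∀ a g i → cf (lin a ⊗ g) (suc i) ≡ cf g i - a * cf g (suc i)
 cf-lin a g i = trans (at (P.trans (P.*-congʳ (lin≋ a)) (solveP 3 (λ x a g → (x :- a) :* g := x :* g :+ :- (a :* g)) P.refl X (C a) g)) (suc i))
   (trans (cf-⊕ (X ⊗ g) (⊝ (C a ⊗ g)) (suc i)) (cong₂ _+_ (at (X⊗ g) (suc i)) (trans (cf-⊝ (C a ⊗ g) (suc i)) (cong (λ b → - b) (cf-C⊗ a g (suc i))))))

 -- Here only the leading coefficient is known to be a unit, so the coefficients vanish from the top
 -- down, starting beyond the length of `g`.
 cancel-lin : ∀ a g → lin a ⊗ g ≋ [] → g ≋ []
 cancel-lin a g e = coeffwise λ i → go (length g) i (m≤n+m _ _)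
   where
   go : ∀ k i → length g ℕ.≤ i ℕ.+ k → cf g i ≡ 0#
   go zero i len = cf-length g (subst (length g ℕ.≤_) (ℕₚ.+-identityʳ i) len)
   go (suc k) i len = trans (x-y≡0⇒x≡y (trans (sym (cf-lin a g i)) (at e (suc i)))) (trans (cong (a *_) (go k (suc i) (subst (length g ℕ.≤_) (ℕₚ.+-suc i k) len))) (zeroʳ a))

 cancel-lin^ : ∀ a n g → lin a ^P n ⊗ g ≋ [] → g ≋ []
 cancel-lin^ a zero g e = P.trans (P.sym (P.*-identityˡ g)) e
 cancel-lin^ a (suc n) g e = cancel-lin^ a n g (cancel-lin a _ (P.trans (P.sym (P.*-assoc (lin a) (lin a ^P n) g)) e))

 ⊖≋[]⇒≋ : ∀ f g → f ⊕ ⊝ g ≋ [] → f ≋ g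
 ⊖≋[]⇒≋ f g e = P.trans (solveP 2 (λ f g → f := (f :- g) :+ g) P.refl f g) (P.+-congʳ e)

 cancel-lin-≋ : ∀ a f g → lin a ⊗ f ≋ lin a ⊗ g → f ≋ g
 cancel-lin-≋ a f g e = ⊖≋[]⇒≋ f g (cancel-lin a _ (P.trans (solveP 3 (λ l f g → l :* (f :- g) := l :* f :- l :* g) P.refl (lin a) f g) (P.trans (P.+-congʳ {⊝ (lin a ⊗ g)} e) (P.-‿inverseʳ (lin a ⊗ g)))))

 -- Synthetic division: the coefficients of the quotient are the values at a of the successive
 -- tails.
 quo : F → Pl → Pl
 quo a [] = []
 quo a (c ∷ []) = []
 quo a (c ∷ g@(_ ∷ _)) = E.ev g a ∷ quo a g

 length-quo : ∀ a f → length (quo a f) ≡ length f ℕ.∸ 1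
 length-quo a [] = refl
 length-quo a (c ∷ []) = refl
 length-quo a (c ∷ g@(_ ∷ _)) = cong suc (length-quo a g)

 division : ∀ a f → f ≋ lin a ⊗ quo a f ⊕ C (E.ev f a)
 division a [] = P.sym (P.trans (P.+-cong (P.zeroʳ (lin a)) C-0) P.refl)
 division a (c ∷ []) = P.sym (P.trans (P.+-congʳ (P.zeroʳ (lin a))) (P.trans (C-cong (trans (cong (λ b → c + b) (zeroʳ a)) (+-identityʳ c))) (P.sym (P.trans (∷≋ c []) (P.trans (P.+-congˡ {C c} (P.zeroʳ X)) (P.+-identityʳ (C c)))))))
 division a (c ∷ g@(_ ∷ _)) = begin
   c ∷ g ≈⟨ ∷≋ c g ⟩
   C c ⊕ X ⊗ g ≈⟨ P.+-congˡ {C c} (P.*-congˡ {X} (division a g)) ⟩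
   C c ⊕ X ⊗ (lin a ⊗ quo a g ⊕ C r) ≈⟨ P.+-congˡ {C c} (P.*-congˡ {X} (P.+-congʳ {C r} (P.*-congʳ {quo a g} (lin≋ a)))) ⟩
   C c ⊕ X ⊗ ((X ⊕ ⊝ C a) ⊗ quo a g ⊕ C r) ≈⟨ solveP 5 (λ c x a q r → c :+ x :* ((x :- a) :* q :+ r) := (x :- a) :* (r :+ x :* q) :+ (c :+ a :* r)) P.refl (C c) X (C a) (quo a g) (C r) ⟩
   (X ⊕ ⊝ C a) ⊗ (C r ⊕ X ⊗ quo a g) ⊕ (C c ⊕ C a ⊗ C r) ≈⟨ P.+-cong (P.*-cong (lin≋ a) (∷≋ r (quo a g))) (P.trans (C-+ c (a * r)) (P.+-congˡ {C c} (C-* a r))) ⟨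
   lin a ⊗ (r ∷ quo a g) ⊕ C (c + a * r) ∎
   where r = E.ev g a

 factor : ∀ a f → E.ev f a ≡ 0# → f ≋ lin a ⊗ quo a f
 factor a f e = P.trans (division a f) (P.trans (P.+-congˡ {lin a ⊗ quo a f} (P.trans (C-cong e) C-0)) (P.+-identityʳ _))

 Root : Pl → F → Set
 Root f a = E.ev f a ≡ 0#

 private
   quo-roots : ∀ {a as} f → Root f a → All (a ≢_) as → All (Root f) as → All (Root (quo a f)) as
   quo-roots f fa [] [] = []
   quo-roots {a} {b ∷ _} f fa (a≢b ∷ ne) (fb ∷ fbs) = [ (λ e → ⊥-elim (a≢b (sym (x-y≡0⇒x≡y (trans (sym (E.ev-lin a b)) e))))) , (λ e → e) ]′ (x*y≡0 (trans (sym (E.ev-⊗ (lin a) (quo a f) b)) (trans (sym (E.ev-cong b (factor a f fa))) fb)))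
     ∷ quo-roots f fa ne fbs

 too-many-roots : ∀ {as} f → Unique as → All (Root f) as → length f ℕ.≤ length as → f ≋ []
 too-many-roots [] [] [] len = P.refl
 too-many-roots {a ∷ as} f (ne ∷ uniq) (fa ∷ fas) len = P.trans (factor a f fa) (P.trans (P.*-congˡ {lin a} (too-many-roots (quo a f) uniq (quo-roots f fa ne fas) (subst (ℕ._≤ length as) (sym (length-quo a f)) (ℕₚ.∸-monoˡ-≤ 1 len)))) (P.zeroʳ (lin a)))

 factor-roots : ∀ {as} f → Unique as → All (Root f) as → ∃ λ h → f ≋ Π as ⊗ h
 factor-roots f [] [] = f , P.sym (P.*-identityˡ f)
 factor-roots {a ∷ as} f (ne ∷ uniq) (fa ∷ fas) with factor-roots (quo a f) uniq (quo-roots f fa ne fas)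
 ... | h , e = h , P.trans (factor a f fa) (P.trans (P.*-congˡ {lin a} e) (P.sym (P.*-assoc (lin a) (Π as) h)))

 -- Derivatives and degree bounds.

 D : Pl → Pl
 D [] = []
 D (a ∷ f) = f ⊕ (0# ∷ D f)

 cf-D : ∀ f i → cf (D f) i ≡ nat (suc i) * cf f (suc i)
 cf-D [] i = sym (zeroʳ _)
 cf-D (a ∷ f) zero = trans (cf-⊕ f (0# ∷ D f) 0) (trans (+-identityʳ _) (sym (trans (cong (_* cf f 0) nat-1) (*-identityˡ _))))
 cf-D (a ∷ f) (suc i) = trans (cf-⊕ f (0# ∷ D f) (suc i)) (trans (cong (cf f (suc i) +_) (cf-D f i)) (trans (solve 2 (λ c n → c :+ n :* c := (# 1 :+ n) :* c) refl (cf f (suc i)) (nat (suc i))) (cong (_* cf f (suc i)) (sym (nat-suc (suc i))))))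

 D-cong : ∀ {f g} → f ≋ g → D f ≋ D g
 D-cong {f} {g} e = coeffwise λ i → trans (cf-D f i) (trans (cong (nat (suc i) *_) (at e (suc i))) (sym (cf-D g i)))

 D-⊕ : ∀ f g → D (f ⊕ g) ≋ D f ⊕ D g
 D-⊕ f g = coeffwise λ i → trans (cf-D (f ⊕ g) i) (trans (cong (nat (suc i) *_) (cf-⊕ f g (suc i))) (trans (distribˡ _ _ _) (trans (cong₂ _+_ (sym (cf-D f i)) (sym (cf-D g i))) (sym (cf-⊕ (D f) (D g) i)))))

 D-⊝ : ∀ f → D (⊝ f) ≋ ⊝ D f
 D-⊝ f = coeffwise λ i → trans (cf-D (⊝ f) i) (trans (cong (nat (suc i) *_) (cf-⊝ f (suc i))) (trans (solve 2 (λ n c → n :* :- c := :- (n :* c)) refl (nat (suc i)) (cf f (suc i))) (trans (cong (λ a → - a) (sym (cf-D f i))) (sym (cf-⊝ (D f) i)))))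

 D-scl : ∀ a f → D (scl a f) ≋ C a ⊗ D f
 D-scl a f = coeffwise λ i → trans (cf-D (scl a f) i) (trans (cong (nat (suc i) *_) (cf-scl a f (suc i))) (trans (solve 3 (λ n a c → n :* (a :* c) := a :* (n :* c)) refl (nat (suc i)) a (cf f (suc i))) (trans (cong (a *_) (sym (cf-D f i))) (sym (cf-C⊗ a (D f) i)))))

 D-∷ : ∀ a f → D (a ∷ f) ≋ f ⊕ X ⊗ D f
 D-∷ a f = P.+-congˡ {f} (P.sym (X⊗ (D f)))

 opaque
   unfolding C X
   D-C : ∀ a → D (C a) ≋ []
   D-C a = C-0

   D-X : D X ≋ C 1#
   D-X = coeffwise λ { zero → +-identityʳ 1# ; (suc zero) → refl ; (suc (suc i)) → refl }

 D-1 : D (C 1#) ≋ []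
 D-1 = D-C 1#

 D-nat : ∀ n → D (PN.nat n) ≋ []
 D-nat n = P.trans (D-cong (P.sym (C-nat n))) (D-C (nat n))

 leibniz : ∀ f g → D (f ⊗ g) ≋ D f ⊗ g ⊕ f ⊗ D g
 leibniz [] g = P.refl
 leibniz (a ∷ f) g = begin
   D (scl a g ⊕ (0# ∷ f ⊗ g)) ≈⟨ D-⊕ (scl a g) (0# ∷ f ⊗ g) ⟩
   D (scl a g) ⊕ D (0# ∷ f ⊗ g) ≈⟨ P.+-cong (D-scl a g) (P.trans (D-∷ 0# (f ⊗ g)) (P.+-congˡ {f ⊗ g} (P.*-congˡ {X} (leibniz f g)))) ⟩
   C a ⊗ D g ⊕ (f ⊗ g ⊕ X ⊗ (D f ⊗ g ⊕ f ⊗ D g)) ≈⟨ solveP 6 (λ a x f g f' g' → a :* g' :+ (f :* g :+ x :* (f' :* g :+ f :* g')) := (f :+ x :* f') :* g :+ (a :+ x :* f) :* g') P.refl (C a) X f g (D f) (D g) ⟩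
   (f ⊕ X ⊗ D f) ⊗ g ⊕ (C a ⊕ X ⊗ f) ⊗ D g ≈⟨ P.+-cong (P.*-congʳ {g} (D-∷ a f)) (P.*-congʳ {D g} (∷≋ a f)) ⟨
   D (a ∷ f) ⊗ g ⊕ (a ∷ f) ⊗ D g ∎

 D-C⊗ : ∀ a f → D (C a ⊗ f) ≋ C a ⊗ D f
 D-C⊗ a f = P.trans (D-cong (P.sym (scl≋C⊗ a f))) (D-scl a f)

 D-^ : ∀ f n → D (f ^P suc n) ≋ PN.nat (suc n) ⊗ (f ^P n ⊗ D f)
 D-^ f zero = begin
   D (f ⊗ C 1#) ≈⟨ D-cong (P.*-identityʳ f) ⟩
   D f ≈⟨ solveP 1 (λ d → # 1 :* (# 1 :* d) := d) P.refl (D f) ⟨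
   C 1# ⊗ (C 1# ⊗ D f) ≈⟨ P.*-congʳ {C 1# ⊗ D f} PN.nat-1 ⟨
   PN.nat 1 ⊗ (C 1# ⊗ D f) ∎
 D-^ f (suc n) = begin
   D (f ⊗ f ^P suc n) ≈⟨ leibniz f (f ^P suc n) ⟩
   D f ⊗ f ^P suc n ⊕ f ⊗ D (f ^P suc n) ≈⟨ P.+-congˡ {D f ⊗ f ^P suc n} (P.*-congˡ {f} (D-^ f n)) ⟩
   D f ⊗ (f ⊗ f ^P n) ⊕ f ⊗ (PN.nat (suc n) ⊗ (f ^P n ⊗ D f)) ≈⟨ solveP 4 (λ d f g n → d :* (f :* g) :+ f :* (n :* (g :* d)) := (# 1 :+ n) :* ((f :* g) :* d)) P.refl (D f) f (f ^P n) (PN.nat (suc n)) ⟩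
   (C 1# ⊕ PN.nat (suc n)) ⊗ ((f ⊗ f ^P n) ⊗ D f) ≈⟨ P.*-congʳ {f ^P suc n ⊗ D f} (PN.nat-suc (suc n)) ⟨
   PN.nat (suc (suc n)) ⊗ (f ^P suc n ⊗ D f) ∎

 -- The additional factor `f` avoids the exponent n - 1, so n = 0 is no exception.
 f⊗D-^ : ∀ f n → f ⊗ D (f ^P n) ≋ PN.nat n ⊗ (f ^P n ⊗ D f)
 f⊗D-^ f zero = P.trans (P.*-congˡ {f} D-1) (P.trans (P.zeroʳ f) (P.sym (P.trans (P.*-congʳ {(f ^P 0) ⊗ D f} PN.nat-0) (P.zeroˡ ((f ^P 0) ⊗ D f)))))
 f⊗D-^ f (suc n) = P.trans (P.*-congˡ {f} (D-^ f n)) (solveP 4 (λ f n g d → f :* (n :* (g :* d)) := n :* ((f :* g) :* d)) P.refl f (PN.nat (suc n)) (f ^P n) (D f))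

 θ : Pl → Pl
 θ f = X ⊗ D f

 cf-θ : ∀ f i → cf (θ f) i ≡ nat i * cf f i
 cf-θ f zero = trans (at (X⊗ (D f)) 0) (sym (trans (cong (_* cf f 0) nat-0) (zeroˡ _)))
 cf-θ f (suc i) = trans (at (X⊗ (D f)) (suc i)) (cf-D f i)

 -- A degree bound that, unlike the length of the list, respects `≋`.
 Below : ℕ → Pl → Set
 Below n f = ∀ i → n ℕ.≤ i → cf f i ≡ 0#

 Below-mono : ∀ {m n} f → m ℕ.≤ n → Below m f → Below n f
 Below-mono f m≤n b i n≤i = b i (≤-trans m≤n n≤i)

 Below-⊕ : ∀ {n} f g → Below n f → Below n g → Below n (f ⊕ g)
 Below-⊕ f g bf bg i n≤i = trans (cf-⊕ f g i) (trans (cong₂ _+_ (bf i n≤i) (bg i n≤i)) (+-identityˡ 0#))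

 Below-C⊗ : ∀ {n} a f → Below n f → Below n (C a ⊗ f)
 Below-C⊗ a f bf i n≤i = trans (cf-C⊗ a f i) (trans (cong (a *_) (bf i n≤i)) (zeroʳ a))

 Below-⊗ : ∀ {m n} f g → Below (suc m) f → Below (suc n) g → Below (suc (m ℕ.+ n)) (f ⊗ g)
 Below-⊗ [] g bf bg i _ = refl
 Below-⊗ {m} {n} (a ∷ f) g bf bg (suc i) (ℕ.s≤s m+n≤i) = trans (cf-⊕ (scl a g) (0# ∷ f ⊗ g) (suc i)) (trans (cong₂ _+_ (trans (cf-scl a g (suc i)) (trans (cong (a *_) (bg (suc i) (ℕ.s≤s (≤-trans (m≤n+m n m) m+n≤i)))) (zeroʳ a))) (rest m bf m+n≤i)) (+-identityˡ 0#))
   where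
   rest : ∀ m → Below (suc m) (a ∷ f) → m ℕ.+ n ℕ.≤ i → cf (f ⊗ g) i ≡ 0#
   rest zero b _ = at (P.trans (P.*-congʳ {g} {f} {[]} (coeffwise λ j → b (suc j) (ℕ.s≤s ℕ.z≤n))) P.refl) i
   rest (suc m) b le = Below-⊗ {m} {n} f g (λ j le' → b (suc j) (ℕ.s≤s le')) bg i le

 Below-C : ∀ a → Below 1 (C a)
 Below-C a i le = cf-length (C a) (≤-trans (≤-reflexive (length-C a)) le)

 Below-X : Below 2 X
 Below-X i le = cf-length X (≤-trans (≤-reflexive length-X) le)

 Below-^ : ∀ f {k} → Below (suc k) f → ∀ n → Below (suc (n ℕ.* k)) (f ^P n)
 Below-^ f b zero = Below-C 1#
 Below-^ f b (suc n) = Below-⊗ f (f ^P n) b (Below-^ f b n)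

 Below-cong : ∀ {n f g} → f ≋ g → Below n f → Below n g
 Below-cong e b i le = trans (sym (at e i)) (b i le)

 Below-Σ : ∀ {n} k {t} → (∀ i → i ℕ.≤ k → Below n (t i)) → Below n (PL.Σ≤ k t)
 Below-Σ zero b = b 0 ℕ.z≤n
 Below-Σ (suc k) {t} b = Below-⊕ (PL.Σ≤ k t) (t (suc k)) (Below-Σ k (λ i le → b i (ℕₚ.m≤n⇒m≤1+n le))) (b (suc k) ≤-refl)

 ev-0 : ∀ f → E.ev f 0# ≡ cf f 0
 ev-0 [] = refl
 ev-0 (a ∷ f) = trans (cong (λ b → a + b) (zeroˡ _)) (+-identityʳ a)

 D-nat⊗ : ∀ n f → D (PN.nat n ⊗ f) ≋ PN.nat n ⊗ D f
 D-nat⊗ n f = P.trans (leibniz (PN.nat n) f) (P.+-congʳ {PN.nat n ⊗ D f} (P.*-congʳ {f} (D-nat n)))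

 -- The hypergeometric equation satisfied by ψ.

 -- The quadratic transformation of Gauss: (1 - 2u)^ν φ(4u(1 - u)), where φ is a truncated
 -- ₂F₁(-m, b; 1; ·), solves the hypergeometric equation u(1 - u)y″ + (1 - 2u)y′ = g y.

 record GaussData : Set where
   field
     m ν : ℕ
     ν≤1 : ν ≡ 0 ⊎ ν ≡ 1
     b g : F
     c : ℕ → F
     -- The parameters -m and b have sum 1/2 + ν. For ν = 0 this is the condition in Gauss's
     -- transformation; for ν = 1 it is the one after Euler's transformation, whose factor √(1 - z)
     -- is 1 - 2u. The field `mb` fixes their product accordingly.
     b-m : nat 2 * (b - nat m) ≡ 1# + nat 2 * nat ν
     mb : - (nat 4 * (nat m * b)) ≡ g + nat 2 * nat ν
     c-rec : ∀ n → n ℕ.< m → nat (suc n) * nat (suc n) * c (suc n) ≡ (nat n - nat m) * (nat n + b) * c n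
     c-0 : c 0 ≡ 1#

 module Gauss (data₀ : GaussData) where
   open GaussData data₀

   -- The operator u(1 - u)y″ + (1 - 2u)y′ - gy, written with θ = u d/du so that the coefficients of
   -- `L f` can be read off; `L-expand` restores the usual form.
   L : Pl → Pl
   L f = D (θ f) ⊕ ⊝ θ (θ f) ⊕ ⊝ θ f ⊕ ⊝ (C g ⊗ f)

   private
     S Z : Pl
     S = C 1# ⊕ ⊝ (PN.nat 2 ⊗ X)
     Z = PN.nat 4 ⊗ (X ⊗ (C 1# ⊕ ⊝ X))

     D-θ : ∀ f → D (θ f) ≋ D f ⊕ X ⊗ D (D f)
     D-θ f = P.trans (leibniz X (D f)) (P.+-congʳ {X ⊗ D (D f)} (P.trans (P.*-congʳ {D f} D-X) (P.*-identityˡ (D f))))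

     L-expand : ∀ f → L f ≋ X ⊗ (C 1# ⊕ ⊝ X) ⊗ D (D f) ⊕ S ⊗ D f ⊕ ⊝ (C g ⊗ f)
     L-expand f = P.trans (P.+-congʳ {⊝ (C g ⊗ f)} (P.+-congʳ {⊝ θ f} (P.+-cong (D-θ f) (P.-‿cong (P.*-congˡ {X} (D-θ f))))))
       (solveP 5 (λ x d dd g f → (d :+ x :* dd) :- x :* (d :+ x :* dd) :- x :* d :- g :* f := x :* (# 1 :- x) :* dd :+ (# 1 :- # 2 :* x) :* d :- g :* f) P.refl X (D f) (D (D f)) (C g) f)

     L-cong : ∀ {f h} → f ≋ h → L f ≋ L h
     L-cong {f} {h} e = P.+-cong (P.+-cong (P.+-cong (D-cong (P.*-congˡ {X} (D-cong e))) (P.-‿cong (P.*-congˡ {X} (D-cong (P.*-congˡ {X} (D-cong e)))))) (P.-‿cong (P.*-congˡ {X} (D-cong e)))) (P.-‿cong (P.*-congˡ {C g} e))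

     L-⊕ : ∀ f h → L (f ⊕ h) ≋ L f ⊕ L h
     L-⊕ f h = P.trans (L-expand (f ⊕ h)) (P.trans
       (P.+-congʳ {⊝ (C g ⊗ (f ⊕ h))} (P.+-cong (P.*-congˡ {X ⊗ (C 1# ⊕ ⊝ X)} (P.trans (D-cong (D-⊕ f h)) (D-⊕ (D f) (D h)))) (P.*-congˡ {S} (D-⊕ f h))))
       (P.trans (solveP 9 (λ q s g f h a b d e → q :* (a :+ b) :+ s :* (d :+ e) :- g :* (f :+ h) := (q :* a :+ s :* d :- g :* f) :+ (q :* b :+ s :* e :- g :* h)) P.refl (X ⊗ (C 1# ⊕ ⊝ X)) S (C g) f h (D (D f)) (D (D h)) (D f) (D h))
       (P.sym (P.+-cong (L-expand f) (L-expand h)))))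

     L-C⊗ : ∀ a f → L (C a ⊗ f) ≋ C a ⊗ L f
     L-C⊗ a f = P.trans (L-expand (C a ⊗ f)) (P.trans
       (P.+-congʳ {⊝ (C g ⊗ (C a ⊗ f))} (P.+-cong (P.*-congˡ {X ⊗ (C 1# ⊕ ⊝ X)} (P.trans (D-cong (D-C⊗ a f)) (D-C⊗ a (D f)))) (P.*-congˡ {S} (D-C⊗ a f))))
       (P.trans (solveP 7 (λ a q s g f d e → q :* (a :* e) :+ s :* (a :* d) :- g :* (a :* f) := a :* (q :* e :+ s :* d :- g :* f)) P.refl (C a) (X ⊗ (C 1# ⊕ ⊝ X)) S (C g) f (D f) (D (D f)))
       (P.*-congˡ {C a} (P.sym (L-expand f)))))

     D-S : D S ≋ ⊝ PN.nat 2
     D-S = P.trans (D-⊕ (C 1#) (⊝ (PN.nat 2 ⊗ X))) (P.trans (P.+-cong D-1 (P.trans (D-⊝ (PN.nat 2 ⊗ X)) (P.-‿cong (P.trans (D-nat⊗ 2 X) (P.trans (P.*-congˡ {PN.nat 2} D-X) (P.*-identityʳ (PN.nat 2))))))) P.refl)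

     D-Z : D Z ≋ PN.nat 4 ⊗ S
     D-Z = P.trans (D-nat⊗ 4 (X ⊗ (C 1# ⊕ ⊝ X))) (P.*-congˡ {PN.nat 4} (P.trans (leibniz X (C 1# ⊕ ⊝ X)) (P.trans
       (P.+-cong (P.*-congʳ {C 1# ⊕ ⊝ X} D-X) (P.*-congˡ {X} (P.trans (D-⊕ (C 1#) (⊝ X)) (P.+-cong D-1 (P.trans (D-⊝ X) (P.-‿cong D-X))))))
       (solveP 1 (λ x → # 1 :* (# 1 :- x) :+ x :* (:- # 1) := # 1 :- # 2 :* x) P.refl X))))

     Z^ : ℕ → Pl
     Z^ n = Z ^P n

     n⁺ : ℕ → Pl
     n⁺ k = PN.nat (suc k)

     D-Z^ : ∀ k → D (Z^ (suc k)) ≋ n⁺ k ⊗ (Z^ k ⊗ (PN.nat 4 ⊗ S))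
     D-Z^ k = P.trans (D-^ Z k) (P.*-congˡ {n⁺ k} (P.*-congˡ {Z^ k} D-Z))

     Z⊗D-Z^ : ∀ k → Z ⊗ D (Z^ k) ≋ PN.nat k ⊗ (Z^ k ⊗ (PN.nat 4 ⊗ S))
     Z⊗D-Z^ k = P.trans (f⊗D-^ Z k) (P.*-congˡ {PN.nat k} (P.*-congˡ {Z^ k} D-Z))

     DD-Z^ : ∀ k → D (D (Z^ (suc k))) ≋ n⁺ k ⊗ (D (Z^ k) ⊗ (PN.nat 4 ⊗ S) ⊕ Z^ k ⊗ ⊝ (PN.nat 4 ⊗ PN.nat 2))
     DD-Z^ k = P.trans (D-cong (D-Z^ k)) (P.trans (D-nat⊗ (suc k) _) (P.*-congˡ {n⁺ k} (P.trans (leibniz (Z^ k) (PN.nat 4 ⊗ S))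
       (P.+-congˡ {D (Z^ k) ⊗ (PN.nat 4 ⊗ S)} (P.*-congˡ {Z^ k} (P.trans (D-nat⊗ 4 S) (P.trans (P.*-congˡ {PN.nat 4} D-S) (solveP 2 (λ a b → a :* (:- b) := :- (a :* b)) P.refl (PN.nat 4) (PN.nat 2)))))))))

     q₀ : ℕ → Pl
     q₀ k = PN.nat 4 ⊗ (n⁺ k ⊗ n⁺ k)

     L-Z^ : ∀ k → L (Z^ (suc k)) ≋ Z^ k ⊗ (q₀ k ⊕ ⊝ (Z ⊗ (q₀ k ⊕ PN.nat 2 ⊗ n⁺ k ⊕ C g)))
     L-Z^ k = begin
       L (Z^ (suc k))
         ≈⟨ L-expand (Z^ (suc k)) ⟩
       X ⊗ (C 1# ⊕ ⊝ X) ⊗ D (D (Z^ (suc k))) ⊕ S ⊗ D (Z^ (suc k)) ⊕ ⊝ (C g ⊗ Z^ (suc k))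
         ≈⟨ P.+-congʳ {⊝ (C g ⊗ Z^ (suc k))} (P.+-cong (P.*-congˡ {X ⊗ (C 1# ⊕ ⊝ X)} (DD-Z^ k)) (P.*-congˡ {S} (D-Z^ k))) ⟩
       X ⊗ (C 1# ⊕ ⊝ X) ⊗ (n⁺ k ⊗ (D (Z^ k) ⊗ (PN.nat 4 ⊗ S) ⊕ Z^ k ⊗ ⊝ (PN.nat 4 ⊗ PN.nat 2))) ⊕ S ⊗ (n⁺ k ⊗ (Z^ k ⊗ (PN.nat 4 ⊗ S))) ⊕ ⊝ (C g ⊗ Z^ (suc k))
         ≈⟨ solveP 5 (λ x n dq q g → let s = # 1 :- # 2 :* x ; z = # 4 :* (x :* (# 1 :- x)) in
              x :* (# 1 :- x) :* (n :* (dq :* (# 4 :* s) :+ q :* (:- (# 4 :* # 2)))) :+ s :* (n :* (q :* (# 4 :* s))) :- g :* (z :* q)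
              := n :* s :* (z :* dq) :- # 2 :* (n :* (z :* q)) :+ # 4 :* (n :* (q :* (s :* s))) :- g :* (z :* q)) P.refl X (n⁺ k) (D (Z^ k)) (Z^ k) (C g) ⟩
       n⁺ k ⊗ S ⊗ (Z ⊗ D (Z^ k)) ⊕ ⊝ (PN.nat 2 ⊗ (n⁺ k ⊗ (Z ⊗ Z^ k))) ⊕ PN.nat 4 ⊗ (n⁺ k ⊗ (Z^ k ⊗ (S ⊗ S))) ⊕ ⊝ (C g ⊗ (Z ⊗ Z^ k))
         ≈⟨ P.+-congʳ {⊝ (C g ⊗ (Z ⊗ Z^ k))} (P.+-congʳ {PN.nat 4 ⊗ (n⁺ k ⊗ (Z^ k ⊗ (S ⊗ S)))} (P.+-congʳ {⊝ (PN.nat 2 ⊗ (n⁺ k ⊗ (Z ⊗ Z^ k)))} (P.*-congˡ {n⁺ k ⊗ S} (Z⊗D-Z^ k)))) ⟩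
       n⁺ k ⊗ S ⊗ (PN.nat k ⊗ (Z^ k ⊗ (PN.nat 4 ⊗ S))) ⊕ ⊝ (PN.nat 2 ⊗ (n⁺ k ⊗ (Z ⊗ Z^ k))) ⊕ PN.nat 4 ⊗ (n⁺ k ⊗ (Z^ k ⊗ (S ⊗ S))) ⊕ ⊝ (C g ⊗ (Z ⊗ Z^ k))
         ≈⟨ solveP 5 (λ x k n q g → let s = # 1 :- # 2 :* x ; z = # 4 :* (x :* (# 1 :- x)) in
              n :* s :* (k :* (q :* (# 4 :* s))) :- # 2 :* (n :* (z :* q)) :+ # 4 :* (n :* (q :* (s :* s))) :- g :* (z :* q)
              := q :* (# 4 :* (n :* (# 1 :+ k)) :- z :* (# 4 :* (n :* (# 1 :+ k)) :+ # 2 :* n :+ g))) P.refl X (PN.nat k) (n⁺ k) (Z^ k) (C g) ⟩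
       Z^ k ⊗ (PN.nat 4 ⊗ (n⁺ k ⊗ (C 1# ⊕ PN.nat k)) ⊕ ⊝ (Z ⊗ (PN.nat 4 ⊗ (n⁺ k ⊗ (C 1# ⊕ PN.nat k)) ⊕ PN.nat 2 ⊗ n⁺ k ⊕ C g)))
         ≈⟨ P.*-congˡ {Z^ k} (P.+-cong (e k) (P.-‿cong (P.*-congˡ {Z} (P.+-congʳ {C g} (P.+-congʳ {PN.nat 2 ⊗ n⁺ k} (e k)))))) ⟩
       Z^ k ⊗ (q₀ k ⊕ ⊝ (Z ⊗ (q₀ k ⊕ PN.nat 2 ⊗ n⁺ k ⊕ C g))) ∎
       where
       e : ∀ k → PN.nat 4 ⊗ (n⁺ k ⊗ (C 1# ⊕ PN.nat k)) ≋ q₀ k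
       e k = P.*-congˡ {PN.nat 4} (P.*-congˡ {n⁺ k} (P.sym (PN.nat-suc k)))

     -- The commutation of `L` with the factor 1 - 2u, for ν = 1. The term with `D f` does no harm,
     -- because for a power of `Z` it is again a multiple of 1 - 2u.
     L-S⊗ : ∀ f → L (S ⊗ f) ≋ S ⊗ (L f ⊕ ⊝ (PN.nat 2 ⊗ f)) ⊕ ⊝ (Z ⊗ D f)
     L-S⊗ f = begin
       L (S ⊗ f) ≈⟨ L-expand (S ⊗ f) ⟩
       X ⊗ (C 1# ⊕ ⊝ X) ⊗ D (D (S ⊗ f)) ⊕ S ⊗ D (S ⊗ f) ⊕ ⊝ (C g ⊗ (S ⊗ f))
         ≈⟨ P.+-congʳ {⊝ (C g ⊗ (S ⊗ f))} (P.+-cong (P.*-congˡ {X ⊗ (C 1# ⊕ ⊝ X)} DD) (P.*-congˡ {S} D₁)) ⟩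
       X ⊗ (C 1# ⊕ ⊝ X) ⊗ (⊝ (PN.nat 2 ⊗ D f) ⊕ (⊝ PN.nat 2 ⊗ D f ⊕ S ⊗ D (D f))) ⊕ S ⊗ (⊝ PN.nat 2 ⊗ f ⊕ S ⊗ D f) ⊕ ⊝ (C g ⊗ (S ⊗ f))
         ≈⟨ solveP 5 (λ x f d dd g → let s = # 1 :- # 2 :* x ; z = # 4 :* (x :* (# 1 :- x)) in
              x :* (# 1 :- x) :* (:- (# 2 :* d) :+ (:- # 2 :* d :+ s :* dd)) :+ s :* (:- # 2 :* f :+ s :* d) :- g :* (s :* f)
              := s :* ((x :* (# 1 :- x) :* dd :+ s :* d :- g :* f) :- # 2 :* f) :- z :* d) P.refl X f (D f) (D (D f)) (C g) ⟩
       S ⊗ ((X ⊗ (C 1# ⊕ ⊝ X) ⊗ D (D f) ⊕ S ⊗ D f ⊕ ⊝ (C g ⊗ f)) ⊕ ⊝ (PN.nat 2 ⊗ f)) ⊕ ⊝ (Z ⊗ D f)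
         ≈⟨ P.+-congʳ {⊝ (Z ⊗ D f)} (P.*-congˡ {S} (P.+-congʳ {⊝ (PN.nat 2 ⊗ f)} (L-expand f))) ⟨
       S ⊗ (L f ⊕ ⊝ (PN.nat 2 ⊗ f)) ⊕ ⊝ (Z ⊗ D f) ∎
       where
       D₁ : D (S ⊗ f) ≋ ⊝ PN.nat 2 ⊗ f ⊕ S ⊗ D f
       D₁ = P.trans (leibniz S f) (P.+-congʳ {S ⊗ D f} (P.*-congʳ {f} D-S))
       DD : D (D (S ⊗ f)) ≋ ⊝ (PN.nat 2 ⊗ D f) ⊕ (⊝ PN.nat 2 ⊗ D f ⊕ S ⊗ D (D f))
       DD = P.trans (D-cong D₁) (P.trans (D-⊕ (⊝ PN.nat 2 ⊗ f) (S ⊗ D f)) (P.+-cong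
         (P.trans (D-cong (solveP 2 (λ a f → :- a :* f := :- (a :* f)) P.refl (PN.nat 2) f)) (P.trans (D-⊝ (PN.nat 2 ⊗ f)) (P.-‿cong (D-nat⊗ 2 f))))
         (P.trans (leibniz S (D f)) (P.+-congʳ {S ⊗ D (D f)} (P.*-congʳ {D f} D-S)))))

     L-1 : L (C 1#) ≋ ⊝ C g
     L-1 = P.trans (L-expand (C 1#)) (P.trans (P.+-congʳ {⊝ (C g ⊗ C 1#)} (P.+-cong (P.*-congˡ {X ⊗ (C 1# ⊕ ⊝ X)} (D-cong D-1)) (P.*-congˡ {S} D-1))) (solveP 3 (λ q s g → q :* # 0 :+ s :* # 0 :- g :* # 1 := :- g) P.refl (X ⊗ (C 1# ⊕ ⊝ X)) S (C g)))

     Eν : Pl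
     Eν = S ^P ν

     2ν : Pl
     2ν = PN.nat 2 ⊗ PN.nat ν

     L-E : ∀ ν → ν ≡ 0 ⊎ ν ≡ 1 → L (S ^P ν ⊗ C 1#) ≋ ⊝ ((C g ⊕ PN.nat 2 ⊗ PN.nat ν) ⊗ (S ^P ν ⊗ C 1#))
     L-E _ (inj₁ refl) = P.trans (L-cong (P.*-identityʳ (C 1#))) (P.trans L-1 (P.trans (solveP 1 (λ g → :- g := :- ((g :+ # 2 :* # 0) :* (# 1 :* # 1))) P.refl (C g)) (P.-‿cong (P.*-congʳ (P.+-congˡ {C g} (P.*-congˡ {PN.nat 2} (P.sym PN.nat-0)))))))
     L-E _ (inj₂ refl) = P.trans (L-cong (solveP 1 (λ s → s :* # 1 :* # 1 := s :* # 1) P.refl S)) (P.trans (L-S⊗ (C 1#)) (P.trans (P.+-cong (P.*-congˡ {S} (P.+-congʳ {⊝ (PN.nat 2 ⊗ C 1#)} L-1)) (P.-‿cong (P.*-congˡ {Z} D-1)))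
       (P.trans (solveP 3 (λ g s z → s :* (:- g :- # 2 :* # 1) :- z :* # 0 := :- ((g :+ # 2 :* # 1) :* (s :* # 1 :* # 1))) P.refl (C g) S Z) (P.-‿cong (P.*-congʳ (P.+-congˡ {C g} (P.*-congˡ {PN.nat 2} (P.sym PN.nat-1))))))))

     bracket : ℕ → Pl → Pl
     bracket k w = q₀ k ⊕ PN.nat 2 ⊗ n⁺ k ⊕ PN.nat 4 ⊗ (w ⊗ n⁺ k) ⊕ C g ⊕ PN.nat 2 ⊗ w

     bracket-cong : ∀ k {w w'} → w ≋ w' → bracket k w ≋ bracket k w'
     bracket-cong k e = P.+-cong (P.+-congʳ {C g} (P.+-congˡ {q₀ k ⊕ PN.nat 2 ⊗ n⁺ k} (P.*-congˡ {PN.nat 4} (P.*-congʳ {n⁺ k} e)))) (P.*-congˡ {PN.nat 2} e)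

     main : Pl → ℕ → Pl → Pl
     main e k y = e ⊗ (Z^ k ⊗ (q₀ k ⊕ ⊝ (Z ⊗ y)))

     main-cong : ∀ e k {y y'} → y ≋ y' → main e k y ≋ main e k y'
     main-cong e k h = P.*-congˡ {e} (P.*-congˡ {Z^ k} (P.+-congˡ {q₀ k} (P.-‿cong (P.*-congˡ {Z} h))))

     L-EZ : ∀ ν → ν ≡ 0 ⊎ ν ≡ 1 → ∀ k → L (S ^P ν ⊗ Z^ (suc k)) ≋ main (S ^P ν) k (bracket k (PN.nat ν))
     L-EZ _ (inj₁ refl) k = begin
       L (C 1# ⊗ Z^ (suc k)) ≈⟨ L-cong (P.*-identityˡ (Z^ (suc k))) ⟩
       L (Z^ (suc k)) ≈⟨ L-Z^ k ⟩
       Z^ k ⊗ (q₀ k ⊕ ⊝ (Z ⊗ (q₀ k ⊕ PN.nat 2 ⊗ n⁺ k ⊕ C g))) ≈⟨ solveP 5 (λ q c z n g → q :* (c :- z :* (c :+ # 2 :* n :+ g)) := # 1 :* (q :* (c :- z :* (c :+ # 2 :* n :+ # 4 :* (# 0 :* n) :+ g :+ # 2 :* # 0)))) P.refl (Z^ k) (q₀ k) Z (n⁺ k) (C g) ⟩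
       main (C 1#) k (bracket k []) ≈⟨ main-cong (C 1#) k (bracket-cong k PN.nat-0) ⟨
       main (C 1#) k (bracket k (PN.nat 0)) ∎
     L-EZ _ (inj₂ refl) k = begin
       L (S ^P 1 ⊗ Z^ (suc k)) ≈⟨ L-cong (P.*-congʳ {Z^ (suc k)} (P.*-identityʳ S)) ⟩
       L (S ⊗ Z^ (suc k)) ≈⟨ L-S⊗ (Z^ (suc k)) ⟩
       S ⊗ (L (Z^ (suc k)) ⊕ ⊝ (PN.nat 2 ⊗ Z^ (suc k))) ⊕ ⊝ (Z ⊗ D (Z^ (suc k))) ≈⟨ P.+-cong (P.*-congˡ {S} (P.+-congʳ {⊝ (PN.nat 2 ⊗ Z^ (suc k))} (L-Z^ k))) (P.-‿cong (Z⊗D-Z^ (suc k))) ⟩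
       S ⊗ (Z^ k ⊗ (q₀ k ⊕ ⊝ (Z ⊗ (q₀ k ⊕ PN.nat 2 ⊗ n⁺ k ⊕ C g))) ⊕ ⊝ (PN.nat 2 ⊗ Z^ (suc k))) ⊕ ⊝ (n⁺ k ⊗ (Z^ (suc k) ⊗ (PN.nat 4 ⊗ S)))
         ≈⟨ solveP 6 (λ q c z n g s → s :* (q :* (c :- z :* (c :+ # 2 :* n :+ g)) :- # 2 :* (z :* q)) :- n :* ((z :* q) :* (# 4 :* s)) := (s :* # 1) :* (q :* (c :- z :* (c :+ # 2 :* n :+ # 4 :* (# 1 :* n) :+ g :+ # 2 :* # 1)))) P.refl (Z^ k) (q₀ k) Z (n⁺ k) (C g) S ⟩
       main (S ^P 1) k (bracket k (C 1#)) ≈⟨ main-cong (S ^P 1) k (bracket-cong k PN.nat-1) ⟨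
       main (S ^P 1) k (bracket k (PN.nat 1)) ∎

     q : ℕ → F
     q n = nat 4 * ((nat n - nat m) * (nat n + b))

     q-suc : ∀ k → q₀ k ⊕ PN.nat 2 ⊗ n⁺ k ⊕ PN.nat 4 ⊗ (PN.nat ν ⊗ n⁺ k) ⊕ C g ⊕ 2ν ≋ C (q (suc k))
     q-suc k = P.trans (P.+-cong (P.+-congʳ {C g} (P.+-cong (P.+-cong (P.*-cong (c≋ 4) (P.*-cong (c≋ (suc k)) (c≋ (suc k)))) (P.*-cong (c≋ 2) (c≋ (suc k)))) (P.*-cong (c≋ 4) (P.*-cong (c≋ ν) (c≋ (suc k)))))) (P.*-cong (c≋ 2) (c≋ ν)))
       (P.trans (P.+-cong (P.+-congʳ {C g} (P.+-cong (P.+-cong (C-*₃ _ _ _) (P.sym (C-* _ _))) (C-*₃ _ _ _))) (P.sym (C-* _ _))) (P.trans (C-+₅ _ _ _ _ _) (C-cong eq)))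
       where
       c≋ : ∀ n → PN.nat n ≋ C (nat n)
       c≋ n = P.sym (C-nat n)
       C-*₃ : ∀ a b c → C a ⊗ (C b ⊗ C c) ≋ C (a * (b * c))
       C-*₃ a b c = P.trans (P.*-congˡ {C a} (P.sym (C-* b c))) (P.sym (C-* a (b * c)))
       C-+₅ : ∀ a b c d e → C a ⊕ C b ⊕ C c ⊕ C d ⊕ C e ≋ C (a + b + c + d + e)
       C-+₅ a b c d e = P.sym (P.trans (C-+ _ e) (P.+-congʳ {C e} (P.trans (C-+ _ d) (P.+-congʳ {C d} (P.trans (C-+ _ c) (P.+-congʳ {C c} (C-+ a b)))))))
       n = nat (suc k)
       eq : nat 4 * (n * n) + nat 2 * n + nat 4 * (nat ν * n) + g + nat 2 * nat ν ≡ q (suc k)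
       eq = trans (solve 3 (λ n ν g → # 4 :* (n :* n) :+ # 2 :* n :+ # 4 :* (ν :* n) :+ g :+ # 2 :* ν := # 4 :* (n :* n) :+ # 2 :* n :* (# 1 :+ # 2 :* ν) :+ (g :+ # 2 :* ν)) refl n (nat ν) g)
         (trans (cong₂ (λ x y → nat 4 * (n * n) + nat 2 * n * x + y) (sym b-m) (sym mb))
         (solve 3 (λ n m b → # 4 :* (n :* n) :+ # 2 :* n :* (# 2 :* (b :- m)) :+ :- (# 4 :* (m :* b)) := # 4 :* ((n :- m) :* (n :+ b))) refl n (nat m) b))

     term : ℕ → Pl
     term n = C (c n) ⊗ (Eν ⊗ Z^ n)

     -- `L` maps E Z^(n+1) to a combination of E Z^n and E Z^(n+1). The recursion of `c` cancels
     -- everything except the last contribution, whose factor `q k` = 4(k - m)(k + b) vanishes at k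
     -- = m.
     L-partial : ∀ k → k ℕ.≤ m → L (PL.Σ≤ k term) ≋ ⊝ (C (q k * c k) ⊗ (Eν ⊗ Z^ k))
     L-partial zero _ = P.trans (L-C⊗ (c 0) (Eν ⊗ C 1#)) (P.trans (P.*-congˡ {C (c 0)} (L-E ν ν≤1)) (P.trans (solveP 3 (λ c g e → c :* (:- (g :* e)) := :- (g :* c :* e)) P.refl (C (c 0)) (C g ⊕ 2ν) (Eν ⊗ C 1#)) (P.-‿cong (P.*-congʳ {Eν ⊗ C 1#} (P.trans (P.*-congʳ {C (c 0)} eq) (P.sym (C-* (q 0) (c 0))))))))
       where
       eq : C g ⊕ 2ν ≋ C (q 0)
       eq = P.trans (P.+-congˡ {C g} (P.trans (P.*-cong (P.sym (C-nat 2)) (P.sym (C-nat ν))) (P.sym (C-* (nat 2) (nat ν))))) (P.trans (P.sym (C-+ g (nat 2 * nat ν))) (C-cong (trans (sym mb) (trans (solve 2 (λ m b → :- (# 4 :* (m :* b)) := # 4 :* ((# 0 :- m) :* (# 0 :+ b))) refl (nat m) b) (cong (λ z → nat 4 * ((z - nat m) * (z + b))) (sym nat-0))))))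
     L-partial (suc k) k<m = begin
       L (PL.Σ≤ k term ⊕ term (suc k)) ≈⟨ L-⊕ (PL.Σ≤ k term) (term (suc k)) ⟩
       L (PL.Σ≤ k term) ⊕ L (term (suc k)) ≈⟨ P.+-cong (L-partial k (<⇒≤ k<m)) (P.trans (L-C⊗ (c (suc k)) (Eν ⊗ Z^ (suc k))) (P.*-congˡ {C (c (suc k))} (P.trans (L-EZ ν ν≤1 k) (P.*-congˡ {Eν} (P.*-congˡ {Z^ k} (P.+-congˡ {q₀ k} (P.-‿cong (P.*-congˡ {Z} (q-suc k))))))))) ⟩
       ⊝ (C (q k * c k) ⊗ (Eν ⊗ Z^ k)) ⊕ C (c (suc k)) ⊗ (Eν ⊗ (Z^ k ⊗ (q₀ k ⊕ ⊝ (Z ⊗ C (q (suc k))))))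
         ≈⟨ P.+-congʳ (P.-‿cong (P.*-congʳ {Eν ⊗ Z^ k} eq)) ⟩
       ⊝ (q₀ k ⊗ C (c (suc k)) ⊗ (Eν ⊗ Z^ k)) ⊕ C (c (suc k)) ⊗ (Eν ⊗ (Z^ k ⊗ (q₀ k ⊕ ⊝ (Z ⊗ C (q (suc k))))))
         ≈⟨ solveP 6 (λ q₀ c e y z q → :- (q₀ :* c :* (e :* y)) :+ c :* (e :* (y :* (q₀ :- z :* q))) := :- (q :* c :* (e :* (z :* y)))) P.refl (q₀ k) (C (c (suc k))) Eν (Z^ k) Z (C (q (suc k))) ⟩
       ⊝ (C (q (suc k)) ⊗ C (c (suc k)) ⊗ (Eν ⊗ Z^ (suc k))) ≈⟨ P.-‿cong (P.*-congʳ {Eν ⊗ Z^ (suc k)} (C-* (q (suc k)) (c (suc k)))) ⟨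
       ⊝ (C (q (suc k) * c (suc k)) ⊗ (Eν ⊗ Z^ (suc k))) ∎
       where
       n = nat (suc k)
       eq : C (q k * c k) ≋ q₀ k ⊗ C (c (suc k))
       eq = P.trans (C-cong (trans (solve 4 (λ x m b c → # 4 :* ((x :- m) :* (x :+ b)) :* c := # 4 :* ((x :- m) :* (x :+ b) :* c)) refl (nat k) (nat m) b (c k)) (trans (cong (nat 4 *_) (sym (c-rec k k<m))) (solve 2 (λ n c → # 4 :* (n :* n :* c) := # 4 :* (n :* n) :* c) refl n (c (suc k))))))
         (P.trans (C-* (nat 4 * (n * n)) (c (suc k))) (P.*-congʳ {C (c (suc k))} (P.trans (C-* (nat 4) (n * n)) (P.*-cong (C-nat 4) (P.trans (C-* n n) (P.*-cong (C-nat (suc k)) (C-nat (suc k))))))))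

   ψ : Pl
   ψ = PL.Σ≤ m term

   d : ℕ → F
   d = cf ψ

   Lψ≋0 : L ψ ≋ []
   Lψ≋0 = P.trans (L-partial m ≤-refl) (P.trans (P.-‿cong (P.trans (P.*-congʳ {Eν ⊗ Z^ m} (P.trans (C-cong qm) C-0)) (P.zeroˡ (Eν ⊗ Z^ m)))) P.refl)
     where
     qm : q m * c m ≡ 0#
     qm = solve 3 (λ m b c → # 4 :* ((m :- m) :* (m :+ b)) :* c := # 0) refl (nat m) b (c m)

   -- Coefficient i of `L ψ`. As i² + i + 3/16 = (i + 1/4)(i + 3/4) and i² + i + 2/9 = (i + 1/3)(i +
   -- 2/3), the two values of `g` give the hypergeometric coefficients with these parameters.
   d-rec : ∀ i → nat (suc i) * nat (suc i) * d (suc i) ≡ (nat i * nat i + nat i + g) * d i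
   d-rec i = x-y≡0⇒x≡y (trans (sym eq) (at Lψ≋0 i))
     where
     n = nat (suc i)
     eq : cf (L ψ) i ≡ n * n * d (suc i) - (nat i * nat i + nat i + g) * d i
     eq = trans (cf-⊕ (D (θ ψ) ⊕ ⊝ θ (θ ψ) ⊕ ⊝ θ ψ) (⊝ (C g ⊗ ψ)) i)
       (trans (cong₂ _+_ (trans (cf-⊕ (D (θ ψ) ⊕ ⊝ θ (θ ψ)) (⊝ θ ψ) i) (cong₂ _+_ (trans (cf-⊕ (D (θ ψ)) (⊝ θ (θ ψ)) i) (cong₂ _+_ (trans (cf-D (θ ψ) i) (cong (n *_) (cf-θ ψ (suc i)))) (trans (cf-⊝ (θ (θ ψ)) i) (cong (λ a → - a) (trans (cf-θ (θ ψ) i) (cong (nat i *_) (cf-θ ψ i))))))) (trans (cf-⊝ (θ ψ) i) (cong (λ a → - a) (cf-θ ψ i))))) (trans (cf-⊝ (C g ⊗ ψ) i) (cong (λ a → - a) (cf-C⊗ g ψ i))))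
       (solve 5 (λ n i g a b → n :* (n :* a) :- i :* (i :* b) :- i :* b :- g :* b := n :* n :* a :- (i :* i :+ i :+ g) :* b) refl n (nat i) g (d (suc i)) (d i)))

   ψ-below : Below (suc (2 ℕ.* m ℕ.+ ν)) ψ
   ψ-below = Below-Σ m (λ n n≤m → Below-C⊗ (c n) (Eν ⊗ Z^ n) (Below-mono (Eν ⊗ Z^ n) (ℕ.s≤s (bound n n≤m)) (Below-⊗ Eν (Z^ n) (Below-^ S {1} S-below ν) (Below-^ Z {2} Z-below n))))
     where
     bound : ∀ n → n ℕ.≤ m → ν ℕ.* 1 ℕ.+ n ℕ.* 2 ℕ.≤ 2 ℕ.* m ℕ.+ ν
     bound n n≤m = ≤-trans (≤-reflexive (trans (cong₂ ℕ._+_ (ℕₚ.*-identityʳ ν) (ℕₚ.*-comm n 2)) (ℕₚ.+-comm ν (2 ℕ.* n)))) (ℕₚ.+-monoˡ-≤ ν (ℕₚ.*-monoʳ-≤ 2 n≤m))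
     nat-below : ∀ n → Below 1 (PN.nat n)
     nat-below n = Below-cong (C-nat n) (Below-C (nat n))
     ⊝-below : ∀ {n} f → Below n f → Below n (⊝ f)
     ⊝-below f b i le = trans (cf-⊝ f i) (trans (cong (λ a → - a) (b i le)) (solve 0 (:- # 0 := # 0) refl))
     S-below : Below 2 S
     S-below = Below-⊕ (C 1#) (⊝ (PN.nat 2 ⊗ X)) (Below-mono (C 1#) (ℕ.s≤s ℕ.z≤n) (Below-C 1#)) (⊝-below (PN.nat 2 ⊗ X) (Below-⊗ (PN.nat 2) X (nat-below 2) Below-X))
     Z-below : Below 3 Z
     Z-below = Below-⊗ (PN.nat 4) (X ⊗ (C 1# ⊕ ⊝ X)) (nat-below 4) (Below-⊗ X (C 1# ⊕ ⊝ X) Below-X (Below-⊕ (C 1#) (⊝ X) (Below-mono (C 1#) (ℕ.s≤s ℕ.z≤n) (Below-C 1#)) (⊝-below X Below-X)))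

   module ψ-Evaluation (A : Algebra) where
     open Algebra A
     open Evaluation A
     open CommutativeRing ring renaming (_+_ to _+R_; _*_ to _*R_; -_ to -R_; _-_ to _-R_; 0# to 0R; 1# to 1R; refl to ≈-refl; sym to ≈-sym; trans to ≈-trans) using (Carrier; _≈_; *-cong; *-congˡ; *-congʳ; +-cong; +-congˡ; +-congʳ; -‿cong)
     private solveR = IntSolver.solve ring
     private ^R-congˡ = Exp.^-congˡ (CommutativeRing.semiring ring)

     φ : Carrier → Carrier
     φ z = L.Σ≤ m (λ n → ρ (c n) *R z ^R n)

     ev-nat : ∀ n x → ev (PN.nat n) x ≈ N.nat n
     ev-nat n x = ≈-trans (ev-cong x (P.sym (C-nat n))) (≈-trans (ev-C (nat n) x) (ρ-nat n))

     ev-Σ : ∀ k t x → ev (PL.Σ≤ k t) x ≈ L.Σ≤ k (λ i → ev (t i) x)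
     ev-Σ zero t x = ≈-refl
     ev-Σ (suc k) t x = ≈-trans (ev-⊕ (PL.Σ≤ k t) (t (suc k)) x) (+-congʳ (ev-Σ k t x))

     ev-ψ : ∀ x → ev ψ x ≈ (1R -R N.nat 2 *R x) ^R ν *R φ (N.nat 4 *R (x *R (1R -R x)))
     ev-ψ x = ≈-trans (ev-Σ m term x) (≈-trans (L.Σ≤-cong m (λ n _ → ev-term n)) (≈-sym (L.*-distribˡ-Σ≤ m _ _)))
       where
       ev-1-X : ev (C 1# ⊕ ⊝ X) x ≈ 1R -R x
       ev-1-X = ≈-trans (ev-⊕ (C 1#) (⊝ X) x) (+-cong (ev-1 x) (≈-trans (ev-⊝ X x) (-‿cong (ev-X x))))
       ev-S : ev S x ≈ 1R -R N.nat 2 *R x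
       ev-S = ≈-trans (ev-⊕ (C 1#) (⊝ (PN.nat 2 ⊗ X)) x) (+-cong (ev-1 x) (≈-trans (ev-⊝ (PN.nat 2 ⊗ X) x) (-‿cong (≈-trans (ev-⊗ (PN.nat 2) X x) (*-cong (ev-nat 2 x) (ev-X x))))))
       ev-Z : ev Z x ≈ N.nat 4 *R (x *R (1R -R x))
       ev-Z = ≈-trans (ev-⊗ (PN.nat 4) (X ⊗ (C 1# ⊕ ⊝ X)) x) (*-cong (ev-nat 4 x) (≈-trans (ev-⊗ X (C 1# ⊕ ⊝ X) x) (*-cong (ev-X x) ev-1-X)))
       ev-term : ∀ n → ev (term n) x ≈ (1R -R N.nat 2 *R x) ^R ν *R (ρ (c n) *R (N.nat 4 *R (x *R (1R -R x))) ^R n)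
       ev-term n = ≈-trans (ev-⊗ (C (c n)) (Eν ⊗ Z^ n) x) (≈-trans (*-cong (ev-C (c n) x) (≈-trans (ev-⊗ Eν (Z^ n) x) (*-cong (≈-trans (ev-^ S ν x) (^R-congˡ ν ev-S)) (≈-trans (ev-^ Z n x) (^R-congˡ n ev-Z)))))
         (solveR 3 (λ c e z → c :* (e :* z) := e :* (c :* z)) ≈-refl (ρ (c n)) _ _))

   d-0 : d 0 ≡ 1#
   d-0 = trans (sym (ev-0 ψ)) (trans (ev-ψ 0#) (trans (cong₂ _*_ (trans (cong (_^ ν) (solve 0 (# 1 :- # 2 :* # 0 := # 1) refl)) (1^n≈1 ν)) (trans (Σ≤-cong m (λ n _ → cong (λ z → c n * z ^ n) (solve 0 (# 4 :* (# 0 :* (# 1 :- # 0)) := # 0) refl))) (trans (sum0 m) c-0))) (*-identityˡ 1#)))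
     where
     open ψ-Evaluation self
     sum0 : ∀ k → Σ≤ k (λ n → c n * 0# ^ n) ≡ c 0
     sum0 zero = *-identityʳ _
     sum0 (suc k) = trans (cong₂ _+_ (sum0 k) (trans (cong (c (suc k) *_) (zeroˡ (0# ^ k))) (zeroʳ _))) (+-identityʳ _)

 -- Stability of the zeros of ψ(v^r) under the involution.

 θ-cong : ∀ {f h} → f ≋ h → θ f ≋ θ h
 θ-cong e = P.*-congˡ {X} (D-cong e)

 θ-⊕ : ∀ f h → θ (f ⊕ h) ≋ θ f ⊕ θ h
 θ-⊕ f h = P.trans (P.*-congˡ {X} (D-⊕ f h)) (P.distribˡ X (D f) (D h))

 θ-C⊗ : ∀ a f → θ (C a ⊗ f) ≋ C a ⊗ θ f
 θ-C⊗ a f = P.trans (P.*-congˡ {X} (D-C⊗ a f)) (solveP 3 (λ x a d → x :* (a :* d) := a :* (x :* d)) P.refl X (C a) (D f))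

 cf-X^⊗-≥ : ∀ r h k → cf (X ^P r ⊗ h) (r ℕ.+ k) ≡ cf h k
 cf-X^⊗-≥ zero h k = at (P.*-identityˡ h) k
 cf-X^⊗-≥ (suc r) h k = trans (at (P.*-assoc X (X ^P r) h) (suc (r ℕ.+ k))) (trans (at (X⊗ (X ^P r ⊗ h)) (suc (r ℕ.+ k))) (cf-X^⊗-≥ r h k))

 cf-X^⊗-< : ∀ r h k → k ℕ.< r → cf (X ^P r ⊗ h) k ≡ 0#
 cf-X^⊗-< (suc r) h zero _ = trans (at (P.*-assoc X (X ^P r) h) 0) (at (X⊗ (X ^P r ⊗ h)) 0)
 cf-X^⊗-< (suc r) h (suc k) (ℕ.s≤s k<r) = trans (at (P.*-assoc X (X ^P r) h) (suc k)) (trans (at (X⊗ (X ^P r ⊗ h)) (suc k)) (cf-X^⊗-< r h k k<r))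

 -- With (r, a₁, a₂, a₃) = (2, 16, 32, 12) or (3, 4, 12, 8) this operator kills v ↦ y(v^r) for every solution y
 -- of u(1 - u)y″ + (1 - 2u)y′ = g y with g = 3/16 or 2/9.
 module CuspOperator (r a₁ a₂ a₃ : ℕ) where
   Λ : Pl → Pl
   Λ f = PN.nat a₁ ⊗ θ (θ f) ⊕ ⊝ (X ^P r ⊗ (PN.nat a₁ ⊗ θ (θ f) ⊕ PN.nat a₂ ⊗ θ f ⊕ PN.nat a₃ ⊗ f))

   private
     Λ₀ : Pl → Pl → Pl → Pl
     Λ₀ f t tt = PN.nat a₁ ⊗ tt ⊕ ⊝ (X ^P r ⊗ (PN.nat a₁ ⊗ tt ⊕ PN.nat a₂ ⊗ t ⊕ PN.nat a₃ ⊗ f))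

     Λ₀-cong : ∀ {f f' t t' tt tt'} → f ≋ f' → t ≋ t' → tt ≋ tt' → Λ₀ f t tt ≋ Λ₀ f' t' tt'
     Λ₀-cong e e' e″ = P.+-cong (P.*-congˡ {PN.nat a₁} e″) (P.-‿cong (P.*-congˡ {X ^P r} (P.+-cong (P.+-cong (P.*-congˡ {PN.nat a₁} e″) (P.*-congˡ {PN.nat a₂} e')) (P.*-congˡ {PN.nat a₃} e))))

   Λ-⊕ : ∀ f h → Λ (f ⊕ h) ≋ Λ f ⊕ Λ h
   Λ-⊕ f h = begin
     Λ (f ⊕ h) ≈⟨ Λ₀-cong (P.refl {f ⊕ h}) (θ-⊕ f h) (P.trans (θ-cong (θ-⊕ f h)) (θ-⊕ (θ f) (θ h))) ⟩
     Λ₀ (f ⊕ h) (θ f ⊕ θ h) (θ (θ f) ⊕ θ (θ h)) ≈⟨ solveP 10 (λ a b c x f h t s tt ss → a :* (tt :+ ss) :- x :* (a :* (tt :+ ss) :+ b :* (t :+ s) :+ c :* (f :+ h)) := (a :* tt :- x :* (a :* tt :+ b :* t :+ c :* f)) :+ (a :* ss :- x :* (a :* ss :+ b :* s :+ c :* h))) P.refl (PN.nat a₁) (PN.nat a₂) (PN.nat a₃) (X ^P r) f h (θ f) (θ h) (θ (θ f)) (θ (θ h)) ⟩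
     Λ f ⊕ Λ h ∎

   Λ-C⊗ : ∀ e f → Λ (C e ⊗ f) ≋ C e ⊗ Λ f
   Λ-C⊗ e f = begin
     Λ (C e ⊗ f) ≈⟨ Λ₀-cong (P.refl {C e ⊗ f}) (θ-C⊗ e f) (P.trans (θ-cong (θ-C⊗ e f)) (θ-C⊗ e (θ f))) ⟩
     Λ₀ (C e ⊗ f) (C e ⊗ θ f) (C e ⊗ θ (θ f)) ≈⟨ solveP 8 (λ e a b c x f t tt → a :* (e :* tt) :- x :* (a :* (e :* tt) :+ b :* (e :* t) :+ c :* (e :* f)) := e :* (a :* tt :- x :* (a :* tt :+ b :* t :+ c :* f))) P.refl (C e) (PN.nat a₁) (PN.nat a₂) (PN.nat a₃) (X ^P r) f (θ f) (θ (θ f)) ⟩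
     C e ⊗ Λ f ∎

   cf-θθ : ∀ f k → cf (PN.nat a₁ ⊗ θ (θ f)) k ≡ nat a₁ * (nat k * (nat k * cf f k))
   cf-θθ f k = trans (at (P.*-congʳ {θ (θ f)} (P.sym (C-nat a₁))) k) (trans (cf-C⊗ (nat a₁) (θ (θ f)) k) (cong (nat a₁ *_) (trans (cf-θ (θ f) k) (cong (nat k *_) (cf-θ f k)))))

   private
     cf-Λ : ∀ f → Λ f ≋ [] → ∀ k → nat a₁ * (nat k * (nat k * cf f k)) ≡ cf (X ^P r ⊗ (PN.nat a₁ ⊗ θ (θ f) ⊕ PN.nat a₂ ⊗ θ f ⊕ PN.nat a₃ ⊗ f)) k
     cf-Λ f e k = trans (sym (cf-θθ f k)) (at (⊖≋[]⇒≋ (PN.nat a₁ ⊗ θ (θ f)) (X ^P r ⊗ (PN.nat a₁ ⊗ θ (θ f) ⊕ PN.nat a₂ ⊗ θ f ⊕ PN.nat a₃ ⊗ f)) e) k)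

     shifted-zero : ∀ f k → cf f k ≡ 0# → cf (PN.nat a₁ ⊗ θ (θ f) ⊕ PN.nat a₂ ⊗ θ f ⊕ PN.nat a₃ ⊗ f) k ≡ 0#
     shifted-zero f k z = trans (cf-⊕ (PN.nat a₁ ⊗ θ (θ f) ⊕ PN.nat a₂ ⊗ θ f) (PN.nat a₃ ⊗ f) k) (trans (cong₂ _+_
       (trans (cf-⊕ (PN.nat a₁ ⊗ θ (θ f)) (PN.nat a₂ ⊗ θ f) k) (cong₂ _+_ (trans (cf-θθ f k) (cong (λ y → nat a₁ * (nat k * (nat k * y))) z)) (trans (at (P.*-congʳ {θ f} (P.sym (C-nat a₂))) k) (trans (cf-C⊗ (nat a₂) (θ f) k) (cong (nat a₂ *_) (trans (cf-θ f k) (cong (nat k *_) z)))))))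
       (trans (at (P.*-congʳ {f} (P.sym (C-nat a₃))) k) (trans (cf-C⊗ (nat a₃) f k) (cong (nat a₃ *_) z))))
       (solve 4 (λ a b c k → a :* (k :* (k :* # 0)) :+ b :* (k :* # 0) :+ c :* # 0 := # 0) refl (nat a₁) (nat a₂) (nat a₃) (nat k)))

   module _ (0<a₁ : nat a₁ ≢ 0#) (0<r : 0 ℕ.< r) where
     -- Coefficient k of `Λ f` expresses a₁k² times coefficient k of `f` through coefficient k - r,
     -- and k² is invertible for 0 < k < p. Below degree p a solution is therefore determined by its
     -- constant coefficient.
     Λ-unique : ∀ f → Λ f ≋ [] → cf f 0 ≡ 0# → Below p f → f ≋ []
     Λ-unique f Λf f0 below = coeffwise λ k → go k k ≤-refl
       where
       go : ∀ b k → k ℕ.≤ b → cf f k ≡ 0#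
       go b zero _ = f0
       go (suc b) (suc k) (ℕ.s≤s k≤b) with p ℕ.≤? suc k
       ... | yes p≤k = below (suc k) p≤k
       ... | no p≰k = [ (λ e → ⊥-elim (0<a₁ e)) , (λ e → [ (λ e → ⊥-elim (nz e)) , (λ e → [ (λ e → ⊥-elim (nz e)) , (λ e → e) ]′ (x*y≡0 e)) ]′ (x*y≡0 e)) ]′ (x*y≡0 (trans (cf-Λ f Λf (suc k)) (rhs (suc k ℕ.<? r))))
         where
         nz : nat (suc k) ≢ 0#
         nz = nat≢0 (ℕ.s≤s ℕ.z≤n) (ℕₚ.≰⇒> p≰k)
         rhs : Dec (suc k ℕ.< r) → cf (X ^P r ⊗ (PN.nat a₁ ⊗ θ (θ f) ⊕ PN.nat a₂ ⊗ θ f ⊕ PN.nat a₃ ⊗ f)) (suc k) ≡ 0#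
         rhs (yes k<r) = cf-X^⊗-< r _ (suc k) k<r
         rhs (no k≮r) = trans (cong (cf (X ^P r ⊗ (PN.nat a₁ ⊗ θ (θ f) ⊕ PN.nat a₂ ⊗ θ f ⊕ PN.nat a₃ ⊗ f))) (sym (m+[n∸m]≡n r≤k)))
           (trans (cf-X^⊗-≥ r _ (suc k ℕ.∸ r)) (shifted-zero f (suc k ℕ.∸ r) (go b (suc k ℕ.∸ r) (≤-trans (ℕₚ.∸-monoʳ-≤ (suc k) 0<r) k≤b))))
           where r≤k = ≮⇒≥ k≮r

   W₁ W₂ : ℕ → Pl
   W₁ i = PN.nat a₁ ⊗ (PN.nat (i ℕ.* r) ⊗ PN.nat (i ℕ.* r))
   W₂ i = PN.nat a₁ ⊗ (PN.nat (i ℕ.* r) ⊗ PN.nat (i ℕ.* r)) ⊕ PN.nat a₂ ⊗ PN.nat (i ℕ.* r) ⊕ PN.nat a₃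

   -- The common pattern for Q i = X^(ir) and Q i = (1 - X)^(ir) (1 + cX)^(N - ir): consecutive
   -- terms have quotient U/V, and Λ multiplies Q i by (M₁/M₀)(W₁V - W₂U). By the recursion the
   -- U-part of each term cancels the V-part of the next one. The first V-part contains W₁ 0 = 0,
   -- and the last U-part vanishes because d (I + 1) = 0.
   module Telescope (d : ℕ → F) (I : ℕ)
     (d-rec : ∀ i → W₁ (suc i) ⊗ C (d (suc i)) ≋ W₂ i ⊗ C (d i)) (d-end : d (suc I) ≡ 0#)
     (M₀ M₁ U V : Pl) (Q : ℕ → Pl)
     (Q-step : ∀ i → i ℕ.< I → Q (suc i) ⊗ V ≋ Q i ⊗ U)
     (Λ-Q : ∀ i → i ℕ.≤ I → M₀ ⊗ Λ (Q i) ≋ M₁ ⊗ (Q i ⊗ (W₁ i ⊗ V ⊕ ⊝ (W₂ i ⊗ U))))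
     where
     private
       term : ℕ → Pl
       term i = C (d i) ⊗ Q i

       partial : ∀ k → k ℕ.≤ I → M₀ ⊗ Λ (PL.Σ≤ k term) ≋ ⊝ (M₁ ⊗ (W₂ k ⊗ C (d k) ⊗ (Q k ⊗ U)))
       partial zero _ = begin
         M₀ ⊗ Λ (C (d 0) ⊗ Q 0) ≈⟨ P.*-congˡ {M₀} (Λ-C⊗ (d 0) (Q 0)) ⟩
         M₀ ⊗ (C (d 0) ⊗ Λ (Q 0)) ≈⟨ solveP 3 (λ m d l → m :* (d :* l) := d :* (m :* l)) P.refl M₀ (C (d 0)) (Λ (Q 0)) ⟩
         C (d 0) ⊗ (M₀ ⊗ Λ (Q 0)) ≈⟨ P.*-congˡ {C (d 0)} (Λ-Q 0 ℕ.z≤n) ⟩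
         C (d 0) ⊗ (M₁ ⊗ (Q 0 ⊗ (W₁ 0 ⊗ V ⊕ ⊝ (W₂ 0 ⊗ U)))) ≈⟨ P.*-congˡ {C (d 0)} (P.*-congˡ {M₁} (P.*-congˡ {Q 0} (P.+-congʳ {⊝ (W₂ 0 ⊗ U)} (P.*-congʳ {V} (P.trans (P.*-congˡ {PN.nat a₁} (P.*-congʳ {PN.nat 0} PN.nat-0)) (P.zeroʳ (PN.nat a₁))))))) ⟩
         C (d 0) ⊗ (M₁ ⊗ (Q 0 ⊗ ([] ⊗ V ⊕ ⊝ (W₂ 0 ⊗ U)))) ≈⟨ solveP 6 (λ d m q v w u → d :* (m :* (q :* (# 0 :* v :- w :* u))) := :- (m :* (w :* d :* (q :* u)))) P.refl (C (d 0)) M₁ (Q 0) V (W₂ 0) U ⟩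
         ⊝ (M₁ ⊗ (W₂ 0 ⊗ C (d 0) ⊗ (Q 0 ⊗ U))) ∎
       partial (suc k) k<I = begin
         M₀ ⊗ Λ (PL.Σ≤ k term ⊕ term (suc k)) ≈⟨ P.*-congˡ {M₀} (P.trans (Λ-⊕ (PL.Σ≤ k term) (term (suc k))) (P.+-congˡ {Λ (PL.Σ≤ k term)} (Λ-C⊗ (d (suc k)) (Q (suc k))))) ⟩
         M₀ ⊗ (Λ (PL.Σ≤ k term) ⊕ C (d (suc k)) ⊗ Λ (Q (suc k))) ≈⟨ solveP 4 (λ m a d l → m :* (a :+ d :* l) := m :* a :+ d :* (m :* l)) P.refl M₀ (Λ (PL.Σ≤ k term)) (C (d (suc k))) (Λ (Q (suc k))) ⟩
         M₀ ⊗ Λ (PL.Σ≤ k term) ⊕ C (d (suc k)) ⊗ (M₀ ⊗ Λ (Q (suc k))) ≈⟨ P.+-cong (partial k (<⇒≤ k<I)) (P.*-congˡ {C (d (suc k))} (Λ-Q (suc k) k<I)) ⟩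
         ⊝ (M₁ ⊗ (W₂ k ⊗ C (d k) ⊗ (Q k ⊗ U))) ⊕ C (d (suc k)) ⊗ (M₁ ⊗ (Q (suc k) ⊗ (W₁ (suc k) ⊗ V ⊕ ⊝ (W₂ (suc k) ⊗ U))))
           ≈⟨ P.+-congʳ (P.-‿cong (P.*-congˡ {M₁} (P.*-cong (P.sym (d-rec k)) (P.sym (Q-step k k<I))))) ⟩
         ⊝ (M₁ ⊗ (W₁ (suc k) ⊗ C (d (suc k)) ⊗ (Q (suc k) ⊗ V))) ⊕ C (d (suc k)) ⊗ (M₁ ⊗ (Q (suc k) ⊗ (W₁ (suc k) ⊗ V ⊕ ⊝ (W₂ (suc k) ⊗ U))))
           ≈⟨ solveP 7 (λ m w d q v w' u → :- (m :* (w :* d :* (q :* v))) :+ d :* (m :* (q :* (w :* v :- w' :* u))) := :- (m :* (w' :* d :* (q :* u)))) P.refl M₁ (W₁ (suc k)) (C (d (suc k))) (Q (suc k)) V (W₂ (suc k)) U ⟩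
         ⊝ (M₁ ⊗ (W₂ (suc k) ⊗ C (d (suc k)) ⊗ (Q (suc k) ⊗ U))) ∎

     telescope : M₀ ⊗ Λ (PL.Σ≤ I term) ≋ []
     telescope = begin
       M₀ ⊗ Λ (PL.Σ≤ I term) ≈⟨ partial I ≤-refl ⟩
       ⊝ (M₁ ⊗ (W₂ I ⊗ C (d I) ⊗ (Q I ⊗ U))) ≈⟨ P.-‿cong (P.*-congˡ {M₁} (P.*-congʳ {Q I ⊗ U} (P.trans (P.sym (d-rec I)) (P.*-congˡ {W₁ (suc I)} (P.trans (C-cong d-end) C-0))))) ⟩
       ⊝ (M₁ ⊗ (W₁ (suc I) ⊗ [] ⊗ (Q I ⊗ U))) ≈⟨ solveP 3 (λ m w q → :- (m :* (w :* # 0 :* q)) := # 0) P.refl M₁ (W₁ (suc I)) (Q I ⊗ U) ⟩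
       [] ∎

 θ-X^ : ∀ k → θ (X ^P k) ≋ PN.nat k ⊗ X ^P k
 θ-X^ k = P.trans (f⊗D-^ X k) (P.*-congˡ {PN.nat k} (P.trans (P.*-congˡ {X ^P k} D-X) (P.*-identityʳ (X ^P k))))

 θ-nat⊗ : ∀ n f → θ (PN.nat n ⊗ f) ≋ PN.nat n ⊗ θ f
 θ-nat⊗ n f = P.trans (P.*-congˡ {X} (D-nat⊗ n f)) (solveP 3 (λ x a d → x :* (a :* d) := a :* (x :* d)) P.refl X (PN.nat n) (D f))

 α : Pl
 α = C 1# ⊕ ⊝ X

 β : ℕ → Pl
 β c = C 1# ⊕ PN.nat c ⊗ X

 -- Derivatives of A^k B^j for A = 1 - X and B = 1 + cX, where μ j = -2 - μ k in 𝔽.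
 module LinearForms (μ c : ℕ) (k j : ℕ) (μj : nat μ * nat j ≡ - nat 2 - nat μ * nat k) where
   A B T : Pl
   A = α
   B = β c
   -- T/(μAB) is the logarithmic derivative of `Q`, with the exponent j eliminated by μj = -2 - μk.
   T = ⊝ (PN.nat μ ⊗ (PN.nat k ⊗ B)) ⊕ PN.nat c ⊗ ((⊝ PN.nat 2 ⊕ ⊝ (PN.nat μ ⊗ PN.nat k)) ⊗ A)

   Q : Pl
   Q = A ^P k ⊗ B ^P j

   private
     D-A : D A ≋ ⊝ C 1#
     D-A = P.trans (D-⊕ (C 1#) (⊝ X)) (P.trans (P.+-cong D-1 (P.trans (D-⊝ X) (P.-‿cong D-X))) P.refl)

     D-B : D B ≋ PN.nat c
     D-B = P.trans (D-⊕ (C 1#) (PN.nat c ⊗ X)) (P.trans (P.+-cong D-1 (P.trans (D-nat⊗ c X) (P.trans (P.*-congˡ {PN.nat c} D-X) (P.*-identityʳ (PN.nat c))))) P.refl)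

     μj' : PN.nat μ ⊗ PN.nat j ≋ ⊝ PN.nat 2 ⊕ ⊝ (PN.nat μ ⊗ PN.nat k)
     μj' = begin
       PN.nat μ ⊗ PN.nat j ≈⟨ P.*-cong (C-nat μ) (C-nat j) ⟨
       C (nat μ) ⊗ C (nat j) ≈⟨ C-* (nat μ) (nat j) ⟨
       C (nat μ * nat j) ≈⟨ C-cong μj ⟩
       C (- nat 2 - nat μ * nat k) ≈⟨ C-+ (- nat 2) (- (nat μ * nat k)) ⟩
       C (- nat 2) ⊕ C (- (nat μ * nat k)) ≈⟨ P.+-cong (P.trans (C-neg (nat 2)) (P.-‿cong (C-nat 2))) (P.trans (C-neg (nat μ * nat k)) (P.-‿cong (P.trans (C-* (nat μ) (nat k)) (P.*-cong (C-nat μ) (C-nat k))))) ⟩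
       ⊝ PN.nat 2 ⊕ ⊝ (PN.nat μ ⊗ PN.nat k) ∎

   D-Q : PN.nat μ ⊗ (A ⊗ B) ⊗ D Q ≋ T ⊗ Q
   D-Q = begin
     PN.nat μ ⊗ (A ⊗ B) ⊗ D Q
       ≈⟨ P.*-congˡ {PN.nat μ ⊗ (A ⊗ B)} (leibniz (A ^P k) (B ^P j)) ⟩
     PN.nat μ ⊗ (A ⊗ B) ⊗ (D (A ^P k) ⊗ B ^P j ⊕ A ^P k ⊗ D (B ^P j))
       ≈⟨ solveP 7 (λ m a b da bj ak db → m :* (a :* b) :* (da :* bj :+ ak :* db) := m :* b :* bj :* (a :* da) :+ m :* a :* ak :* (b :* db)) P.refl (PN.nat μ) A B (D (A ^P k)) (B ^P j) (A ^P k) (D (B ^P j)) ⟩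
     PN.nat μ ⊗ B ⊗ B ^P j ⊗ (A ⊗ D (A ^P k)) ⊕ PN.nat μ ⊗ A ⊗ A ^P k ⊗ (B ⊗ D (B ^P j))
       ≈⟨ P.+-cong (P.*-congˡ {PN.nat μ ⊗ B ⊗ B ^P j} (P.trans (f⊗D-^ A k) (P.*-congˡ {PN.nat k} (P.*-congˡ {A ^P k} D-A)))) (P.*-congˡ {PN.nat μ ⊗ A ⊗ A ^P k} (P.trans (f⊗D-^ B j) (P.*-congˡ {PN.nat j} (P.*-congˡ {B ^P j} D-B)))) ⟩
     PN.nat μ ⊗ B ⊗ B ^P j ⊗ (PN.nat k ⊗ (A ^P k ⊗ ⊝ C 1#)) ⊕ PN.nat μ ⊗ A ⊗ A ^P k ⊗ (PN.nat j ⊗ (B ^P j ⊗ PN.nat c))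
       ≈⟨ solveP 8 (λ m a b bj ak k j c → m :* b :* bj :* (k :* (ak :* (:- # 1))) :+ m :* a :* ak :* (j :* (bj :* c)) := (:- (m :* (k :* b)) :+ c :* (m :* j :* a)) :* (ak :* bj)) P.refl (PN.nat μ) A B (B ^P j) (A ^P k) (PN.nat k) (PN.nat j) (PN.nat c) ⟩
     (⊝ (PN.nat μ ⊗ (PN.nat k ⊗ B)) ⊕ PN.nat c ⊗ (PN.nat μ ⊗ PN.nat j ⊗ A)) ⊗ Q
       ≈⟨ P.*-congʳ {Q} (P.+-congˡ {⊝ (PN.nat μ ⊗ (PN.nat k ⊗ B))} (P.*-congˡ {PN.nat c} (P.*-congʳ {A} μj'))) ⟩
     T ⊗ Q ∎

   private
     D-T : D T ≋ ⊝ (PN.nat μ ⊗ (PN.nat k ⊗ PN.nat c)) ⊕ PN.nat c ⊗ ((⊝ PN.nat 2 ⊕ ⊝ (PN.nat μ ⊗ PN.nat k)) ⊗ ⊝ C 1#)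
     D-T = begin
       D T
         ≈⟨ D-⊕ (⊝ (PN.nat μ ⊗ (PN.nat k ⊗ B))) (PN.nat c ⊗ (J ⊗ A)) ⟩
       D (⊝ (PN.nat μ ⊗ (PN.nat k ⊗ B))) ⊕ D (PN.nat c ⊗ (J ⊗ A))
         ≈⟨ P.+-cong (P.trans (D-⊝ (PN.nat μ ⊗ (PN.nat k ⊗ B))) (P.-‿cong (P.trans (D-nat⊗ μ (PN.nat k ⊗ B)) (P.*-congˡ {PN.nat μ} (P.trans (D-nat⊗ k B) (P.*-congˡ {PN.nat k} D-B)))))) (P.trans (D-nat⊗ c (J ⊗ A)) (P.*-congˡ {PN.nat c} D-JA)) ⟩
       ⊝ (PN.nat μ ⊗ (PN.nat k ⊗ PN.nat c)) ⊕ PN.nat c ⊗ (J ⊗ ⊝ C 1#) ∎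
       where
       J = ⊝ PN.nat 2 ⊕ ⊝ (PN.nat μ ⊗ PN.nat k)
       D-J : D J ≋ []
       D-J = P.trans (D-⊕ (⊝ PN.nat 2) (⊝ (PN.nat μ ⊗ PN.nat k))) (P.trans (P.+-cong (P.trans (D-⊝ (PN.nat 2)) (P.-‿cong (D-nat 2))) (P.trans (D-⊝ (PN.nat μ ⊗ PN.nat k)) (P.-‿cong (P.trans (D-nat⊗ μ (PN.nat k)) (P.trans (P.*-congˡ {PN.nat μ} (D-nat k)) (P.zeroʳ (PN.nat μ))))))) P.refl)
       D-JA : D (J ⊗ A) ≋ J ⊗ ⊝ C 1#
       D-JA = P.trans (leibniz J A) (P.trans (P.+-cong (P.*-congʳ {A} D-J) (P.*-congˡ {J} D-A)) P.refl)

     D-AB : D (A ⊗ B) ≋ ⊝ B ⊕ A ⊗ PN.nat c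
     D-AB = P.trans (leibniz A B) (P.+-cong (P.trans (P.*-congʳ {B} D-A) (solveP 1 (λ b → (:- # 1) :* b := :- b) P.refl B)) (P.*-congˡ {A} D-B))

   T' T″ mAB : Pl
   T' = ⊝ (PN.nat μ ⊗ (PN.nat k ⊗ PN.nat c)) ⊕ PN.nat c ⊗ ((⊝ PN.nat 2 ⊕ ⊝ (PN.nat μ ⊗ PN.nat k)) ⊗ ⊝ C 1#)
   T″ = PN.nat μ ⊗ (A ⊗ B) ⊗ T' ⊕ T ⊗ T ⊕ ⊝ (PN.nat μ ⊗ (⊝ B ⊕ A ⊗ PN.nat c) ⊗ T)

   mAB = PN.nat μ ⊗ (A ⊗ B)

   DD-Q : mAB ⊗ mAB ⊗ D (D Q) ≋ T″ ⊗ Q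
   DD-Q = begin
     mAB ⊗ mAB ⊗ D (D Q)
       ≈⟨ solveP 4 (λ m dm d dd → m :* m :* dd := m :* (dm :* d :+ m :* dd) :- dm :* (m :* d)) P.refl mAB (PN.nat μ ⊗ D (A ⊗ B)) (D Q) (D (D Q)) ⟩
     mAB ⊗ (PN.nat μ ⊗ D (A ⊗ B) ⊗ D Q ⊕ mAB ⊗ D (D Q)) ⊕ ⊝ (PN.nat μ ⊗ D (A ⊗ B) ⊗ (mAB ⊗ D Q))
       ≈⟨ P.+-cong (P.*-congˡ {mAB} diff) (P.-‿cong (P.*-cong (P.*-congˡ {PN.nat μ} D-AB) D-Q)) ⟩
     mAB ⊗ (T' ⊗ Q ⊕ T ⊗ D Q) ⊕ ⊝ (PN.nat μ ⊗ (⊝ B ⊕ A ⊗ PN.nat c) ⊗ (T ⊗ Q))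
       ≈⟨ solveP 6 (λ m t' q t d s → m :* (t' :* q :+ t :* d) :- s :* (t :* q) := m :* t' :* q :+ t :* (m :* d) :- s :* t :* q) P.refl mAB T' Q T (D Q) (PN.nat μ ⊗ (⊝ B ⊕ A ⊗ PN.nat c)) ⟩
     mAB ⊗ T' ⊗ Q ⊕ T ⊗ (mAB ⊗ D Q) ⊕ ⊝ (PN.nat μ ⊗ (⊝ B ⊕ A ⊗ PN.nat c) ⊗ T ⊗ Q)
       ≈⟨ P.+-congʳ {⊝ (PN.nat μ ⊗ (⊝ B ⊕ A ⊗ PN.nat c) ⊗ T ⊗ Q)} (P.+-congˡ {mAB ⊗ T' ⊗ Q} (P.*-congˡ {T} D-Q)) ⟩
     mAB ⊗ T' ⊗ Q ⊕ T ⊗ (T ⊗ Q) ⊕ ⊝ (PN.nat μ ⊗ (⊝ B ⊕ A ⊗ PN.nat c) ⊗ T ⊗ Q)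
       ≈⟨ solveP 4 (λ a t q b → a :* q :+ t :* (t :* q) :- b :* q := (a :+ t :* t :- b) :* q) P.refl (mAB ⊗ T') T Q (PN.nat μ ⊗ (⊝ B ⊕ A ⊗ PN.nat c) ⊗ T) ⟩
     T″ ⊗ Q ∎
     where
     diff : PN.nat μ ⊗ D (A ⊗ B) ⊗ D Q ⊕ mAB ⊗ D (D Q) ≋ T' ⊗ Q ⊕ T ⊗ D Q
     diff = begin
       PN.nat μ ⊗ D (A ⊗ B) ⊗ D Q ⊕ mAB ⊗ D (D Q) ≈⟨ P.+-congʳ {mAB ⊗ D (D Q)} (P.*-congʳ {D Q} (D-nat⊗ μ (A ⊗ B))) ⟨
       D mAB ⊗ D Q ⊕ mAB ⊗ D (D Q) ≈⟨ leibniz mAB (D Q) ⟨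
       D (mAB ⊗ D Q) ≈⟨ D-cong D-Q ⟩
       D (T ⊗ Q) ≈⟨ leibniz T Q ⟩
       D T ⊗ Q ⊕ T ⊗ D Q ≈⟨ P.+-congʳ {T ⊗ D Q} (P.*-congʳ {Q} D-T) ⟩
       T' ⊗ Q ⊕ T ⊗ D Q ∎

   θ-Q : A ⊗ B ⊗ (A ⊗ B) ⊗ (PN.nat μ ⊗ PN.nat μ ⊗ θ Q) ≋ X ⊗ (mAB ⊗ (T ⊗ Q))
   θ-Q = P.trans (solveP 5 (λ m a b x d → a :* b :* (a :* b) :* (m :* m :* (x :* d)) := x :* (m :* (a :* b) :* (m :* (a :* b) :* d))) P.refl (PN.nat μ) A B X (D Q)) (P.*-congˡ {X} (P.*-congˡ {mAB} D-Q))

   θθ-Q : A ⊗ B ⊗ (A ⊗ B) ⊗ (PN.nat μ ⊗ PN.nat μ ⊗ θ (θ Q)) ≋ X ⊗ (mAB ⊗ (T ⊗ Q)) ⊕ X ⊗ (X ⊗ (T″ ⊗ Q))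
   θθ-Q = begin
     A ⊗ B ⊗ (A ⊗ B) ⊗ (PN.nat μ ⊗ PN.nat μ ⊗ (X ⊗ D (θ Q)))
       ≈⟨ P.*-congˡ {A ⊗ B ⊗ (A ⊗ B)} (P.*-congˡ {PN.nat μ ⊗ PN.nat μ} (P.*-congˡ {X} (P.trans (leibniz X (D Q)) (P.+-congʳ {X ⊗ D (D Q)} (P.trans (P.*-congʳ {D Q} D-X) (P.*-identityˡ (D Q))))))) ⟩
     A ⊗ B ⊗ (A ⊗ B) ⊗ (PN.nat μ ⊗ PN.nat μ ⊗ (X ⊗ (D Q ⊕ X ⊗ D (D Q))))
       ≈⟨ solveP 6 (λ m a b x d dd → a :* b :* (a :* b) :* (m :* m :* (x :* (d :+ x :* dd))) := x :* (m :* (a :* b) :* (m :* (a :* b) :* d)) :+ x :* (x :* (m :* (a :* b) :* (m :* (a :* b)) :* dd))) P.refl (PN.nat μ) A B X (D Q) (D (D Q)) ⟩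
     X ⊗ (mAB ⊗ (mAB ⊗ D Q)) ⊕ X ⊗ (X ⊗ (mAB ⊗ mAB ⊗ D (D Q)))
       ≈⟨ P.+-cong (P.*-congˡ {X} (P.*-congˡ {mAB} D-Q)) (P.*-congˡ {X} (P.*-congˡ {X} DD-Q)) ⟩
     X ⊗ (mAB ⊗ (T ⊗ Q)) ⊕ X ⊗ (X ⊗ (T″ ⊗ Q)) ∎

 module _ (k j : ℕ) (μj : nat 4 * nat j ≡ - nat 2 - nat 4 * nat k) where
   open LinearForms 4 3 k j μj
   open CuspOperator 2 16 32 12

   -- The exponents have sum -1/2 in the field: `Q` is (1 + 3v)^(-1/2) times the k-th power of (1 -
   -- v)/(1 + 3v), and this weight factor is what the quadratic transformation demands. Once the
   -- derivatives are expressed by `T` and `T″`, a polynomial identity in X and k remains.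
   Λ-Q₂ : A ⊗ B ⊗ (A ⊗ B) ⊗ Λ Q ≋ PN.nat 2 ⊗ (X ⊗ A) ⊗ (Q ⊗ (PN.nat 16 ⊗ (PN.nat k ⊗ PN.nat k) ⊗ B ^P 2 ⊕ ⊝ ((PN.nat 16 ⊗ (PN.nat k ⊗ PN.nat k) ⊕ PN.nat 32 ⊗ PN.nat k ⊕ PN.nat 12) ⊗ A ^P 2)))
   Λ-Q₂ = begin
     M ⊗ (PN.nat 16 ⊗ θ (θ Q) ⊕ ⊝ (X ^P 2 ⊗ (PN.nat 16 ⊗ θ (θ Q) ⊕ PN.nat 32 ⊗ θ Q ⊕ PN.nat 12 ⊗ Q)))
       ≈⟨ solveP 5 (λ m x tt t q → m :* (# 16 :* tt :- x :^ 2 :* (# 16 :* tt :+ # 32 :* t :+ # 12 :* q)) := (# 1 :- x :^ 2) :* (m :* (# 4 :* # 4 :* tt)) :- # 2 :* x :^ 2 :* (m :* (# 4 :* # 4 :* t)) :- x :^ 2 :* (# 12 :* (m :* q))) P.refl M X (θ (θ Q)) (θ Q) Q ⟩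
     (C 1# ⊕ ⊝ X ^P 2) ⊗ (M ⊗ (PN.nat 4 ⊗ PN.nat 4 ⊗ θ (θ Q))) ⊕ ⊝ (PN.nat 2 ⊗ X ^P 2 ⊗ (M ⊗ (PN.nat 4 ⊗ PN.nat 4 ⊗ θ Q))) ⊕ ⊝ (X ^P 2 ⊗ (PN.nat 12 ⊗ (M ⊗ Q)))
       ≈⟨ P.+-congʳ {⊝ (X ^P 2 ⊗ (PN.nat 12 ⊗ (M ⊗ Q)))} (P.+-cong (P.*-congˡ {C 1# ⊕ ⊝ X ^P 2} θθ-Q) (P.-‿cong (P.*-congˡ {PN.nat 2 ⊗ X ^P 2} θ-Q))) ⟩
     (C 1# ⊕ ⊝ X ^P 2) ⊗ (X ⊗ (mAB ⊗ (T ⊗ Q)) ⊕ X ⊗ (X ⊗ (T″ ⊗ Q))) ⊕ ⊝ (PN.nat 2 ⊗ X ^P 2 ⊗ (X ⊗ (mAB ⊗ (T ⊗ Q)))) ⊕ ⊝ (X ^P 2 ⊗ (PN.nat 12 ⊗ (M ⊗ Q)))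
       ≈⟨ solveP 3 (λ x k q → let a = # 1 :- x ; b = # 1 :+ # 3 :* x ; mab = # 4 :* (a :* b)
                                  t = :- (# 4 :* (k :* b)) :+ # 3 :* ((:- # 2 :- # 4 :* k) :* a)
                                  t' = :- (# 4 :* (k :* # 3)) :+ # 3 :* ((:- # 2 :- # 4 :* k) :* (:- # 1))
                                  t″ = mab :* t' :+ t :* t :- # 4 :* (:- b :+ a :* # 3) :* t in
            (# 1 :- x :^ 2) :* (x :* (mab :* (t :* q)) :+ x :* (x :* (t″ :* q))) :- # 2 :* x :^ 2 :* (x :* (mab :* (t :* q))) :- x :^ 2 :* (# 12 :* (a :* b :* (a :* b) :* q))
            := # 2 :* (x :* a) :* (q :* (# 16 :* (k :* k) :* b :^ 2 :- (# 16 :* (k :* k) :+ # 32 :* k :+ # 12) :* a :^ 2))) P.refl X (PN.nat k) Q ⟩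
     PN.nat 2 ⊗ (X ⊗ A) ⊗ (Q ⊗ (PN.nat 16 ⊗ (PN.nat k ⊗ PN.nat k) ⊗ B ^P 2 ⊕ ⊝ ((PN.nat 16 ⊗ (PN.nat k ⊗ PN.nat k) ⊕ PN.nat 32 ⊗ PN.nat k ⊕ PN.nat 12) ⊗ A ^P 2))) ∎
     where M = A ⊗ B ⊗ (A ⊗ B)

 module _ (k j : ℕ) (μj : nat 2 * nat j ≡ - nat 2 - nat 2 * nat k) where
   open LinearForms 2 2 k j μj
   open CuspOperator 3 4 12 8

   -- The same with exponent sum -1, corresponding to the weight factor (1 + 2v)^(-1) of the cubic
   -- transformation.
   Λ-Q₃ : A ⊗ B ⊗ (A ⊗ B) ⊗ Λ Q ≋ X ⊗ A ⊗ (Q ⊗ (PN.nat 4 ⊗ (PN.nat k ⊗ PN.nat k) ⊗ B ^P 3 ⊕ ⊝ ((PN.nat 4 ⊗ (PN.nat k ⊗ PN.nat k) ⊕ PN.nat 12 ⊗ PN.nat k ⊕ PN.nat 8) ⊗ A ^P 3)))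
   Λ-Q₃ = begin
     M ⊗ (PN.nat 4 ⊗ θ (θ Q) ⊕ ⊝ (X ^P 3 ⊗ (PN.nat 4 ⊗ θ (θ Q) ⊕ PN.nat 12 ⊗ θ Q ⊕ PN.nat 8 ⊗ Q)))
       ≈⟨ solveP 5 (λ m x tt t q → m :* (# 4 :* tt :- x :^ 3 :* (# 4 :* tt :+ # 12 :* t :+ # 8 :* q)) := (# 1 :- x :^ 3) :* (m :* (# 2 :* # 2 :* tt)) :- # 3 :* x :^ 3 :* (m :* (# 2 :* # 2 :* t)) :- x :^ 3 :* (# 8 :* (m :* q))) P.refl M X (θ (θ Q)) (θ Q) Q ⟩
     (C 1# ⊕ ⊝ X ^P 3) ⊗ (M ⊗ (PN.nat 2 ⊗ PN.nat 2 ⊗ θ (θ Q))) ⊕ ⊝ (PN.nat 3 ⊗ X ^P 3 ⊗ (M ⊗ (PN.nat 2 ⊗ PN.nat 2 ⊗ θ Q))) ⊕ ⊝ (X ^P 3 ⊗ (PN.nat 8 ⊗ (M ⊗ Q)))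
       ≈⟨ P.+-congʳ {⊝ (X ^P 3 ⊗ (PN.nat 8 ⊗ (M ⊗ Q)))} (P.+-cong (P.*-congˡ {C 1# ⊕ ⊝ X ^P 3} θθ-Q) (P.-‿cong (P.*-congˡ {PN.nat 3 ⊗ X ^P 3} θ-Q))) ⟩
     (C 1# ⊕ ⊝ X ^P 3) ⊗ (X ⊗ (mAB ⊗ (T ⊗ Q)) ⊕ X ⊗ (X ⊗ (T″ ⊗ Q))) ⊕ ⊝ (PN.nat 3 ⊗ X ^P 3 ⊗ (X ⊗ (mAB ⊗ (T ⊗ Q)))) ⊕ ⊝ (X ^P 3 ⊗ (PN.nat 8 ⊗ (M ⊗ Q)))
       ≈⟨ solveP 3 (λ x k q → let a = # 1 :- x ; b = # 1 :+ # 2 :* x ; mab = # 2 :* (a :* b)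
                                  t = :- (# 2 :* (k :* b)) :+ # 2 :* ((:- # 2 :- # 2 :* k) :* a)
                                  t' = :- (# 2 :* (k :* # 2)) :+ # 2 :* ((:- # 2 :- # 2 :* k) :* (:- # 1))
                                  t″ = mab :* t' :+ t :* t :- # 2 :* (:- b :+ a :* # 2) :* t in
            (# 1 :- x :^ 3) :* (x :* (mab :* (t :* q)) :+ x :* (x :* (t″ :* q))) :- # 3 :* x :^ 3 :* (x :* (mab :* (t :* q))) :- x :^ 3 :* (# 8 :* (a :* b :* (a :* b) :* q))
            := x :* a :* (q :* (# 4 :* (k :* k) :* b :^ 3 :- (# 4 :* (k :* k) :+ # 12 :* k :+ # 8) :* a :^ 3))) P.refl X (PN.nat k) Q ⟩
     X ⊗ A ⊗ (Q ⊗ (PN.nat 4 ⊗ (PN.nat k ⊗ PN.nat k) ⊗ B ^P 3 ⊕ ⊝ ((PN.nat 4 ⊗ (PN.nat k ⊗ PN.nat k) ⊕ PN.nat 12 ⊗ PN.nat k ⊕ PN.nat 8) ⊗ A ^P 3))) ∎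
     where M = A ⊗ B ⊗ (A ⊗ B)

 cancel-α : ∀ f → α ⊗ f ≋ [] → f ≋ []
 cancel-α f e = cancel-1+ (- 1#) f (P.trans (P.*-congʳ {f} (P.+-congˡ {C 1#} (P.trans (P.*-congʳ {X} (C-neg 1#)) (solveP 1 (λ x → (:- # 1) :* x := :- x) P.refl X)))) e)

 cancel-β : ∀ c f → β c ⊗ f ≋ [] → f ≋ []
 cancel-β c f e = cancel-1+ (nat c) f (P.trans (P.*-congʳ {f} (P.+-congˡ {C 1#} (P.*-congʳ {X} (C-nat c)))) e)

 module _ (A : Algebra) where
   open Algebra A
   open Evaluation A
   private module R = CommutativeRing ring
   private solveR = IntSolver.solve ring

   Σ≤-shift : ∀ k t → L.Σ≤ (suc k) t R.≈ t 0 R.+ L.Σ≤ k (λ i → t (suc i))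
   Σ≤-shift zero t = R.refl
   Σ≤-shift (suc k) t = R.trans (R.+-congʳ (Σ≤-shift k t)) (R.+-assoc _ _ _)

   ev-coeffs : ∀ I f x → Below (suc I) f → ev f x R.≈ L.Σ≤ I (λ i → ρ (cf f i) R.* x ^R i)
   ev-coeffs I [] x b = R.sym (zeros I)
     where
     zeros : ∀ I → L.Σ≤ I (λ i → ρ 0# R.* x ^R i) R.≈ R.0#
     zeros zero = R.trans (R.*-congʳ ρ-0) (R.zeroˡ _)
     zeros (suc I) = R.trans (R.+-cong (zeros I) (R.trans (R.*-congʳ ρ-0) (R.zeroˡ _))) (R.+-identityˡ _)
   ev-coeffs zero (a ∷ f) x b = R.trans (R.+-congˡ (R.trans (R.*-congˡ (ev-zero f x (coeffwise λ i → b (suc i) (ℕ.s≤s ℕ.z≤n)))) (R.zeroʳ x))) (solveR 1 (λ a → a :+ # 0 := a :* # 1) R.refl (ρ a))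
   ev-coeffs (suc I) (a ∷ f) x b = R.trans (R.+-cong (R.sym (R.*-identityʳ (ρ a))) (R.trans (R.*-congˡ (ev-coeffs I f x (λ i le → b (suc i) (ℕ.s≤s le)))) (R.trans (L.*-distribˡ-Σ≤ I x _) (L.Σ≤-cong I (λ i _ → solveR 3 (λ x a y → x :* (a :* y) := a :* (x :* y)) R.refl x (ρ (cf f i)) (x ^R i)))))) (R.sym (Σ≤-shift I (λ i → ρ (cf (a ∷ f) i) R.* x ^R i)))

 -- K(v) = ψ(v^r) and K̃(v) = (1 + cv)^N ψ(((1 - v)/(1 + cv))^r) are both annihilated by Λ and have
 -- degree at most N < p, so they are proportional. The exponent N represents -2/μ modulo p: (p -
 -- 1)/2 for the weight factor (1 + 3v)^(-1/2), and p - 1 for (1 + 2v)^(-1).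
 module Closure (data₀ : GaussData) (r μ c a₁ a₂ a₃ N : ℕ) (M₁ : Pl)
   (0<r : 0 ℕ.< r) (a₁≢0 : nat a₁ ≢ 0#) (N<p : N ℕ.< p) (μN : nat μ * nat N ≡ - nat 2)
   (a₂≡ : nat a₂ ≡ nat a₁ * nat r) (a₃≡ : nat a₁ * (nat r * nat r) * GaussData.g data₀ ≡ nat a₃)
   (degree : (2 ℕ.* GaussData.m data₀ ℕ.+ GaussData.ν data₀) ℕ.* r ℕ.≤ N)
   (Λ-Q : ∀ k j → nat μ * nat j ≡ - nat 2 - nat μ * nat k →
          α ⊗ β c ⊗ (α ⊗ β c) ⊗ CuspOperator.Λ r a₁ a₂ a₃ (α ^P k ⊗ β c ^P j) ≋
          M₁ ⊗ (α ^P k ⊗ β c ^P j ⊗ (PN.nat a₁ ⊗ (PN.nat k ⊗ PN.nat k) ⊗ β c ^P r ⊕ ⊝ ((PN.nat a₁ ⊗ (PN.nat k ⊗ PN.nat k) ⊕ PN.nat a₂ ⊗ PN.nat k ⊕ PN.nat a₃) ⊗ α ^P r))))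
   where
   open GaussData data₀ using (m; ν; g)
   open Gauss data₀
   open CuspOperator r a₁ a₂ a₃

   private
     I : ℕ
     I = 2 ℕ.* m ℕ.+ ν

     d-rec' : ∀ i → W₁ (suc i) ⊗ C (d (suc i)) ≋ W₂ i ⊗ C (d i)
     d-rec' i = begin
       W₁ (suc i) ⊗ C (d (suc i)) ≈⟨ P.*-congʳ {C (d (suc i))} (P.*-cong (C-nat a₁) (P.*-cong (C-nat (suc i ℕ.* r)) (C-nat (suc i ℕ.* r)))) ⟨
       C (nat a₁) ⊗ (C k' ⊗ C k') ⊗ C (d (suc i)) ≈⟨ P.*-congʳ {C (d (suc i))} (P.trans (C-* _ _) (P.*-congˡ {C (nat a₁)} (C-* k' k'))) ⟨
       C (nat a₁ * (k' * k')) ⊗ C (d (suc i)) ≈⟨ C-* _ _ ⟨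
       C (nat a₁ * (k' * k') * d (suc i)) ≈⟨ C-cong eq ⟩
       C ((nat a₁ * (k * k) + nat a₂ * k + nat a₃) * d i) ≈⟨ C-* _ _ ⟩
       C (nat a₁ * (k * k) + nat a₂ * k + nat a₃) ⊗ C (d i) ≈⟨ P.*-congʳ {C (d i)} (P.trans (C-+ _ (nat a₃)) (P.+-cong (P.trans (C-+ _ _) (P.+-cong (P.trans (C-* _ _) (P.*-cong (C-nat a₁) (P.trans (C-* k k) (P.*-cong (C-nat (i ℕ.* r)) (C-nat (i ℕ.* r)))))) (P.trans (C-* _ _) (P.*-cong (C-nat a₂) (C-nat (i ℕ.* r)))))) (C-nat a₃))) ⟩
       W₂ i ⊗ C (d i) ∎
       where
       k k' : F
       k = nat (i ℕ.* r)
       k' = nat (suc i ℕ.* r)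
       eq : nat a₁ * (k' * k') * d (suc i) ≡ (nat a₁ * (k * k) + nat a₂ * k + nat a₃) * d i
       eq = trans (cong (λ z → nat a₁ * (z * z) * d (suc i)) (nat-* (suc i) r))
         (trans (solve 4 (λ a n r d → a :* (n :* r :* (n :* r)) :* d := a :* (r :* r) :* (n :* n :* d)) refl (nat a₁) (nat (suc i)) (nat r) (d (suc i)))
         (trans (cong (nat a₁ * (nat r * nat r) *_) (d-rec i))
         (trans (solve 5 (λ a r n g d → a :* (r :* r) :* ((n :* n :+ n :+ g) :* d) := (a :* (n :* r :* (n :* r)) :+ a :* r :* (n :* r) :+ a :* (r :* r) :* g) :* d) refl (nat a₁) (nat r) (nat i) g (d i))
         (trans (cong₂ (λ x y → (nat a₁ * (nat i * nat r * (nat i * nat r)) + x * (nat i * nat r) + y) * d i) (sym a₂≡) a₃≡)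
         (cong (λ z → (nat a₁ * (z * z) + nat a₂ * z + nat a₃) * d i) (sym (nat-* i r)))))))

     d-end : d (suc I) ≡ 0#
     d-end = ψ-below (suc I) ≤-refl

     Q : ℕ → Pl
     Q i = α ^P (i ℕ.* r) ⊗ β c ^P (N ℕ.∸ i ℕ.* r)

     i≤I⇒ir≤N : ∀ {i} → i ℕ.≤ I → i ℕ.* r ℕ.≤ N
     i≤I⇒ir≤N i≤I = ≤-trans (ℕₚ.*-monoˡ-≤ r i≤I) degree

     Q-step : ∀ i → i ℕ.< I → Q (suc i) ⊗ β c ^P r ≋ Q i ⊗ α ^P r
     Q-step i i<I = begin
       α ^P (r ℕ.+ i ℕ.* r) ⊗ β c ^P (N ℕ.∸ suc i ℕ.* r) ⊗ β c ^P r ≈⟨ P.*-congʳ {β c ^P r} (P.*-congʳ {β c ^P (N ℕ.∸ suc i ℕ.* r)} (^P-homo-* α r (i ℕ.* r))) ⟩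
       α ^P r ⊗ α ^P (i ℕ.* r) ⊗ β c ^P (N ℕ.∸ suc i ℕ.* r) ⊗ β c ^P r ≈⟨ solveP 4 (λ a b c d → a :* b :* c :* d := b :* (c :* d) :* a) P.refl (α ^P r) (α ^P (i ℕ.* r)) (β c ^P (N ℕ.∸ suc i ℕ.* r)) (β c ^P r) ⟩
       α ^P (i ℕ.* r) ⊗ (β c ^P (N ℕ.∸ suc i ℕ.* r) ⊗ β c ^P r) ⊗ α ^P r ≈⟨ P.*-congʳ {α ^P r} (P.*-congˡ {α ^P (i ℕ.* r)} (^P-homo-* (β c) (N ℕ.∸ suc i ℕ.* r) r)) ⟨
       α ^P (i ℕ.* r) ⊗ β c ^P (N ℕ.∸ suc i ℕ.* r ℕ.+ r) ⊗ α ^P r ≡⟨ cong (λ e → α ^P (i ℕ.* r) ⊗ β c ^P e ⊗ α ^P r) exponent ⟩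
       Q i ⊗ α ^P r ∎
       where
       exponent : N ℕ.∸ suc i ℕ.* r ℕ.+ r ≡ N ℕ.∸ i ℕ.* r
       exponent = trans (cong (ℕ._+ r) (trans (cong (N ℕ.∸_) (ℕₚ.+-comm r (i ℕ.* r))) (sym (ℕₚ.∸-+-assoc N (i ℕ.* r) r)))) (ℕₚ.m∸n+n≡m (ℕₚ.m+n≤o⇒m≤o∸n r (i≤I⇒ir≤N i<I)))

     μj : ∀ i → i ℕ.≤ I → nat μ * nat (N ℕ.∸ i ℕ.* r) ≡ - nat 2 - nat μ * nat (i ℕ.* r)
     μj i i≤I = trans (solve 3 (λ m j k → m :* j := m :* (k :+ j) :- m :* k) refl (nat μ) (nat (N ℕ.∸ i ℕ.* r)) (nat (i ℕ.* r))) (cong (_- nat μ * nat (i ℕ.* r)) (trans (cong (nat μ *_) (trans (sym (nat-+ (i ℕ.* r) _)) (cong nat (m+[n∸m]≡n (i≤I⇒ir≤N i≤I))))) μN))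

     module K̃-telescope = Telescope d I d-rec' d-end (α ⊗ β c ⊗ (α ⊗ β c)) M₁ (α ^P r) (β c ^P r) Q Q-step (λ i i≤I → Λ-Q (i ℕ.* r) (N ℕ.∸ i ℕ.* r) (μj i i≤I))

     Λ-X^ : ∀ i → C 1# ⊗ Λ (X ^P (i ℕ.* r)) ≋ C 1# ⊗ (X ^P (i ℕ.* r) ⊗ (W₁ i ⊗ C 1# ⊕ ⊝ (W₂ i ⊗ X ^P r)))
     Λ-X^ i = P.*-congˡ {C 1#} (begin
       PN.nat a₁ ⊗ θ (θ Y) ⊕ ⊝ (X ^P r ⊗ (PN.nat a₁ ⊗ θ (θ Y) ⊕ PN.nat a₂ ⊗ θ Y ⊕ PN.nat a₃ ⊗ Y))
         ≈⟨ P.+-cong (P.*-congˡ {PN.nat a₁} θθ) (P.-‿cong (P.*-congˡ {X ^P r} (P.+-congʳ {PN.nat a₃ ⊗ Y} (P.+-cong (P.*-congˡ {PN.nat a₁} θθ) (P.*-congˡ {PN.nat a₂} (θ-X^ k)))))) ⟩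
       PN.nat a₁ ⊗ (PN.nat k ⊗ (PN.nat k ⊗ Y)) ⊕ ⊝ (X ^P r ⊗ (PN.nat a₁ ⊗ (PN.nat k ⊗ (PN.nat k ⊗ Y)) ⊕ PN.nat a₂ ⊗ (PN.nat k ⊗ Y) ⊕ PN.nat a₃ ⊗ Y))
         ≈⟨ solveP 6 (λ a b c k y x → a :* (k :* (k :* y)) :- x :* (a :* (k :* (k :* y)) :+ b :* (k :* y) :+ c :* y) := y :* (a :* (k :* k) :* # 1 :- (a :* (k :* k) :+ b :* k :+ c) :* x)) P.refl (PN.nat a₁) (PN.nat a₂) (PN.nat a₃) (PN.nat k) Y (X ^P r) ⟩
       Y ⊗ (W₁ i ⊗ C 1# ⊕ ⊝ (W₂ i ⊗ X ^P r)) ∎)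
       where
       k = i ℕ.* r
       Y = X ^P k
       θθ : θ (θ Y) ≋ PN.nat k ⊗ (PN.nat k ⊗ Y)
       θθ = P.trans (θ-cong (θ-X^ k)) (P.trans (θ-nat⊗ k Y) (P.*-congˡ {PN.nat k} (θ-X^ k)))

     module K-telescope = Telescope d I d-rec' d-end (C 1#) (C 1#) (X ^P r) (C 1#) (λ i → X ^P (i ℕ.* r)) (λ i _ → P.trans (P.*-identityʳ (X ^P (suc i ℕ.* r))) (P.trans (^P-homo-* X r (i ℕ.* r)) (P.*-comm (X ^P r) (X ^P (i ℕ.* r))))) (λ i _ → Λ-X^ i)

     K K̃ : Pl
     K = PL.Σ≤ I (λ i → C (d i) ⊗ X ^P (i ℕ.* r))
     K̃ = PL.Σ≤ I (λ i → C (d i) ⊗ Q i)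

     ΛK : Λ K ≋ []
     ΛK = P.trans (P.sym (P.*-identityˡ (Λ K))) K-telescope.telescope

     ΛK̃ : Λ K̃ ≋ []
     ΛK̃ = cancel-β c (Λ K̃) (cancel-α _ (cancel-β c _ (cancel-α _ (P.trans (solveP 3 (λ a b l → a :* (b :* (a :* (b :* l))) := a :* b :* (a :* b) :* l) P.refl α (β c) (Λ K̃)) K̃-telescope.telescope))))

     α-below : Below 2 α
     α-below = Below-⊕ (C 1#) (⊝ X) (Below-mono (C 1#) (ℕ.s≤s ℕ.z≤n) (Below-C 1#)) (λ i le → trans (cf-⊝ X i) (trans (cong (λ a → - a) (Below-X i le)) (solve 0 (:- # 0 := # 0) refl)))

     β-below : Below 2 (β c)
     β-below = Below-⊕ (C 1#) (PN.nat c ⊗ X) (Below-mono (C 1#) (ℕ.s≤s ℕ.z≤n) (Below-C 1#)) (Below-⊗ (PN.nat c) X (Below-cong (C-nat c) (Below-C (nat c))) Below-X)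

     K-below : Below p K
     K-below = Below-Σ I (λ i i≤I → Below-C⊗ (d i) (X ^P (i ℕ.* r)) (Below-mono (X ^P (i ℕ.* r)) (≤-trans (ℕ.s≤s (≤-trans (≤-reflexive (ℕₚ.*-identityʳ (i ℕ.* r))) (i≤I⇒ir≤N i≤I))) N<p) (Below-^ X Below-X (i ℕ.* r))))

     K̃-below : Below p K̃
     K̃-below = Below-Σ I (λ i i≤I → Below-C⊗ (d i) (Q i) (Below-mono (Q i) (≤-trans (ℕ.s≤s (≤-reflexive (trans (cong₂ ℕ._+_ (ℕₚ.*-identityʳ (i ℕ.* r)) (ℕₚ.*-identityʳ (N ℕ.∸ i ℕ.* r))) (m+[n∸m]≡n (i≤I⇒ir≤N i≤I))))) N<p) (Below-⊗ (α ^P (i ℕ.* r)) (β c ^P (N ℕ.∸ i ℕ.* r)) (Below-^ α α-below (i ℕ.* r)) (Below-^ (β c) β-below (N ℕ.∸ i ℕ.* r)))))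

     K₀ K̃₀ : F
     K₀ = cf K 0
     K̃₀ = cf K̃ 0

     proportional : C K₀ ⊗ K̃ ≋ C K̃₀ ⊗ K
     proportional = ⊖≋[]⇒≋ (C K₀ ⊗ K̃) (C K̃₀ ⊗ K) (P.trans (P.+-congˡ {C K₀ ⊗ K̃} neg) (Λ-unique a₁≢0 0<r f Λf f0 f-below))
       where
       f = C K₀ ⊗ K̃ ⊕ C (- K̃₀) ⊗ K
       neg : ⊝ (C K̃₀ ⊗ K) ≋ C (- K̃₀) ⊗ K
       neg = P.trans (solveP 2 (λ a k → :- (a :* k) := (:- a) :* k) P.refl (C K̃₀) K) (P.*-congʳ {K} (P.sym (C-neg K̃₀)))
       Λf : Λ f ≋ []
       Λf = P.trans (Λ-⊕ (C K₀ ⊗ K̃) (C (- K̃₀) ⊗ K)) (P.trans (P.+-cong (P.trans (Λ-C⊗ K₀ K̃) (P.*-congˡ {C K₀} ΛK̃)) (P.trans (Λ-C⊗ (- K̃₀) K) (P.*-congˡ {C (- K̃₀)} ΛK))) (solveP 2 (λ a b → a :* # 0 :+ b :* # 0 := # 0) P.refl (C K₀) (C (- K̃₀))))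
       f0 : cf f 0 ≡ 0#
       f0 = trans (cf-⊕ (C K₀ ⊗ K̃) (C (- K̃₀) ⊗ K) 0) (trans (cong₂ _+_ (cf-C⊗ K₀ K̃ 0) (cf-C⊗ (- K̃₀) K 0)) (solve 2 (λ a b → a :* b :+ (:- b) :* a := # 0) refl K₀ K̃₀))
       f-below : Below p f
       f-below = Below-⊕ (C K₀ ⊗ K̃) (C (- K̃₀) ⊗ K) (Below-C⊗ K₀ K̃ K̃-below) (Below-C⊗ (- K̃₀) K K-below)

   module _ (A : Algebra) where
     open Algebra A
     open Evaluation A
     open ψ-Evaluation A using (ev-Σ; ev-nat)
     private
       module R = CommutativeRing ring
       solveR = IntSolver.solve ring
       ^R-congˡ = Exp.^-congˡ R.semiring
       ^R-assocʳ = Exp.^-assocʳ R.semiring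
       ^R-homo-* = Exp.^-homo-* R.semiring

     ev-K : ∀ v → ev K v R.≈ ev ψ (v ^R r)
     ev-K v = R.trans (ev-Σ I _ v) (R.trans (L.Σ≤-cong I (λ i _ → R.trans (ev-⊗ (C (d i)) (X ^P (i ℕ.* r)) v) (R.*-cong (ev-C (d i) v) (R.trans (ev-^ X (i ℕ.* r) v) (R.trans (^R-congˡ (i ℕ.* r) (ev-X v)) (R.trans (R.reflexive (cong (v ^R_) (ℕₚ.*-comm i r))) (R.sym (^R-assocʳ v r i)))))))) (R.sym (ev-coeffs A I ψ (v ^R r) ψ-below)))

     ev-K̃ : ∀ v w → (R.1# R.+ N.nat c R.* v) R.* w R.≈ R.1# → ev K̃ v R.≈ (R.1# R.+ N.nat c R.* v) ^R N R.* ev ψ (((R.1# R.- v) R.* w) ^R r)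
     ev-K̃ v w bw = R.trans (ev-Σ I _ v) (R.trans (L.Σ≤-cong I term-eq) (R.trans (R.sym (L.*-distribˡ-Σ≤ I (b ^R N) _)) (R.*-congˡ (R.sym (ev-coeffs A I ψ ((a R.* w) ^R r) ψ-below)))))
       where
       a b : R.Carrier
       a = R.1# R.- v
       b = R.1# R.+ N.nat c R.* v
       ev-α : ev α v R.≈ a
       ev-α = R.trans (ev-⊕ (C 1#) (⊝ X) v) (R.+-cong (ev-1 v) (R.trans (ev-⊝ X v) (R.-‿cong (ev-X v))))
       ev-β : ev (β c) v R.≈ b
       ev-β = R.trans (ev-⊕ (C 1#) (PN.nat c ⊗ X) v) (R.+-cong (ev-1 v) (R.trans (ev-⊗ (PN.nat c) X v) (R.*-cong (ev-nat c v) (ev-X v))))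
       ev-Q : ∀ i → ev (Q i) v R.≈ a ^R (i ℕ.* r) R.* b ^R (N ℕ.∸ i ℕ.* r)
       ev-Q i = R.trans (ev-⊗ (α ^P (i ℕ.* r)) (β c ^P (N ℕ.∸ i ℕ.* r)) v) (R.*-cong (R.trans (ev-^ α (i ℕ.* r) v) (^R-congˡ (i ℕ.* r) ev-α)) (R.trans (ev-^ (β c) (N ℕ.∸ i ℕ.* r) v) (^R-congˡ (N ℕ.∸ i ℕ.* r) ev-β)))
       bw^ : ∀ k → b ^R k R.* w ^R k R.≈ R.1#
       bw^ k = R.trans (R.sym (L.^-distrib-* b w k)) (R.trans (^R-congˡ k bw) (L.1^n≈1 k))
       power : ∀ i → i ℕ.≤ I → a ^R (i ℕ.* r) R.* b ^R (N ℕ.∸ i ℕ.* r) R.≈ b ^R N R.* ((a R.* w) ^R r) ^R i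
       power i i≤I = R.sym (R.trans (R.*-cong
           (R.trans (R.reflexive (cong (b ^R_) (sym (m+[n∸m]≡n (i≤I⇒ir≤N i≤I))))) (^R-homo-* b (i ℕ.* r) _))
           (R.trans (^R-assocʳ (a R.* w) r i) (R.trans (R.reflexive (cong ((a R.* w) ^R_) (ℕₚ.*-comm r i))) (L.^-distrib-* a w (i ℕ.* r)))))
         (R.trans (solveR 4 (λ x y z t → x :* y :* (z :* t) := (x :* t) :* (z :* y)) R.refl (b ^R (i ℕ.* r)) (b ^R (N ℕ.∸ i ℕ.* r)) (a ^R (i ℕ.* r)) (w ^R (i ℕ.* r)))
         (R.trans (R.*-congʳ (bw^ (i ℕ.* r))) (R.*-identityˡ _))))
       term-eq : ∀ i → i ℕ.≤ I → ev (C (d i) ⊗ Q i) v R.≈ b ^R N R.* (ρ (d i) R.* ((a R.* w) ^R r) ^R i)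
       term-eq i i≤I = R.trans (ev-⊗ (C (d i)) (Q i) v) (R.trans (R.*-cong (ev-C (d i) v) (R.trans (ev-Q i) (power i i≤I))) (solveR 3 (λ d b y → d :* (b :* y) := b :* (d :* y)) R.refl (ρ (d i)) (b ^R N) _))

   private
     K₀≡1 : K₀ ≡ 1#
     K₀≡1 = trans (sym (ev-0 K)) (trans (ev-K self 0#) (trans (cong (E.ev ψ) (0^r 0<r)) (trans (ev-0 ψ) d-0)))
       where
       0^r : ∀ {r} → 0 ℕ.< r → 0# ^ r ≡ 0#
       0^r {suc r} _ = zeroˡ _

   module _ (A : Algebra) where
     open Algebra A
     open Evaluation A
     private
       module R = CommutativeRing ring
       solveR = IntSolver.solve ring

     -- K has constant coefficient 1, so K̃ is a multiple of K and vanishes where K does; powers of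
     -- w = 1/(1 + cv) remove the factor (1 + cv)^N.
     closure : ∀ v w → (R.1# R.+ N.nat c R.* v) R.* w R.≈ R.1# → ev ψ (v ^R r) R.≈ R.0# → ev ψ (((R.1# R.- v) R.* w) ^R r) R.≈ R.0#
     closure v w bw zero' = R.trans (R.sym (R.*-identityˡ y)) (R.trans (R.*-congʳ (R.sym (bw^ N))) (R.trans (solveR 3 (λ b w y → b :* w :* y := w :* (b :* y)) R.refl (b ^R N) (w ^R N) y) (R.trans (R.*-congˡ (R.trans (R.sym (ev-K̃ A v w bw)) K̃≈0)) (R.zeroʳ _))))
       where
       b y : R.Carrier
       b = R.1# R.+ N.nat c R.* v
       y = ev ψ (((R.1# R.- v) R.* w) ^R r)
       bw^ : ∀ k → b ^R k R.* w ^R k R.≈ R.1#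
       bw^ k = R.trans (R.sym (L.^-distrib-* b w k)) (R.trans (Exp.^-congˡ R.semiring k bw) (L.1^n≈1 k))
       K̃≈0 : ev K̃ v R.≈ R.0#
       K̃≈0 = R.trans (R.sym (R.trans (ev-⊗ (C K₀) K̃ v) (R.trans (R.*-congʳ (R.trans (ev-C K₀ v) (R.trans (ρ-cong K₀≡1) ρ-1))) (R.*-identityˡ _)))) (R.trans (ev-cong v proportional) (R.trans (ev-⊗ (C K̃₀) K v) (R.trans (R.*-congˡ (R.trans (ev-K A v) zero')) (R.zeroʳ _))))

 -- Products of linear factors and fixed points of Frobenius.

 lin-root : ∀ a → E.ev (lin a) a ≡ 0#
 lin-root a = trans (E.ev-lin a a) (-‿inverseʳ a)

 cancel-X : ∀ f → X ⊗ f ≋ [] → f ≋ []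
 cancel-X f e = coeffwise λ i → trans (sym (at (X⊗ f) (suc i))) (at e (suc i))

 D-lin : ∀ a → D (lin a) ≋ C 1#
 D-lin a = P.trans (D-cong (lin≋ a)) (P.trans (D-⊕ X (⊝ C a)) (P.trans (P.+-cong D-X (P.trans (D-⊝ (C a)) (P.-‿cong (D-C a)))) (P.+-identityʳ (C 1#))))

 count : F → List F → ℕ
 count a [] = 0
 count a (x ∷ xs) with a ≟F x
 ... | yes _ = suc (count a xs)
 ... | no _ = count a xs

 remove : F → List F → List F
 remove a [] = []
 remove a (x ∷ xs) with a ≟F x
 ... | yes _ = remove a xs
 ... | no _ = x ∷ remove a xs

 count≤length : ∀ a as → count a as ℕ.≤ length as
 count≤length a [] = ℕ.z≤n
 count≤length a (x ∷ xs) with a ≟F x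
 ... | yes _ = ℕ.s≤s (count≤length a xs)
 ... | no _ = ℕₚ.m≤n⇒m≤1+n (count≤length a xs)

 Π-split : ∀ a as → Π as ≋ lin a ^P count a as ⊗ Π (remove a as)
 Π-split a [] = P.sym (P.*-identityˡ (C 1#))
 Π-split a (x ∷ xs) with a ≟F x
 ... | yes refl = P.trans (P.*-congˡ {lin a} (Π-split a xs)) (P.sym (P.*-assoc (lin a) (lin a ^P count a xs) (Π (remove a xs))))
 ... | no _ = P.trans (P.*-congˡ {lin x} (Π-split a xs)) (solveP 3 (λ x y z → x :* (y :* z) := y :* (x :* z)) P.refl (lin x) (lin a ^P count a xs) (Π (remove a xs)))

 Π-remove≢0 : ∀ a as → E.ev (Π (remove a as)) a ≢ 0#
 Π-remove≢0 a [] e = 1≢0 (trans (sym (E.ev-1 a)) e)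
 Π-remove≢0 a (x ∷ xs) with a ≟F x
 ... | yes _ = Π-remove≢0 a xs
 ... | no a≢x = λ e → x*y≢0 (λ e' → a≢x (x-y≡0⇒x≡y (trans (sym (E.ev-lin x a)) e'))) (Π-remove≢0 a xs) (trans (sym (E.ev-⊗ (lin x) (Π (remove a xs)) a)) e)

 count-∷ : ∀ a x xs → count a xs ℕ.≤ count a (x ∷ xs)
 count-∷ a x xs with a ≟F x
 ... | yes _ = ℕₚ.n≤1+n _
 ... | no _ = ≤-refl

 count-self : ∀ a xs → count a (a ∷ xs) ≡ suc (count a xs)
 count-self a xs with a ≟F a
 ... | yes _ = refl
 ... | no a≢a = ⊥-elim (a≢a refl)

 count≡0⇒All≢ : ∀ a xs → count a xs ≡ 0 → All (a ≢_) xs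
 count≡0⇒All≢ a [] _ = []
 count≡0⇒All≢ a (x ∷ xs) with a ≟F x
 ... | yes _ = λ ()
 ... | no a≢x = λ e → a≢x ∷ count≡0⇒All≢ a xs e

 count≤1⇒Unique : ∀ xs → (∀ a → count a xs ℕ.≤ 1) → Unique xs
 count≤1⇒Unique [] _ = []
 count≤1⇒Unique (x ∷ xs) c = count≡0⇒All≢ x xs (ℕₚ.n≤0⇒n≡0 (ℕₚ.≤-pred (subst (ℕ._≤ 1) (count-self x xs) (c x)))) ∷ count≤1⇒Unique xs (λ a → ≤-trans (count-∷ a x xs) (c a))

 count>0⇒All : ∀ {Q : F → Set} xs → (∀ a → 0 ℕ.< count a xs → Q a) → All Q xs
 count>0⇒All [] _ = []
 count>0⇒All (x ∷ xs) q = q x (subst (0 ℕ.<_) (sym (count-self x xs)) (ℕ.s≤s ℕ.z≤n)) ∷ count>0⇒All xs (λ a 0<c → q a (≤-trans 0<c (count-∷ a x xs)))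

 Π-extract : ∀ c as → E.ev (Π as) c ≡ 0# → ∃ λ as' → (Π as ≋ lin c ⊗ Π as') × length as ≡ suc (length as')
 Π-extract c [] e = ⊥-elim (1≢0 (trans (sym (E.ev-1 c)) e))
 Π-extract c (x ∷ xs) e = [ at-head , in-tail ]′ (x*y≡0 (trans (sym (E.ev-⊗ (lin x) (Π xs) c)) e))
   where
   at-head : E.ev (lin x) c ≡ 0# → _
   at-head e' = xs , P.*-congʳ {Π xs} (P.reflexive (cong lin (sym (x-y≡0⇒x≡y {c} {x} (trans (sym (E.ev-lin x c)) e'))))) , refl
   in-tail : E.ev (Π xs) c ≡ 0# → _
   in-tail e' = x ∷ proj₁ r , P.trans (P.*-congˡ {lin x} (proj₁ (proj₂ r))) (solveP 3 (λ x c y → x :* (c :* y) := c :* (x :* y)) P.refl (lin x) (lin c) (Π (proj₁ r))) , cong suc (proj₂ (proj₂ r))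
     where r = Π-extract c xs e'

 -- Repetitions in the list are allowed; their absence is proved from the differential equation.
 Splits : Pl → List F → Set
 Splits f as = ∃ λ k → (k ≢ 0#) × (f ≋ C k ⊗ Π as)

 Splits-cancel : ∀ c h as → Splits (lin c ⊗ h) as → ∃ λ as' → Splits h as' × length as ≡ suc (length as')
 Splits-cancel c h as (k , k≢0 , e) = proj₁ r , (k , k≢0 , cancel-lin-≋ c h (C k ⊗ Π (proj₁ r)) (P.trans e (P.trans (P.*-congˡ {C k} (proj₁ (proj₂ r))) (solveP 3 (λ k l y → k :* (l :* y) := l :* (k :* y)) P.refl (C k) (lin c) (Π (proj₁ r)))))) , proj₂ (proj₂ r)
   where
   zero-at-c : E.ev (Π as) c ≡ 0#
   zero-at-c = [ (λ e' → ⊥-elim (k≢0 (trans (sym (E.ev-C k c)) e'))) , (λ e' → e') ]′ (x*y≡0 (trans (sym (E.ev-⊗ (C k) (Π as) c)) (trans (sym (E.ev-cong c e)) (trans (E.ev-⊗ (lin c) h c) (trans (cong (_* E.ev h c) (lin-root c)) (zeroˡ _))))))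
   r = Π-extract c as zero-at-c

 -- By Fermat every entry of the list is a root of X^p - X, and the entries are distinct, so `Π as`
 -- divides X^p - X. Such a divisibility can be evaluated in every algebra.
 frobenius-fixed : ∀ (A : Algebra) {as} → Unique as → let open Algebra A in let open Evaluation A in let open CommutativeRing ring using (_≈_) renaming (0# to 0R) in
   ∀ x → ev (Π as) x ≈ 0R → x ^R p ≈ x
 frobenius-fixed A {as} uniq x e = R.trans (solveR 2 (λ a b → a := (a :- b) :+ b) R.refl (x ^R p) x) (R.trans (R.+-congʳ fixed) (R.+-identityˡ x))
   where
   open Algebra A
   open Evaluation A
   module R = CommutativeRing ring
   solveR = IntSolver.solve ring
   f = X ^P p ⊕ ⊝ X
   roots : ∀ as → All (Root f) as
   roots [] = []
   roots (a ∷ as) = trans (E.ev-⊕ (X ^P p) (⊝ X) a) (trans (cong₂ _+_ (trans (E.ev-^ X p a) (trans (cong (_^ p) (E.ev-X a)) (fermat a))) (trans (E.ev-⊝ X a) (cong (λ b → - b) (E.ev-X a)))) (-‿inverseʳ a)) ∷ roots as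
   h = factor-roots f uniq (roots as)
   fixed : x ^R p R.- x R.≈ R.0#
   fixed = R.trans (R.sym (R.trans (ev-⊕ (X ^P p) (⊝ X) x) (R.+-cong (R.trans (ev-^ X p x) (Exp.^-congˡ R.semiring p (ev-X x))) (R.trans (ev-⊝ X x) (R.-‿cong (ev-X x)))))) (R.trans (ev-cong x (proj₂ h)) (R.trans (ev-⊗ (Π as) (proj₁ h) x) (R.trans (R.*-congʳ e) (R.zeroˡ _))))

 -- Simplicity of the roots.

 -- The reversed truncated series f₀ = Σ eₙ X^(m-n) satisfies
 -- X(X - κ)f″ + ((1 - 2m)X - κ(1 - m - b))f′ + m²f = 0, which rules out multiple roots.
 record ReversedData : Set where
   field
     m : ℕ
     κ b : F
     e : ℕ → F
     e-0 : e 0 ≡ 1#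
     e-rec : ∀ n → n ℕ.< m → nat (suc n) * nat (suc n) * e (suc n) ≡ κ * ((nat n - nat m) * (nat n + b)) * e n
     m<p : m ℕ.< p
     κ≢0 : κ ≢ 0#
     -- The local exponents of the equation are 0 and m + b at X = 0, and 0 and m - b + 1 at X = κ.
     -- These two conditions exclude the second exponents as multiplicities between 1 and m; for
     -- `at-κ` the multiplicity is k + 1.
     at-0 : ∀ k → 0 ℕ.< k → k ℕ.≤ m → nat k ≢ nat m + b
     at-κ : ∀ k → k ℕ.< m → nat k ≢ nat m - b

 module Reversed (data₁ : ReversedData) where
   open ReversedData data₁

   f₀ : Pl
   f₀ = PL.Σ≤ m (λ n → C (e n) ⊗ X ^P (m ℕ.∸ n))

   private
     c₁ c₂ : F
     c₁ = 1# - nat 2 * nat m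
     c₂ = κ * (1# - nat m - b)

     Ω₀ : Pl → Pl → Pl → Pl
     Ω₀ f d dd = X ⊗ (X ⊕ ⊝ C κ) ⊗ dd ⊕ (C c₁ ⊗ X ⊕ ⊝ C c₂) ⊗ d ⊕ C (nat m * nat m) ⊗ f

     Ω : Pl → Pl
     Ω f = Ω₀ f (D f) (D (D f))

     Ω₀-cong : ∀ {f f' d d' dd dd'} → f ≋ f' → d ≋ d' → dd ≋ dd' → Ω₀ f d dd ≋ Ω₀ f' d' dd'
     Ω₀-cong x y z = P.+-cong (P.+-cong (P.*-congˡ {X ⊗ (X ⊕ ⊝ C κ)} z) (P.*-congˡ {C c₁ ⊗ X ⊕ ⊝ C c₂} y)) (P.*-congˡ {C (nat m * nat m)} x)

     Ω-⊕ : ∀ f h → Ω (f ⊕ h) ≋ Ω f ⊕ Ω h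
     Ω-⊕ f h = begin
       Ω (f ⊕ h) ≈⟨ Ω₀-cong (P.refl {f ⊕ h}) (D-⊕ f h) (P.trans (D-cong (D-⊕ f h)) (D-⊕ (D f) (D h))) ⟩
       Ω₀ (f ⊕ h) (D f ⊕ D h) (D (D f) ⊕ D (D h)) ≈⟨ solveP 9 (λ x y z f h d d' dd dd' → x :* (dd :+ dd') :+ y :* (d :+ d') :+ z :* (f :+ h) := (x :* dd :+ y :* d :+ z :* f) :+ (x :* dd' :+ y :* d' :+ z :* h)) P.refl (X ⊗ (X ⊕ ⊝ C κ)) (C c₁ ⊗ X ⊕ ⊝ C c₂) (C (nat m * nat m)) f h (D f) (D h) (D (D f)) (D (D h)) ⟩
       Ω f ⊕ Ω h ∎

     Ω-C⊗ : ∀ a f → Ω (C a ⊗ f) ≋ C a ⊗ Ω f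
     Ω-C⊗ a f = begin
       Ω (C a ⊗ f) ≈⟨ Ω₀-cong (P.refl {C a ⊗ f}) (D-C⊗ a f) (P.trans (D-cong (D-C⊗ a f)) (D-C⊗ a (D f))) ⟩
       Ω₀ (C a ⊗ f) (C a ⊗ D f) (C a ⊗ D (D f)) ≈⟨ solveP 7 (λ a x y z f d dd → x :* (a :* dd) :+ y :* (a :* d) :+ z :* (a :* f) := a :* (x :* dd :+ y :* d :+ z :* f)) P.refl (C a) (X ⊗ (X ⊕ ⊝ C κ)) (C c₁ ⊗ X ⊕ ⊝ C c₂) (C (nat m * nat m)) f (D f) (D (D f)) ⟩
       C a ⊗ Ω f ∎

     X²DD-X^ : ∀ k → X ⊗ (X ⊗ D (D (X ^P k))) ≋ PN.nat k ⊗ (PN.nat k ⊗ X ^P k) ⊕ ⊝ (PN.nat k ⊗ X ^P k)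
     X²DD-X^ k = begin
       X ⊗ (X ⊗ D (D Y)) ≈⟨ solveP 3 (λ x d dd → x :* (x :* dd) := x :* (# 1 :* d :+ x :* dd) :- x :* d) P.refl X (D Y) (D (D Y)) ⟩
       X ⊗ (C 1# ⊗ D Y ⊕ X ⊗ D (D Y)) ⊕ ⊝ θ Y ≈⟨ P.+-congʳ {⊝ θ Y} (P.*-congˡ {X} (P.trans (leibniz X (D Y)) (P.+-congʳ {X ⊗ D (D Y)} (P.*-congʳ {D Y} D-X)))) ⟨
       θ (θ Y) ⊕ ⊝ θ Y ≈⟨ P.+-cong (P.trans (θ-cong (θ-X^ k)) (P.trans (θ-nat⊗ k Y) (P.*-congˡ {PN.nat k} (θ-X^ k)))) (P.-‿cong (θ-X^ k)) ⟩
       PN.nat k ⊗ (PN.nat k ⊗ Y) ⊕ ⊝ (PN.nat k ⊗ Y) ∎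
       where Y = X ^P k

     -- `Ω` maps X^(m - n) to n²X^(m - n) plus a multiple of X^(m - n - 1). The factor X avoids the
     -- negative exponent that would occur for n = m.
     X⊗Ω-X^ : ∀ n → n ℕ.≤ m → X ⊗ Ω (X ^P (m ℕ.∸ n)) ≋ C (nat n * nat n) ⊗ (X ⊗ X ^P (m ℕ.∸ n)) ⊕ C (κ * ((nat m - nat n) * (nat n + b))) ⊗ X ^P (m ℕ.∸ n)
     X⊗Ω-X^ n n≤m = begin
       X ⊗ Ω Y
         ≈⟨ solveP 7 (λ x κ a c z d dd → x :* (x :* (x :- κ) :* dd :+ (a :* x :- c) :* d :+ z) := (x :- κ) :* (x :* (x :* dd)) :+ (a :* x :- c) :* (x :* d) :+ x :* z) P.refl X (C κ) (C c₁) (C c₂) (C (nat m * nat m) ⊗ Y) (D Y) (D (D Y)) ⟩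
       (X ⊕ ⊝ C κ) ⊗ (X ⊗ (X ⊗ D (D Y))) ⊕ (C c₁ ⊗ X ⊕ ⊝ C c₂) ⊗ θ Y ⊕ X ⊗ (C (nat m * nat m) ⊗ Y)
         ≈⟨ P.+-congʳ {X ⊗ (C (nat m * nat m) ⊗ Y)} (P.+-cong (P.*-congˡ {X ⊕ ⊝ C κ} (P.trans (X²DD-X^ k) (P.+-cong (P.*-cong k≋ (P.*-congʳ {Y} k≋)) (P.-‿cong (P.*-congʳ {Y} k≋))))) (P.*-congˡ {C c₁ ⊗ X ⊕ ⊝ C c₂} (P.trans (θ-X^ k) (P.*-congʳ {Y} k≋)))) ⟩
       (X ⊕ ⊝ C κ) ⊗ (C k' ⊗ (C k' ⊗ Y) ⊕ ⊝ (C k' ⊗ Y)) ⊕ (C c₁ ⊗ X ⊕ ⊝ C c₂) ⊗ (C k' ⊗ Y) ⊕ X ⊗ (C (nat m * nat m) ⊗ Y)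
         ≈⟨ solveP 7 (λ x κ k a c mm y → (x :- κ) :* (k :* (k :* y) :- k :* y) :+ (a :* x :- c) :* (k :* y) :+ x :* (mm :* y) := (k :* k :- k :+ a :* k :+ mm) :* (x :* y) :+ (:- (κ :* (k :* k :- k)) :- c :* k) :* y) P.refl X (C κ) (C k') (C c₁) (C c₂) (C (nat m * nat m)) Y ⟩
       (C k' ⊗ C k' ⊕ ⊝ C k' ⊕ C c₁ ⊗ C k' ⊕ C (nat m * nat m)) ⊗ (X ⊗ Y) ⊕ (⊝ (C κ ⊗ (C k' ⊗ C k' ⊕ ⊝ C k')) ⊕ ⊝ (C c₂ ⊗ C k')) ⊗ Y
         ≈⟨ P.+-cong (P.*-congʳ {X ⊗ Y} (P.trans (C-expr₁ k' c₁ (nat m * nat m)) (C-cong eq₁))) (P.*-congʳ {Y} (P.trans (C-expr₂ κ k' c₂) (C-cong eq₂))) ⟩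
       C (nat n * nat n) ⊗ (X ⊗ Y) ⊕ C (κ * ((nat m - nat n) * (nat n + b))) ⊗ Y ∎
       where
       k = m ℕ.∸ n
       Y = X ^P k
       k' = nat m - nat n
       k≋ : PN.nat k ≋ C k'
       k≋ = P.trans (P.sym (C-nat k)) (C-cong (trans (solve 2 (λ k n → k := (n :+ k) :- n) refl (nat k) (nat n)) (cong (_- nat n) (trans (sym (nat-+ n k)) (cong nat (m+[n∸m]≡n n≤m))))))
       C-- : ∀ x y → C x ⊕ ⊝ C y ≋ C (x - y)
       C-- x y = P.trans (P.+-congˡ {C x} (P.sym (C-neg y))) (P.sym (C-+ x (- y)))
       C-expr₁ : ∀ k a w → C k ⊗ C k ⊕ ⊝ C k ⊕ C a ⊗ C k ⊕ C w ≋ C (k * k - k + a * k + w)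
       C-expr₁ k a w = P.sym (P.trans (C-+ _ w) (P.+-congʳ {C w} (P.trans (C-+ _ (a * k)) (P.+-cong (P.trans (P.sym (C-- (k * k) k)) (P.+-congʳ {⊝ C k} (C-* k k))) (C-* a k)))))
       C-expr₂ : ∀ κ k c → ⊝ (C κ ⊗ (C k ⊗ C k ⊕ ⊝ C k)) ⊕ ⊝ (C c ⊗ C k) ≋ C (- (κ * (k * k - k)) - c * k)
       C-expr₂ κ k c = P.trans (P.+-cong (P.-‿cong (P.trans (P.*-congˡ {C κ} (P.trans (P.+-congʳ {⊝ C k} (P.sym (C-* k k))) (C-- (k * k) k))) (P.sym (C-* κ (k * k - k))))) (P.-‿cong (P.sym (C-* c k)))) (P.trans (P.+-congʳ {⊝ C (c * k)} (P.sym (C-neg (κ * (k * k - k))))) (C-- (- (κ * (k * k - k))) (c * k)))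
       eq₁ : k' * k' - k' + c₁ * k' + nat m * nat m ≡ nat n * nat n
       eq₁ = solve 2 (λ m n → let k = m :- n in k :* k :- k :+ (# 1 :- # 2 :* m) :* k :+ m :* m := n :* n) refl (nat m) (nat n)
       eq₂ : - (κ * (k' * k' - k')) - c₂ * k' ≡ κ * ((nat m - nat n) * (nat n + b))
       eq₂ = solve 4 (λ m n κ b → let k = m :- n in :- (κ :* (k :* k :- k)) :- κ :* (# 1 :- m :- b) :* k := κ :* (k :* (n :+ b))) refl (nat m) (nat n) κ b

     s : ℕ → F
     s n = κ * ((nat m - nat n) * (nat n + b))

     partial : ∀ k → k ℕ.≤ m → X ⊗ Ω (PL.Σ≤ k (λ n → C (e n) ⊗ X ^P (m ℕ.∸ n))) ≋ C (s k) ⊗ C (e k) ⊗ X ^P (m ℕ.∸ k)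
     partial zero _ = begin
       X ⊗ Ω (C (e 0) ⊗ Y) ≈⟨ P.*-congˡ {X} (Ω-C⊗ (e 0) Y) ⟩
       X ⊗ (C (e 0) ⊗ Ω Y) ≈⟨ solveP 3 (λ x c o → x :* (c :* o) := c :* (x :* o)) P.refl X (C (e 0)) (Ω Y) ⟩
       C (e 0) ⊗ (X ⊗ Ω Y) ≈⟨ P.*-congˡ {C (e 0)} (X⊗Ω-X^ 0 ℕ.z≤n) ⟩
       C (e 0) ⊗ (C (nat 0 * nat 0) ⊗ (X ⊗ Y) ⊕ C (s 0) ⊗ Y) ≈⟨ P.*-congˡ {C (e 0)} (P.+-congʳ {C (s 0) ⊗ Y} (P.*-congʳ {X ⊗ Y} (P.trans (C-cong (trans (cong (_* nat 0) nat-0) (zeroˡ _))) C-0))) ⟩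
       C (e 0) ⊗ ([] ⊗ (X ⊗ Y) ⊕ C (s 0) ⊗ Y) ≈⟨ solveP 4 (λ e x s y → e :* (# 0 :* x :+ s :* y) := s :* e :* y) P.refl (C (e 0)) (X ⊗ Y) (C (s 0)) Y ⟩
       C (s 0) ⊗ C (e 0) ⊗ Y ∎
       where Y = X ^P m
     partial (suc k) k<m = begin
       X ⊗ Ω (S ⊕ C (e (suc k)) ⊗ Y) ≈⟨ P.*-congˡ {X} (P.trans (Ω-⊕ S (C (e (suc k)) ⊗ Y)) (P.+-congˡ {Ω S} (Ω-C⊗ (e (suc k)) Y))) ⟩
       X ⊗ (Ω S ⊕ C (e (suc k)) ⊗ Ω Y) ≈⟨ solveP 4 (λ x a c o → x :* (a :+ c :* o) := x :* a :+ c :* (x :* o)) P.refl X (Ω S) (C (e (suc k))) (Ω Y) ⟩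
       X ⊗ Ω S ⊕ C (e (suc k)) ⊗ (X ⊗ Ω Y) ≈⟨ P.+-cong (partial k (<⇒≤ k<m)) (P.*-congˡ {C (e (suc k))} (X⊗Ω-X^ (suc k) k<m)) ⟩
       C (s k) ⊗ C (e k) ⊗ X ^P (m ℕ.∸ k) ⊕ C (e (suc k)) ⊗ (C (n * n) ⊗ (X ⊗ Y) ⊕ C (s (suc k)) ⊗ Y)
         ≈⟨ P.+-congʳ {C (e (suc k)) ⊗ (C (n * n) ⊗ (X ⊗ Y) ⊕ C (s (suc k)) ⊗ Y)} (P.*-cong rec (P.reflexive (cong (X ^P_) (ℕₚ.+-∸-assoc 1 k<m)))) ⟩
       ⊝ (C (n * n) ⊗ C (e (suc k))) ⊗ (X ⊗ Y) ⊕ C (e (suc k)) ⊗ (C (n * n) ⊗ (X ⊗ Y) ⊕ C (s (suc k)) ⊗ Y)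
         ≈⟨ solveP 5 (λ n e x s y → (:- (n :* e)) :* x :+ e :* (n :* x :+ s :* y) := s :* e :* y) P.refl (C (n * n)) (C (e (suc k))) (X ⊗ Y) (C (s (suc k))) Y ⟩
       C (s (suc k)) ⊗ C (e (suc k)) ⊗ Y ∎
       where
       S = PL.Σ≤ k (λ n → C (e n) ⊗ X ^P (m ℕ.∸ n))
       Y = X ^P (m ℕ.∸ suc k)
       n = nat (suc k)
       rec : C (s k) ⊗ C (e k) ≋ ⊝ (C (n * n) ⊗ C (e (suc k)))
       rec = P.trans (P.sym (C-* (s k) (e k))) (P.trans (C-cong (trans (solve 5 (λ κ m k b e → κ :* ((m :- k) :* (k :+ b)) :* e := :- (κ :* ((k :- m) :* (k :+ b)) :* e)) refl κ (nat m) (nat k) b (e k)) (cong (λ z → - z) (sym (e-rec k k<m))))) (P.trans (C-neg _) (P.-‿cong (C-* (n * n) (e (suc k))))))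

   private
     Ωf₀ : Ω f₀ ≋ []
     Ωf₀ = cancel-X (Ω f₀) (P.trans (partial m ≤-refl) (P.trans (P.*-congʳ {X ^P (m ℕ.∸ m)} (P.trans (P.*-congʳ {C (e m)} (P.trans (C-cong (solve 3 (λ κ m b → κ :* ((m :- m) :* (m :+ b)) := # 0) refl κ (nat m) b)) C-0)) (P.zeroˡ (C (e m))))) (P.zeroˡ (X ^P (m ℕ.∸ m)))))

   -- The multiplicity j + 1 of a root must be a local exponent of the equation at a. `G` is (X - a)
   -- `Ω f₀` divided by (X - a)^j. Its value at a is a(a - κ)j times a unit, which leaves j = 0 at
   -- ordinary points.
   simple-root : ∀ a j χ → f₀ ≋ lin a ^P suc j ⊗ χ → E.ev χ a ≢ 0# → suc j ℕ.≤ m → j ≡ 0 × a ≢ 0# × a ≢ κ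
   simple-root a j χ f₀≋ χa≢0 j<m = j≡0 , a≢0 , a≢κ
     where
     B χ₁ G : Pl
     B = lin a
     χ₁ = PN.nat (suc j) ⊗ χ ⊕ B ⊗ D χ
     G = X ⊗ (X ⊕ ⊝ C κ) ⊗ (PN.nat j ⊗ χ₁ ⊕ B ⊗ D χ₁) ⊕ B ⊗ ((C c₁ ⊗ X ⊕ ⊝ C c₂) ⊗ χ₁ ⊕ C (nat m * nat m) ⊗ (B ⊗ χ))
     Df : D f₀ ≋ B ^P j ⊗ χ₁
     Df = begin
       D f₀ ≈⟨ D-cong f₀≋ ⟩
       D (B ^P suc j ⊗ χ) ≈⟨ leibniz (B ^P suc j) χ ⟩
       D (B ^P suc j) ⊗ χ ⊕ B ^P suc j ⊗ D χ ≈⟨ P.+-congʳ {B ^P suc j ⊗ D χ} (P.*-congʳ {χ} (P.trans (D-^ B j) (P.*-congˡ {PN.nat (suc j)} (P.*-congˡ {B ^P j} (D-lin a))))) ⟩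
       PN.nat (suc j) ⊗ (B ^P j ⊗ C 1#) ⊗ χ ⊕ B ⊗ B ^P j ⊗ D χ ≈⟨ solveP 5 (λ n q x b d → n :* (q :* # 1) :* x :+ b :* q :* d := q :* (n :* x :+ b :* d)) P.refl (PN.nat (suc j)) (B ^P j) χ B (D χ) ⟩
       B ^P j ⊗ χ₁ ∎
     BDDf : B ⊗ D (D f₀) ≋ B ^P j ⊗ (PN.nat j ⊗ χ₁ ⊕ B ⊗ D χ₁)
     BDDf = begin
       B ⊗ D (D f₀) ≈⟨ P.*-congˡ {B} (P.trans (D-cong Df) (leibniz (B ^P j) χ₁)) ⟩
       B ⊗ (D (B ^P j) ⊗ χ₁ ⊕ B ^P j ⊗ D χ₁) ≈⟨ solveP 5 (λ b d x q e → b :* (d :* x :+ q :* e) := (b :* d) :* x :+ q :* (b :* e)) P.refl B (D (B ^P j)) χ₁ (B ^P j) (D χ₁) ⟩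
       B ⊗ D (B ^P j) ⊗ χ₁ ⊕ B ^P j ⊗ (B ⊗ D χ₁) ≈⟨ P.+-congʳ {B ^P j ⊗ (B ⊗ D χ₁)} (P.*-congʳ {χ₁} (P.trans (f⊗D-^ B j) (P.*-congˡ {PN.nat j} (P.*-congˡ {B ^P j} (D-lin a))))) ⟩
       PN.nat j ⊗ (B ^P j ⊗ C 1#) ⊗ χ₁ ⊕ B ^P j ⊗ (B ⊗ D χ₁) ≈⟨ solveP 4 (λ n q x d → n :* (q :* # 1) :* x :+ q :* d := q :* (n :* x :+ d)) P.refl (PN.nat j) (B ^P j) χ₁ (B ⊗ D χ₁) ⟩
       B ^P j ⊗ (PN.nat j ⊗ χ₁ ⊕ B ⊗ D χ₁) ∎
     G≋0 : G ≋ []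
     G≋0 = cancel-lin^ a j G (begin
       B ^P j ⊗ G
         ≈⟨ solveP 7 (λ q x y b l χ₁ z → q :* (x :* y :+ b :* (l :* χ₁ :+ z)) := x :* (q :* y) :+ b :* (l :* (q :* χ₁)) :+ b :* (q :* z)) P.refl (B ^P j) (X ⊗ (X ⊕ ⊝ C κ)) (PN.nat j ⊗ χ₁ ⊕ B ⊗ D χ₁) B (C c₁ ⊗ X ⊕ ⊝ C c₂) χ₁ (C (nat m * nat m) ⊗ (B ⊗ χ)) ⟩
       X ⊗ (X ⊕ ⊝ C κ) ⊗ (B ^P j ⊗ (PN.nat j ⊗ χ₁ ⊕ B ⊗ D χ₁)) ⊕ B ⊗ ((C c₁ ⊗ X ⊕ ⊝ C c₂) ⊗ (B ^P j ⊗ χ₁)) ⊕ B ⊗ (B ^P j ⊗ (C (nat m * nat m) ⊗ (B ⊗ χ)))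
         ≈⟨ P.+-cong (P.+-cong (P.*-congˡ {X ⊗ (X ⊕ ⊝ C κ)} BDDf) (P.*-congˡ {B} (P.*-congˡ {C c₁ ⊗ X ⊕ ⊝ C c₂} Df))) (P.*-congˡ {B} (P.trans (P.*-congˡ {C (nat m * nat m)} f₀≋) (solveP 4 (λ q w b χ → w :* ((b :* q) :* χ) := q :* (w :* (b :* χ))) P.refl (B ^P j) (C (nat m * nat m)) B χ))) ⟨
       X ⊗ (X ⊕ ⊝ C κ) ⊗ (B ⊗ D (D f₀)) ⊕ B ⊗ ((C c₁ ⊗ X ⊕ ⊝ C c₂) ⊗ D f₀) ⊕ B ⊗ (C (nat m * nat m) ⊗ f₀)
         ≈⟨ solveP 6 (λ b x dd l d z → x :* (b :* dd) :+ b :* (l :* d) :+ b :* z := b :* (x :* dd :+ l :* d :+ z)) P.refl B (X ⊗ (X ⊕ ⊝ C κ)) (D (D f₀)) (C c₁ ⊗ X ⊕ ⊝ C c₂) (D f₀) (C (nat m * nat m) ⊗ f₀) ⟩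
       B ⊗ Ω f₀ ≈⟨ P.*-congˡ {B} Ωf₀ ⟩
       B ⊗ [] ≈⟨ P.zeroʳ B ⟩
       [] ∎)
     ev-B : E.ev B a ≡ 0#
     ev-B = lin-root a
     ev-nat : ∀ n → E.ev (PN.nat n) a ≡ nat n
     ev-nat n = trans (E.ev-cong a (P.sym (C-nat n))) (E.ev-C (nat n) a)
     ev-B⊗ : ∀ f → E.ev (B ⊗ f) a ≡ 0#
     ev-B⊗ f = trans (E.ev-⊗ B f a) (trans (cong (_* E.ev f a) ev-B) (zeroˡ _))
     x₁ : F
     x₁ = E.ev χ₁ a
     j<p : j ℕ.< p
     j<p = <-trans j<m m<p
     x₁≢0 : x₁ ≢ 0#
     x₁≢0 x₁≡0 = x*y≢0 (nat≢0 (ℕ.s≤s ℕ.z≤n) (≤-<-trans j<m m<p)) χa≢0 (trans (sym (trans (E.ev-⊕ (PN.nat (suc j) ⊗ χ) (B ⊗ D χ) a) (trans (cong₂ _+_ (trans (E.ev-⊗ (PN.nat (suc j)) χ a) (cong (_* E.ev χ a) (ev-nat (suc j)))) (ev-B⊗ (D χ))) (+-identityʳ _)))) x₁≡0)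
     ev-inner : E.ev (PN.nat j ⊗ χ₁ ⊕ B ⊗ D χ₁) a ≡ nat j * x₁
     ev-inner = trans (E.ev-⊕ (PN.nat j ⊗ χ₁) (B ⊗ D χ₁) a) (trans (cong₂ _+_ (trans (E.ev-⊗ (PN.nat j) χ₁ a) (cong (_* x₁) (ev-nat j))) (ev-B⊗ (D χ₁))) (+-identityʳ _))
     ev-X-κ : E.ev (X ⊕ ⊝ C κ) a ≡ a - κ
     ev-X-κ = trans (E.ev-⊕ X (⊝ C κ) a) (cong₂ _+_ (E.ev-X a) (trans (E.ev-⊝ (C κ) a) (cong (λ z → - z) (E.ev-C κ a))))
     eq₁ : a * (a - κ) * (nat j * x₁) ≡ 0#
     eq₁ = trans (sym (trans (E.ev-⊕ (X ⊗ (X ⊕ ⊝ C κ) ⊗ (PN.nat j ⊗ χ₁ ⊕ B ⊗ D χ₁)) (B ⊗ ((C c₁ ⊗ X ⊕ ⊝ C c₂) ⊗ χ₁ ⊕ C (nat m * nat m) ⊗ (B ⊗ χ))) a) (trans (cong₂ _+_ (trans (E.ev-⊗ (X ⊗ (X ⊕ ⊝ C κ)) (PN.nat j ⊗ χ₁ ⊕ B ⊗ D χ₁) a) (cong₂ _*_ (trans (E.ev-⊗ X (X ⊕ ⊝ C κ) a) (cong₂ _*_ (E.ev-X a) ev-X-κ)) ev-inner)) (ev-B⊗ _)) (+-identityʳ _)))) (E.ev-cong a G≋0)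

     -- At a singular point X(X - κ) itself contains the factor X - a. After one more division the
     -- value at a is the indicial equation for the exponent j + 1.
     eq₂ : a * (a - κ) ≡ 0# → (nat 2 * a - κ) * nat j + c₁ * a - c₂ ≡ 0#
     eq₂ aκ≡0 = [ (λ z → z) , (λ z → ⊥-elim (x₁≢0 z)) ]′ (x*y≡0 {(nat 2 * a - κ) * nat j + c₁ * a - c₂} {x₁} (trans (sym evG₂) (E.ev-cong a (cancel-lin a G₂ (P.trans (P.sym G≋BG₂) G≋0)))))
       where
       G₂ = (X ⊕ C (a - κ)) ⊗ (PN.nat j ⊗ χ₁ ⊕ B ⊗ D χ₁) ⊕ ((C c₁ ⊗ X ⊕ ⊝ C c₂) ⊗ χ₁ ⊕ C (nat m * nat m) ⊗ (B ⊗ χ))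
       factorX : X ⊗ (X ⊕ ⊝ C κ) ≋ B ⊗ (X ⊕ C (a - κ))
       factorX = begin
         X ⊗ (X ⊕ ⊝ C κ) ≈⟨ solveP 3 (λ x k a → x :* (x :- k) := (x :- a) :* (x :+ (a :- k)) :+ a :* (a :- k)) P.refl X (C κ) (C a) ⟩
         (X ⊕ ⊝ C a) ⊗ (X ⊕ (C a ⊕ ⊝ C κ)) ⊕ C a ⊗ (C a ⊕ ⊝ C κ) ≈⟨ P.+-cong (P.*-cong (P.sym (lin≋ a)) (P.+-congˡ {X} a-κ)) (P.trans (P.*-congˡ {C a} a-κ) (P.trans (P.sym (C-* a (a - κ))) (P.trans (C-cong aκ≡0) C-0))) ⟩
         B ⊗ (X ⊕ C (a - κ)) ⊕ [] ≈⟨ P.+-identityʳ _ ⟩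
         B ⊗ (X ⊕ C (a - κ)) ∎
         where
         a-κ : C a ⊕ ⊝ C κ ≋ C (a - κ)
         a-κ = P.trans (P.+-congˡ {C a} (P.sym (C-neg κ))) (P.sym (C-+ a (- κ)))
       G≋BG₂ : G ≋ B ⊗ G₂
       G≋BG₂ = P.trans (P.+-congʳ {B ⊗ ((C c₁ ⊗ X ⊕ ⊝ C c₂) ⊗ χ₁ ⊕ C (nat m * nat m) ⊗ (B ⊗ χ))} (P.*-congʳ {PN.nat j ⊗ χ₁ ⊕ B ⊗ D χ₁} factorX)) (solveP 4 (λ b l y z → b :* l :* y :+ b :* z := b :* (l :* y :+ z)) P.refl B (X ⊕ C (a - κ)) (PN.nat j ⊗ χ₁ ⊕ B ⊗ D χ₁) ((C c₁ ⊗ X ⊕ ⊝ C c₂) ⊗ χ₁ ⊕ C (nat m * nat m) ⊗ (B ⊗ χ)))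
       evG₂ : E.ev G₂ a ≡ ((nat 2 * a - κ) * nat j + c₁ * a - c₂) * x₁
       evG₂ = trans (E.ev-⊕ ((X ⊕ C (a - κ)) ⊗ (PN.nat j ⊗ χ₁ ⊕ B ⊗ D χ₁)) ((C c₁ ⊗ X ⊕ ⊝ C c₂) ⊗ χ₁ ⊕ C (nat m * nat m) ⊗ (B ⊗ χ)) a) (trans (cong₂ _+_
           (trans (E.ev-⊗ (X ⊕ C (a - κ)) (PN.nat j ⊗ χ₁ ⊕ B ⊗ D χ₁) a) (cong₂ _*_ (trans (E.ev-⊕ X (C (a - κ)) a) (cong₂ _+_ (E.ev-X a) (E.ev-C (a - κ) a))) ev-inner))
           (trans (E.ev-⊕ ((C c₁ ⊗ X ⊕ ⊝ C c₂) ⊗ χ₁) (C (nat m * nat m) ⊗ (B ⊗ χ)) a) (cong₂ _+_ (trans (E.ev-⊗ (C c₁ ⊗ X ⊕ ⊝ C c₂) χ₁ a) (cong (_* x₁) (trans (E.ev-⊕ (C c₁ ⊗ X) (⊝ C c₂) a) (cong₂ _+_ (trans (E.ev-⊗ (C c₁) X a) (cong₂ _*_ (E.ev-C c₁ a) (E.ev-X a))) (trans (E.ev-⊝ (C c₂) a) (cong (λ z → - z) (E.ev-C c₂ a))))))) (trans (E.ev-⊗ (C (nat m * nat m)) (B ⊗ χ) a) (trans (cong (E.ev (C (nat m * nat m)) a *_) (ev-B⊗ χ)) (zeroʳ _))))))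
         (solve 6 (λ a κ j x c d → (a :+ (a :- κ)) :* (j :* x) :+ ((c :* a :- d) :* x :+ # 0) := ((# 2 :* a :- κ) :* j :+ c :* a :- d) :* x) refl a κ (nat j) x₁ c₁ c₂))

     a≢0 : a ≢ 0#
     a≢0 refl = at-0 (suc j) (ℕ.s≤s ℕ.z≤n) j<m (trans (nat-suc j) (x-y≡0⇒x≡y ([ (λ z → ⊥-elim (κ≢0 z)) , (λ z → z) ]′ (x*y≡0 {κ} {1# + nat j - (nat m + b)} (trans (solve 4 (λ κ j m b → κ :* (# 1 :+ j :- (m :+ b)) := :- ((# 2 :* # 0 :- κ) :* j :+ (# 1 :- # 2 :* m) :* # 0 :- κ :* (# 1 :- m :- b))) refl κ (nat j) (nat m) b) (trans (cong (λ z → - z) (eq₂ (zeroˡ _))) (solve 0 (:- # 0 := # 0) refl)))))))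

     a≢κ : a ≢ κ
     a≢κ refl = at-κ j j<m (x-y≡0⇒x≡y ([ (λ z → ⊥-elim (κ≢0 z)) , (λ z → z) ]′ (x*y≡0 {κ} {nat j - (nat m - b)} (trans (solve 4 (λ κ j m b → κ :* (j :- (m :- b)) := (# 2 :* κ :- κ) :* j :+ (# 1 :- # 2 :* m) :* κ :- κ :* (# 1 :- m :- b)) refl κ (nat j) (nat m) b) (eq₂ (trans (cong (κ *_) (-‿inverseʳ κ)) (zeroʳ κ)))))))

     j≡0 : j ≡ 0
     j≡0 = nat-injective j<p (ℕ.>-nonZero⁻¹ p) (trans ([ (λ z → ⊥-elim ([ a≢0 , (λ z' → a≢κ (x-y≡0⇒x≡y z')) ]′ (x*y≡0 z))) , (λ z → [ (λ z' → z') , (λ z' → ⊥-elim (x₁≢0 z')) ]′ (x*y≡0 z)) ]′ (x*y≡0 eq₁)) (sym nat-0))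

   roots-distinct : ∀ as → length as ≡ m → Splits f₀ as → Unique as × All (λ a → a ≢ 0# × a ≢ κ) as
   roots-distinct as len (k , k≢0 , e') = count≤1⇒Unique as (λ a → one a (count a as) refl) , count>0⇒All as (λ a 0<c → nonzero a (count a as) refl 0<c)
     where
     analyse : ∀ a j → count a as ≡ suc j → j ≡ 0 × a ≢ 0# × a ≢ κ
     analyse a j c = simple-root a j (C k ⊗ Π (remove a as))
       (P.trans e' (P.trans (P.*-congˡ {C k} (P.trans (Π-split a as) (P.reflexive (cong (λ n → lin a ^P n ⊗ Π (remove a as)) c)))) (solveP 3 (λ k l y → k :* (l :* y) := l :* (k :* y)) P.refl (C k) (lin a ^P suc j) (Π (remove a as)))))
       (λ z → x*y≢0 k≢0 (Π-remove≢0 a as) (trans (sym (trans (E.ev-⊗ (C k) (Π (remove a as)) a) (cong (_* E.ev (Π (remove a as)) a) (E.ev-C k a)))) z))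
       (subst (ℕ._≤ m) c (subst (count a as ℕ.≤_) len (count≤length a as)))
     one : ∀ a n → count a as ≡ n → n ℕ.≤ 1
     one a zero _ = ℕ.z≤n
     one a (suc j) c = ℕ.s≤s (≤-reflexive (proj₁ (analyse a j c)))
     nonzero : ∀ a n → count a as ≡ n → 0 ℕ.< n → a ≢ 0# × a ≢ κ
     nonzero a (suc j) c _ = proj₂ (analyse a j c)

 -- Squares in the prime field and Frobenius on quadratic extensions.

 trunc : ℕ → Pl → Pl
 trunc zero f = []
 trunc (suc k) [] = []
 trunc (suc k) (a ∷ f) = a ∷ trunc k f

 length-trunc : ∀ k f → length (trunc k f) ℕ.≤ k
 length-trunc zero f = ℕ.z≤n
 length-trunc (suc k) [] = ℕ.z≤n
 length-trunc (suc k) (a ∷ f) = ℕ.s≤s (length-trunc k f)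

 trunc≋ : ∀ k f → Below k f → f ≋ trunc k f
 trunc≋ zero f b = coeffwise λ i → b i ℕ.z≤n
 trunc≋ (suc k) [] b = P.refl
 trunc≋ (suc k) (a ∷ f) b = coeffwise λ { zero → refl ; (suc i) → at (trunc≋ k f (λ i le → b (suc i) (ℕ.s≤s le))) i }

 Below-too-many-roots : ∀ {as} k f → Below k f → Unique as → All (Root f) as → k ℕ.≤ length as → f ≋ []
 Below-too-many-roots {as} k f b uniq roots k≤ = P.trans (trunc≋ k f b) (too-many-roots (trunc k f) uniq (All.map (λ {a} r → trans (sym (E.ev-cong a (trunc≋ k f b))) r) roots) (≤-trans (length-trunc k f) k≤))

 -1^ : ∀ k → (- 1#) ^ (k ℕ.+ k) ≡ 1#
 -1^ k = trans (^-homo-* (- 1#) k k) (trans (sym (^-distrib-* (- 1#) (- 1#) k)) (trans (cong (_^ k) (solve 0 ((:- # 1) :* (:- # 1) := # 1) refl)) (1^n≈1 k)))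

 module OddPrime (n : ℕ) (p≡ : p ≡ suc (n ℕ.+ n)) where
   0<n : 0 ℕ.< n
   0<n = ℕₚ.n≢0⇒n>0 λ { refl → ¬prime[1] (subst Prime p≡ pp) }

   n<p : n ℕ.< p
   n<p = subst (n ℕ.<_) (sym p≡) (ℕ.s≤s (m≤m+n n n))

   2≢0 : nat 2 ≢ 0#
   2≢0 = nat≢0 (ℕ.s≤s ℕ.z≤n) (subst (2 ℕ.<_) (sym p≡) (ℕ.s≤s (+-mono-≤ 0<n 0<n)))

   4≢0 : nat 4 ≢ 0#
   4≢0 e = x^n≢0 2≢0 2 (trans (solve 0 (# 2 :^ 2 := # 4) refl) e)

   p-1 : p ℕ.∸ 1 ≡ n ℕ.+ n
   p-1 = cong (ℕ._∸ 1) p≡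

   2n≡-1 : nat 2 * nat n ≡ - 1#
   2n≡-1 = trans (solve 1 (λ n → # 2 :* n := (# 1 :+ (n :+ n)) :- # 1) refl (nat n)) (trans (cong (_- 1#) (trans (cong (1# +_) (sym (nat-+ n n))) (trans (sym (nat-suc (n ℕ.+ n))) (trans (cong nat (sym p≡)) nat-p)))) (+-identityˡ _))

   -1≢1 : - 1# ≢ 1#
   -1≢1 e = 2≢0 (trans (solve 0 (# 2 := # 1 :- (:- # 1)) refl) (trans (cong (λ z → 1# - z) e) (-‿inverseʳ 1#)))

   square⇒^n : ∀ {s} → s ≢ 0# → (s * s) ^ n ≡ 1#
   square⇒^n {s} s≢0 = trans (^-distrib-* s s n) (trans (sym (^-homo-* s n n)) (trans (cong (s ^_) (sym (cong (ℕ._∸ 1) p≡))) (fermat′ s≢0)))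

   private
     squares : ℕ → List F
     squares zero = []
     squares (suc k) = nat (suc k) * nat (suc k) ∷ squares k

     length-squares : ∀ k → length (squares k) ≡ k
     length-squares zero = refl
     length-squares (suc k) = cong suc (length-squares k)

     k²≢l² : ∀ {k l} → l ℕ.< k → k ℕ.≤ n → nat k * nat k ≢ nat l * nat l
     k²≢l² {k} {l} l<k k≤n e = [ (λ z → <⇒≢ l<k (sym (nat-injective (≤-<-trans k≤n n<p) (<-trans l<k (≤-<-trans k≤n n<p)) (x-y≡0⇒x≡y z)))) , (λ z → nat≢0 (<-≤-trans (≤-<-trans ℕ.z≤n l<k) (m≤m+n k l)) (subst (k ℕ.+ l ℕ.<_) (sym p≡) (ℕ.s≤s (+-mono-≤ k≤n (<⇒≤ (<-≤-trans l<k k≤n))))) (trans (nat-+ k l) z)) ]′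
       (x*y≡0 {nat k - nat l} {nat k + nat l} (trans (solve 2 (λ k l → (k :- l) :* (k :+ l) := k :* k :- l :* l) refl (nat k) (nat l)) (trans (cong (_- nat l * nat l) e) (-‿inverseʳ _))))

     squares-distinct : ∀ k l → l ℕ.< k → k ℕ.≤ n → All (nat k * nat k ≢_) (squares l)
     squares-distinct k zero _ _ = []
     squares-distinct k (suc l) l<k k≤n = k²≢l² l<k k≤n ∷ squares-distinct k l (<-trans ≤-refl l<k) k≤n

     squares-unique : ∀ k → k ℕ.≤ n → Unique (squares k)
     squares-unique zero _ = []
     squares-unique (suc k) k<n = squares-distinct (suc k) k ≤-refl k<n ∷ squares-unique k (<⇒≤ k<n)

     f : Pl
     f = X ^P n ⊕ ⊝ C 1#

     ev-f : ∀ a → E.ev f a ≡ a ^ n - 1#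
     ev-f a = trans (E.ev-⊕ (X ^P n) (⊝ C 1#) a) (cong₂ _+_ (trans (E.ev-^ X n a) (cong (_^ n) (E.ev-X a))) (trans (E.ev-⊝ (C 1#) a) (cong (λ z → - z) (E.ev-1 a))))

     root : ∀ {a} → a ^ n ≡ 1# → Root f a
     root {a} e = trans (ev-f a) (trans (cong (_- 1#) e) (-‿inverseʳ 1#))

     squares-roots : ∀ k → k ℕ.≤ n → All (Root f) (squares k)
     squares-roots zero _ = []
     squares-roots (suc k) k<n = root (square⇒^n (nat≢0 (ℕ.s≤s ℕ.z≤n) (≤-<-trans k<n n<p))) ∷ squares-roots k (<⇒≤ k<n)

     f-below : Below (suc n) f
     f-below = Below-⊕ (X ^P n) (⊝ C 1#) (λ i le → Below-^ X Below-X n i (≤-trans (ℕ.s≤s (≤-reflexive (ℕₚ.*-identityʳ n))) le)) (λ i le → trans (cf-⊝ (C 1#) i) (trans (cong (λ z → - z) (Below-C 1# i (≤-trans (ℕ.s≤s ℕ.z≤n) le))) (solve 0 (:- # 0 := # 0) refl)))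

     All≢-squares : ∀ t → (∀ s → s * s ≢ t) → ∀ k → All (t ≢_) (squares k)
     All≢-squares t ns zero = []
     All≢-squares t ns (suc k) = (λ e → ns (nat (suc k)) (sym e)) ∷ All≢-squares t ns k

   -- The polynomial X^n - 1 already has the n distinct roots 1², ..., n²; a non-square t would be
   -- one root too many.
   euler : ∀ t → t ^ n ≡ 1# → ∃ λ s → s * s ≡ t
   euler t e with Finₚ.any? (λ s → s * s ≟F t)
   ... | yes found = found
   ... | no none = ⊥-elim (1≢0 (trans (solve 0 (# 1 := :- (# 0 :- # 1)) refl) (trans (cong (λ z → - z) (sym at-zero)) (trans (cong (λ z → - z) (E.ev-cong 0# f≋0)) (solve 0 (:- # 0 := # 0) refl)))))
     where
     f≋0 : f ≋ []
     f≋0 = Below-too-many-roots {t ∷ squares n} (suc n) f f-below (All≢-squares t (λ s e' → none (s , e')) n ∷ squares-unique n ≤-refl) (root e ∷ squares-roots n ≤-refl) (ℕ.s≤s (≤-reflexive (sym (length-squares n))))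
     at-zero : E.ev f 0# ≡ 0# - 1#
     at-zero = trans (ev-f 0#) (cong (_- 1#) (0^ 0<n))

   nonsquare : ∀ t → t ^ n ≡ - 1# → ∀ s → s * s ≢ t
   nonsquare t e s refl with s ≟F 0#
   ... | yes refl = x^n≢0 -1≢0 1 (trans (*-identityʳ _) (trans (sym e) (trans (cong (_^ n) (zeroˡ 0#)) (0^ 0<n))))
     where
     -1≢0 : - 1# ≢ 0#
     -1≢0 z = 1≢0 (trans (solve 0 (# 1 := :- (:- # 1)) refl) (trans (cong (λ y → - y) z) (solve 0 (:- # 0 := # 0) refl)))
   ... | no s≢0 = -1≢1 (trans (sym e) (square⇒^n s≢0))

   module QuadraticFrobenius (A : Algebra) (d : CommutativeRing.Carrier (Algebra.ring A)) where
     private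
       module R = CommutativeRing (Algebra.ring A)
       module EA = Evaluation A
     Q : Algebra
     Q = quadAlgebra A d
     private
       module S = CommutativeRing (Algebra.ring Q)
       module EQ = Evaluation Q
       solveR = IntSolver.solve (Algebra.ring A)
       solveS = IntSolver.solve (Algebra.ring Q)

     open Quadratic (Algebra.ring A) d public using (emb; v; emb-+; emb-*; emb-neg; v*v; pair; emb-pair)

     emb-cong : ∀ {a b} → a R.≈ b → emb a S.≈ emb b
     emb-cong e = e , R.refl

     emb-nat : ∀ k → emb (EA.N.nat k) S.≈ EQ.N.nat k
     emb-nat k = S.trans (emb-cong (R.sym (EA.ρ-nat k))) (EQ.ρ-nat k)

     emb-^ : ∀ a k → emb (a EA.^R k) S.≈ emb a EQ.^R k
     emb-^ a zero = S.refl
     emb-^ a (suc k) = S.trans (emb-* a _) (S.*-congˡ (emb-^ a k))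

     v^p : v EQ.^R p S.≈ emb (d EA.^R n) S.* v
     v^p = S.trans (S.reflexive (cong (v EQ.^R_) p≡)) (S.trans (S.*-congˡ (Exp.^-homo-* S.semiring v n n)) (S.trans (S.*-congˡ (S.sym (EQ.L.^-distrib-* v v n))) (S.trans (S.*-congˡ (S.trans (Exp.^-congˡ S.semiring n v*v) (S.sym (emb-^ d n)))) (S.*-comm v _))))

     -- From p = 2n + 1 and v² = d follows v^p = d^n v. The second coordinate of a Frobenius-fixed
     -- element thus yields d^n without a decision whether d is a square.
     frobenius₂ : ∀ a b → (a , b) EQ.^R p S.≈ (a EA.^R p , b EA.^R p R.* d EA.^R n)
     frobenius₂ a b = S.trans (Exp.^-congˡ S.semiring p (pair a b)) (S.trans (EQ.frobenius (emb a) (emb b S.* v)) (S.trans (S.+-cong (S.sym (emb-^ a p)) (S.trans (EQ.L.^-distrib-* (emb b) v p) (S.trans (S.*-cong (S.sym (emb-^ b p)) v^p) (S.trans (S.sym (S.*-assoc _ _ v)) (S.*-congʳ (S.sym (emb-* _ _))))))) (S.sym (pair _ _))))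

   open QuadraticFrobenius using (frobenius₂)

   -- In 𝔽[i] the identity (1 + i)^p = 1 + i^p becomes (2i)^n (1 + i) = 1 + (-1)^n i.
   private
     module I = QuadraticFrobenius self (- 1#)
     module SI = CommutativeRing (Algebra.ring I.Q)
     module EI = Evaluation I.Q
     solveI = IntSolver.solve (Algebra.ring I.Q)

     [1+i]^p : (1# , 1#) EI.^R p SI.≈ (1# , (- 1#) ^ n)
     [1+i]^p = SI.trans (I.frobenius₂ 1# 1#) (1^n≈1 p , trans (cong (_* (- 1#) ^ n) (1^n≈1 p)) (*-identityˡ _))

     [1+i]^2 : (1# , 1#) SI.* (1# , 1#) SI.≈ I.emb (nat 2) SI.* I.v
     [1+i]^2 = SI.trans (Quadratic.⊠-components 𝔽 (- 1#) 1# 1# 1# 1#) (SI.trans components (SI.sym (I.emb-pair (nat 2) 0# 1#)))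
       where
       components : (1# * 1# + - 1# * (1# * 1#) , 1# * 1# + 1# * 1#) SI.≈ (nat 2 * 0# , nat 2 * 1#)
       components = solve 0 (# 1 :* # 1 :+ (:- # 1) :* (# 1 :* # 1) := # 2 :* # 0) refl , solve 0 (# 1 :* # 1 :+ # 1 :* # 1 := # 2 :* # 1) refl

     [1+i]^p' : (1# , 1#) EI.^R p SI.≈ (1# , 1#) SI.* (I.emb (nat 2 ^ n) SI.* I.v EI.^R n)
     [1+i]^p' = SI.trans (SI.reflexive (cong ((1# , 1#) EI.^R_) p≡)) (SI.*-congˡ (SI.trans (Exp.^-homo-* SI.semiring (1# , 1#) n n) (SI.trans (SI.sym (EI.L.^-distrib-* (1# , 1#) (1# , 1#) n)) (SI.trans (Exp.^-congˡ SI.semiring n [1+i]^2) (SI.trans (EI.L.^-distrib-* (I.emb (nat 2)) I.v n) (SI.*-congʳ (SI.sym (I.emb-^ (nat 2) n))))))))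

     i^2j : ∀ j → I.v EI.^R (j ℕ.+ j) SI.≈ I.emb ((- 1#) ^ j)
     i^2j j = SI.trans (Exp.^-homo-* SI.semiring I.v j j) (SI.trans (SI.sym (EI.L.^-distrib-* I.v I.v j)) (SI.trans (Exp.^-congˡ SI.semiring j I.v*v) (SI.sym (I.emb-^ (- 1#) j))))

   -- For n = 2j one has i^n = (-1)^j, so the first coordinates of the identity for (1 + i)^p give
   -- 2^n (-1)^j = 1.
   [-2]^n-even : ∀ j → n ≡ j ℕ.+ j → (- nat 2) ^ n ≡ (- 1#) ^ j
   [-2]^n-even j n≡ = trans (cong (_^ n) (solve 0 (:- # 2 := (:- # 1) :* # 2) refl)) (trans (^-distrib-* (- 1#) (nat 2) n) (trans (cong (_* nat 2 ^ n) (trans (cong ((- 1#) ^_) n≡) (-1^ j))) (trans (*-identityˡ _) (trans (solve 1 (λ t → t := t :* (# 1 :* # 1)) refl (nat 2 ^ n)) (trans (cong (λ y → nat 2 ^ n * y) (trans (*-identityˡ 1#) (sym (trans (sym (^-homo-* (- 1#) j j)) (-1^ j))))) (trans (solve 2 (λ t s → t :* (s :* s) := s :* (t :* s)) refl (nat 2 ^ n) ((- 1#) ^ j)) (trans (cong ((- 1#) ^ j *_) key) (*-identityʳ _))))))))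
     where
     x : F
     x = nat 2 ^ n * (- 1#) ^ j
     value : (1# , (- 1#) ^ n) SI.≈ (1# * x + - 1# * (1# * 0#) , 1# * 0# + 1# * x)
     value = SI.trans (SI.sym [1+i]^p) (SI.trans [1+i]^p' (SI.trans (SI.*-congˡ {1# , 1#} (SI.trans (SI.*-congˡ {I.emb (nat 2 ^ n)} (SI.trans (SI.reflexive (cong (I.v EI.^R_) n≡)) (i^2j j))) (SI.sym (I.emb-* (nat 2 ^ n) ((- 1#) ^ j))))) (Quadratic.⊠-components 𝔽 (- 1#) 1# 1# x 0#)))
     key : nat 2 ^ n * (- 1#) ^ j ≡ 1#
     key = trans (solve 1 (λ x → x := # 1 :* x :+ (:- # 1) :* (# 1 :* # 0)) refl x) (sym (proj₁ value))

   -- For n = 2j + 1 one has i^n = (-1)^j i and (1 + i)i = -1 + i, so the first coordinates now give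
   -- 2^n (-1)^j = -1.
   [-2]^n-odd : ∀ j → n ≡ suc (j ℕ.+ j) → (- nat 2) ^ n ≡ (- 1#) ^ j
   [-2]^n-odd j n≡ = trans (cong (_^ n) (solve 0 (:- # 2 := (:- # 1) :* # 2) refl)) (trans (^-distrib-* (- 1#) (nat 2) n) (trans (cong (_* nat 2 ^ n) (trans (cong ((- 1#) ^_) n≡) (trans (cong (- 1# *_) (-1^ j)) (*-identityʳ _)))) (trans (solve 1 (λ t → (:- # 1) :* t := :- (t :* # 1)) refl (nat 2 ^ n)) (trans (cong (λ y → - (nat 2 ^ n * y)) (sym (trans (sym (^-homo-* (- 1#) j j)) (-1^ j)))) (trans (solve 2 (λ t s → :- (t :* (s :* s)) := s :* (:- (t :* s))) refl (nat 2 ^ n) ((- 1#) ^ j)) (trans (cong ((- 1#) ^ j *_) key) (*-identityʳ _)))))))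
     where
     x : F
     x = nat 2 ^ n * (- 1#) ^ j
     value : (1# , (- 1#) ^ n) SI.≈ (1# * (x * 0#) + - 1# * (1# * (x * 1#)) , 1# * (x * 1#) + 1# * (x * 0#))
     value = SI.trans (SI.sym [1+i]^p) (SI.trans [1+i]^p' (SI.trans (SI.*-congˡ {1# , 1#} (SI.trans (SI.*-congˡ {I.emb (nat 2 ^ n)} (SI.trans (SI.reflexive (cong (I.v EI.^R_) n≡)) (SI.*-congˡ {I.v} (i^2j j)))) (SI.trans (RingIdentities.a[bc]≈acb (Algebra.ring I.Q) (I.emb (nat 2 ^ n)) I.v (I.emb ((- 1#) ^ j))) (SI.trans (SI.*-congʳ {I.v} (SI.sym (I.emb-* (nat 2 ^ n) ((- 1#) ^ j)))) (I.emb-pair x 0# 1#))))) (Quadratic.⊠-components 𝔽 (- 1#) 1# 1# (x * 0#) (x * 1#))))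
     key : - (nat 2 ^ n * (- 1#) ^ j) ≡ 1#
     key = trans (solve 1 (λ x → :- x := # 1 :* (x :* # 0) :+ (:- # 1) :* (# 1 :* (x :* # 1))) refl x) (sym (proj₁ value))

   private
     module W = QuadraticFrobenius self (- nat 3)
     module SW = CommutativeRing (Algebra.ring W.Q)
     module EW = Evaluation W.Q
     solveW = IntSolver.solve (Algebra.ring W.Q)

   h : F
   h = inv (nat 2)

   2h : nat 2 * h ≡ 1#
   2h = *-inv 2≢0

   -- The cube root of unity (-1 + √-3)/2, with √-3 adjoined formally.
   ω : F × F
   ω = - h , h

   opaque
    unfolding Quadratic._⊞_
    ω² : ω SW.* ω SW.≈ (- h * - h + - nat 3 * (h * h) , - h * h + h * - h)
    ω² = refl , refl

    ω²+ω+1 : ω SW.* ω SW.+ ω SW.+ SW.1# SW.≈ SW.0#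
    ω²+ω+1 = trans (solve 1 (λ h → (:- h) :* (:- h) :+ (:- # 3) :* (h :* h) :+ (:- h) :+ # 1 := (# 1 :- # 2 :* h) :* (# 1 :+ h)) refl h) (trans (cong (λ z → (1# - z) * (1# + h)) 2h) (solve 1 (λ h → (# 1 :- # 1) :* (# 1 :+ h) := # 0) refl h))
          , trans (solve 1 (λ h → (:- h) :* h :+ h :* (:- h) :+ h :+ # 0 := (# 1 :- # 2 :* h) :* h) refl h) (trans (cong (λ z → (1# - z) * h) 2h) (solve 1 (λ h → (# 1 :- # 1) :* h := # 0) refl h))

   ω³ : ω EW.^R 3 SW.≈ SW.1#
   ω³ = SW.trans (solveW 1 (λ w → w :^ 3 := (w :- # 1) :* (w :* w :+ w :+ # 1) :+ # 1) SW.refl ω) (SW.trans (SW.+-congʳ (SW.trans (SW.*-congˡ {ω SW.- SW.1#} ω²+ω+1) (SW.zeroʳ (ω SW.- SW.1#)))) (SW.+-identityˡ SW.1#))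

   private
     ω³ᵏ : ∀ k → ω EW.^R (k ℕ.* 3) SW.≈ SW.1#
     ω³ᵏ k = SW.trans (SW.reflexive (cong (ω EW.^R_) (ℕₚ.*-comm k 3))) (SW.trans (SW.sym (Exp.^-assocʳ SW.semiring ω 3 k)) (SW.trans (Exp.^-congˡ SW.semiring k ω³) (EW.L.1^n≈1 k)))

     ωᵖ : ω EW.^R p SW.≈ (- h , h * (- nat 3) ^ n)
     ωᵖ = SW.trans (W.frobenius₂ (- h) h) (fermat (- h) , cong (_* (- nat 3) ^ n) (fermat h))

     cancel-h : ∀ {x y} → h * x ≡ h * y → x ≡ y
     cancel-h {x} {y} e = trans (scale x) (trans (cong (nat 2 *_) e) (sym (scale y)))
       where
       scale : ∀ x → x ≡ nat 2 * (h * x)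
       scale x = trans (sym (*-identityˡ x)) (trans (cong (_* x) (sym 2h)) (*-assoc (nat 2) h x))

   -- Frobenius multiplies the √-3-coordinate of ω by (-3)^n, while ω³ = 1 gives ω^p = ω for p ≡ 1
   -- mod 3. For p ≡ 2 mod 3 it gives ω^p = ω² = -1 - ω, whose √-3-coordinate is the negative.
   [-3]^n-1mod3 : ∀ k → p ≡ suc (k ℕ.* 3) → (- nat 3) ^ n ≡ 1#
   [-3]^n-1mod3 k p≡' = cancel-h (trans (proj₂ (SW.trans (SW.sym ωᵖ) (SW.trans (SW.reflexive (cong (ω EW.^R_) p≡')) (SW.trans (SW.*-congˡ {ω} (ω³ᵏ k)) (SW.*-identityʳ ω))))) (sym (*-identityʳ h)))

   [-3]^n-2mod3 : ∀ k → p ≡ suc (suc (k ℕ.* 3)) → (- nat 3) ^ n ≡ - 1#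
   [-3]^n-2mod3 k p≡' = cancel-h (trans (proj₂ (SW.trans (SW.sym ωᵖ) (SW.trans (SW.reflexive (cong (ω EW.^R_) p≡')) (SW.trans (SW.*-congˡ {ω} (SW.trans (SW.*-congˡ {ω} (ω³ᵏ k)) (SW.*-identityʳ ω))) ω²)))) (trans (solve 1 (λ h → (:- h) :* h :+ h :* (:- h) := (# 1 :- # 2 :* h) :* h :- h) refl h) (trans (cong (λ z → (1# - z) * h - h) 2h) (solve 1 (λ h → (# 1 :- # 1) :* h :- h := h :* (:- # 1)) refl h))))

 -- Frobenius on cubic extensions.

 module CubicFrobenius (A : Algebra) (d : CommutativeRing.Carrier (Algebra.ring A)) where
   private
     module R = CommutativeRing (Algebra.ring A)
     module EA = Evaluation A
   Q₃ : Algebra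
   Q₃ = cubicAlgebra A d
   private
     module S = CommutativeRing (Algebra.ring Q₃)
     module EQ = Evaluation Q₃
     solveR = IntSolver.solve (Algebra.ring A)
     ^S-congˡ = Exp.^-congˡ S.semiring
     ^S-homo-* = Exp.^-homo-* S.semiring
     ^S-assocʳ = Exp.^-assocʳ S.semiring

   open Cubic (Algebra.ring A) d public using (emb; v; emb-+; emb-*; emb-neg)
   open Cubic (Algebra.ring A) d using (v*v; v*vv; triple₀; first-+; first-v; first-vv₀)

   emb-cong : ∀ {a b} → a R.≈ b → emb a S.≈ emb b
   emb-cong e = e , R.refl , R.refl

   emb-nat : ∀ k → emb (EA.N.nat k) S.≈ EQ.N.nat k
   emb-nat k = S.trans (emb-cong (R.sym (EA.ρ-nat k))) (EQ.ρ-nat k)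

   emb-^ : ∀ a k → emb (a EA.^R k) S.≈ emb a EQ.^R k
   emb-^ a zero = S.refl
   emb-^ a (suc k) = S.trans (emb-* a _) (S.*-congˡ (emb-^ a k))

   v³ : v EQ.^R 3 S.≈ emb d
   v³ = S.trans (S.*-congˡ {v} (S.trans (S.*-congˡ {v} (S.*-identityʳ v)) v*v)) v*vv

   triple : ∀ a b c → (a , b , c) S.≈ emb a S.+ (emb b S.* v S.+ emb c S.* (v S.* v))
   triple a b c = S.trans (triple₀ a b c) (S.+-congˡ {emb a} (S.+-congˡ {emb b S.* v} (S.*-congˡ {emb c} (S.sym v*v))))

   private
     first : S.Carrier → R.Carrier
     first = proj₁

     v^3k : ∀ k → v EQ.^R (k ℕ.* 3) S.≈ emb (d EA.^R k)
     v^3k k = S.trans (S.reflexive (cong (v EQ.^R_) (ℕₚ.*-comm k 3))) (S.trans (S.sym (^S-assocʳ v 3 k)) (S.trans (^S-congˡ k v³) (S.sym (emb-^ d k))))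

     first-vv : ∀ a → first (emb a S.* (v S.* v)) R.≈ R.0#
     first-vv a = R.trans (proj₁ (S.*-congˡ {emb a} v*v)) (first-vv₀ a)

     PowerOfV : Set
     PowerOfV = (∃ λ x → v EQ.^R p S.≈ emb x S.* v) ⊎ (∃ λ x → v EQ.^R p S.≈ emb x S.* (v S.* v))

     frob : ∀ a b c → first ((a , b , c) EQ.^R p) R.≈ a EA.^R p R.+ (first (emb (b EA.^R p) S.* v EQ.^R p) R.+ first (emb (c EA.^R p) S.* (v EQ.^R p S.* v EQ.^R p)))
     frob a b c = R.trans (proj₁ power) (R.trans (first-+ _ _) (R.+-congˡ (first-+ _ _)))
       where
       power : (a , b , c) EQ.^R p S.≈ emb (a EA.^R p) S.+ (emb (b EA.^R p) S.* v EQ.^R p S.+ emb (c EA.^R p) S.* (v EQ.^R p S.* v EQ.^R p))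
       power = S.trans (^S-congˡ p (triple a b c)) (S.trans (EQ.frobenius (emb a) _) (S.+-cong (S.sym (emb-^ a p)) (S.trans (EQ.frobenius (emb b S.* v) (emb c S.* (v S.* v))) (S.+-cong (S.trans (EQ.L.^-distrib-* (emb b) v p) (S.*-congʳ (S.sym (emb-^ b p)))) (S.trans (EQ.L.^-distrib-* (emb c) (v S.* v) p) (S.*-cong (S.sym (emb-^ c p)) (EQ.L.^-distrib-* v v p)))))))

   private
     push₁ : ∀ b x {y} → y S.≈ emb x S.* v → emb b S.* y S.≈ emb (b R.* x) S.* v
     push₁ b x {y} e = S.trans (S.*-congˡ {emb b} e) (S.trans (S.sym (S.*-assoc (emb b) (emb x) v)) (S.*-congʳ {v} (S.sym (emb-* b x))))

     push₂ : ∀ b x {y} → y S.≈ emb x S.* (v S.* v) → emb b S.* y S.≈ emb (b R.* x) S.* (v S.* v)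
     push₂ b x {y} e = S.trans (S.*-congˡ {emb b} e) (S.trans (S.sym (S.*-assoc (emb b) (emb x) (v S.* v))) (S.*-congʳ {v S.* v} (S.sym (emb-* b x))))

     square₁ : ∀ x {y} → y S.≈ emb x S.* v → y S.* y S.≈ emb (x R.* x) S.* (v S.* v)
     square₁ x {y} e = S.trans (S.*-cong e e) (S.trans (RingIdentities.[xv]² (Algebra.ring Q₃) (emb x) v) (S.*-congʳ {v S.* v} (S.sym (emb-* x x))))

     square₂ : ∀ x {y} → y S.≈ emb x S.* (v S.* v) → y S.* y S.≈ emb (x R.* x R.* d) S.* v
     square₂ x {y} e = S.trans (S.*-cong e e) (S.trans (RingIdentities.[xv²]² (Algebra.ring Q₃) (emb x) v) (S.*-congʳ {v} (S.trans (S.*-congˡ {emb x S.* emb x} v³) (S.sym (S.trans (emb-* (x R.* x) d) (S.*-congʳ {emb d} (emb-* x x)))))))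

     first-cong : ∀ {x y} → x S.≈ y → first x R.≈ first y
     first-cong = proj₁

     drop : ∀ {a y z} → y R.≈ R.0# → z R.≈ R.0# → a R.+ (y R.+ z) R.≈ a
     drop ey ez = R.trans (R.+-congˡ (R.trans (R.+-cong ey ez) (R.+-identityˡ _))) (R.+-identityʳ _)

   -- If v^p is a scalar multiple of v, then v^(2p) is one of v²; if v^p is one of v², then v^(2p)
   -- is one of v. In both cases nothing but a^p contributes to the first coordinate.
   frobenius₃ : PowerOfV → ∀ a b c → first ((a , b , c) EQ.^R p) R.≈ a EA.^R p
   frobenius₃ (inj₁ (x , e)) a b c = R.trans (frob a b c) (drop (R.trans (first-cong (push₁ _ x e)) (first-v _)) (R.trans (first-cong (push₂ _ (x R.* x) (square₁ x e))) (first-vv _)))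
   frobenius₃ (inj₂ (x , e)) a b c = R.trans (frob a b c) (drop (R.trans (first-cong (push₂ _ x e)) (first-vv _)) (R.trans (first-cong (push₁ _ (x R.* x R.* d) (square₂ x e))) (first-v _)))

   v^p-1mod3 : ∀ k → p ≡ suc (k ℕ.* 3) → PowerOfV
   v^p-1mod3 k e = inj₁ (_ , S.trans (S.reflexive (cong (v EQ.^R_) e)) (S.trans (S.*-congˡ {v} (v^3k k)) (S.*-comm v _)))

   v^p-2mod3 : ∀ k → p ≡ suc (suc (k ℕ.* 3)) → PowerOfV
   v^p-2mod3 k e = inj₂ (_ , S.trans (S.reflexive (cong (v EQ.^R_) e)) (S.trans (S.*-congˡ {v} (S.*-congˡ {v} (v^3k k))) (RingIdentities.v[vd] (Algebra.ring Q₃) v (emb (d EA.^R k)))))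

 -- The family of polynomials and the consequences of splitting.

 record FamilyData : Set where
   field
     m ν ε : ℕ
     ν≤1 : ν ≡ 0 ⊎ ν ≡ 1
     ε≤1 : ε ≡ 0 ⊎ ε ≡ 1
     κ b g : F
     e : ℕ → F
     e-0 : e 0 ≡ 1#
     e-rec : ∀ n → n ℕ.< m → nat (suc n) * nat (suc n) * e (suc n) ≡ κ * ((nat n - nat m) * (nat n + b)) * e n
     b-m : nat 2 * (b - nat m) ≡ 1# + nat 2 * nat ν
     mb : - (nat 4 * (nat m * b)) ≡ g + nat 2 * nat ν
     m<p : m ℕ.< p
     κ≢0 : κ ≢ 0#
     at-0 : ∀ k → 0 ℕ.< k → k ℕ.≤ m → nat k ≢ nat m + b
     at-κ : ∀ k → k ℕ.< m → nat k ≢ nat m - b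

 module Family (data₂ : FamilyData) where
   open FamilyData data₂

   reversedData : ReversedData
   reversedData = record { m = m ; κ = κ ; b = b ; e = e ; e-0 = e-0 ; e-rec = e-rec ; m<p = m<p ; κ≢0 = κ≢0 ; at-0 = at-0 ; at-κ = at-κ }

   c : ℕ → F
   c n = e n * inv κ ^ n

   private
     κ*inv : κ * inv κ ≡ 1#
     κ*inv = *-inv κ≢0

     κ^inv^ : ∀ n → κ ^ n * inv κ ^ n ≡ 1#
     κ^inv^ n = trans (sym (^-distrib-* κ (inv κ) n)) (trans (cong (_^ n) κ*inv) (1^n≈1 n))

   e≡cκ^ : ∀ n → e n ≡ c n * κ ^ n
   e≡cκ^ n = sym (trans (solve 3 (λ e i k → e :* i :* k := e :* (k :* i)) refl (e n) (inv κ ^ n) (κ ^ n)) (trans (cong (e n *_) (κ^inv^ n)) (*-identityʳ _)))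

   gaussData : GaussData
   gaussData = record
     { m = m ; ν = ν ; ν≤1 = ν≤1 ; b = b ; g = g ; c = c ; b-m = b-m ; mb = mb
     ; c-0 = trans (*-identityʳ _) e-0
     ; c-rec = λ n n<m → trans (solve 4 (λ k e i j → k :* k :* (e :* (i :* j)) := (k :* k :* e) :* (i :* j)) refl (nat (suc n)) (e (suc n)) (inv κ) (inv κ ^ n)) (trans (cong (_* (inv κ * inv κ ^ n)) (e-rec n n<m)) (trans (solve 5 (λ κ q e i j → κ :* q :* e :* (i :* j) := (κ :* i) :* (q :* (e :* j))) refl κ ((nat n - nat m) * (nat n + b)) (e n) (inv κ) (inv κ ^ n)) (trans (cong (_* ((nat n - nat m) * (nat n + b) * c n)) κ*inv) (*-identityˡ _))))
     }

   open Gauss gaussData public using (ψ; d; d-rec; d-0; ψ-below)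
   open Reversed reversedData public using (f₀; roots-distinct)

   f : Pl
   f = lin κ ^P ν ⊗ (X ^P ε ⊗ f₀)

   module _ (A : Algebra) where
     open Algebra A
     open Evaluation A
     open Gauss.ψ-Evaluation gaussData A
     private
       module R = CommutativeRing ring
       solveR = IntSolver.solve ring
       ^R-congˡ = Exp.^-congˡ R.semiring
       ^R-homo-* = Exp.^-homo-* R.semiring

     ev-f : ∀ x → ev f x R.≈ (x R.- ρ κ) ^R ν R.* (x ^R ε R.* ev f₀ x)
     ev-f x = R.trans (ev-⊗ (lin κ ^P ν) (X ^P ε ⊗ f₀) x) (R.*-cong (R.trans (ev-^ (lin κ) ν x) (^R-congˡ ν (ev-lin κ x))) (R.trans (ev-⊗ (X ^P ε) f₀ x) (R.*-congʳ (R.trans (ev-^ X ε x) (^R-congˡ ε (ev-X x))))))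

     ev-f₀ : ∀ z y → z R.* y R.≈ R.1# → ev f₀ (ρ κ R.* y) R.≈ (ρ κ R.* y) ^R m R.* φ z
     ev-f₀ z y zy = R.trans (ev-Σ m (λ n → C (e n) ⊗ X ^P (m ℕ.∸ n)) x) (R.trans (L.Σ≤-cong m term-eq) (R.sym (L.*-distribˡ-Σ≤ m (x ^R m) _)))
       where
       x : R.Carrier
       x = ρ κ R.* y
       zy^ : ∀ n → z ^R n R.* y ^R n R.≈ R.1#
       zy^ n = R.trans (R.sym (L.^-distrib-* z y n)) (R.trans (^R-congˡ n zy) (L.1^n≈1 n))
       term-eq : ∀ n → n ℕ.≤ m → ev (C (e n) ⊗ X ^P (m ℕ.∸ n)) x R.≈ x ^R m R.* (ρ (c n) R.* z ^R n)
       term-eq n n≤m = R.trans (ev-⊗ (C (e n)) (X ^P (m ℕ.∸ n)) x) (R.trans (R.*-cong (R.trans (ev-C (e n) x) (R.trans (ρ-cong (e≡cκ^ n)) (R.trans (ρ-* (c n) (κ ^ n)) (R.*-congˡ (ρ-^ κ n))))) (R.trans (ev-^ X (m ℕ.∸ n) x) (^R-congˡ (m ℕ.∸ n) (ev-X x)))) (R.sym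
         (R.trans (R.*-congʳ (R.trans (R.reflexive (cong (x ^R_) (sym (m+[n∸m]≡n n≤m)))) (R.trans (^R-homo-* x n (m ℕ.∸ n)) (R.*-congʳ (L.^-distrib-* (ρ κ) y n)))))
         (R.trans (solveR 5 (λ k y x c z → k :* y :* x :* (c :* z) := (z :* y) :* (c :* k :* x)) R.refl (ρ κ ^R n) (y ^R n) (x ^R (m ℕ.∸ n)) (ρ (c n)) (z ^R n))
         (R.trans (R.*-congʳ (zy^ n)) (R.*-identityˡ _))))))

     -- The root is X = κ/z with z = 4u(1 - u). For ν = 1 the zero may come from the factor 1 - 2u
     -- of ψ; then X - κ = κy(1 - z) = κy(1 - 2u)² vanishes as well.
     ψ-zero⇒f-zero : ∀ u y → N.nat 4 R.* (u R.* (R.1# R.- u)) R.* y R.≈ R.1# → ev ψ u R.≈ R.0# → ev f (ρ κ R.* y) R.≈ R.0#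
     ψ-zero⇒f-zero u y zy ψ0 = R.trans (ev-f x) (R.trans (R.*-congˡ (R.*-congˡ (ev-f₀ z y zy))) (cases ν≤1 (R.trans (R.sym (ev-ψ u)) ψ0)))
       where
       x z : R.Carrier
       x = ρ κ R.* y
       z = N.nat 4 R.* (u R.* (R.1# R.- u))
       q : R.Carrier
       q = x ^R ε R.* x ^R m
       cases : ∀ {ν} → ν ≡ 0 ⊎ ν ≡ 1 → (R.1# R.- N.nat 2 R.* u) ^R ν R.* φ z R.≈ R.0# → (x R.- ρ κ) ^R ν R.* (x ^R ε R.* (x ^R m R.* φ z)) R.≈ R.0#
       cases (inj₁ refl) h = R.trans (solveR 3 (λ a b c → # 1 :* (a :* (b :* c)) := a :* b :* (# 1 :* c)) R.refl (x ^R ε) (x ^R m) (φ z)) (R.trans (R.*-congˡ h) (R.zeroʳ _))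
       cases (inj₂ refl) h = R.trans (solveR 5 (λ x k a b c → ((x :- k) :* # 1) :* (a :* (b :* c)) := (x :- k :* # 1) :* (a :* b :* c)) R.refl x (ρ κ) (x ^R ε) (x ^R m) (φ z))
         (R.trans (R.*-congʳ (R.+-congˡ (R.-‿cong (R.*-congˡ (R.sym zy)))))
         (R.trans (solveR 5 (λ k y u q c → (k :* y :- k :* (# 4 :* (u :* (# 1 :- u)) :* y)) :* (q :* c) := (k :* y :* (# 1 :- # 2 :* u) :* q) :* (((# 1 :- # 2 :* u) :* # 1) :* c)) R.refl (ρ κ) y u q (φ z))
         (R.trans (R.*-congˡ h) (R.zeroʳ _))))

   root⇒φ : ∀ a → a ≢ 0# → E.ev f₀ a ≡ 0# → Gauss.ψ-Evaluation.φ gaussData self (κ * inv a) ≡ 0#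
   root⇒φ a a≢0 f₀a = [ (λ z → ⊥-elim (x^n≢0 (λ z' → x*y≢0 κ≢0 y≢0 z') m z)) , (λ z → z) ]′ (x*y≡0 (trans (sym (ev-f₀ self (κ * inv a) (a * inv κ) (trans (solve 4 (λ k i a j → k :* i :* (a :* j) := (a :* i) :* (k :* j)) refl κ (inv a) a (inv κ)) (trans (cong₂ _*_ (*-inv a≢0) κ*inv) (*-identityˡ 1#))))) (trans (cong (E.ev f₀) (trans (solve 3 (λ k a i → k :* (a :* i) := a :* (k :* i)) refl κ a (inv κ)) (trans (cong (a *_) κ*inv) (*-identityʳ a)))) f₀a)))
     where
     y≢0 : a * inv κ ≢ 0#
     y≢0 z = x*y≢0 a≢0 (λ z' → 1≢0 (trans (sym κ*inv) (trans (cong (κ *_) z') (zeroʳ κ)))) z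

   module SplitFamily (as : List F) (splits : Splits f as) (len : length as ≡ m ℕ.+ ε ℕ.+ ν) where
     private
       peel : ∀ c k {j} h → (k ≡ 0 ⊎ k ≡ 1) → ∀ as → length as ≡ j ℕ.+ k → Splits (lin c ^P k ⊗ h) as → ∃ λ as' → Splits h as' × length as' ≡ j
       peel c _ {j} h (inj₁ refl) as l (k , k≢0 , s) = as , (k , k≢0 , P.trans (P.sym (P.*-identityˡ h)) s) , trans l (ℕₚ.+-identityʳ j)
       peel c _ {j} h (inj₂ refl) as l (k , k≢0 , s) = proj₁ r , proj₁ (proj₂ r) , suc-injective (trans (sym (proj₂ (proj₂ r))) (trans l (ℕₚ.+-comm j 1)))
         where r = Splits-cancel c h as (k , k≢0 , P.trans (P.*-congʳ {h} (P.sym (P.*-identityʳ (lin c)))) s)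

       lin-0 : lin 0# ≋ X
       lin-0 = P.trans (lin≋ 0#) (P.trans (P.+-congˡ {X} (P.-‿cong C-0)) (P.+-identityʳ X))

       X^≋ : ∀ k → X ^P k ≋ lin 0# ^P k
       X^≋ zero = P.refl
       X^≋ (suc k) = P.*-cong (P.sym lin-0) (X^≋ k)

       first : ∃ λ as' → Splits (X ^P ε ⊗ f₀) as' × length as' ≡ m ℕ.+ ε
       first = peel κ ν (X ^P ε ⊗ f₀) ν≤1 as len splits

       second : ∃ λ as' → Splits f₀ as' × length as' ≡ m
       second with first
       ... | as' , (k , k≢0 , s) , l = peel 0# ε f₀ ε≤1 as' l (k , k≢0 , P.trans (P.*-congʳ {f₀} (P.sym (X^≋ ε))) s)

     roots : List F
     roots = proj₁ second

     length-roots : length roots ≡ m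
     length-roots = proj₂ (proj₂ second)

     private
       f₀-splits : Splits f₀ roots
       f₀-splits = proj₁ (proj₂ second)

       distinct = roots-distinct roots length-roots f₀-splits

     roots-unique : Unique roots
     roots-unique = proj₁ distinct

     roots-nonzero : All (λ a → a ≢ 0# × a ≢ κ) roots
     roots-nonzero = proj₂ distinct

     private
       Π-zero : ∀ (as : List F) → All (λ a → E.ev (Π as) a ≡ 0#) as
       Π-zero [] = []
       Π-zero (a ∷ as) = trans (E.ev-⊗ (lin a) (Π as) a) (trans (cong (_* E.ev (Π as) a) (lin-root a)) (zeroˡ _)) ∷ All.map (λ {b} z → trans (E.ev-⊗ (lin a) (Π as) b) (trans (cong (E.ev (lin a) b *_) z) (zeroʳ _))) (Π-zero as)

     roots-are-roots : All (λ a → E.ev f₀ a ≡ 0#) roots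
     roots-are-roots with f₀-splits
     ... | k , k≢0 , s = All.map (λ {a} z → trans (E.ev-cong a s) (trans (E.ev-⊗ (C k) (Π roots) a) (trans (cong (E.ev (C k) a *_) z) (zeroʳ _)))) (Π-zero roots)

     all-roots-unique : Unique (κ ∷ 0# ∷ roots)
     all-roots-unique = (κ≢0 ∷ All.map (λ (_ , ne) e → ne (sym e)) roots-nonzero) ∷ (All.map (λ (ne , _) e → ne (sym e)) roots-nonzero ∷ roots-unique)

     module _ (A : Algebra) where
       open Algebra A
       open Evaluation A
       private
         module R = CommutativeRing ring
         solveR = IntSolver.solve ring

       -- The exponents ν and ε may be 0, but additional fixed points do no harm: (X - κ)X times the
       -- product over `roots` has distinct roots and vanishes wherever `f` does.
       f-zero⇒fixed : ∀ x → ev f x R.≈ R.0# → x ^R p R.≈ x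
       f-zero⇒fixed x fx with f₀-splits
       ... | k , k≢0 , s = frobenius-fixed A all-roots-unique x (R.trans (ev-⊗ (lin κ) (Π (0# ∷ roots)) x) (R.trans (R.*-cong (ev-lin κ x) (R.trans (ev-⊗ (lin 0#) (Π roots) x) (R.*-congʳ (R.trans (ev-cong x lin-0) (ev-X x)))))
             (cases ν≤1 ε≤1 (R.trans (R.sym (R.trans (ev-f A x) (R.*-congˡ (R.*-congˡ (R.trans (ev-cong x s) (ev-⊗ (C k) (Π roots) x)))))) fx))))
         where
         q : R.Carrier
         q = ev (Π roots) x
         k⁻¹k : ρ (inv k) R.* ev (C k) x R.≈ R.1#
         k⁻¹k = R.trans (R.*-congˡ (ev-C k x)) (R.trans (R.sym (ρ-* (inv k) k)) (R.trans (ρ-cong (trans (*-comm (inv k) k) (*-inv k≢0))) ρ-1))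
         cases : ∀ {ν ε} → ν ≡ 0 ⊎ ν ≡ 1 → ε ≡ 0 ⊎ ε ≡ 1 → (x R.- ρ κ) ^R ν R.* (x ^R ε R.* (ev (C k) x R.* q)) R.≈ R.0# → (x R.- ρ κ) R.* (x R.* q) R.≈ R.0#
         cases {ν} {ε} hν hε h = R.trans (R.sym (R.*-identityˡ _)) (R.trans (R.*-congʳ (R.sym k⁻¹k)) (step hν hε h))
           where
           i K : R.Carrier
           i = ρ (inv k)
           K = ev (C k) x
           step : ∀ {ν ε} → ν ≡ 0 ⊎ ν ≡ 1 → ε ≡ 0 ⊎ ε ≡ 1 → (x R.- ρ κ) ^R ν R.* (x ^R ε R.* (K R.* q)) R.≈ R.0# → i R.* K R.* ((x R.- ρ κ) R.* (x R.* q)) R.≈ R.0#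
           step (inj₁ refl) (inj₁ refl) h = R.trans (solveR 5 (λ i K l x q → i :* K :* (l :* (x :* q)) := i :* l :* x :* (# 1 :* (# 1 :* (K :* q)))) R.refl i K (x R.- ρ κ) x q) (R.trans (R.*-congˡ h) (R.zeroʳ _))
           step (inj₁ refl) (inj₂ refl) h = R.trans (solveR 5 (λ i K l x q → i :* K :* (l :* (x :* q)) := i :* l :* (# 1 :* ((x :* # 1) :* (K :* q)))) R.refl i K (x R.- ρ κ) x q) (R.trans (R.*-congˡ h) (R.zeroʳ _))
           step (inj₂ refl) (inj₁ refl) h = R.trans (solveR 5 (λ i K l x q → i :* K :* (l :* (x :* q)) := i :* x :* ((l :* # 1) :* (# 1 :* (K :* q)))) R.refl i K (x R.- ρ κ) x q) (R.trans (R.*-congˡ h) (R.zeroʳ _))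
           step (inj₂ refl) (inj₂ refl) h = R.trans (solveR 5 (λ i K l x q → i :* K :* (l :* (x :* q)) := i :* ((l :* # 1) :* ((x :* # 1) :* (K :* q)))) R.refl i K (x R.- ρ κ) x q) (R.trans (R.*-congˡ h) (R.zeroʳ _))

 ev-emb : ∀ (A : Algebra) (d : CommutativeRing.Carrier (Algebra.ring A)) f x →
   let module S = CommutativeRing (Algebra.ring (quadAlgebra A d)) in let module R = CommutativeRing (Algebra.ring A) in
   Evaluation.ev (quadAlgebra A d) f (x , R.0#) S.≈ (Evaluation.ev A f x , R.0#)
 ev-emb A d [] x = CommutativeRing.refl (Algebra.ring (quadAlgebra A d))
 ev-emb A d (a ∷ f) x = S.trans (S.+-congˡ {ρ a , R.0#} (S.trans (S.*-congˡ {x , R.0#} (ev-emb A d f x)) (S.sym (Quadratic.emb-* (Algebra.ring A) d x (ev f x))))) (S.sym (Quadratic.emb-+ (Algebra.ring A) d (ρ a) (x R.* ev f x)))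
   where
   module S = CommutativeRing (Algebra.ring (quadAlgebra A d))
   module R = CommutativeRing (Algebra.ring A)
   open Algebra A
   open Evaluation A using (ev)

 ev-emb₃ : ∀ (A : Algebra) (d : CommutativeRing.Carrier (Algebra.ring A)) f x →
   let module S = CommutativeRing (Algebra.ring (cubicAlgebra A d)) in let module R = CommutativeRing (Algebra.ring A) in
   Evaluation.ev (cubicAlgebra A d) f (x , R.0# , R.0#) S.≈ (Evaluation.ev A f x , R.0# , R.0#)
 ev-emb₃ A d [] x = CommutativeRing.refl (Algebra.ring (cubicAlgebra A d))
 ev-emb₃ A d (a ∷ f) x = S.trans (S.+-congˡ {ρ a , R.0# , R.0#} (S.trans (S.*-congˡ {x , R.0# , R.0#} (ev-emb₃ A d f x)) (S.sym (Cubic.emb-* (Algebra.ring A) d x (ev f x))))) (S.sym (Cubic.emb-+ (Algebra.ring A) d (ρ a) (x R.* ev f x)))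
   where
   module S = CommutativeRing (Algebra.ring (cubicAlgebra A d))
   module R = CommutativeRing (Algebra.ring A)
   open Algebra A
   open Evaluation A using (ev)

 allF : List F
 allF = allFin p

 rootList : Pl → List F
 rootList f = filter (λ a → E.ev f a ≟F 0#) allF

 ∈-rootList : ∀ f {a} → Root f a → a ∈ rootList f
 ∈-rootList f {a} r = ∈-filter⁺ (λ a → E.ev f a ≟F 0#) (∈-allFin a) r

 length-rootList : ∀ f → ¬ (f ≋ []) → length (rootList f) ℕ.< length f
 length-rootList f f≢0 = ℕₚ.≰⇒> λ len → f≢0 (too-many-roots f (Uniqueₚ.filter⁺ (λ a → E.ev f a ≟F 0#) (Uniqueₚ.allFin⁺ p)) (all-filter (λ a → E.ev f a ≟F 0#) allF) len)

 nonzero-coefficient : ∀ f i → cf f i ≢ 0# → ¬ (f ≋ [])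
 nonzero-coefficient f i ne e = ne (at e i)

 -- Otherwise `Π ys` would have more distinct roots than its degree allows.
 pigeonhole : ∀ {xs ys : List F} → Unique xs → All (_∈ ys) xs → length xs ℕ.≤ length ys
 pigeonhole {xs} {ys} uniq sub = ≮⇒≥ λ lt → Π≢0 ys (Below-too-many-roots (suc (length ys)) (Π ys) (Π-below ys) uniq (All.map (∈⇒root ys) sub) lt)
   where
   Π-below : ∀ ys → Below (suc (length ys)) (Π ys)
   Π-below [] = Below-C 1#
   Π-below (y ∷ ys) = Below-⊗ (lin y) (Π ys) (Below-cong (P.sym (lin≋ y)) (Below-⊕ X (⊝ C y) Below-X (λ i le → trans (cf-⊝ (C y) i) (trans (cong (λ z → - z) (Below-C y i (≤-trans (ℕ.s≤s ℕ.z≤n) le))) (solve 0 (:- # 0 := # 0) refl))))) (Π-below ys)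
   Π≢0 : ∀ ys → ¬ (Π ys ≋ [])
   Π≢0 [] e = 1≢0 (trans (sym (cf-C-0 1#)) (at e 0))
   Π≢0 (y ∷ ys) e = Π≢0 ys (cancel-lin y (Π ys) e)
   ∈⇒root : ∀ ys {x} → x ∈ ys → Root (Π ys) x
   ∈⇒root (y ∷ ys) (here refl) = trans (E.ev-⊗ (lin y) (Π ys) y) (trans (cong (_* E.ev (Π ys) y) (lin-root y)) (zeroˡ _))
   ∈⇒root (y ∷ ys) {x} (there i) = trans (E.ev-⊗ (lin y) (Π ys) x) (trans (cong (E.ev (lin y) x *_) (∈⇒root ys i)) (zeroʳ _))

 opaque
   unfolding Quadratic._⊞_

   ⊞⊟-components : ∀ (R : Ring₀) d (a b a' b' : CommutativeRing.Carrier R) → let module R = CommutativeRing R in let module S = CommutativeRing (Quadratic.quad R d) in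
     (a , b) S.- (a' , b') S.≈ (a R.- a' , b R.- b')
   ⊞⊟-components R d a b a' b' = CommutativeRing.refl R , CommutativeRing.refl R

 module _ (A : Algebra) where
   open Algebra A
   open Evaluation A
   private module R = CommutativeRing ring

   ev-arg : ∀ f {x y} → x R.≈ y → ev f x R.≈ ev f y
   ev-arg [] e = R.refl
   ev-arg (a ∷ f) e = R.+-congˡ (R.*-cong e (ev-arg f e))

 -- u = (1 - s)/2 with s² = 1 - z solves 4u(1 - u) = z.
 module HalfRoot (n : ℕ) (p≡ : p ≡ suc (n ℕ.+ n)) (z : F) where
   open OddPrime n p≡
   private
     t : F
     t = 1# - z
     module Q₁ = QuadraticFrobenius self t
     module S = CommutativeRing (Algebra.ring Q₁.Q)
     module E₁ = Evaluation Q₁.Q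
     module RI = RingIdentities (Algebra.ring Q₁.Q)
     u s : F × F
     u = h , - h
     s = Q₁.v

   2u : E₁.N.nat 2 S.* u S.≈ S.1# S.- s
   2u = S.trans (S.*-congʳ {u} (S.sym (Q₁.emb-nat 2))) (S.trans (Q₁.emb-pair (nat 2) h (- h)) (S.trans components (S.sym (⊞⊟-components 𝔽 t 1# 0# 0# 1#))))
     where
     components : (nat 2 * h , nat 2 * - h) S.≈ (1# - 0# , 0# - 1#)
     components = trans 2h (solve 0 (# 1 := # 1 :- # 0) refl) , trans (solve 1 (λ h → # 2 :* (:- h) := :- (# 2 :* h)) refl h) (trans (cong (λ y → - y) 2h) (solve 0 (:- # 1 := # 0 :- # 1) refl))
   zu : E₁.N.nat 4 S.* (u S.* (S.1# S.- u)) S.≈ Q₁.emb z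
   zu = S.trans (RI.4u[1-u] u s 2u) (S.trans (S.+-congˡ {S.1#} (S.trans (S.-‿cong Q₁.v*v) (S.sym (Q₁.emb-neg t)))) (S.trans (S.sym (Q₁.emb-+ 1# (- t))) (Q₁.emb-cong (solve 1 (λ z → # 1 :- (# 1 :- z) := z) refl z))))

 module FamilyZeros (data₂ : FamilyData) where
   open FamilyData data₂ using (m; ν; ε; κ; κ≢0)
   open Family data₂

   φ₁ : F → F
   φ₁ = Gauss.ψ-Evaluation.φ gaussData self

   module _ (A : Algebra) where
     open Algebra A
     open Evaluation A
     open Gauss.ψ-Evaluation gaussData A
     private
       module R = CommutativeRing ring
       ^R-congˡ = Exp.^-congˡ R.semiring

       ρ-Σ : ∀ k t → ρ (Σ≤ k t) R.≈ L.Σ≤ k (λ i → ρ (t i))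
       ρ-Σ zero t = R.refl
       ρ-Σ (suc k) t = R.trans (ρ-+ _ _) (R.+-congʳ (ρ-Σ k t))

     ψ-zero : ∀ u z → N.nat 4 R.* (u R.* (R.1# R.- u)) R.≈ ρ z → φ₁ z ≡ 0# → ev ψ u R.≈ R.0#
     ψ-zero u z zu φz = R.trans (ev-ψ u) (R.trans (R.*-congˡ (R.trans (L.Σ≤-cong m (λ i _ → R.trans (R.*-congˡ (R.trans (^R-congˡ i zu) (R.sym (ρ-^ z i)))) (R.sym (ρ-* (c i) (z ^ i))))) (R.trans (R.sym (ρ-Σ m _)) (R.trans (ρ-cong φz) ρ-0)))) (R.zeroʳ _))

   -- The map a ↦ κ/a sends the roots of `f₀` to zeros of φ, and z ↦ κ/z leads back. The m roots are
   -- distinct, so the exceptional values must number at least m.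
   few-zeros : ∀ as → Splits f as → length as ≡ m ℕ.+ ε ℕ.+ ν → ∀ bad → (∀ z → z ≢ 0# → φ₁ z ≡ 0# → ¬ (z ∈ bad) → ⊥) → m ℕ.≤ length bad
   few-zeros as splits len bad absurd = ≤-trans (≤-reflexive (sym length-roots)) (≤-trans (pigeonhole roots-unique (all-bad roots roots-nonzero roots-are-roots)) (≤-reflexive (Listₚ.length-map _ bad)))
     where
     open SplitFamily as splits len
     badA : List F
     badA = map (λ z → κ * inv z) bad
     bad? : ∀ a → Dec (a ∈ badA)
     bad? a = Data.List.Membership.DecPropositional._∈?_ _≟F_ a badA
     one-bad : ∀ a → a ≢ 0# → E.ev f₀ a ≡ 0# → a ∈ badA
     one-bad a a≢0 ra with bad? a
     ... | yes i = i
     ... | no ni = ⊥-elim (absurd (κ * inv a) z≢0 (root⇒φ a a≢0 ra) (λ i → ni (subst (_∈ badA) back (∈-map⁺ (λ z → κ * inv z) i))))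
       where
       inv≢0 : inv a ≢ 0#
       inv≢0 e = 1≢0 (trans (sym (*-inv a≢0)) (trans (cong (a *_) e) (zeroʳ a)))
       z≢0 : κ * inv a ≢ 0#
       z≢0 = x*y≢0 κ≢0 inv≢0
       back : κ * inv (κ * inv a) ≡ a
       back = *-cancelˡ inv≢0 (trans (solve 3 (λ k i j → i :* (k :* j) := (k :* i) :* j) refl κ (inv a) (inv (κ * inv a))) (trans (*-inv z≢0) (sym (trans (*-comm (inv a) a) (*-inv a≢0)))))
     all-bad : ∀ as → All (λ a → a ≢ 0# × a ≢ κ) as → All (λ a → E.ev f₀ a ≡ 0#) as → All (_∈ badA) as
     all-bad [] [] [] = []
     all-bad (a ∷ as) ((a≢0 , _) ∷ ns) (r ∷ rs) = one-bad a a≢0 r ∷ all-bad as ns rs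

 -- The case r = 2: rationality of √(1 - z), √u and √(1 - u).

 module Level₂ (n : ℕ) (p≡ : p ≡ suc (n ℕ.+ n)) (data₂ : FamilyData) where
   open OddPrime n p≡
   open FamilyData data₂ using (m; ν; ε; κ; κ≢0; g)
   open Family data₂
   open FamilyZeros data₂

   module H₂-expansion (A : Algebra) (d : CommutativeRing.Carrier (Algebra.ring A)) where
     open QuadraticFrobenius A d
     open Evaluation A using (module N)
     private
       module R = CommutativeRing (Algebra.ring A)
       module S = CommutativeRing (Algebra.ring Q)
       module RI = RingIdentities (Algebra.ring Q)

     even odd : R.Carrier
     even = N.nat 13 R.* (d R.* d) R.+ N.nat 162 R.* (d R.* d R.* d) R.+ N.nat 81 R.* (d R.* d R.* (d R.* d))
     odd = d R.+ N.nat 66 R.* (d R.* d) R.+ N.nat 189 R.* (d R.* d R.* d)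

     private
       d² : emb (d R.* d) S.≈ emb d S.* emb d
       d² = emb-* d d

       d³ : emb (d R.* d R.* d) S.≈ emb d S.* emb d S.* emb d
       d³ = S.trans (emb-* (d R.* d) d) (S.*-congʳ {emb d} d²)

       module SN = Numerals (Algebra.ring Q)

       scaled : ∀ k {x y} → emb x S.≈ y → emb (N.nat k R.* x) S.≈ SN.nat k S.* y
       scaled k {x} e = S.trans (emb-* (N.nat k) x) (S.*-cong (emb-nat k) e)

       add : ∀ {a b x y} → emb a S.≈ x → emb b S.≈ y → emb (a R.+ b) S.≈ x S.+ y
       add {a} {b} e e' = S.trans (emb-+ a b) (S.+-cong e e')

       emb-even : emb even S.≈ SN.nat 13 S.* (emb d S.* emb d) S.+ SN.nat 162 S.* (emb d S.* emb d S.* emb d) S.+ SN.nat 81 S.* (emb d S.* emb d S.* (emb d S.* emb d))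
       emb-even = add (add (scaled 13 d²) (scaled 162 d³)) (scaled 81 (S.trans (emb-* (d R.* d) (d R.* d)) (S.*-cong d² d²)))

       emb-odd : emb odd S.≈ emb d S.+ SN.nat 66 S.* (emb d S.* emb d) S.+ SN.nat 189 S.* (emb d S.* emb d S.* emb d)
       emb-odd = add (add (S.refl {emb d}) (scaled 66 d²)) (scaled 189 d³)

     expand : ∀ k → emb k S.* RI.h₂ v S.≈ (k R.* even , k R.* odd)
     expand k = S.trans (S.*-congˡ {emb k} (S.trans (RI.h₂-even-odd v (emb d) v*v) (S.+-cong (S.sym emb-even) (S.*-congʳ {v} (S.sym emb-odd)))))
       (S.trans (S.distribˡ (emb k) (emb even) (emb odd S.* v)) (S.trans (S.+-cong (S.sym (emb-* k even)) (S.trans (S.sym (S.*-assoc (emb k) (emb odd) v)) (S.*-congʳ {v} (S.sym (emb-* k odd))))) (S.sym (pair (k R.* even) (k R.* odd)))))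

   module Conditions (g≡ : nat 16 * g ≡ nat 3) (degree : (2 ℕ.* m ℕ.+ ν) ℕ.* 2 ℕ.≤ n)
     (as : List F) (splits : Splits f as) (len : length as ≡ m ℕ.+ ε ℕ.+ ν) where
     open SplitFamily as splits len

     private
       16≢0 : nat 16 ≢ 0#
       16≢0 e = x^n≢0 2≢0 4 (trans (solve 0 (# 2 :^ 4 := # 16) refl) e)

       4n : nat 4 * nat n ≡ - nat 2
       4n = trans (solve 1 (λ n → # 4 :* n := # 2 :* (# 2 :* n)) refl (nat n)) (trans (cong (nat 2 *_) 2n≡-1) (solve 0 (# 2 :* (:- # 1) := :- # 2) refl))

       g-cond : nat 16 * (nat 2 * nat 2) * g ≡ nat 12
       g-cond = trans (solve 1 (λ g → # 16 :* (# 2 :* # 2) :* g := # 4 :* (# 16 :* g)) refl g) (trans (cong (nat 4 *_) g≡) (solve 0 (# 4 :* # 3 := # 12) refl))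

     closure = Closure.closure gaussData 2 4 3 16 32 12 n (PN.nat 2 ⊗ (X ⊗ α)) (ℕ.s≤s ℕ.z≤n) 16≢0 n<p 4n (solve 0 (# 32 := # 16 :* # 2) refl) g-cond degree Λ-Q₂

     module _ (A : Algebra) where
       open Algebra A
       open Evaluation A
       private
         module R = CommutativeRing ring
         module RI = RingIdentities ring
         ^R-congˡ = Exp.^-congˡ R.semiring

       -- The involution maps v to a further zero of ψ(v²), and the root of `f` belonging to this
       -- zero is (κ/2z²) `h₂ v`. As a root of a split polynomial it is fixed by Frobenius, in any
       -- algebra that contains v and 1/(1 + 3v).
       parameter-fixed : ∀ z u v w → z ≢ 0# → v R.* v R.≈ u → N.nat 4 R.* (u R.* (R.1# R.- u)) R.≈ ρ z → ev ψ u R.≈ R.0# → (R.1# R.+ N.nat 3 R.* v) R.* w R.≈ R.1# →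
         (ρ (κ * inv (nat 2 * (z * z))) R.* RI.h₂ v) ^R p R.≈ ρ (κ * inv (nat 2 * (z * z))) R.* RI.h₂ v
       parameter-fixed z u v w z≢0 vv zu ψu bw = R.trans (^R-congˡ p assoc) (R.trans (f-zero⇒fixed A _ (ψ-zero⇒f-zero A _ (ρ i R.* RI.h₂ v) inverse (closure A v w bw ψv))) (R.sym assoc))
         where
         i : F
         i = inv (nat 2 * (z * z))
         assoc : ρ (κ * i) R.* RI.h₂ v R.≈ ρ κ R.* (ρ i R.* RI.h₂ v)
         assoc = R.trans (R.*-congʳ (ρ-* κ i)) (R.*-assoc _ _ _)
         v²≈u : v ^R 2 R.≈ u
         v²≈u = R.trans (R.*-congˡ (R.*-identityʳ v)) vv
         ψv : ev ψ (v ^R 2) R.≈ R.0#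
         ψv = R.trans (ev-arg A ψ v²≈u) ψu
         zv : N.nat 4 R.* ((v R.* v) R.* (R.1# R.- v R.* v)) R.≈ ρ z
         zv = R.trans (R.*-congˡ (R.*-cong vv (R.+-congˡ (R.-‿cong vv)))) zu
         inverse : N.nat 4 R.* (((R.1# R.- v) R.* w) ^R 2 R.* (R.1# R.- ((R.1# R.- v) R.* w) ^R 2)) R.* (ρ i R.* RI.h₂ v) R.≈ R.1#
         inverse = R.trans (RI.h₂-inverse v w (ρ i) bw) (R.trans (R.*-congˡ (R.trans (R.*-cong (R.sym (ρ-nat 2)) (R.trans (R.*-cong zv zv) (R.sym (ρ-* z z)))) (R.sym (ρ-* (nat 2) (z * z))))) (R.trans (R.sym (ρ-* i _)) (R.trans (ρ-cong (trans (*-comm i _) (*-inv (x*y≢0 2≢0 (x*y≢0 z≢0 z≢0))))) ρ-1)))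

     k≢0 : ∀ {z} → z ≢ 0# → κ * inv (nat 2 * (z * z)) ≢ 0#
     k≢0 {z} z≢0 = x*y≢0 κ≢0 (λ e → 1≢0 (trans (sym (*-inv (x*y≢0 2≢0 (x*y≢0 z≢0 z≢0)))) (trans (cong (nat 2 * (z * z) *_) e) (zeroʳ _))))

     module Tower (A : Algebra) (u j : CommutativeRing.Carrier (Algebra.ring A)) where
       open QuadraticFrobenius A u
       open H₂-expansion A u
       private
         module R = CommutativeRing (Algebra.ring A)
         module EA = Evaluation A
         module S = CommutativeRing (Algebra.ring Q)
         module EQ = Evaluation Q

         w : S.Carrier
         -- 1/(1 + 3v) = (1 - 3v)/(1 - 9u), where `j` is the inverse of 1 - 9u.
         w = (S.1# S.- EQ.N.nat 3 S.* v) S.* emb j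

         bw : (R.1# R.- EA.N.nat 9 R.* u) R.* j R.≈ R.1# → (S.1# S.+ EQ.N.nat 3 S.* v) S.* w S.≈ S.1#
         bw 9uj = S.trans (RingIdentities.[1+3v][1-3v] (Algebra.ring Q) v (emb j)) (S.trans (S.*-congʳ {emb j} (S.sym 1-9u)) (S.trans (S.sym (emb-* (R.1# R.- EA.N.nat 9 R.* u) j)) (emb-cong 9uj)))
           where
           1-9u : emb (R.1# R.- EA.N.nat 9 R.* u) S.≈ S.1# S.- EQ.N.nat 9 S.* (v S.* v)
           1-9u = S.trans (emb-+ R.1# (R.- (EA.N.nat 9 R.* u))) (S.+-congˡ {S.1#} (S.trans (emb-neg (EA.N.nat 9 R.* u)) (S.-‿cong (S.trans (emb-* (EA.N.nat 9) u) (S.*-cong (emb-nat 9) (S.sym v*v))))))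

         emb-4u : ∀ {y} → EA.N.nat 4 R.* (u R.* (R.1# R.- u)) R.≈ y → EQ.N.nat 4 S.* (emb u S.* (S.1# S.- emb u)) S.≈ emb y
         emb-4u zu = S.trans (S.sym (S.trans (emb-* (EA.N.nat 4) (u R.* (R.1# R.- u))) (S.*-cong (emb-nat 4) (S.trans (emb-* u (R.1# R.- u)) (S.*-congˡ {emb u} (S.trans (emb-+ R.1# (R.- u)) (S.+-congˡ {S.1#} (emb-neg u)))))))) (emb-cong zu)

       -- The two coordinates of the fixed element over `A`: the even one is itself fixed by
       -- Frobenius, the odd one carries the factor u^n.
       tower : ∀ z → z ≢ 0# → EA.N.nat 4 R.* (u R.* (R.1# R.- u)) R.≈ Algebra.ρ A z → EA.ev ψ u R.≈ R.0# → (R.1# R.- EA.N.nat 9 R.* u) R.* j R.≈ R.1# →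
         let k' = Algebra.ρ A (κ * inv (nat 2 * (z * z))) in (k' R.* even) EA.^R p R.≈ k' R.* even × (k' R.* odd) EA.^R p R.* u EA.^R n R.≈ k' R.* odd
       tower z z≢0 zu ψu 9uj = S.trans (S.sym (frobenius₂ (k' R.* even) (k' R.* odd))) (S.trans (Exp.^-congˡ S.semiring p (S.sym (expand k'))) (S.trans (parameter-fixed Q z (emb u) v w z≢0 v*v (emb-4u zu) (S.trans (ev-emb A u ψ u) (emb-cong ψu)) (bw 9uj)) (expand k')))
         where k' = Algebra.ρ A (κ * inv (nat 2 * (z * z)))

     -- With u rational the odd coordinate k'u(1 + 66u + 189u²) is rational, hence fixed by
     -- Frobenius on its own. If it is nonzero, u^n = 1 follows.
     square₂ : ∀ u → nat 4 * (u * (1# - u)) ≢ 0# → E.ev ψ u ≡ 0# → 1# - nat 9 * u ≢ 0# → 1# + nat 66 * u + nat 189 * (u * u) ≢ 0# → ∃ λ k → k * k ≡ u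
     square₂ u z≢0 ψu 9u q≢0 = euler u (*-cancelˡ K≢0 (trans (sym (cong (_* u ^ n) (fermat K))) (trans (proj₂ (Tower.tower self u (inv (1# - nat 9 * u)) z z≢0 refl ψu (*-inv 9u))) (sym (*-identityʳ K)))))
       where
       z k' K : F
       z = nat 4 * (u * (1# - u))
       k' = κ * inv (nat 2 * (z * z))
       K = k' * (u + nat 66 * (u * u) + nat 189 * (u * u * u))
       u≢0 : u ≢ 0#
       u≢0 e = z≢0 (trans (cong (λ y → nat 4 * (y * (1# - y))) e) (solve 0 (# 4 :* (# 0 :* (# 1 :- # 0)) := # 0) refl))
       K≢0 : K ≢ 0#
       K≢0 e = x*y≢0 (k≢0 z≢0) (x*y≢0 u≢0 q≢0) (trans (cong (k' *_) (solve 1 (λ u → u :* (# 1 :+ # 66 :* u :+ # 189 :* (u :* u)) := u :+ # 66 :* (u :* u) :+ # 189 :* (u :* u :* u)) refl u)) e)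

     -- Now u = (1 - s)/2 lies in the ring with s² = t = 1 - z, and the even coordinate is a fixed
     -- element of this ring. Sixteen times its s-coordinate is k' `qt`, so t^n = 1 unless `qt` = 0.
     -- The other exception, 49 - 81t, is the norm of 2(1 - 9u).
     square₁ : ∀ z → z ≢ 0# → φ₁ z ≡ 0# → nat 49 - nat 81 * (1# - z) ≢ 0# → nat 175 + nat 81 * (1# - z) ≢ 0# → ∃ λ s → s * s ≡ 1# - z
     square₁ z z≢0 φz n≢0 q≢0 = euler t (*-cancelˡ KQ≢0 (trans (sym (cong (_* t ^ n) (fermat (k' * qt)))) (trans (proj₂ fixed) (sym (*-identityʳ _)))))
       where
       t k' pt qt N : F
       t = 1# - z
       k' = κ * inv (nat 2 * (z * z))
       pt = nat 457 + nat 1510 * t + nat 81 * (t * t)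
       qt = - (nat 8 * (nat 175 + nat 81 * t))
       N = inv (nat 49 - nat 81 * t)
       8≢0 : nat 8 ≢ 0#
       8≢0 e = x^n≢0 2≢0 3 (trans (solve 0 (# 2 :^ 3 := # 8) refl) e)
       KQ≢0 : k' * qt ≢ 0#
       KQ≢0 e = x*y≢0 (k≢0 z≢0) (x*y≢0 8≢0 q≢0) (trans (solve 2 (λ k q → k :* q := :- (k :* (:- q))) refl k' (nat 8 * (nat 175 + nat 81 * t))) (trans (cong (λ y → - y) e) (solve 0 (:- # 0 := # 0) refl)))
       module Q₁ = QuadraticFrobenius self t
       module S = CommutativeRing (Algebra.ring Q₁.Q)
       module E₁ = Evaluation Q₁.Q
       module RI = RingIdentities (Algebra.ring Q₁.Q)
       u s : F × F
       u = h , - h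
       s = Q₁.v
       2u : E₁.N.nat 2 S.* u S.≈ S.1# S.- s
       2u = HalfRoot.2u n p≡ z
       zu : E₁.N.nat 4 S.* (u S.* (S.1# S.- u)) S.≈ Q₁.emb z
       zu = HalfRoot.zu n p≡ z
       ψu : E₁.ev ψ u S.≈ S.0#
       ψu = ψ-zero Q₁.Q u z zu φz
       j : F × F
       -- 1 - 9u = (9s - 7)/2 has the inverse -(14 + 18s)/(49 - 81t).
       j = - (nat 14 * N) , - (nat 18 * N)
       9uj : (S.1# S.- E₁.N.nat 9 S.* u) S.* j S.≈ S.1#
       9uj = S.trans (S.*-congʳ {j} (S.trans (S.+-congˡ {S.1#} (S.-‿cong (S.trans (S.*-congʳ {u} (S.sym (Q₁.emb-nat 9))) (Q₁.emb-pair (nat 9) h (- h))))) (⊞⊟-components 𝔽 t 1# 0# (nat 9 * h) (nat 9 * - h)))) (S.trans (Quadratic.⊠-components 𝔽 t (1# - nat 9 * h) (0# - nat 9 * - h) (- (nat 14 * N)) (- (nat 18 * N))) components)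
         where
         components : ((1# - nat 9 * h) * - (nat 14 * N) + t * ((0# - nat 9 * - h) * - (nat 18 * N)) , (1# - nat 9 * h) * - (nat 18 * N) + (0# - nat 9 * - h) * - (nat 14 * N)) S.≈ S.1#
         components = trans (solve 3 (λ h t N → (# 1 :- # 9 :* h) :* (:- (# 14 :* N)) :+ t :* ((# 0 :- # 9 :* (:- h)) :* (:- (# 18 :* N))) := N :* (:- # 14 :+ # 2 :* h :* (# 63 :- # 81 :* t))) refl h t N)
             (trans (cong (λ y → N * (- nat 14 + y * (nat 63 - nat 81 * t))) 2h) (trans (solve 2 (λ t N → N :* (:- # 14 :+ # 1 :* (# 63 :- # 81 :* t)) := (# 49 :- # 81 :* t) :* N) refl t N) (*-inv n≢0)))
           , trans (solve 2 (λ h N → (# 1 :- # 9 :* h) :* (:- (# 18 :* N)) :+ (# 0 :- # 9 :* (:- h)) :* (:- (# 14 :* N)) := N :* # 18 :* (# 2 :* h :- # 1)) refl h N)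
             (trans (cong (λ y → N * nat 18 * (y - 1#)) 2h) (solve 1 (λ N → N :* # 18 :* (# 1 :- # 1) := # 0) refl N))
       open H₂-expansion Q₁.Q u using (even)
       A : F × F
       A = Q₁.emb k' S.* even
       16A : Q₁.emb (nat 16) S.* A S.≈ (k' * pt , k' * qt)
       16A = S.trans (RI.a[bc]≈b[ac] (Q₁.emb (nat 16)) (Q₁.emb k') even) (S.trans (S.*-congˡ {Q₁.emb k'} (S.trans (S.*-congʳ {even} (Q₁.emb-nat 16)) (S.trans (RI.h₂-even-s u s (Q₁.emb t) 2u Q₁.v*v) (S.trans (S.+-cong (S.sym emb-pt) (S.*-congʳ {s} (S.sym emb-qt))) (S.sym (Q₁.pair pt qt))))))
         (Q₁.emb-pair k' pt qt))
         where
         scaled : ∀ k x {y} → Q₁.emb x S.≈ y → Q₁.emb (nat k * x) S.≈ E₁.N.nat k S.* y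
         scaled k x e = S.trans (Q₁.emb-* (nat k) x) (S.*-cong (Q₁.emb-nat k) e)
         emb-pt = S.trans (Q₁.emb-+ (nat 457 + nat 1510 * t) (nat 81 * (t * t))) (S.+-cong (S.trans (Q₁.emb-+ (nat 457) (nat 1510 * t)) (S.+-cong (Q₁.emb-nat 457) (scaled 1510 t (S.refl {Q₁.emb t})))) (scaled 81 (t * t) (Q₁.emb-* t t)))
         emb-qt = S.trans (Q₁.emb-neg (nat 8 * (nat 175 + nat 81 * t))) (S.-‿cong (scaled 8 (nat 175 + nat 81 * t) (S.trans (Q₁.emb-+ (nat 175) (nat 81 * t)) (S.+-cong (Q₁.emb-nat 175) (scaled 81 t (S.refl {Q₁.emb t}))))))
       fixed : ((k' * pt) ^ p , (k' * qt) ^ p * t ^ n) S.≈ (k' * pt , k' * qt)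
       fixed = S.trans (S.sym (Q₁.frobenius₂ (k' * pt) (k' * qt))) (S.trans (Exp.^-congˡ S.semiring p (S.sym 16A)) (S.trans (E₁.L.^-distrib-* (Q₁.emb (nat 16)) A p) (S.trans (S.*-cong (E₁.ρ-fermat (nat 16)) (proj₁ (Tower.tower Q₁.Q u j z z≢0 zu ψu 9uj))) 16A)))

     -- The substitution u ↦ 1 - u preserves 4u(1 - u) and only changes the sign of 1 - 2u.
     ψ-sym : ∀ u → E.ev ψ u ≡ 0# → E.ev ψ (1# - u) ≡ 0#
     ψ-sym u e = trans (ev-ψ (1# - u)) (trans (cong₂ _*_ (trans (cong (_^ ν) (solve 1 (λ u → # 1 :- # 2 :* (# 1 :- u) := (:- # 1) :* (# 1 :- # 2 :* u)) refl u)) (^-distrib-* (- 1#) (1# - nat 2 * u) ν)) (cong φ₁ (solve 1 (λ u → # 4 :* ((# 1 :- u) :* (# 1 :- (# 1 :- u))) := # 4 :* (u :* (# 1 :- u))) refl u)))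
       (trans (*-assoc _ _ _) (trans (cong ((- 1#) ^ ν *_) (trans (sym (ev-ψ u)) e)) (zeroʳ _))))
       where open Gauss.ψ-Evaluation gaussData self using (ev-ψ)

     private
       -- `q₁` and `q₂` are 175 + 81t and 49 - 81t at t = 1 - z, and `q₃` is the odd coordinate
       -- divided by u. `q₄` and `q₅` are 1 - 9w' and 1 + 66w' + 189w'² at w' = 8v(1 + v)/(1 + 3v)²
       -- after clearing denominators. The degrees 1, 1, 2, 2 and 4 add up to 10.
       q₁ q₂ q₃ q₄ q₅ : Pl
       q₁ = nat 256 ∷ - nat 81 ∷ []
       q₂ = - nat 32 ∷ nat 81 ∷ []
       q₃ = 1# ∷ nat 66 ∷ nat 189 ∷ []
       q₄ = 1# ∷ - nat 66 ∷ - nat 63 ∷ []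
       q₅ = 1# ∷ nat 540 ∷ nat 15846 ∷ nat 32220 ∷ nat 16929 ∷ []

       ζ ζ' : F → F
       ζ u = nat 4 * (u * (1# - u))
       ζ' v = ζ (v * v)

       badZ : List F
       badZ = rootList q₁ ++ rootList q₂ ++ map ζ (rootList q₃) ++ map ζ' (rootList q₄) ++ map ζ' (rootList q₅)

       length-badZ : length badZ ℕ.≤ 10
       length-badZ = ≤-trans (≤-reflexive (++₅ (rootList q₁) (rootList q₂) (map ζ (rootList q₃)) (map ζ' (rootList q₄)) (map ζ' (rootList q₅))))
         (+-mono-≤ (bound q₁ 0 2^8) (+-mono-≤ (bound q₂ 0 2^5) (+-mono-≤ (≤-trans (≤-reflexive (Listₚ.length-map ζ (rootList q₃))) (bound q₃ 0 1≢0)) (+-mono-≤ (≤-trans (≤-reflexive (Listₚ.length-map ζ' (rootList q₄))) (bound q₄ 0 1≢0)) (≤-trans (≤-reflexive (Listₚ.length-map ζ' (rootList q₅))) (bound q₅ 0 1≢0))))))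
         where
         ++₅ : ∀ (a b c d e : List F) → length (a ++ b ++ c ++ d ++ e) ≡ length a ℕ.+ (length b ℕ.+ (length c ℕ.+ (length d ℕ.+ length e)))
         ++₅ a b c d e = trans (Listₚ.length-++ a) (cong (length a ℕ.+_) (trans (Listₚ.length-++ b) (cong (length b ℕ.+_) (trans (Listₚ.length-++ c) (cong (length c ℕ.+_) (Listₚ.length-++ d))))))
         bound : ∀ f i → cf f i ≢ 0# → length (rootList f) ℕ.≤ length f ℕ.∸ 1
         bound f i ne = ℕₚ.∸-monoˡ-≤ 1 (length-rootList f (nonzero-coefficient f i ne))
         2^8 : nat 256 ≢ 0#
         2^8 e = x^n≢0 2≢0 8 (trans (solve 0 (# 2 :^ 8 := # 256) refl) e)
         2^5 : - nat 32 ≢ 0#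
         2^5 e = x^n≢0 2≢0 5 (trans (solve 0 (# 2 :^ 5 := :- (:- # 32)) refl) (trans (cong (λ y → - y) e) (solve 0 (:- # 0 := # 0) refl)))

     -- The first alternative is p ≡ 3 mod 4; the second is what counting points yields for p ≡ 1
     -- mod 4.
     LevelHypothesis : Set
     LevelHypothesis = ((- 1#) ^ n ≡ - 1#) ⊎ (∀ v → v ≢ 0# → 1# - v * v ≢ 0# → E.ev ψ (1# - v * v) ≡ 0# → ⊥)

     private
       module Good (z : F) (z≢0 : z ≢ 0#) (φz : φ₁ z ≡ 0#) (good : ¬ (z ∈ badZ)) where
         in₁ : z ∈ rootList q₁ → ⊥
         in₁ i = good (∈-++⁺ˡ i)
         in₂ : z ∈ rootList q₂ → ⊥
         in₂ i = good (∈-++⁺ʳ (rootList q₁) (∈-++⁺ˡ i))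
         in₃ : z ∈ map ζ (rootList q₃) → ⊥
         in₃ i = good (∈-++⁺ʳ (rootList q₁) (∈-++⁺ʳ (rootList q₂) (∈-++⁺ˡ i)))
         in₄ : z ∈ map ζ' (rootList q₄) → ⊥
         in₄ i = good (∈-++⁺ʳ (rootList q₁) (∈-++⁺ʳ (rootList q₂) (∈-++⁺ʳ (map ζ (rootList q₃)) (∈-++⁺ˡ i))))
         in₅ : z ∈ map ζ' (rootList q₅) → ⊥
         in₅ i = good (∈-++⁺ʳ (rootList q₁) (∈-++⁺ʳ (rootList q₂) (∈-++⁺ʳ (map ζ (rootList q₃)) (∈-++⁺ʳ (map ζ' (rootList q₄)) i))))

         sqrt : ∃ λ s → s * s ≡ 1# - z
         sqrt = square₁ z z≢0 φz
           (λ e → in₂ (∈-rootList q₂ (trans (solve 1 (λ z → :- # 32 :+ z :* (# 81 :+ z :* # 0) := # 49 :- # 81 :* (# 1 :- z)) refl z) e)))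
           (λ e → in₁ (∈-rootList q₁ (trans (solve 1 (λ z → # 256 :+ z :* (:- # 81 :+ z :* # 0) := # 175 :+ # 81 :* (# 1 :- z)) refl z) e)))

         s u₀ : F
         s = proj₁ sqrt
         u₀ = h * (1# - s)

         ζu₀ : ζ u₀ ≡ z
         ζu₀ = trans (RingIdentities.4u[1-u] 𝔽 u₀ s (trans (sym (*-assoc (nat 2) h (1# - s))) (trans (cong (_* (1# - s)) 2h) (*-identityˡ _)))) (trans (cong (λ y → 1# - y) (proj₂ sqrt)) (solve 1 (λ z → # 1 :- (# 1 :- z) := z) refl z))

         1-9u≢0 : ∀ u → ζ u ≡ z → 1# - nat 9 * u ≢ 0#
         1-9u≢0 u ζu e = in₂ (∈-rootList q₂ (trans (cong (λ y → - nat 32 + y * (nat 81 + y * 0#)) (sym ζu)) (trans (solve 1 (λ u → let z = # 4 :* (u :* (# 1 :- u)) in :- # 32 :+ z :* (# 81 :+ z :* # 0) := # 4 :* ((# 1 :- # 9 :* u) :* (# 1 :- # 9 :* (# 1 :- u)))) refl u) (trans (cong (λ y → nat 4 * (y * (1# - nat 9 * (1# - u)))) e) (solve 1 (λ y → # 4 :* (# 0 :* y) := # 0) refl (1# - nat 9 * (1# - u)))))))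

         ψ-at : ∀ u → ζ u ≡ z → E.ev ψ u ≡ 0#
         ψ-at u ζu = ψ-zero self u z ζu φz

         root-of : ∀ u → ζ u ≡ z → ∃ λ k → k * k ≡ u
         root-of u ζu = square₂ u (λ e → z≢0 (trans (sym ζu) e)) (ψ-at u ζu) (1-9u≢0 u ζu)
           (λ e → in₃ (subst (_∈ map ζ (rootList q₃)) ζu (∈-map⁺ ζ (∈-rootList q₃ (trans (solve 1 (λ u → # 1 :+ u :* (# 66 :+ u :* (# 189 :+ u :* # 0)) := # 1 :+ # 66 :* u :+ # 189 :* (u :* u)) refl u) e)))))

         -- The involution followed by u' ↦ 1 - u' gives the zero w' = 1 - u' of ψ, which is a
         -- square like every other unexceptional zero; and (1 + 3v)²w' = (1 + 3v)² - (1 - v)² =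
         -- 8v(1 + v).
         level-two : ∀ v → ζ' v ≡ z → ∃ λ y → y * y ≡ nat 8 * (v * (1# + v))
         level-two v ζv = k * b , trans (solve 2 (λ k b → k :* b :* (k :* b) := b :* b :* (k :* k)) refl k b) (trans (cong (b * b *_) (proj₂ found)) b²w')
           where
           b w u' w' i : F
           b = 1# + nat 3 * v
           w = inv b
           u' = ((1# - v) * w) ^ 2
           w' = 1# - u'
           i = inv (nat 2 * (z * z))
           b≢0 : b ≢ 0#
           b≢0 e = 1-9u≢0 (v * v) ζv (trans (solve 1 (λ v → # 1 :- # 9 :* (v :* v) := (# 1 :+ # 3 :* v) :* (# 1 :- # 3 :* v)) refl v) (trans (cong (_* (1# - nat 3 * v)) e) (zeroˡ _)))
           bw : b * w ≡ 1#
           bw = *-inv b≢0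
           ψu' : E.ev ψ u' ≡ 0#
           ψu' = closure self v w bw (trans (cong (E.ev ψ) (cong (v *_) (*-identityʳ v))) (ψ-at (v * v) ζv))
           bw-1 : b * b * (w * w) ≡ 1#
           bw-1 = trans (solve 2 (λ b w → b :* b :* (w :* w) := (b :* w) :* (b :* w)) refl b w) (trans (cong₂ _*_ bw bw) (*-identityˡ 1#))
           b²w' : b * b * w' ≡ nat 8 * (v * (1# + v))
           b²w' = trans (solve 2 (λ v w → let b = # 1 :+ # 3 :* v in b :* b :* (# 1 :- ((# 1 :- v) :* w) :^ 2) := b :* b :- (# 1 :- v) :^ 2 :* (b :* b :* (w :* w))) refl v w) (trans (cong (λ y → b * b - (1# - v) ^ 2 * y) bw-1) (solve 1 (λ v → let b = # 1 :+ # 3 :* v in b :* b :- (# 1 :- v) :^ 2 :* # 1 := # 8 :* (v :* (# 1 :+ v))) refl v))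
           ζw'≢0 : ζ w' ≢ 0#
           ζw'≢0 e = 1≢0 (trans (sym (*-inv (x*y≢0 2≢0 (x*y≢0 z≢0 z≢0)))) (trans (*-comm _ i) (trans (cong (λ y → i * (nat 2 * (y * y))) (sym ζv)) (trans (sym (RingIdentities.h₂-inverse 𝔽 v w i bw)) (trans (cong (_* (i * RingIdentities.h₂ 𝔽 v)) (trans (solve 1 (λ u → # 4 :* (u :* (# 1 :- u)) := # 4 :* ((# 1 :- u) :* (# 1 :- (# 1 :- u)))) refl u') e)) (zeroˡ _))))))
           found : ∃ λ k → k * k ≡ w'
           found = square₂ w' ζw'≢0 (ψ-sym u' ψu')
             (λ e → in₄ (subst (_∈ map ζ' (rootList q₄)) ζv (∈-map⁺ ζ' (∈-rootList q₄ (trans (solve 1 (λ v → let b = # 1 :+ # 3 :* v in # 1 :+ v :* (:- # 66 :+ v :* (:- # 63 :+ v :* # 0)) := b :* b :- # 9 :* (# 8 :* (v :* (# 1 :+ v)))) refl v) (trans (cong (λ y → b * b - nat 9 * y) (sym b²w')) (trans (solve 2 (λ b w → b :* b :- # 9 :* (b :* b :* w) := b :* b :* (# 1 :- # 9 :* w)) refl b w') (trans (cong (b * b *_) e) (zeroʳ _)))))))))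
             (λ e → in₅ (subst (_∈ map ζ' (rootList q₅)) ζv (∈-map⁺ ζ' (∈-rootList q₅ (trans (solve 1 (λ v → let b = # 1 :+ # 3 :* v ; y = # 8 :* (v :* (# 1 :+ v)) in # 1 :+ v :* (# 540 :+ v :* (# 15846 :+ v :* (# 32220 :+ v :* (# 16929 :+ v :* # 0)))) := b :* b :* (b :* b) :+ # 66 :* (y :* (b :* b)) :+ # 189 :* (y :* y)) refl v) (trans (cong (λ y → b * b * (b * b) + nat 66 * (y * (b * b)) + nat 189 * (y * y)) (sym b²w')) (trans (solve 2 (λ b w → let y = b :* b :* w in b :* b :* (b :* b) :+ # 66 :* (y :* (b :* b)) :+ # 189 :* (y :* y) := b :* b :* (b :* b) :* (# 1 :+ # 66 :* w :+ # 189 :* (w :* w))) refl b w') (trans (cong (b * b * (b * b) *_) e) (zeroʳ _)))))))))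
           k : F
           k = proj₁ found

         absurd : LevelHypothesis → ⊥
         absurd hyp = [ odd-case , even-case ]′ hyp
           where
           ζ1-u₀ : ζ (1# - u₀) ≡ z
           ζ1-u₀ = trans (solve 1 (λ u → # 4 :* ((# 1 :- u) :* (# 1 :- (# 1 :- u))) := # 4 :* (u :* (# 1 :- u))) refl u₀) ζu₀
           v k : F
           v = proj₁ (root-of (1# - u₀) ζ1-u₀)
           k = proj₁ (root-of u₀ ζu₀)
           vv : v * v ≡ 1# - u₀
           vv = proj₂ (root-of (1# - u₀) ζ1-u₀)
           kk : k * k ≡ u₀
           kk = proj₂ (root-of u₀ ζu₀)
           1-vv : 1# - v * v ≡ u₀
           1-vv = trans (cong (λ y → 1# - y) vv) (solve 1 (λ u → # 1 :- (# 1 :- u) := u) refl u₀)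
           u₀≢0 : u₀ ≢ 0#
           u₀≢0 e = z≢0 (trans (sym ζu₀) (trans (cong ζ e) (solve 0 (# 4 :* (# 0 :* (# 1 :- # 0)) := # 0) refl)))
           v≢0 : v ≢ 0#
           v≢0 e = z≢0 (trans (sym ζ1-u₀) (trans (cong ζ (trans (sym vv) (trans (cong (_* v) e) (zeroˡ v)))) (solve 0 (# 4 :* (# 0 :* (# 1 :- # 0)) := # 0) refl)))
           k≢0' : k ≢ 0#
           k≢0' e = u₀≢0 (trans (sym kk) (trans (cong (_* k) e) (zeroˡ k)))
           ζv : ζ' v ≡ z
           ζv = trans (cong ζ vv) ζ1-u₀
           even-case : (∀ v → v ≢ 0# → 1# - v * v ≢ 0# → E.ev ψ (1# - v * v) ≡ 0# → ⊥) → ⊥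
           even-case cs = cs v v≢0 (λ e → u₀≢0 (trans (sym 1-vv) e)) (trans (cong (E.ev ψ) 1-vv) (ψ-at u₀ ζu₀))
           -- Both v and -v are admissible in `level-two`. The squares 8v(1 + v) and -8v(1 - v) have
           -- the product -64v²(1 - v²) = -(8vk)², so -1 would be a square.
           odd-case : (- 1#) ^ n ≡ - 1# → ⊥
           odd-case e = nonsquare (- 1#) e (y₁ * y₂ * j) (trans (solve 3 (λ a b j → a :* b :* j :* (a :* b :* j) := (a :* a) :* (b :* b) :* (j :* j)) refl y₁ y₂ j) (trans (cong₂ (λ a b → a * b * (j * j)) (proj₂ r₁) (proj₂ r₂)) (trans (solve 3 (λ v j c → c :* (v :* (# 1 :+ v)) :* (c :* ((:- v) :* (# 1 :+ (:- v)))) :* (j :* j) := :- (c :* v :* (c :* v) :* (# 1 :- v :* v) :* (j :* j))) refl v j (nat 8)) (trans (cong (λ y → - (nat 8 * v * (nat 8 * v) * y * (j * j))) (trans 1-vv (sym kk))) (trans (solve 3 (λ a k j → :- (a :* a :* (k :* k) :* (j :* j)) := :- ((a :* k :* j) :* (a :* k :* j))) refl (nat 8 * v) k j) (trans (cong (λ y → - (y * y)) (*-inv (x*y≢0 (x*y≢0 8≢0 v≢0) k≢0'))) (cong (λ y → - y) (*-identityˡ 1#))))))))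
             where
             r₁ = level-two v ζv
             r₂ = level-two (- v) (trans (cong ζ (solve 1 (λ v → (:- v) :* (:- v) := v :* v) refl v)) ζv)
             y₁ y₂ j : F
             y₁ = proj₁ r₁
             y₂ = proj₁ r₂
             j = inv (nat 8 * v * k)
             8≢0 : nat 8 ≢ 0#
             8≢0 e' = x^n≢0 2≢0 3 (trans (solve 0 (# 2 :^ 3 := # 8) refl) e')

     contradiction₂ : LevelHypothesis → 11 ℕ.≤ m → ⊥
     contradiction₂ hyp 11≤m = <⇒≱ 11≤m (≤-trans (few-zeros as splits len badZ (λ z z≢0 φz good → Good.absurd z z≢0 φz good hyp)) length-badZ)

 -- Sums over the prime field.

 Sum : (F → F) → F
 Sum = Sums.sum semiring {p}

 Sumℕ : (F → ℕ) → ℕ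
 Sumℕ = MonoidSums.sum ℕₚ.+-0-commutativeMonoid {p}

 Sum-cong : ∀ {s t : F → F} → (∀ x → s x ≡ t x) → Sum s ≡ Sum t
 Sum-cong e = Sums.sum-cong-≗ semiring e

 Sumℕ-cong : ∀ {s t : F → ℕ} → (∀ x → s x ≡ t x) → Sumℕ s ≡ Sumℕ t
 Sumℕ-cong e = MonoidSums.sum-cong-≗ ℕₚ.+-0-commutativeMonoid e

 Sum-+ : ∀ (s t : F → F) → Sum (λ x → s x + t x) ≡ Sum s + Sum t
 Sum-+ = Sums.∑-distrib-+ semiring {p}

 Sumℕ-+ : ∀ (s t : F → ℕ) → Sumℕ (λ x → s x ℕ.+ t x) ≡ Sumℕ s ℕ.+ Sumℕ t
 Sumℕ-+ = MonoidSums.∑-distrib-+ ℕₚ.+-0-commutativeMonoid {p}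

 Sum-* : ∀ c (t : F → F) → Sum (λ x → c * t x) ≡ c * Sum t
 Sum-* c t = sym (Sums.*-distribˡ-sum semiring {p} c t)

 Sum-perm : ∀ (σ τ : F → F) → (∀ x → σ (τ x) ≡ x) → (∀ x → τ (σ x) ≡ x) → ∀ t → Sum t ≡ Sum (λ x → t (σ x))
 Sum-perm σ τ στ τσ t = Sums.sum-permute semiring t (permutation σ τ στ τσ)

 Sumℕ-perm : ∀ (σ τ : F → F) → (∀ x → σ (τ x) ≡ x) → (∀ x → τ (σ x) ≡ x) → ∀ t → Sumℕ t ≡ Sumℕ (λ x → t (σ x))
 Sumℕ-perm σ τ στ τσ t = MonoidSums.sum-permute ℕₚ.+-0-commutativeMonoid t (permutation σ τ στ τσ)

 Sum-- : ∀ (s t : F → F) → Sum (λ x → s x - t x) ≡ Sum s - Sum t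
 Sum-- s t = trans (Sum-+ s (λ x → - t x)) (cong (Sum s +_) (trans (Sum-cong (λ x → solve 1 (λ y → :- y := (:- # 1) :* y) refl (t x))) (trans (Sum-* (- 1#) t) (solve 1 (λ y → (:- # 1) :* y := :- y) refl (Sum t)))))

 nat-Sumℕ : ∀ t → nat (Sumℕ t) ≡ Sum (λ x → nat (t x))
 nat-Sumℕ = go p
   where
   go : ∀ k (t : Fin k → ℕ) → nat (MonoidSums.sum ℕₚ.+-0-commutativeMonoid t) ≡ Sums.sum semiring (λ x → nat (t x))
   go zero t = nat-0
   go (suc k) t = trans (nat-+ (t zero) _) (cong (nat (t zero) +_) (go k (λ i → t (suc i))))

 Sumℕ-1 : Sumℕ (λ _ → 1) ≡ p
 Sumℕ-1 = go p
   where
   go : ∀ k → MonoidSums.sum ℕₚ.+-0-commutativeMonoid {k} (λ _ → 1) ≡ k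
   go zero = refl
   go (suc k) = cong suc (go k)

 -- The Iverson bracket, so that points are counted by summation.
 [_] : ∀ {P : Set} → Dec P → ℕ
 [ yes _ ] = 1
 [ no _ ] = 0

 []-yes : ∀ {P : Set} (d : Dec P) → P → [ d ] ≡ 1
 []-yes (yes _) _ = refl
 []-yes (no ¬p) p = ⊥-elim (¬p p)

 []-no : ∀ {P : Set} (d : Dec P) → ¬ P → [ d ] ≡ 0
 []-no (yes p) ¬p = ⊥-elim (¬p p)
 []-no (no _) _ = refl

 Sumℕ-δ : ∀ a → Sumℕ (λ x → [ x ≟F a ]) ≡ 1
 Sumℕ-δ a = go p a
   where
   sumℕ = MonoidSums.sum ℕₚ.+-0-commutativeMonoid
   zeros : ∀ k (t : Fin k → ℕ) → (∀ i → t i ≡ 0) → sumℕ t ≡ 0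
   zeros zero t e = refl
   zeros (suc k) t e = cong₂ ℕ._+_ (e zero) (zeros k (λ i → t (suc i)) (λ i → e (suc i)))
   go : ∀ k (a : Fin k) → sumℕ (λ x → [ x Finₚ.≟ a ]) ≡ 1
   go (suc k) zero = cong suc (zeros k _ (λ i → []-no (suc i Finₚ.≟ zero) (λ ())))
   go (suc k) (suc a) = trans (MonoidSums.sum-cong-≗ ℕₚ.+-0-commutativeMonoid {k} {λ i → [ suc i Finₚ.≟ suc a ]} {λ i → [ i Finₚ.≟ a ]} (λ i → suc-≟ i a)) (go k a)
     where
     suc-≟ : ∀ {k} (i j : Fin k) → [ suc i Finₚ.≟ suc j ] ≡ [ i Finₚ.≟ j ]
     suc-≟ i j with i Finₚ.≟ j
     ... | yes _ = refl
     ... | no _ = refl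

 Sum-1 : Sum (λ _ → 1#) ≡ 0#
 Sum-1 = trans (Sum-cong (λ _ → sym nat-1)) (trans (sym (nat-Sumℕ (λ _ → 1))) (trans (cong nat Sumℕ-1) nat-p))

 Sum-δ : ∀ a (t : F → F) → Sum (λ x → nat [ x ≟F a ] * t x) ≡ t a
 Sum-δ a t = trans (Sum-cong pointwise) (trans (Sum-* (t a) (λ x → nat [ x ≟F a ])) (trans (cong (t a *_) (trans (sym (nat-Sumℕ (λ x → [ x ≟F a ]))) (trans (cong nat (Sumℕ-δ a)) nat-1))) (*-identityʳ _)))
   where
   pointwise : ∀ x → nat [ x ≟F a ] * t x ≡ t a * nat [ x ≟F a ]
   pointwise x with x ≟F a
   ... | yes refl = *-comm _ _
   ... | no _ = trans (trans (cong (_* t x) nat-0) (zeroˡ _)) (sym (trans (cong (t a *_) nat-0) (zeroʳ _)))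

 x^[p-1] : ∀ x → x ^ (p ℕ.∸ 1) ≡ 1# - nat [ x ≟F 0# ]
 x^[p-1] x with x ≟F 0#
 ... | yes refl = trans (0^ (ℕₚ.m<n⇒0<n∸m 1<p)) (sym (trans (cong (λ y → 1# - y) nat-1) (-‿inverseʳ 1#)))
   where
 ... | no x≢0 = trans (fermat′ x≢0) (sym (trans (cong (λ y → 1# - y) nat-0) (solve 0 (# 1 :- # 0 := # 1) refl)))

 -- Multiplication by g ≠ 0 permutes the field and multiplies the sum by g^e. Some g has g^e ≠ 1,
 -- since X^(e+1) - X has degree below p and cannot vanish everywhere.
 power-sum : ∀ e → e ℕ.< p ℕ.∸ 1 → Sum (_^ e) ≡ 0#
 power-sum zero _ = Sum-1
 power-sum (suc e) e< with Finₚ.any? (λ g → Decidable._×-dec_ (Decidable.¬? (g ≟F 0#)) (Decidable.¬? (g ^ suc e ≟F 1#)))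
 ... | yes (g , g≢0 , g^e≢1) = [ (λ z → ⊥-elim (g^e≢1 (x-y≡0⇒x≡y z))) , (λ z → z) ]′ (x*y≡0 {g ^ suc e - 1#} {Sum (_^ suc e)} (trans (solve 2 (λ a s → (a :- # 1) :* s := a :* s :- s) refl (g ^ suc e) (Sum (_^ suc e))) (trans (cong (_- Sum (_^ suc e)) scaled) (-‿inverseʳ _))))
   where
   scaled : g ^ suc e * Sum (_^ suc e) ≡ Sum (_^ suc e)
   scaled = trans (sym (Sum-* (g ^ suc e) (_^ suc e))) (trans (Sum-cong (λ x → sym (^-distrib-* g x (suc e)))) (sym (Sum-perm (g *_) (inv g *_) (λ x → trans (sym (*-assoc g (inv g) x)) (trans (cong (_* x) (*-inv g≢0)) (*-identityˡ x))) (λ x → trans (sym (*-assoc (inv g) g x)) (trans (cong (_* x) (trans (*-comm (inv g) g) (*-inv g≢0))) (*-identityˡ x))) (_^ suc e))))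
 ... | no none = ⊥-elim (1≢0 (trans (sym coefficient) (at f≋0 (suc (suc e)))))
   where
   f : Pl
   f = X ^P suc (suc e) ⊕ ⊝ X
   coefficient : cf f (suc (suc e)) ≡ 1#
   coefficient = trans (cf-⊕ (X ^P suc (suc e)) (⊝ X) (suc (suc e))) (trans (cong₂ _+_ (trans (sym (at (P.*-identityʳ (X ^P suc (suc e))) (suc (suc e)))) (trans (cong (cf (X ^P suc (suc e) ⊗ C 1#)) (sym (ℕₚ.+-identityʳ (suc (suc e))))) (trans (cf-X^⊗-≥ (suc (suc e)) (C 1#) 0) (cf-C-0 1#)))) (trans (cf-⊝ X (suc (suc e))) (cong (λ y → - y) (Below-X (suc (suc e)) (ℕ.s≤s (ℕ.s≤s ℕ.z≤n)))))) (solve 0 (# 1 :+ (:- # 0) := # 1) refl))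
   all-roots : ∀ as → All (Root f) as
   all-roots [] = []
   all-roots (a ∷ as) = root a ∷ all-roots as
     where
     root : ∀ a → Root f a
     root a = trans (trans (E.ev-⊕ (X ^P suc (suc e)) (⊝ X) a) (cong₂ _+_ (trans (E.ev-^ X (suc (suc e)) a) (cong (_^ suc (suc e)) (E.ev-X a))) (trans (E.ev-⊝ X a) (cong (λ y → - y) (E.ev-X a))))) (case (a ≟F 0#))
       where
       case : Dec (a ≡ 0#) → a * a ^ suc e + - a ≡ 0#
       case (yes z) = trans (cong (λ y → y * a ^ suc e + - y) z) (trans (cong (_+ - 0#) (zeroˡ _)) (solve 0 (# 0 :+ (:- # 0) := # 0) refl))
       case (no nz) with a ^ suc e ≟F 1#
       ... | yes one = trans (cong (λ y → a * y + - a) one) (trans (cong (_+ - a) (*-identityʳ a)) (-‿inverseʳ a))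
       ... | no ne = ⊥-elim (none (a , nz , ne))
   f≋0 : f ≋ []
   f≋0 = Below-too-many-roots {allF} (suc (suc (suc e))) f (Below-⊕ (X ^P suc (suc e)) (⊝ X) (λ i le → Below-^ X Below-X (suc (suc e)) i (≤-trans (≤-reflexive (cong suc (ℕₚ.*-identityʳ (suc (suc e))))) le)) (λ i le → trans (cf-⊝ X i) (trans (cong (λ y → - y) (Below-X i (≤-trans (ℕ.s≤s (ℕ.s≤s ℕ.z≤n)) le))) (solve 0 (:- # 0 := # 0) refl)))) (Uniqueₚ.allFin⁺ p) (all-roots allF) (≤-trans (ℕ.s≤s e<) (≤-reflexive (trans suc-pred-p (sym (Listₚ.length-tabulate {n = p} (λ i → i))))))

 -- Pascal's rule lowers b.
 beta-sum : ∀ b j → b ℕ.< p ℕ.∸ 1 → j ℕ.≤ p ℕ.∸ 1 → Sum (λ x → x ^ (p ℕ.∸ 1 ℕ.∸ j) * (1# - x) ^ b) ≡ - ((- 1#) ^ j * nat (b choose j))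
 -- For j = 0 the power x^(p - 1) is the indicator function of x ≠ 0, which `power-sum` does not
 -- cover.
 beta-sum zero zero _ _ = trans (Sum-cong (λ x → trans (*-identityʳ _) (x^[p-1] x))) (trans (Sum-- (λ _ → 1#) (λ x → nat [ x ≟F 0# ])) (trans (cong₂ (λ a b → a - b) Sum-1 (trans (sym (nat-Sumℕ (λ x → [ x ≟F 0# ]))) (trans (cong nat (Sumℕ-δ 0#)) nat-1))) (trans (solve 0 (# 0 :- # 1 := :- (# 1 :* # 1)) refl) (cong (λ y → - (1# * y)) (sym nat-1)))))
 beta-sum zero (suc j) _ j≤ = trans (Sum-cong (λ x → *-identityʳ _)) (trans (power-sum (p ℕ.∸ 1 ℕ.∸ suc j) (ℕₚ.∸-monoʳ-< {p ℕ.∸ 1} {suc j} {0} (ℕ.s≤s ℕ.z≤n) j≤)) (trans (solve 1 (λ y → # 0 := :- (y :* # 0)) refl ((- 1#) ^ suc j)) (cong (λ y → - ((- 1#) ^ suc j * y)) (sym (trans (cong nat (k>n⇒nCk≡0 {0} {suc j} (ℕ.s≤s ℕ.z≤n))) nat-0)))))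
 beta-sum (suc b) zero b< _ = trans (Sum-cong pointwise) (trans (Sum-- (λ x → (1# - x) ^ suc b) (λ x → nat [ x ≟F 0# ] * (1# - x) ^ suc b)) (trans (cong₂ (λ a b → a - b) reflected (trans (Sum-δ 0# (λ x → (1# - x) ^ suc b)) (trans (cong (_^ suc b) (solve 0 (# 1 :- # 0 := # 1) refl)) (1^n≈1 (suc b))))) (trans (solve 0 (# 0 :- # 1 := :- (# 1 :* # 1)) refl) (cong (λ y → - (1# * y)) (sym nat-1)))))
   where
   pointwise : ∀ x → x ^ (p ℕ.∸ 1) * (1# - x) ^ suc b ≡ (1# - x) ^ suc b - nat [ x ≟F 0# ] * (1# - x) ^ suc b
   pointwise x = trans (cong (_* (1# - x) ^ suc b) (x^[p-1] x)) (solve 2 (λ d y → (# 1 :- d) :* y := y :- d :* y) refl (nat [ x ≟F 0# ]) ((1# - x) ^ suc b))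
   reflected : Sum (λ x → (1# - x) ^ suc b) ≡ 0#
   reflected = trans (sym (Sum-perm (λ x → 1# - x) (λ x → 1# - x) 1-1-x 1-1-x (_^ suc b))) (power-sum (suc b) b<)
     where
     1-1-x : ∀ x → 1# - (1# - x) ≡ x
     1-1-x = solve 1 (λ x → # 1 :- (# 1 :- x) := x) refl
 beta-sum (suc b) (suc j) b< j≤ = trans (Sum-cong pointwise) (trans (Sum-- (λ x → x ^ (p ℕ.∸ 1 ℕ.∸ suc j) * (1# - x) ^ b) (λ x → x ^ (p ℕ.∸ 1 ℕ.∸ j) * (1# - x) ^ b)) (trans (cong₂ (λ y z → y - z) (beta-sum b (suc j) (<-trans ≤-refl b<) j≤) (beta-sum b j (<-trans ≤-refl b<) (<⇒≤ j≤)))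
   (trans (solve 3 (λ s x y → :- ((:- # 1) :* s :* x) :- (:- (s :* y)) := :- ((:- # 1) :* s :* (y :+ x))) refl ((- 1#) ^ j) (nat (b choose suc j)) (nat (b choose j))) (cong (λ y → - ((- 1#) ^ suc j * y)) (trans (sym (nat-+ (b choose j) (b choose suc j))) (cong nat (nCk+nC[k+1]≡[n+1]C[k+1] b j)))))))
   where
   pointwise : ∀ x → x ^ (p ℕ.∸ 1 ℕ.∸ suc j) * (1# - x) ^ suc b ≡ x ^ (p ℕ.∸ 1 ℕ.∸ suc j) * (1# - x) ^ b - x ^ (p ℕ.∸ 1 ℕ.∸ j) * (1# - x) ^ b
   pointwise x = trans (solve 3 (λ x a y → a :* ((# 1 :- x) :* y) := a :* y :- (x :* a) :* y) refl x (x ^ (p ℕ.∸ 1 ℕ.∸ suc j)) ((1# - x) ^ b)) (cong (λ k → x ^ (p ℕ.∸ 1 ℕ.∸ suc j) * (1# - x) ^ b - x ^ k * (1# - x) ^ b) (sym (ℕₚ.+-∸-assoc 1 j≤)))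

 [1+k]*nC[1+k] : ∀ n k → nat (suc k) * nat (n choose suc k) ≡ (nat n - nat k) * nat (n choose k)
 [1+k]*nC[1+k] n k = trans (solve 3 (λ k x y → (# 1 :+ k) :* y := ((# 1 :+ k) :* (x :+ y)) :- (# 1 :+ k) :* x) refl (nat k) (nat (n choose k)) (nat (n choose suc k)) ⟪ cong (_* nat (n choose suc k)) (sym (nat-suc k)) ⟫) (trans (cong (_- (1# + nat k) * nat (n choose k)) pascal) (trans (cong (λ y → y * nat (n choose k) - (1# + nat k) * nat (n choose k)) (nat-suc n)) (solve 3 (λ n k x → (# 1 :+ n) :* x :- (# 1 :+ k) :* x := (n :- k) :* x) refl (nat n) (nat k) (nat (n choose k)))))
   where
   _⟪_⟫ : ∀ {x y z : F} → x ≡ z → x ≡ y → y ≡ z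
   e ⟪ e' ⟫ = trans (sym e') e
   pascal : (1# + nat k) * (nat (n choose k) + nat (n choose suc k)) ≡ nat (suc n) * nat (n choose k)
   pascal = trans (cong₂ _*_ (sym (nat-suc k)) (trans (sym (nat-+ (n choose k) (n choose suc k))) (cong nat (nCk+nC[k+1]≡[n+1]C[k+1] n k)))) (trans (sym (nat-* (suc k) (suc n choose suc k))) (trans (cong nat ([1+k]*[1+n]C[1+k]≡[1+n]*nCk n k)) (nat-* (suc n) (n choose k))))

 [1+n]*nCk : ∀ n k → nat (suc n) * nat (n choose k) ≡ (nat (suc n) - nat k) * nat (suc n choose k)
 [1+n]*nCk n k = trans (trans (sym (nat-* (suc n) (n choose k))) (trans (cong nat (sym ([1+k]*[1+n]C[1+k]≡[1+n]*nCk n k))) (nat-* (suc k) (suc n choose suc k)))) ([1+k]*nC[1+k] (suc n) k)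

 sum-toℕ : ∀ k t → Sums.sum semiring {suc k} (λ i → t (toℕ i)) ≡ Σ≤ k t
 sum-toℕ zero t = +-identityʳ _
 sum-toℕ (suc k) t = trans (cong (t 0 +_) (sum-toℕ k (λ i → t (suc i)))) (sym (Σ≤-shift self k t))

 nat-∸ : ∀ {m n} → n ℕ.≤ m → nat (m ℕ.∸ n) ≡ nat m - nat n
 nat-∸ {m} {n} n≤m = trans (solve 2 (λ k n → k := (n :+ k) :- n) refl (nat (m ℕ.∸ n)) (nat n)) (cong (_- nat n) (trans (sym (nat-+ n (m ℕ.∸ n))) (cong nat (m+[n∸m]≡n n≤m))))

 -- Where the weight is nonzero every orbit has two elements, and the order of representatives
 -- selects one of them.
 involution-even : ∀ (i : F → ℕ) (τ : F → F) → (∀ x → τ (τ x) ≡ x) → (∀ x → i (τ x) ≡ i x) → (∀ x → i x ≡ 0 ⊎ x ≢ τ x) → ∃ λ k → Sumℕ i ≡ k ℕ.+ k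
 involution-even i τ ττ iτ fp = Sumℕ small , trans (Sumℕ-cong split) (trans (Sumℕ-+ small large) (cong (Sumℕ small ℕ.+_) (trans (Sumℕ-perm τ τ ττ ττ large) (Sumℕ-cong swap))))
   where
   small large : F → ℕ
   small x = i x ℕ.* [ toℕ x ℕ.<? toℕ (τ x) ]
   large x = i x ℕ.* [ toℕ (τ x) ℕ.<? toℕ x ]
   split : ∀ x → i x ≡ small x ℕ.+ large x
   split x = [ (λ z → trans z (sym (cong₂ ℕ._+_ (cong (ℕ._* [ toℕ x ℕ.<? toℕ (τ x) ]) z) (cong (ℕ._* [ toℕ (τ x) ℕ.<? toℕ x ]) z)))) , cases ]′ (fp x)
     where
     cases : x ≢ τ x → i x ≡ small x ℕ.+ large x
     cases ne = [ (λ lt → sym (trans (cong₂ (λ a b → i x ℕ.* a ℕ.+ i x ℕ.* b) ([]-yes (toℕ x ℕ.<? toℕ (τ x)) lt) ([]-no (toℕ (τ x) ℕ.<? toℕ x) (ℕₚ.<⇒≯ lt))) (trans (cong₂ ℕ._+_ (ℕₚ.*-identityʳ (i x)) (ℕₚ.*-zeroʳ (i x))) (ℕₚ.+-identityʳ (i x)))))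
                , (λ lt → sym (trans (cong₂ (λ a b → i x ℕ.* a ℕ.+ i x ℕ.* b) ([]-no (toℕ x ℕ.<? toℕ (τ x)) (ℕₚ.<⇒≯ lt)) ([]-yes (toℕ (τ x) ℕ.<? toℕ x) lt)) (cong₂ ℕ._+_ (ℕₚ.*-zeroʳ (i x)) (ℕₚ.*-identityʳ (i x))))) ]′ (compare (ℕₚ.<-cmp (toℕ x) (toℕ (τ x))))
       where
       compare : Tri (toℕ x ℕ.< toℕ (τ x)) (toℕ x ≡ toℕ (τ x)) (toℕ (τ x) ℕ.< toℕ x) → (toℕ x ℕ.< toℕ (τ x)) ⊎ (toℕ (τ x) ℕ.< toℕ x)
       compare (tri< lt _ _) = inj₁ lt
       compare (tri≈ _ e _) = ⊥-elim (ne (Finₚ.toℕ-injective e))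
       compare (tri> _ _ gt) = inj₂ gt
   swap : ∀ x → large (τ x) ≡ small x
   swap x = cong₂ ℕ._*_ (iτ x) (cong (λ y → [ toℕ y ℕ.<? toℕ (τ x) ]) (ττ x))

 -- The points of y² = x(x² + 2x + b).

 module CharacterSum₂ (n : ℕ) (p≡ : p ≡ suc (n ℕ.+ n)) (data₂ : FamilyData) (g≡ : nat 16 * FamilyData.g data₂ ≡ nat 3)
   (degree : (2 ℕ.* FamilyData.m data₂ ℕ.+ FamilyData.ν data₂) ℕ.* 2 ℕ.≤ n) where
   open OddPrime n p≡
   open FamilyData data₂ using (m; ν; g)
   open Family data₂ using (ψ; d; d-rec; d-0; ψ-below)

   private
     Dₖ : ℕ → F
     Dₖ k = nat (n choose k) * nat ((n ℕ.∸ k) choose k)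

     -- As n ≡ -1/2 modulo p, (n - 2k)(n - 2k - 1) = 4(k² + k + 3/16): the multinomial coefficients
     -- n!/(k! k! (n - 2k)!) satisfy the recursion of ψ up to the factor 4.
     D-rec : ∀ k → k ℕ.< n → nat (suc k) * nat (suc k) * Dₖ (suc k) ≡ nat 4 * (nat k * nat k + nat k + g) * Dₖ k
     D-rec k k<n = begin′
       where
       N : ℕ
       N = n ℕ.∸ suc k
       sN : suc N ≡ n ℕ.∸ k
       sN = sym (ℕₚ.+-∸-assoc 1 k<n)
       natN : nat N ≡ nat n - (1# + nat k)
       natN = trans (nat-∸ k<n) (cong (λ y → nat n - y) (nat-suc k))
       natsN : nat (suc N) ≡ nat n - nat k
       natsN = trans (cong nat sN) (nat-∸ (<⇒≤ k<n))
       x y : F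
       x = nat (n choose k)
       y = nat ((n ℕ.∸ k) choose k)
       y' : (nat n - nat k) * nat (N choose k) ≡ (nat n - nat k - nat k) * y
       y' = trans (cong (_* nat (N choose k)) (sym natsN)) (trans ([1+n]*nCk N k) (cong₂ _*_ (cong (_- nat k) natsN) (cong (λ z → nat (z choose k)) sN)))
       quadratic : (nat n - nat k - nat k) * (nat n - (1# + nat k) - nat k) ≡ nat 4 * (nat k * nat k + nat k + g)
       quadratic = *-cancelˡ 4≢0 (trans (solve 2 (λ n k → # 4 :* ((n :- k :- k) :* (n :- (# 1 :+ k) :- k)) := (# 2 :* n :- # 4 :* k) :* (# 2 :* n :- # 4 :* k :- # 2)) refl (nat n) (nat k)) (trans (cong (λ t → (t - nat 4 * nat k) * (t - nat 4 * nat k - nat 2)) 2n≡-1) (trans (solve 1 (λ k → (:- # 1 :- # 4 :* k) :* (:- # 1 :- # 4 :* k :- # 2) := # 16 :* (k :* k :+ k) :+ # 3) refl (nat k)) (trans (cong (nat 16 * (nat k * nat k + nat k) +_) (sym g≡)) (solve 2 (λ k g → # 16 :* (k :* k :+ k) :+ # 16 :* g := # 4 :* (# 4 :* (k :* k :+ k :+ g))) refl (nat k) g)))))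
       begin′ : nat (suc k) * nat (suc k) * Dₖ (suc k) ≡ nat 4 * (nat k * nat k + nat k + g) * Dₖ k
       begin′ = trans (solve 3 (λ k a b → k :* k :* (a :* b) := (k :* a) :* (k :* b)) refl (nat (suc k)) (nat (n choose suc k)) (nat (N choose suc k)))
         (trans (cong₂ _*_ ([1+k]*nC[1+k] n k) (trans ([1+k]*nC[1+k] N k) (cong (λ z → (z - nat k) * nat (N choose k)) natN)))
         (trans (solve 4 (λ a x b c → (a :* x) :* (b :* c) := x :* b :* (a :* c)) refl (nat n - nat k) x (nat n - (1# + nat k) - nat k) (nat (N choose k)))
         (trans (cong (x * (nat n - (1# + nat k) - nat k) *_) y')
         (trans (solve 4 (λ x b a y → x :* b :* (a :* y) := (a :* b) :* (x :* y)) refl x (nat n - (1# + nat k) - nat k) (nat n - nat k - nat k) y)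
         (cong (_* (x * y)) quadratic)))))

     D≡4ᵏd : ∀ k → k ℕ.≤ n → Dₖ k ≡ nat 4 ^ k * d k
     D≡4ᵏd zero _ = trans (cong₂ _*_ nat-1 nat-1) (cong (1# *_) (sym d-0))
     D≡4ᵏd (suc k) k<n = *-cancelˡ (x*y≢0 k≢0 k≢0) (trans (D-rec k k<n) (trans (cong (nat 4 * (nat k * nat k + nat k + g) *_) (D≡4ᵏd k (<⇒≤ k<n))) (trans (solve 4 (λ a q e d → a :* q :* (e :* d) := a :* e :* (q :* d)) refl (nat 4) (nat k * nat k + nat k + g) (nat 4 ^ k) (d k)) (trans (cong (nat 4 * nat 4 ^ k *_) (sym (d-rec k))) (solve 4 (λ a e s d → a :* e :* (s :* s :* d) := s :* s :* (a :* e :* d)) refl (nat 4) (nat 4 ^ k) (nat (suc k)) (d (suc k)))))))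
       where
       k≢0 : nat (suc k) ≢ 0#
       k≢0 = nat≢0 (ℕ.s≤s ℕ.z≤n) (≤-<-trans k<n n<p)

     J : ℕ → F
     J k = Sum (λ x → x ^ (n ℕ.+ n ℕ.∸ k) * (x + nat 2) ^ (n ℕ.∸ k))

     -2≢0 : - nat 2 ≢ 0#
     -2≢0 e = 2≢0 (trans (solve 0 (# 2 := :- (:- # 2)) refl) (trans (cong (λ y → - y) e) (solve 0 (:- # 0 := # 0) refl)))

     -- The substitution x ↦ -2x turns x + 2 into 2(1 - x) and `J` into a beta sum. The powers of 2
     -- collected on the way simplify by (-2)^(p - 1) = 1.
     J-value : ∀ k → k ℕ.≤ n → nat 4 ^ k * J k ≡ - (nat 2 ^ n * nat ((n ℕ.∸ k) choose k))
     J-value k k≤n = trans (cong (nat 4 ^ k *_) (trans (Sum-perm (- nat 2 *_) (inv (- nat 2) *_) (λ x → trans (sym (*-assoc _ _ x)) (trans (cong (_* x) (*-inv -2≢0)) (*-identityˡ x))) (λ x → trans (sym (*-assoc _ _ x)) (trans (cong (_* x) (trans (*-comm _ _) (*-inv -2≢0))) (*-identityˡ x))) _) (trans (Sum-cong pointwise) (trans (Sum-* (A * B) _) (cong (A * B *_) beta)))))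
       (trans (cong (_* (A * B * - ((- 1#) ^ k * c))) 4ᵏ) (trans (solve 6 (λ t s A B e c → t :* s :* (A :* B :* (:- (e :* c))) := :- (((e :* t) :* A) :* (s :* B) :* c)) refl (nat 2 ^ k) (nat 2 ^ k) A B ((- 1#) ^ k) c) (trans (cong (λ y → - (y * (nat 2 ^ k * B) * c)) one) (trans (cong (λ y → - (1# * y * c)) (trans (sym (^-homo-* (nat 2) k (n ℕ.∸ k))) (cong (nat 2 ^_) (m+[n∸m]≡n k≤n)))) (cong (λ y → - (y * c)) (*-identityˡ _))))))
       where
       A B c : F
       A = (- nat 2) ^ (n ℕ.+ n ℕ.∸ k)
       B = nat 2 ^ (n ℕ.∸ k)
       c = nat ((n ℕ.∸ k) choose k)
       k≤2n : k ℕ.≤ n ℕ.+ n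
       k≤2n = ≤-trans k≤n (m≤m+n n n)
       pointwise : ∀ x → (- nat 2 * x) ^ (n ℕ.+ n ℕ.∸ k) * (- nat 2 * x + nat 2) ^ (n ℕ.∸ k) ≡ A * B * (x ^ (n ℕ.+ n ℕ.∸ k) * (1# - x) ^ (n ℕ.∸ k))
       pointwise x = trans (cong₂ _*_ (^-distrib-* (- nat 2) x (n ℕ.+ n ℕ.∸ k)) (trans (cong (_^ (n ℕ.∸ k)) (solve 1 (λ x → (:- # 2) :* x :+ # 2 := # 2 :* (# 1 :- x)) refl x)) (^-distrib-* (nat 2) (1# - x) (n ℕ.∸ k)))) (solve 4 (λ a b c d → a :* b :* (c :* d) := a :* c :* (b :* d)) refl A (x ^ (n ℕ.+ n ℕ.∸ k)) B ((1# - x) ^ (n ℕ.∸ k)))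
       beta : Sum (λ x → x ^ (n ℕ.+ n ℕ.∸ k) * (1# - x) ^ (n ℕ.∸ k)) ≡ - ((- 1#) ^ k * c)
       beta = trans (Sum-cong (λ x → cong (λ e → x ^ (e ℕ.∸ k) * (1# - x) ^ (n ℕ.∸ k)) (sym p-1))) (beta-sum (n ℕ.∸ k) k (subst (n ℕ.∸ k ℕ.<_) (sym p-1) (≤-<-trans (m∸n≤m n k) (ℕₚ.m<m+n n 0<n))) (subst (k ℕ.≤_) (sym p-1) k≤2n))
       4ᵏ : nat 4 ^ k ≡ nat 2 ^ k * nat 2 ^ k
       4ᵏ = trans (cong (_^ k) (solve 0 (# 4 := # 2 :* # 2) refl)) (^-distrib-* (nat 2) (nat 2) k)
       one : (- 1#) ^ k * nat 2 ^ k * A ≡ 1#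
       one = trans (cong (_* A) (trans (sym (^-distrib-* (- 1#) (nat 2) k)) (cong (_^ k) (solve 0 ((:- # 1) :* # 2 := :- # 2) refl)))) (trans (sym (^-homo-* (- nat 2) k (n ℕ.+ n ℕ.∸ k))) (trans (cong ((- nat 2) ^_) (trans (m+[n∸m]≡n k≤2n) (sym p-1))) (fermat′ -2≢0)))

   -- Binomial expansion of x^n (b + x(x + 2))^n in powers of b, followed by summation over x: the
   -- Hasse invariant of the curve is ψ(b) up to a unit.
   character-sum : ∀ b → Sum (λ x → (x * (x * x + nat 2 * x + b)) ^ n) ≡ - (nat 2 ^ n) * E.ev ψ b
   character-sum b = trans (Sum-cong pointwise) (trans (Sums.∑-comm semiring {p} {suc n} (λ x k → s x (toℕ k))) (trans (sum-toℕ n (λ k → Sum (λ x → s x k))) (trans (Σ≤-cong n {λ k → Sum (λ x → s x k)} term-value) (trans (sym (*-distribˡ-Σ≤ n (- (nat 2 ^ n)) (λ k → d k * b ^ k))) (cong (- (nat 2 ^ n) *_) (sym (ev-coeffs self n ψ b (Below-mono ψ (ℕ.s≤s I≤n) ψ-below))))))))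
     where
     I≤n : 2 ℕ.* m ℕ.+ ν ℕ.≤ n
     I≤n = ≤-trans (ℕₚ.m≤m*n (2 ℕ.* m ℕ.+ ν) 2) degree
     s : F → ℕ → F
     s x k = nat (n choose k) * b ^ k * (x ^ n * (x * (x + nat 2)) ^ (n ℕ.∸ k))
     pointwise : ∀ x → (x * (x * x + nat 2 * x + b)) ^ n ≡ Sums.sum semiring {suc n} (λ k → s x (toℕ k))
     pointwise x = trans (cong (_^ n) (solve 2 (λ x b → x :* (x :* x :+ # 2 :* x :+ b) := x :* (b :+ x :* (x :+ # 2))) refl x b)) (trans (^-distrib-* x _ n) (trans (cong (x ^ n *_) (Binomial.theorem (CommutativeRing.commutativeSemiring 𝔽) n b (x * (x + nat 2)))) (trans (Sums.*-distribˡ-sum semiring {suc n} (x ^ n) (Binomial.binomialTerm (CommutativeRing.commutativeSemiring 𝔽) b (x * (x + nat 2)) n)) (Sums.sum-cong-≗ semiring {suc n} (λ k → trans (cong (x ^ n *_) (×≈nat* (n choose toℕ k) _)) (solve 4 (λ a c e f → a :* (c :* (e :* f)) := c :* e :* (a :* f)) refl (x ^ n) (nat (n choose toℕ k)) (b ^ toℕ k) ((x * (x + nat 2)) ^ (n ℕ.∸ toℕ k))))))))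
     term-value : ∀ k → k ℕ.≤ n → Sum (λ x → s x k) ≡ - (nat 2 ^ n) * (d k * b ^ k)
     term-value k k≤n = trans (Sum-* (nat (n choose k) * b ^ k) _) (trans (cong (nat (n choose k) * b ^ k *_) (Sum-cong (λ x → trans (cong (x ^ n *_) (^-distrib-* x (x + nat 2) (n ℕ.∸ k))) (trans (sym (*-assoc _ _ _)) (cong (_* (x + nat 2) ^ (n ℕ.∸ k)) (trans (sym (^-homo-* x n (n ℕ.∸ k))) (cong (x ^_) (sym (ℕₚ.+-∸-assoc n k≤n)))))))))
       (*-cancelˡ (x^n≢0 4≢0 k) (trans (solve 4 (λ a c b j → a :* (c :* b :* j) := c :* b :* (a :* j)) refl (nat 4 ^ k) (nat (n choose k)) (b ^ k) (J k)) (trans (cong (nat (n choose k) * b ^ k *_) (J-value k k≤n)) (trans (solve 4 (λ c b t e → c :* b :* (:- (t :* e)) := (:- t) :* (b :* (c :* e))) refl (nat (n choose k)) (b ^ k) (nat 2 ^ n) (nat ((n ℕ.∸ k) choose k))) (trans (cong (λ y → - (nat 2 ^ n) * (b ^ k * y)) (D≡4ᵏd k k≤n)) (solve 4 (λ t b a d → t :* (b :* (a :* d)) := a :* (t :* (d :* b))) refl (- (nat 2 ^ n)) (b ^ k) (nat 4 ^ k) (d k))))))))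

   -- Supersingularity makes x(x + 1 + v)(x + 1 - v) equally often a square and a non-square, namely (p - 3)/2 times.
   -- That number is even, as the involution x ↦ (1 - v²)/x has no fixed point among the non-squares (after twisting by 1 + v).
   supersingular⇒n-odd : ∀ v → v ≢ 0# → 1# - v * v ≢ 0# → E.ev ψ (1# - v * v) ≡ 0# → ∀ j → n ≢ j ℕ.+ j
   supersingular⇒n-odd v v≢0 b≢0 ψb j n≡ = parity (proj₁ even) j (trans (sym n≡) n-value)
     where
     b : F
     b = 1# - v * v
     γ : F → F
     γ x = (1# + v) * (x * (x * x + nat 2 * x + b))
     χ : F → F
     χ x = γ x ^ n
     Sumχ : Sum χ ≡ 0#
     Sumχ = trans (Sum-cong (λ x → ^-distrib-* (1# + v) _ n)) (trans (Sum-* ((1# + v) ^ n) _) (trans (cong ((1# + v) ^ n *_) (trans (character-sum b) (trans (cong (- (nat 2 ^ n) *_) ψb) (zeroʳ _)))) (zeroʳ _)))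
     1+v≢0 : 1# + v ≢ 0#
     1+v≢0 e = b≢0 (trans (solve 1 (λ v → # 1 :- v :* v := (# 1 :+ v) :* (# 1 :- v)) refl v) (trans (cong (_* (1# - v)) e) (zeroˡ _)))
     1-v≢0 : 1# - v ≢ 0#
     1-v≢0 e = b≢0 (trans (solve 1 (λ v → # 1 :- v :* v := (# 1 :- v) :* (# 1 :+ v)) refl v) (trans (cong (_* (1# + v)) e) (zeroˡ _)))
     r₁ r₂ : F
     r₁ = - (1# + v)
     r₂ = - (1# - v)
     neg≢0 : ∀ {x} → x ≢ 0# → - x ≢ 0#
     neg≢0 {x} x≢0 e = x≢0 (trans (solve 1 (λ x → x := :- (:- x)) refl x) (trans (cong (λ y → - y) e) (solve 0 (:- # 0 := # 0) refl)))
     r₁≢r₂ : r₁ ≢ r₂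
     r₁≢r₂ e = x*y≢0 2≢0 v≢0 (trans (solve 1 (λ v → # 2 :* v := (:- (# 1 :- v)) :- (:- (# 1 :+ v))) refl v) (trans (cong (_- r₁) (sym e)) (-‿inverseʳ r₁)))
     γ-factor : ∀ x → γ x ≡ (1# + v) * (x * ((x - r₁) * (x - r₂)))
     γ-factor x = solve 2 (λ x v → (# 1 :+ v) :* (x :* (x :* x :+ # 2 :* x :+ (# 1 :- v :* v))) := (# 1 :+ v) :* (x :* ((x :- (:- (# 1 :+ v))) :* (x :- (:- (# 1 :- v)))))) refl x v
     N⁺ N⁻ N⁰ : F → ℕ
     N⁺ x = [ χ x ≟F 1# ]
     N⁻ x = [ χ x ≟F - 1# ]
     N⁰ x = [ x ≟F 0# ] ℕ.+ ([ x ≟F r₁ ] ℕ.+ [ x ≟F r₂ ])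
     0^n : 0# ^ n ≡ 0#
     0^n = go 0<n
       where
       go : ∀ {k} → 0 ℕ.< k → 0# ^ k ≡ 0#
       go {suc k} _ = zeroˡ _
     0≢±1 : ∀ {y} → y ≡ 0# → (y ≢ 1#) × (y ≢ - 1#)
     0≢±1 refl = (λ e → 1≢0 (sym e)) , (λ e → neg≢0 1≢0 (sym e))
     χ≡0 : ∀ x → γ x ≡ 0# → χ x ≡ 0#
     χ≡0 x e = trans (cong (_^ n) e) 0^n
     χ² : ∀ x → γ x ≢ 0# → χ x ≡ 1# ⊎ χ x ≡ - 1#
     χ² x ne = [ (λ e → inj₁ (x-y≡0⇒x≡y e)) , (λ e → inj₂ (trans (solve 1 (λ y → y := (y :+ # 1) :- # 1) refl (χ x)) (trans (cong (_- 1#) e) (+-identityˡ _)))) ]′ (x*y≡0 {χ x - 1#} {χ x + 1#} (trans (solve 1 (λ y → (y :- # 1) :* (y :+ # 1) := y :* y :- # 1) refl (χ x)) (trans (cong (_- 1#) (trans (sym (^-distrib-* (γ x) (γ x) n)) (square⇒^n ne))) (-‿inverseʳ 1#))))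
     γ-zero : ∀ x → x ≢ 0# → x ≢ r₁ → x ≢ r₂ → γ x ≢ 0#
     γ-zero x a b c e = x*y≢0 1+v≢0 (x*y≢0 a (x*y≢0 (λ z → b (x-y≡0⇒x≡y z)) (λ z → c (x-y≡0⇒x≡y z)))) (trans (sym (γ-factor x)) e)
     γ-0 : γ 0# ≡ 0#
     γ-0 = solve 2 (λ v b → (# 1 :+ v) :* (# 0 :* (# 0 :* # 0 :+ # 2 :* # 0 :+ b)) := # 0) refl v b
     γ-r₁ : γ r₁ ≡ 0#
     γ-r₁ = trans (γ-factor r₁) (solve 3 (λ v r s → (# 1 :+ v) :* (r :* ((r :- r) :* s)) := # 0) refl v r₁ (r₁ - r₂))
     γ-r₂ : γ r₂ ≡ 0#
     γ-r₂ = trans (γ-factor r₂) (solve 3 (λ v r s → (# 1 :+ v) :* (r :* (s :* (r :- r))) := # 0) refl v r₂ (r₂ - r₁))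
     r₁≢0 : r₁ ≢ 0#
     r₁≢0 = neg≢0 1+v≢0
     r₂≢0 : r₂ ≢ 0#
     r₂≢0 = neg≢0 1-v≢0
     triv : ∀ x → γ x ≡ 0# → N⁰ x ≡ 1 → (1 ≡ N⁺ x ℕ.+ N⁻ x ℕ.+ N⁰ x) × (χ x ≡ nat (N⁺ x) - nat (N⁻ x))
     triv x e n0 = sym (trans (cong₂ ℕ._+_ (cong₂ ℕ._+_ p0 m0) n0) refl) , trans (χ≡0 x e) (sym (trans (cong₂ (λ a b → nat a - nat b) p0 m0) (-‿inverseʳ (nat 0))))
       where
       p0 = []-no (χ x ≟F 1#) (proj₁ (0≢±1 (χ≡0 x e)))
       m0 = []-no (χ x ≟F - 1#) (proj₂ (0≢±1 (χ≡0 x e)))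
     local : ∀ x → (1 ≡ N⁺ x ℕ.+ N⁻ x ℕ.+ N⁰ x) × (χ x ≡ nat (N⁺ x) - nat (N⁻ x))
     local x = by (x ≟F 0#) (x ≟F r₁) (x ≟F r₂)
       where
       by : Dec (x ≡ 0#) → Dec (x ≡ r₁) → Dec (x ≡ r₂) → (1 ≡ N⁺ x ℕ.+ N⁻ x ℕ.+ N⁰ x) × (χ x ≡ nat (N⁺ x) - nat (N⁻ x))
       by (yes a) _ _ = triv x (trans (cong γ a) γ-0) (cong₂ ℕ._+_ ([]-yes (x ≟F 0#) a) (cong₂ ℕ._+_ ([]-no (x ≟F r₁) (λ e → r₁≢0 (trans (sym e) a))) ([]-no (x ≟F r₂) (λ e → r₂≢0 (trans (sym e) a)))))
       by (no a) (yes b) _ = triv x (trans (cong γ b) γ-r₁) (cong₂ ℕ._+_ ([]-no (x ≟F 0#) a) (cong₂ ℕ._+_ ([]-yes (x ≟F r₁) b) ([]-no (x ≟F r₂) (λ e → r₁≢r₂ (trans (sym b) e)))))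
       by (no a) (no b) (yes c) = triv x (trans (cong γ c) γ-r₂) (cong₂ ℕ._+_ ([]-no (x ≟F 0#) a) (cong₂ ℕ._+_ ([]-no (x ≟F r₁) b) ([]-yes (x ≟F r₂) c)))
       by (no a) (no b) (no c) = [ plus , minus ]′ (χ² x (γ-zero x a b c))
         where
         n0 : N⁰ x ≡ 0
         n0 = cong₂ ℕ._+_ ([]-no (x ≟F 0#) a) (cong₂ ℕ._+_ ([]-no (x ≟F r₁) b) ([]-no (x ≟F r₂) c))
         plus : χ x ≡ 1# → _
         plus e = sym (cong₂ ℕ._+_ (cong₂ ℕ._+_ P⁺ M⁻) n0) , trans e (sym (trans (cong₂ (λ a b → nat a - nat b) P⁺ M⁻) (trans (cong₂ (λ a b → a - b) nat-1 nat-0) (solve 0 (# 1 :- # 0 := # 1) refl))))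
           where
           P⁺ = []-yes (χ x ≟F 1#) e
           M⁻ = []-no (χ x ≟F - 1#) (λ e' → -1≢1 (trans (sym e') e))
         minus : χ x ≡ - 1# → _
         minus e = sym (cong₂ ℕ._+_ (cong₂ ℕ._+_ P⁺ M⁻) n0) , trans e (sym (trans (cong₂ (λ a b → nat a - nat b) P⁺ M⁻) (trans (cong₂ (λ a b → a - b) nat-0 nat-1) (+-identityˡ _))))
           where
           P⁺ = []-no (χ x ≟F 1#) (λ e' → -1≢1 (trans (sym e) e'))
           M⁻ = []-yes (χ x ≟F - 1#) e
     total : p ≡ Sumℕ N⁺ ℕ.+ Sumℕ N⁻ ℕ.+ 3
     total = trans (sym Sumℕ-1) (trans (Sumℕ-cong (λ x → proj₁ (local x))) (trans (Sumℕ-+ (λ x → N⁺ x ℕ.+ N⁻ x) N⁰) (cong₂ ℕ._+_ (Sumℕ-+ N⁺ N⁻) (trans (Sumℕ-+ (λ x → [ x ≟F 0# ]) (λ x → [ x ≟F r₁ ] ℕ.+ [ x ≟F r₂ ])) (cong₂ ℕ._+_ (Sumℕ-δ 0#) (trans (Sumℕ-+ (λ x → [ x ≟F r₁ ]) (λ x → [ x ≟F r₂ ])) (cong₂ ℕ._+_ (Sumℕ-δ r₁) (Sumℕ-δ r₂))))))))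
     -- The vanishing character sum gives equality modulo p only, but both numbers are below p.
     balanced : Sumℕ N⁺ ≡ Sumℕ N⁻
     balanced = nat-injective (small (Sumℕ N⁺) (≤-trans (m≤m+n _ (Sumℕ N⁻)) ≤-refl)) (small (Sumℕ N⁻) (m≤n+m (Sumℕ N⁻) (Sumℕ N⁺))) (x-y≡0⇒x≡y (trans (cong₂ (λ a b → a - b) (nat-Sumℕ N⁺) (nat-Sumℕ N⁻)) (trans (sym (Sum-- (λ x → nat (N⁺ x)) (λ x → nat (N⁻ x)))) (trans (Sum-cong (λ x → sym (proj₂ (local x)))) Sumχ))))
       where
       small : ∀ k → k ℕ.≤ Sumℕ N⁺ ℕ.+ Sumℕ N⁻ → k ℕ.< p
       small k le = ≤-<-trans le (subst (Sumℕ N⁺ ℕ.+ Sumℕ N⁻ ℕ.<_) (sym total) (ℕₚ.m<m+n _ (ℕ.s≤s ℕ.z≤n)))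
     τ : F → F
     τ x = b * inv x
     inv≢0 : ∀ {x} → x ≢ 0# → inv x ≢ 0#
     inv≢0 {x} x≢0 e = 1≢0 (trans (sym (*-inv x≢0)) (trans (cong (x *_) e) (zeroʳ x)))
     τ-0 : τ 0# ≡ 0#
     τ-0 = trans (cong (b *_) (0^ (ℕₚ.m<n⇒0<n∸m (subst (2 ℕ.<_) (sym p≡) (ℕ.s≤s (+-mono-≤ 0<n 0<n)))))) (zeroʳ b)
       where
     ττ : ∀ x → τ (τ x) ≡ x
     ττ x with x ≟F 0#
     ... | yes refl = trans (cong τ τ-0) τ-0
     ... | no x≢0 = *-cancelˡ (inv≢0 x≢0) (trans (solve 3 (λ b i j → i :* (b :* j) := (b :* i) :* j) refl b (inv x) (inv (b * inv x))) (trans (*-inv (x*y≢0 b≢0 (inv≢0 x≢0))) (sym (trans (*-comm (inv x) x) (*-inv x≢0)))))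
     χτ : ∀ x → χ (τ x) ≡ χ x
     χτ x with x ≟F 0#
     ... | yes refl = cong χ τ-0
     ... | no x≢0 = trans (cong (_^ n) γτ) (trans (^-distrib-* (w * w) (γ x) n) (trans (cong (_* γ x ^ n) (square⇒^n (x*y≢0 b≢0 (x*y≢0 (inv≢0 x≢0) (inv≢0 x≢0))))) (*-identityˡ _)))
       where
       i w : F
       i = inv x
       w = b * (i * i)
       xi : x * i ≡ 1#
       xi = *-inv x≢0
       γτ : γ (b * i) ≡ w * w * γ x
       γτ = sym (trans (solve 4 (λ v b i x → b :* (i :* i) :* (b :* (i :* i)) :* ((# 1 :+ v) :* (x :* (x :* x :+ # 2 :* x :+ b))) := (# 1 :+ v) :* ((x :* i) :* (b :* b :* i) :* ((x :* i) :* (x :* i) :+ # 2 :* ((x :* i) :* i) :+ b :* (i :* i)))) refl v b i x) (trans (cong (λ y → (1# + v) * (y * (b * b * i) * (y * y + nat 2 * (y * i) + b * (i * i)))) xi) (solve 3 (λ v b i → (# 1 :+ v) :* (# 1 :* (b :* b :* i) :* (# 1 :* # 1 :+ # 2 :* (# 1 :* i) :+ b :* (i :* i))) := (# 1 :+ v) :* (b :* i :* (b :* i :* (b :* i) :+ # 2 :* (b :* i) :+ b))) refl v b i)))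
     fixed-free : ∀ x → N⁻ x ≡ 0 ⊎ x ≢ τ x
     fixed-free x with χ x ≟F - 1#
     ... | no _ = inj₁ refl
     ... | yes e = inj₂ λ fx → [ (λ z → proj₂ (0≢±1 (χ≡0 x z)) e) , (λ ne → -1≢1 (trans (sym e) (χ-square x fx ne))) ]′ (dec (γ x ≟F 0#))
       where
       dec : ∀ {P : Set} → Dec P → P ⊎ ¬ P
       dec (yes a) = inj₁ a
       dec (no a) = inj₂ a
       χ-square : ∀ x → x ≡ τ x → γ x ≢ 0# → χ x ≡ 1#
       χ-square x fx ne = trans (cong (_^ n) γ-square) (square⇒^n {x * (1# + x + v)} (λ z → ne (trans γ-square (trans (cong (_* (x * (1# + x + v))) z) (zeroˡ _)))))
         where
         x≢0 : x ≢ 0#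
         x≢0 z = ne (trans (cong γ z) γ-0)
         xx : x * x ≡ b
         xx = trans (cong (x *_) fx) (trans (solve 3 (λ x b i → x :* (b :* i) := b :* (x :* i)) refl x b (inv x)) (trans (cong (b *_) (*-inv x≢0)) (*-identityʳ b)))
         -- This identity is the reason for the twist by 1 + v: at a fixed point x² = 1 - v², and
         -- then 2(1 + x)(1 + v) = (1 + x + v)².
         γ-square : γ x ≡ x * (1# + x + v) * (x * (1# + x + v))
         γ-square = trans (cong (λ y → (1# + v) * (x * (x * x + nat 2 * x + y))) (sym xx)) (trans (solve 2 (λ x v → (# 1 :+ v) :* (x :* (x :* x :+ # 2 :* x :+ x :* x)) := x :* x :* (# 2 :* (# 1 :+ x) :* (# 1 :+ v))) refl x v) (trans (cong (λ y → x * x * y) (trans (solve 2 (λ x v → # 2 :* (# 1 :+ x) :* (# 1 :+ v) := (# 1 :+ x :+ v) :* (# 1 :+ x :+ v) :+ ((# 1 :- v :* v) :- x :* x)) refl x v) (trans (cong (λ y → (1# + x + v) * (1# + x + v) + (b - y)) xx) (solve 2 (λ s b → s :* s :+ (b :- b) := s :* s) refl (1# + x + v) b)))) (solve 2 (λ x s → x :* x :* (s :* s) := x :* s :* (x :* s)) refl x (1# + x + v))))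
     even : ∃ λ k → Sumℕ N⁻ ≡ k ℕ.+ k
     even = involution-even N⁻ τ ττ (λ x → cong (λ y → [ y ≟F - 1# ]) (χτ x)) fixed-free
     n-value : n ≡ suc (proj₁ even ℕ.+ proj₁ even)
     n-value = half (trans (sym (cong (ℕ._∸ 1) p≡)) (trans (cong (ℕ._∸ 1) total) (trans (cong (λ y → y ℕ.+ Sumℕ N⁻ ℕ.+ 3 ℕ.∸ 1) balanced) (trans (cong (λ y → y ℕ.+ y ℕ.+ 3 ℕ.∸ 1) (proj₂ even)) (arith (proj₁ even ℕ.+ proj₁ even))))))
       where
       half : ∀ {a b} → a ℕ.+ a ≡ b ℕ.+ b → a ≡ b
       half {zero} {zero} _ = refl
       half {suc a} {suc b} e = cong suc (half (suc-injective (trans (sym (ℕₚ.+-suc a a)) (trans (suc-injective e) (ℕₚ.+-suc b b)))))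
       arith : ∀ q → q ℕ.+ q ℕ.+ 3 ℕ.∸ 1 ≡ suc q ℕ.+ suc q
       arith q = trans (ℕₚ.+-∸-assoc (q ℕ.+ q) {3} {1} (ℕ.s≤s ℕ.z≤n)) (trans (ℕₚ.+-comm (q ℕ.+ q) 2) (cong suc (sym (ℕₚ.+-suc q q))))
     parity : ∀ k j → j ℕ.+ j ≢ suc (k ℕ.+ k)
     parity zero (suc j) e = 1+n≢0 (trans (sym (ℕₚ.+-suc j j)) (suc-injective e))
     parity (suc k) (suc j) e = parity k j (suc-injective (trans (sym (ℕₚ.+-suc j j)) (trans (suc-injective e) (cong suc (ℕₚ.+-suc k k)))))

 -- The case r = 3: rationality of √(1 - z) and of a cube root.

 module Level₃ (n : ℕ) (p≡ : p ≡ suc (n ℕ.+ n)) (3≢0 : nat 3 ≢ 0#) (data₃ : FamilyData) where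
   open OddPrime n p≡
   open FamilyData data₃ using (m; ν; ε; κ; κ≢0; g)
   open Family data₃
   open FamilyZeros data₃

   module Conditions (g≡ : nat 9 * g ≡ nat 2) (degree : (2 ℕ.* m ℕ.+ ν) ℕ.* 3 ℕ.≤ p ℕ.∸ 1)
     (mod3 : (∃ λ k → p ≡ suc (k ℕ.* 3)) ⊎ (∃ λ k → p ≡ suc (suc (k ℕ.* 3))))
     (as : List F) (splits : Splits f as) (len : length as ≡ m ℕ.+ ε ℕ.+ ν) where
     open SplitFamily as splits len

     private
       p-1<p : p ℕ.∸ 1 ℕ.< p
       p-1<p = subst (λ q → q ℕ.∸ 1 ℕ.< q) (sym p≡) (n<1+n _)

       2[p-1] : nat 2 * nat (p ℕ.∸ 1) ≡ - nat 2
       2[p-1] = trans (solve 1 (λ q → # 2 :* q := # 2 :* (# 1 :+ q) :- # 2) refl (nat (p ℕ.∸ 1))) (trans (cong (λ y → nat 2 * y - nat 2) (trans (sym (nat-suc (p ℕ.∸ 1))) (trans (cong nat (trans (cong (λ q → suc (q ℕ.∸ 1)) p≡) (sym p≡))) nat-p))) (solve 0 (# 2 :* # 0 :- # 2 := :- # 2) refl))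

       g-cond : nat 4 * (nat 3 * nat 3) * g ≡ nat 8
       g-cond = trans (solve 1 (λ g → # 4 :* (# 3 :* # 3) :* g := # 4 :* (# 9 :* g)) refl g) (trans (cong (nat 4 *_) g≡) (solve 0 (# 4 :* # 2 := # 8) refl))

     closure = Closure.closure gaussData 3 2 2 4 12 8 (p ℕ.∸ 1) (X ⊗ α) (ℕ.s≤s ℕ.z≤n) 4≢0 p-1<p 2[p-1] (solve 0 (# 12 := # 4 :* # 3) refl) g-cond degree Λ-Q₃

     -- The factor that turns `h₃ v` into the root of `f` belonging to the image of v under the
     -- involution.
     scale : F → F
     scale z = κ * inv (nat 9 * (z * (z * z)))

     private
       9z³≢0 : ∀ {z} → z ≢ 0# → nat 9 * (z * (z * z)) ≢ 0#
       9z³≢0 z≢0 = x*y≢0 (λ e → x*y≢0 3≢0 3≢0 (trans (solve 0 (# 3 :* # 3 := # 9) refl) e)) (x*y≢0 z≢0 (x*y≢0 z≢0 z≢0))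

     scale≢0 : ∀ {z} → z ≢ 0# → scale z ≢ 0#
     scale≢0 {z} z≢0 = x*y≢0 κ≢0 (λ e → 1≢0 (trans (sym (*-inv (9z³≢0 z≢0))) (trans (cong (nat 9 * (z * (z * z)) *_) e) (zeroʳ _))))

     module _ (A : Algebra) where
       open Algebra A
       open Evaluation A
       private
         module R = CommutativeRing ring
         module RI = RingIdentities₃ ring
         ^R-congˡ = Exp.^-congˡ R.semiring

       parameter-fixed : ∀ z u v j → z ≢ 0# → v ^R 3 R.≈ u → N.nat 4 R.* (u R.* (R.1# R.- u)) R.≈ ρ z → ev ψ u R.≈ R.0# → (R.1# R.+ N.nat 8 R.* u) R.* j R.≈ R.1# →
         (ρ (scale z) R.* RI.h₃ v) ^R p R.≈ ρ (scale z) R.* RI.h₃ v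
       parameter-fixed z u v j z≢0 vv zu ψu 8uj = R.trans (^R-congˡ p assoc) (R.trans (f-zero⇒fixed A _ (ψ-zero⇒f-zero A _ (ρ i R.* RI.h₃ v) inverse (closure A v w bw ψv))) (R.sym assoc))
         where
         i : F
         i = inv (nat 9 * (z * (z * z)))
         w : R.Carrier
         -- 1/(1 + 2v) = (1 - 2v + 4v²)/(1 + 8u), where `j` is the inverse of 1 + 8u.
         w = (R.1# R.- N.nat 2 R.* v R.+ N.nat 4 R.* (v R.* v)) R.* j
         bw : (R.1# R.+ N.nat 2 R.* v) R.* w R.≈ R.1#
         bw = R.trans (RI.[1+2v][1-2v+4v²] v j) (R.trans (R.*-congʳ (R.+-congˡ (R.*-congˡ vv))) 8uj)
         assoc : ρ (κ * i) R.* RI.h₃ v R.≈ ρ κ R.* (ρ i R.* RI.h₃ v)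
         assoc = R.trans (R.*-congʳ (ρ-* κ i)) (R.*-assoc _ _ _)
         ψv : ev ψ (v ^R 3) R.≈ R.0#
         ψv = R.trans (ev-arg A ψ vv) ψu
         zv : N.nat 4 R.* (v ^R 3 R.* (R.1# R.- v ^R 3)) R.≈ ρ z
         zv = R.trans (R.*-congˡ (R.*-cong vv (R.+-congˡ (R.-‿cong vv)))) zu
         inverse : N.nat 4 R.* (((R.1# R.- v) R.* w) ^R 3 R.* (R.1# R.- ((R.1# R.- v) R.* w) ^R 3)) R.* (ρ i R.* RI.h₃ v) R.≈ R.1#
         inverse = R.trans (RI.h₃-inverse v w (ρ i) bw) (R.trans (R.*-congˡ (R.trans (R.*-cong (R.sym (ρ-nat 9)) (R.trans (R.*-cong zv (R.trans (R.*-cong zv zv) (R.sym (ρ-* z z)))) (R.sym (ρ-* z (z * z))))) (R.sym (ρ-* (nat 9) (z * (z * z)))))) (R.trans (R.sym (ρ-* i _)) (R.trans (ρ-cong (trans (*-comm i _) (*-inv (9z³≢0 z≢0)))) ρ-1)))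

     module Tower (A : Algebra) (u j : CommutativeRing.Carrier (Algebra.ring A)) where
       open CubicFrobenius A u
       private
         module R = CommutativeRing (Algebra.ring A)
         module EA = Evaluation A
         module S = CommutativeRing (Algebra.ring Q₃)
         module EQ = Evaluation Q₃
         module RI = RingIdentities₃ (Algebra.ring A)
         module SI = RingIdentities₃ (Algebra.ring Q₃)

         emb-horner : ∀ cs x → emb (RI.horner cs x) S.≈ SI.horner cs (emb x)
         emb-horner = HornerHomomorphism.hom-horner (Algebra.ring A) (Algebra.ring Q₃) emb (S.refl {S.0#}) emb-+ emb-* emb-nat

         emb-part : ∀ k cs x → emb (x EA.^R k R.* RI.horner cs x) S.≈ emb x EQ.^R k S.* SI.horner cs (emb x)
         emb-part k cs x = S.trans (emb-* (x EA.^R k) (RI.horner cs x)) (S.*-cong (emb-^ x k) (emb-horner cs x))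

         scaled : ∀ k a {x y} → emb a S.≈ x → emb k S.* (x S.* y) S.≈ emb (k R.* a) S.* y
         scaled k a {x} {y} e = S.trans (S.sym (S.*-assoc (emb k) x y)) (S.*-congʳ {y} (S.trans (S.*-congˡ {emb k} (S.sym e)) (S.sym (emb-* k a))))

         expand : ∀ k → emb k S.* SI.h₃ v S.≈ (k R.* RI.part₀ u , k R.* RI.part₁ u , k R.* RI.part₂ u)
         expand k = S.trans (S.*-congˡ {emb k} (SI.h₃-parts v (emb u) v³)) (S.trans (S.distribˡ (emb k) (SI.part₀ (emb u)) (SI.part₁ (emb u) S.* v S.+ SI.part₂ (emb u) S.* (v S.* v))) (S.trans (S.+-cong (S.trans (S.*-congˡ {emb k} (S.sym (emb-part 3 cs₀ u))) (S.sym (emb-* k (RI.part₀ u)))) (S.trans (S.distribˡ (emb k) (SI.part₁ (emb u) S.* v) (SI.part₂ (emb u) S.* (v S.* v))) (S.+-cong (scaled k (RI.part₁ u) {SI.part₁ (emb u)} {v} (emb-part 3 cs₁ u)) (scaled k (RI.part₂ u) {SI.part₂ (emb u)} {v S.* v} (emb-part 2 cs₂ u))))) (S.sym (triple (k R.* RI.part₀ u) (k R.* RI.part₁ u) (k R.* RI.part₂ u)))))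

         emb-4u : ∀ {y} → EA.N.nat 4 R.* (u R.* (R.1# R.- u)) R.≈ y → EQ.N.nat 4 S.* (emb u S.* (S.1# S.- emb u)) S.≈ emb y
         emb-4u zu = S.trans (S.sym (S.trans (emb-* (EA.N.nat 4) (u R.* (R.1# R.- u))) (S.*-cong (emb-nat 4) (S.trans (emb-* u (R.1# R.- u)) (S.*-congˡ {emb u} (S.trans (emb-+ R.1# (R.- u)) (S.+-congˡ {S.1#} (emb-neg u)))))))) (emb-cong zu)

         emb-8uj : (R.1# R.+ EA.N.nat 8 R.* u) R.* j R.≈ R.1# → (S.1# S.+ EQ.N.nat 8 S.* emb u) S.* emb j S.≈ S.1#
         emb-8uj 8uj = S.trans (S.*-congʳ {emb j} (S.sym (S.trans (emb-+ R.1# (EA.N.nat 8 R.* u)) (S.+-congˡ {S.1#} (S.trans (emb-* (EA.N.nat 8) u) (S.*-congʳ {emb u} (emb-nat 8))))))) (S.trans (S.sym (emb-* (R.1# R.+ EA.N.nat 8 R.* u) j)) (emb-cong 8uj))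

       -- The first coordinate suffices, because it behaves in the same way for both residues of p
       -- modulo 3.
       tower : ∀ z → z ≢ 0# → EA.N.nat 4 R.* (u R.* (R.1# R.- u)) R.≈ Algebra.ρ A z → EA.ev ψ u R.≈ R.0# → (R.1# R.+ EA.N.nat 8 R.* u) R.* j R.≈ R.1# →
         (Algebra.ρ A (scale z) R.* RI.part₀ u) EA.^R p R.≈ Algebra.ρ A (scale z) R.* RI.part₀ u
       tower z z≢0 zu ψu 8uj = R.trans (R.sym (frobenius₃ ([ (λ (k , e) → v^p-1mod3 k e) , (λ (k , e) → v^p-2mod3 k e) ]′ mod3) (k' R.* RI.part₀ u) (k' R.* RI.part₁ u) (k' R.* RI.part₂ u)))
         (proj₁ (S.trans (Exp.^-congˡ S.semiring p (S.sym (expand k'))) (S.trans (parameter-fixed Q₃ z (emb u) v (emb j) z≢0 v³ (emb-4u zu) (S.trans (ev-emb₃ A u ψ u) (emb-cong ψu)) (emb-8uj 8uj)) (expand k'))))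
         where k' = Algebra.ρ A (scale z)

     private
       horner : List ℕ → F → F
       horner = RingIdentities₃.horner 𝔽

     -- As for r = 2, the first coordinate is a Frobenius-fixed element of the ring with s² = t = 1
     -- - z, and its s-coordinate k' `qt` forces t^n = 1. Here 25 - 16t is the norm of 1 + 8u.
     square₁ : ∀ z → z ≢ 0# → φ₁ z ≡ 0# → nat 25 - nat 16 * (1# - z) ≢ 0# → horner (275 ∷ 422 ∷ 32 ∷ []) (1# - z) ≢ 0# → ∃ λ s → s * s ≡ 1# - z
     square₁ z z≢0 φz n≢0 q≢0 = euler t (*-cancelˡ KQ≢0 (trans (sym (cong (_* t ^ n) (fermat (k' * qt)))) (trans (proj₂ fixed) (sym (*-identityʳ _)))))
       where
       t k' pt qt N : F
       t = 1# - z
       k' = scale z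
       pt = horner (1481 ∷ 11634 ∷ 4365 ∷ 16 ∷ []) t
       qt = - (nat 24 * horner (275 ∷ 422 ∷ 32 ∷ []) t)
       N = inv (nat 25 - nat 16 * t)
       24≢0 : nat 24 ≢ 0#
       24≢0 e = x*y≢0 (x^n≢0 2≢0 3) 3≢0 (trans (solve 0 (# 2 :^ 3 :* # 3 := # 24) refl) e)
       KQ≢0 : k' * qt ≢ 0#
       KQ≢0 e = x*y≢0 (scale≢0 z≢0) (x*y≢0 24≢0 q≢0) (trans (solve 2 (λ k q → k :* q := :- (k :* (:- q))) refl k' (nat 24 * horner (275 ∷ 422 ∷ 32 ∷ []) t)) (trans (cong (λ y → - y) e) (solve 0 (:- # 0 := # 0) refl)))
       module Q₁ = QuadraticFrobenius self t
       module S = CommutativeRing (Algebra.ring Q₁.Q)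
       module E₁ = Evaluation Q₁.Q
       module RI = RingIdentities (Algebra.ring Q₁.Q)
       module SI = RingIdentities₃ (Algebra.ring Q₁.Q)
       u s : F × F
       u = h , - h
       s = Q₁.v
       2u : E₁.N.nat 2 S.* u S.≈ S.1# S.- s
       2u = HalfRoot.2u n p≡ z
       zu : E₁.N.nat 4 S.* (u S.* (S.1# S.- u)) S.≈ Q₁.emb z
       zu = HalfRoot.zu n p≡ z
       ψu : E₁.ev ψ u S.≈ S.0#
       ψu = ψ-zero Q₁.Q u z zu φz
       j : F × F
       -- 1 + 8u = 5 - 4s has the inverse (5 + 4s)/(25 - 16t).
       j = nat 5 * N , nat 4 * N
       8uj : (S.1# S.+ E₁.N.nat 8 S.* u) S.* j S.≈ S.1#
       8uj = S.trans (S.*-congʳ {j} (S.trans (S.+-congˡ {S.1#} (S.trans (S.*-congʳ {u} (S.sym (Q₁.emb-nat 8))) (S.trans (Q₁.emb-pair (nat 8) h (- h)) (S.sym (SI.neg-neg (nat 8 * h , nat 8 * - h)))))) (S.trans (S.+-congˡ {S.1#} (S.-‿cong (S.trans (S.sym (S.+-identityˡ _)) (⊞⊟-components 𝔽 t 0# 0# (nat 8 * h) (nat 8 * - h))))) (⊞⊟-components 𝔽 t 1# 0# (0# - nat 8 * h) (0# - nat 8 * - h))))) (S.trans (Quadratic.⊠-components 𝔽 t (1# - (0# - nat 8 * h)) (0# - (0# - nat 8 * - h)) (nat 5 * N) (nat 4 * N)) components)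
         where
         components : ((1# - (0# - nat 8 * h)) * (nat 5 * N) + t * ((0# - (0# - nat 8 * - h)) * (nat 4 * N)) , (1# - (0# - nat 8 * h)) * (nat 4 * N) + (0# - (0# - nat 8 * - h)) * (nat 5 * N)) S.≈ S.1#
         components = trans (solve 3 (λ h t N → (# 1 :- (# 0 :- # 8 :* h)) :* (# 5 :* N) :+ t :* ((# 0 :- (# 0 :- # 8 :* (:- h))) :* (# 4 :* N)) := N :* (# 5 :+ # 2 :* h :* (# 20 :- # 16 :* t))) refl h t N)
             (trans (cong (λ y → N * (nat 5 + y * (nat 20 - nat 16 * t))) 2h) (trans (solve 2 (λ t N → N :* (# 5 :+ # 1 :* (# 20 :- # 16 :* t)) := (# 25 :- # 16 :* t) :* N) refl t N) (*-inv n≢0)))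
           , trans (solve 2 (λ h N → (# 1 :- (# 0 :- # 8 :* h)) :* (# 4 :* N) :+ (# 0 :- (# 0 :- # 8 :* (:- h))) :* (# 5 :* N) := N :* # 4 :* (# 1 :- # 2 :* h)) refl h N)
             (trans (cong (λ y → N * nat 4 * (1# - y)) 2h) (solve 1 (λ N → N :* # 4 :* (# 1 :- # 1) := # 0) refl N))
       A : F × F
       A = Q₁.emb k' S.* SI.part₀ u
       A≈ : A S.≈ (k' * pt , k' * qt)
       A≈ = S.trans (S.*-congˡ {Q₁.emb k'} (S.trans (SI.part₀-s u s (Q₁.emb t) 2u Q₁.v*v) (S.trans (S.+-cong (S.sym (emb-horner (1481 ∷ 11634 ∷ 4365 ∷ 16 ∷ []) t)) (S.*-congʳ {s} (S.sym emb-qt))) (S.sym (Q₁.pair pt qt))))) (Q₁.emb-pair k' pt qt)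
         where
         emb-horner = HornerHomomorphism.hom-horner 𝔽 (Algebra.ring Q₁.Q) Q₁.emb (S.refl {S.0#}) Q₁.emb-+ Q₁.emb-* Q₁.emb-nat
         emb-qt : Q₁.emb qt S.≈ S.- (E₁.N.nat 24 S.* SI.horner (275 ∷ 422 ∷ 32 ∷ []) (Q₁.emb t))
         emb-qt = S.trans (Q₁.emb-neg (nat 24 * horner (275 ∷ 422 ∷ 32 ∷ []) t)) (S.-‿cong (S.trans (Q₁.emb-* (nat 24) (horner (275 ∷ 422 ∷ 32 ∷ []) t)) (S.*-cong (Q₁.emb-nat 24) (emb-horner (275 ∷ 422 ∷ 32 ∷ []) t))))
       fixed : ((k' * pt) ^ p , (k' * qt) ^ p * t ^ n) S.≈ (k' * pt , k' * qt)
       fixed = S.trans (S.sym (Q₁.frobenius₂ (k' * pt) (k' * qt))) (S.trans (Exp.^-congˡ S.semiring p (S.sym A≈)) (S.trans (Tower.tower Q₁.Q u j z z≢0 zu ψu 8uj) A≈))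

     private
       ζ : F → F
       ζ u = nat 4 * (u * (1# - u))

       -- `q₁` and `q₂` are 275 + 422t + 32t² and 25 - 16t at t = 1 - z. `q₃`, multiplied by v⁸, is
       -- the ω-coordinate of `h₃` at ωv for a rational cube root v of u. The degrees 2, 1 and 9 add
       -- up to 12.
       q₁ q₂ q₃ : Pl
       q₁ = nat 729 ∷ - nat 486 ∷ nat 32 ∷ []
       q₂ = nat 9 ∷ nat 16 ∷ []
       q₃ = - nat 16 ∷ 0# ∷ nat 1392 ∷ - nat 5088 ∷ 0# ∷ nat 20544 ∷ - nat 24768 ∷ 0# ∷ nat 13056 ∷ - nat 5120 ∷ []

     -- For p ≡ 2 mod 3 every u is a cube; evaluating at the conjugate ω v of a rational cube root v makes -3 a square.
     not-2mod3 : ∀ k → p ≡ suc (suc (k ℕ.* 3)) → ∀ u v → v ^ 3 ≡ u → ζ u ≢ 0# → E.ev ψ u ≡ 0# → 1# + nat 8 * u ≢ 0# → v ≢ 0# → E.ev q₃ v ≢ 0# → ⊥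
     not-2mod3 k pk u v₀ v₀³ z≢0 ψu 8u≢0 v₀≢0 q≢0 = x*y≢0 2≢0 Y≢0 (trans (solve 1 (λ y → # 2 :* y := y :- y :* (:- # 1)) refl Y) (trans (cong (λ y → Y - y) (trans (cong₂ _*_ (sym (fermat Y)) (sym ([-3]^n-2mod3 k pk))) (proj₂ fixed))) (-‿inverseʳ Y)))
       where
       module W = QuadraticFrobenius self (- nat 3)
       module S = CommutativeRing (Algebra.ring W.Q)
       module EW = Evaluation W.Q
       module RI = RingIdentities₃ 𝔽
       module SI = RingIdentities₃ (Algebra.ring W.Q)
       k' a b c' A B X' Y : F
       k' = scale (ζ u)
       a = RI.part₀ u
       b = RI.part₁ u
       c' = RI.part₂ u
       A = a - c' * (v₀ * v₀)
       B = b * v₀ - c' * (v₀ * v₀)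
       X' = k' * B * - h - - (k' * A)
       -- The √-3-coordinate of k' `h₃`(ωv₀) = k'(A + Bω). Since (-3)^n = -1, Frobenius negates it,
       -- so a fixed element has 2Y = 0.
       Y = k' * B * h - 0#
       h≢0 : h ≢ 0#
       h≢0 e = 1≢0 (trans (sym 2h) (trans (cong (nat 2 *_) e) (zeroʳ _)))
       Y≢0 : Y ≢ 0#
       Y≢0 e = x*y≢0 (x*y≢0 (scale≢0 z≢0) (x*y≢0 (x^n≢0 v₀≢0 8) q≢0)) h≢0 (trans (cong (λ y → k' * y * h) B≡) (trans (solve 1 (λ y → y := y :- # 0) refl (k' * B * h)) e))
         where
         B≡ : v₀ ^ 8 * E.ev q₃ v₀ ≡ B
         B≡ = trans (solve 1 (λ v → let u = v :^ 3 in v :^ 8 :* (:- # 16 :+ v :* (# 0 :+ v :* (# 1392 :+ v :* (:- # 5088 :+ v :* (# 0 :+ v :* (# 20544 :+ v :* (:- # 24768 :+ v :* (# 0 :+ v :* (# 13056 :+ v :* (:- # 5120 :+ v :* # 0))))))))))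
           := u :^ 3 :* (# 1392 :+ u :* (# 20544 :+ u :* (# 13056 :+ u :* # 0))) :* v :- u :^ 2 :* (# 16 :+ u :* (# 5088 :+ u :* (# 24768 :+ u :* (# 5120 :+ u :* # 0)))) :* (v :* v)) refl v₀)
           (cong (λ u → RI.part₁ u * v₀ - RI.part₂ u * (v₀ * v₀)) v₀³)
       v : F × F
       v = ω S.* W.emb v₀
       v³ : v EW.^R 3 S.≈ W.emb u
       v³ = S.trans (EW.L.^-distrib-* ω (W.emb v₀) 3) (S.trans (S.*-cong ω³ (S.trans (S.sym (W.emb-^ v₀ 3)) (W.emb-cong v₀³))) (S.*-identityˡ (W.emb u)))
       emb-part : ∀ k cs x → W.emb (x ^ k * RI.horner cs x) S.≈ W.emb x EW.^R k S.* SI.horner cs (W.emb x)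
       emb-part k cs x = S.trans (W.emb-* (x ^ k) (RI.horner cs x)) (S.*-cong (W.emb-^ x k) (HornerHomomorphism.hom-horner 𝔽 (Algebra.ring W.Q) W.emb (S.refl {S.0#}) W.emb-+ W.emb-* W.emb-nat cs x))
       emb-- : ∀ x y → W.emb (x - y) S.≈ W.emb x S.- W.emb y
       emb-- x y = S.trans (W.emb-+ x (- y)) (S.+-congˡ {W.emb x} (W.emb-neg y))
       cVV : W.emb (c' * (v₀ * v₀)) S.≈ W.emb c' S.* (W.emb v₀ S.* W.emb v₀)
       cVV = S.trans (W.emb-* c' (v₀ * v₀)) (S.*-congˡ {W.emb c'} (W.emb-* v₀ v₀))
       h₃≈ : SI.h₃ v S.≈ W.emb A S.+ W.emb B S.* ω
       h₃≈ = S.trans (SI.h₃-parts v (W.emb u) v³) (S.trans (S.+-cong (S.sym (emb-part 3 cs₀ u)) (S.+-cong (S.*-congʳ {v} (S.sym (emb-part 3 cs₁ u))) (S.*-congʳ {v S.* v} (S.sym (emb-part 2 cs₂ u)))))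
         (S.trans (SI.reduce-ω (W.emb a) (W.emb b) (W.emb c') (W.emb v₀) ω ω²+ω+1) (S.sym (S.+-cong (S.trans (emb-- a (c' * (v₀ * v₀))) (S.+-congˡ {W.emb a} (S.-‿cong cVV))) (S.*-congʳ {ω} (S.trans (emb-- (b * v₀) (c' * (v₀ * v₀))) (S.+-cong (W.emb-* b v₀) (S.-‿cong cVV))))))))
       expand : W.emb k' S.* SI.h₃ v S.≈ (X' , Y)
       expand = S.trans (S.*-congˡ {W.emb k'} h₃≈) (S.trans (SI.a[b+cd] (W.emb k') (W.emb A) (W.emb B) ω) (S.trans (S.+-cong (S.trans (S.*-congʳ {ω} (S.sym (W.emb-* k' B))) (W.emb-pair (k' * B) (- h) h)) (S.-‿cong (S.trans (S.-‿cong (S.sym (W.emb-* k' A))) (S.sym (W.emb-neg (k' * A)))))) (⊞⊟-components 𝔽 (- nat 3) (k' * B * - h) (k' * B * h) (- (k' * A)) 0#)))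
       emb-4u : EW.N.nat 4 S.* (W.emb u S.* (S.1# S.- W.emb u)) S.≈ W.emb (ζ u)
       emb-4u = S.sym (S.trans (W.emb-* (nat 4) (u * (1# - u))) (S.*-cong (W.emb-nat 4) (S.trans (W.emb-* u (1# - u)) (S.*-congˡ {W.emb u} (emb-- 1# u)))))
       emb-8uj : (S.1# S.+ EW.N.nat 8 S.* W.emb u) S.* W.emb (inv (1# + nat 8 * u)) S.≈ S.1#
       emb-8uj = S.trans (S.*-congʳ {W.emb (inv (1# + nat 8 * u))} (S.sym (S.trans (W.emb-+ 1# (nat 8 * u)) (S.+-congˡ {S.1#} (S.trans (W.emb-* (nat 8) u) (S.*-congʳ {W.emb u} (W.emb-nat 8))))))) (S.trans (S.sym (W.emb-* (1# + nat 8 * u) _)) (W.emb-cong (*-inv 8u≢0)))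
       fixed : (X' ^ p , Y ^ p * (- nat 3) ^ n) S.≈ (X' , Y)
       fixed = S.trans (S.sym (W.frobenius₂ X' Y)) (S.trans (Exp.^-congˡ S.semiring p (S.sym expand)) (S.trans (parameter-fixed W.Q (ζ u) (W.emb u) v (W.emb (inv (1# + nat 8 * u))) z≢0 v³ emb-4u (S.trans (ev-emb self (- nat 3) ψ u) (W.emb-cong ψu)) emb-8uj) expand))

     private
       badZ : List F
       badZ = rootList q₁ ++ rootList q₂ ++ map (λ v → ζ (v ^ 3)) (rootList q₃)

       length-badZ : length badZ ℕ.≤ 12
       length-badZ = ≤-trans (≤-reflexive (trans (Listₚ.length-++ (rootList q₁)) (cong (length (rootList q₁) ℕ.+_) (trans (Listₚ.length-++ (rootList q₂)) (cong (length (rootList q₂) ℕ.+_) (Listₚ.length-map _ (rootList q₃)))))))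
         (+-mono-≤ (bound q₁ 2 (power 5 (solve 0 (# 2 :^ 5 := # 32) refl))) (+-mono-≤ (bound q₂ 1 (power 4 (solve 0 (# 2 :^ 4 := # 16) refl))) (bound q₃ 0 (λ e → power 4 (solve 0 (# 2 :^ 4 := :- (:- # 16)) refl) (trans (cong (λ y → - y) e) (solve 0 (:- # 0 := # 0) refl))))))
         where
         bound : ∀ f i → cf f i ≢ 0# → length (rootList f) ℕ.≤ length f ℕ.∸ 1
         bound f i ne = ℕₚ.∸-monoˡ-≤ 1 (length-rootList f (nonzero-coefficient f i ne))
         power : ∀ k {x} → nat 2 ^ k ≡ x → x ≢ 0#
         power k e z = x^n≢0 2≢0 k (trans e z)

       module Good (z : F) (z≢0 : z ≢ 0#) (φz : φ₁ z ≡ 0#) (good : ¬ (z ∈ badZ)) where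
         sqrt : ∃ λ s → s * s ≡ 1# - z
         sqrt = square₁ z z≢0 φz
           (λ e → good (∈-++⁺ʳ (rootList q₁) (∈-++⁺ˡ (∈-rootList q₂ (trans (solve 1 (λ z → # 9 :+ z :* (# 16 :+ z :* # 0) := # 25 :- # 16 :* (# 1 :- z)) refl z) e)))))
           (λ e → good (∈-++⁺ˡ (∈-rootList q₁ (trans (solve 1 (λ z → let t = # 1 :- z in # 729 :+ z :* (:- # 486 :+ z :* (# 32 :+ z :* # 0)) := # 275 :+ t :* (# 422 :+ t :* (# 32 :+ t :* # 0))) refl z) e))))
         u : F
         u = h * (1# - proj₁ sqrt)
         ζu : ζ u ≡ z
         ζu = trans (RingIdentities.4u[1-u] 𝔽 u (proj₁ sqrt) (trans (sym (*-assoc (nat 2) h (1# - proj₁ sqrt))) (trans (cong (_* (1# - proj₁ sqrt)) 2h) (*-identityˡ _)))) (trans (cong (λ y → 1# - y) (proj₂ sqrt)) (solve 1 (λ z → # 1 :- (# 1 :- z) := z) refl z))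
         ψu : E.ev ψ u ≡ 0#
         ψu = ψ-zero self u z ζu φz
         u≢0 : u ≢ 0#
         u≢0 e = z≢0 (trans (sym ζu) (trans (cong ζ e) (solve 0 (# 4 :* (# 0 :* (# 1 :- # 0)) := # 0) refl)))
         1-u≢0 : 1# - u ≢ 0#
         1-u≢0 e = z≢0 (trans (sym ζu) (trans (cong (λ y → nat 4 * (u * y)) e) (solve 1 (λ u → # 4 :* (u :* # 0) := # 0) refl u)))
         8u≢0 : 1# + nat 8 * u ≢ 0#
         8u≢0 e = good (∈-++⁺ʳ (rootList q₁) (∈-++⁺ˡ (∈-rootList q₂ (trans (cong (λ y → nat 9 + y * (nat 16 + y * 0#)) (sym ζu)) (trans (solve 1 (λ u → let z = # 4 :* (u :* (# 1 :- u)) in # 9 :+ z :* (# 16 :+ z :* # 0) := (# 1 :+ # 8 :* u) :* (# 9 :- # 8 :* u)) refl u) (trans (cong (_* (nat 9 - nat 8 * u)) e) (zeroˡ _)))))))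
         2mod3 : ∀ k → p ≡ suc (suc (k ℕ.* 3)) → ⊥
         2mod3 k pk = not-2mod3 k pk u v v³ (λ e → z≢0 (trans (sym ζu) e)) ψu 8u≢0 (x^n≢0 u≢0 (suc (k ℕ.+ k)))
           (λ e → good (∈-++⁺ʳ (rootList q₁) (∈-++⁺ʳ (rootList q₂) (subst (_∈ map (λ v → ζ (v ^ 3)) (rootList q₃)) (trans (cong ζ v³) ζu) (∈-map⁺ (λ v → ζ (v ^ 3)) (∈-rootList q₃ e))))))
           where
           v : F
           -- For p = 3k + 2 one has 3(2k + 1) = 1 + 2(p - 1), so this power is a cube root of u.
           v = u ^ suc (k ℕ.+ k)
           v³ : v ^ 3 ≡ u
           v³ = trans (^-assocʳ u (suc (k ℕ.+ k)) 3) (trans (cong (u ^_) (exponent k)) (trans (cong (u *_) (trans (^-homo-* u (suc (k ℕ.* 3)) (suc (k ℕ.* 3))) (trans (cong₂ _*_ fermat₁ fermat₁) (*-identityˡ 1#)))) (*-identityʳ u)))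
             where
             fermat₁ : u ^ suc (k ℕ.* 3) ≡ 1#
             fermat₁ = trans (cong (λ q → u ^ (q ℕ.∸ 1)) (sym pk)) (fermat′ u≢0)
             exponent : ∀ k → suc (k ℕ.+ k) ℕ.* 3 ≡ suc (suc (k ℕ.* 3) ℕ.+ suc (k ℕ.* 3))
             exponent k = cong (λ y → suc (suc (suc y))) (trans (ℕₚ.*-distribʳ-+ 3 k k) refl) ∙ cong (λ y → suc (suc y)) (sym (ℕₚ.+-suc (k ℕ.* 3) (k ℕ.* 3)))
               where _∙_ = trans

     contradiction₃ : (∀ k → p ≡ suc (k ℕ.* 3) → ∀ u → u ≢ 0# → 1# - u ≢ 0# → E.ev ψ u ≡ 0# → ⊥) → 13 ℕ.≤ m → ⊥
     contradiction₃ hyp 13≤m = <⇒≱ 13≤m (≤-trans (few-zeros as splits len badZ (λ z z≢0 φz good → let open Good z z≢0 φz good in [ (λ (k , e) → hyp k e u u≢0 1-u≢0 ψu) , (λ (k , e) → 2mod3 k e) ]′ mod3)) length-badZ)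

 -- Counting on the plane x + y + z = 1.

 Sumℕ-comm : ∀ (t : F → F → ℕ) → Sumℕ (λ x → Sumℕ (t x)) ≡ Sumℕ (λ y → Sumℕ (λ x → t x y))
 Sumℕ-comm t = MonoidSums.∑-comm ℕₚ.+-0-commutativeMonoid {p} {p} t

 Sumℕ≡0 : ∀ (t : F → ℕ) → Sumℕ t ≡ 0 → ∀ x → t x ≡ 0
 Sumℕ≡0 = go
   where
   go : ∀ {k} (t : Fin k → ℕ) → MonoidSums.sum ℕₚ.+-0-commutativeMonoid t ≡ 0 → ∀ x → t x ≡ 0
   go t e zero = ℕₚ.m+n≡0⇒m≡0 (t zero) e
   go t e (suc x) = go (λ i → t (suc i)) (ℕₚ.m+n≡0⇒n≡0 (t zero) e) x

 Sumℕ-max : ∀ b (t : F → ℕ) → (∀ x → t x ℕ.≤ b) → Sumℕ t ≡ Sumℕ (λ _ → b) → ∀ x → t x ≡ b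
 Sumℕ-max b t le e x = ≤-antisym (le x) (ℕₚ.m∸n≡0⇒m≤n (Sumℕ≡0 (λ x → b ℕ.∸ t x) (ℕₚ.+-cancelˡ-≡ (Sumℕ t) _ _ (trans (sym (Sumℕ-+ t (λ x → b ℕ.∸ t x))) (trans (Sumℕ-cong (λ x → m+[n∸m]≡n (le x))) (trans (sym e) (sym (ℕₚ.+-identityʳ _)))))) x))

 Sumℕ-mono : ∀ (s t : F → ℕ) → (∀ x → s x ℕ.≤ t x) → Sumℕ s ℕ.≤ Sumℕ t
 Sumℕ-mono s t le = ≤-trans (m≤m+n (Sumℕ s) (Sumℕ (λ x → t x ℕ.∸ s x))) (≤-reflexive (trans (sym (Sumℕ-+ s (λ x → t x ℕ.∸ s x))) (Sumℕ-cong (λ x → m+[n∸m]≡n (le x)))))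

 -- The plane is parametrised by x and y, but the summand keeps three arguments so that rotation can
 -- act on them.
 Sum₃ : (F → F → F → ℕ) → ℕ
 Sum₃ H = Sumℕ (λ x → Sumℕ (λ y → H x y (1# - x - y)))

 Sum₃-cong : ∀ {H H'} → (∀ x y z → x + y + z ≡ 1# → H x y z ≡ H' x y z) → Sum₃ H ≡ Sum₃ H'
 Sum₃-cong e = Sumℕ-cong (λ x → Sumℕ-cong (λ y → e x y (1# - x - y) (solve 2 (λ x y → x :+ y :+ (# 1 :- x :- y) := # 1) refl x y)))

 Sum₃-+ : ∀ H H' → Sum₃ (λ x y z → H x y z ℕ.+ H' x y z) ≡ Sum₃ H ℕ.+ Sum₃ H'
 Sum₃-+ H H' = trans (Sumℕ-cong (λ x → Sumℕ-+ (λ y → H x y (1# - x - y)) (λ y → H' x y (1# - x - y)))) (Sumℕ-+ _ _)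

 Sum₃-rotate : ∀ H → Sum₃ H ≡ Sum₃ (λ x y z → H y z x)
 Sum₃-rotate H = trans (Sumℕ-cong (λ b → trans (Sumℕ-perm (σ b) (σ b) (invol b) (invol b) (λ y → H b y (1# - b - y))) (Sumℕ-cong (λ a → cong (H b (1# - a - b)) (solve 2 (λ a b → # 1 :- b :- (# 1 :- a :- b) := a) refl a b))))) (sym (Sumℕ-comm (λ a b → H b (1# - a - b) a)))
   where
   σ : F → F → F
   σ b a = 1# - a - b
   invol : ∀ b x → σ b (σ b x) ≡ x
   invol b x = solve 2 (λ b x → # 1 :- (# 1 :- x :- b) :- b := x) refl b x

 Sum₃-orbit : ∀ H → Sum₃ (λ x y z → H x y z ℕ.+ (H y z x ℕ.+ H z x y)) ≡ 3 ℕ.* Sum₃ H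
 Sum₃-orbit H = trans (Sum₃-+ H (λ x y z → H y z x ℕ.+ H z x y)) (cong (Sum₃ H ℕ.+_) (trans (Sum₃-+ (λ x y z → H y z x) (λ x y z → H z x y)) (cong₂ ℕ._+_ (sym (Sum₃-rotate H)) (trans (sym (trans (Sum₃-rotate H) (Sum₃-rotate (λ x y z → H y z x)))) (sym (ℕₚ.+-identityʳ _))))))

 pick : ∀ {P Q : Set} → Dec P → Dec Q → ℕ
 pick (yes _) (no _) = 1
 pick (yes _) (yes _) = 0
 pick (no _) _ = 0

 -- Exactly one rotation of a non-constant triple starts with a minimum followed by a larger element.
 pick-one : ∀ a b c → ¬ (a ≡ b × b ≡ c) → pick (a ℕ.<? b) (c ℕ.<? a) ℕ.+ (pick (b ℕ.<? c) (a ℕ.<? b) ℕ.+ pick (c ℕ.<? a) (b ℕ.<? c)) ≡ 1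
 pick-one a b c ne with a ℕ.<? b | b ℕ.<? c | c ℕ.<? a
 ... | yes l | yes l' | yes l'' = ⊥-elim (ℕₚ.<-irrefl refl (<-trans l (<-trans l' l'')))
 ... | yes _ | yes _ | no _ = refl
 ... | yes _ | no _ | yes _ = refl
 ... | yes _ | no _ | no _ = refl
 ... | no _ | yes _ | yes _ = refl
 ... | no _ | yes _ | no _ = refl
 ... | no _ | no _ | yes _ = refl
 ... | no g | no g' | no g'' = ⊥-elim (ne (≤-antisym (≤-trans (≮⇒≥ g'') (≮⇒≥ g')) (≮⇒≥ g) , ≤-antisym (≤-trans (≮⇒≥ g) (≮⇒≥ g'')) (≮⇒≥ g')))

 -- The points of xyz = u/27, x + y + z = 1.

 module CharacterSum₃ (n : ℕ) (p≡ : p ≡ suc (n ℕ.+ n)) (3≢0 : nat 3 ≢ 0#) (data₃ : FamilyData) (g≡ : nat 9 * FamilyData.g data₃ ≡ nat 2)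
   (degree : (2 ℕ.* FamilyData.m data₃ ℕ.+ FamilyData.ν data₃) ℕ.* 3 ℕ.≤ p ℕ.∸ 1) where
   open OddPrime n p≡
   open FamilyData data₃ using (m; ν; g)
   open Family data₃ using (ψ; d; d-rec; d-0; ψ-below)

   private
     27≢0 : nat 27 ≢ 0#
     27≢0 e = x^n≢0 3≢0 3 (trans (solve 0 (# 3 :^ 3 := # 27) refl) e)

     B : ℕ → ℕ
     B k = (n ℕ.∸ k) ℕ.+ (n ℕ.∸ k)

     Dₖ : ℕ → F
     Dₖ k = nat (n choose k) * nat (B k choose k)

     -- As n ≡ -1/2 modulo p, 2(n - k) equals -1 - 2k. The factors gained between k and k + 1 become
     -- (3k + 1)(3k + 2)(3k + 3) up to sign, and 3(3k + 1)(3k + 2) = 27(k² + k + 2/9).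
     D-rec : ∀ k → k ℕ.< n → nat (suc k) ≢ 0# → nat 4 * (nat (suc k) * nat (suc k) * Dₖ (suc k)) ≡ nat 27 * (nat k * nat k + nat k + g) * Dₖ k
     D-rec k k<n s≢0 = *-cancelˡ (x*y≢0 s≢0 n-k≢0) (trans (solve 5 (λ s b f x y → s :* b :* (f :* (s :* s :* (x :* y))) := f :* s :* b :* ((s :* x) :* (s :* y))) refl s b (nat 4) x' y')
       (trans (cong₂ (λ α β → nat 4 * s * b * (α * β)) ([1+k]*nC[1+k] n k) ([1+k]*nC[1+k] (B (suc k)) k))
       (trans (cong (λ M → nat 4 * s * b * (b * x * ((M - nat k) * y₀))) natB)
       (trans (solve 6 (λ f s b x e y → f :* s :* b :* (b :* x :* (e :* y)) := s :* b :* (x :* (e :* (f :* b :* y)))) refl (nat 4) s b x (M - nat 2 - nat k) y₀)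
       (cong (s * b *_) final)))))
       where
       s b M x y x' y' y₀ : F
       s = nat (suc k)
       b = nat n - nat k
       M = nat 2 * b
       x = nat (n choose k)
       y = nat (B k choose k)
       x' = nat (n choose suc k)
       y' = nat (B (suc k) choose suc k)
       y₀ = nat (B (suc k) choose k)
       n-k≢0 : b ≢ 0#
       n-k≢0 e = nat≢0 (ℕₚ.m<n⇒0<n∸m k<n) (≤-<-trans (m∸n≤m n k) n<p) (trans (nat-∸ (<⇒≤ k<n)) e)
       natB : nat (B (suc k)) ≡ M - nat 2
       natB = trans (nat-+ _ _) (trans (cong₂ _+_ e e) (solve 2 (λ n k → (n :- (# 1 :+ k)) :+ (n :- (# 1 :+ k)) := # 2 :* (n :- k) :- # 2) refl (nat n) (nat k)))
         where e = trans (nat-∸ k<n) (cong (λ y → nat n - y) (nat-suc k))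
       BB : suc (suc (B (suc k))) ≡ B k
       BB = trans (cong suc (sym (ℕₚ.+-suc (n ℕ.∸ suc k) (n ℕ.∸ suc k)))) (cong (λ a → a ℕ.+ a) (sym (ℕₚ.+-∸-assoc 1 k<n)))
       natsB : nat (suc (B (suc k))) ≡ M - 1#
       natsB = trans (nat-suc _) (trans (cong (1# +_) natB) (solve 1 (λ M → # 1 :+ (M :- # 2) := M :- # 1) refl M))
       natssB : nat (suc (suc (B (suc k)))) ≡ M
       natssB = trans (nat-suc _) (trans (cong (1# +_) natsB) (solve 1 (λ M → # 1 :+ (M :- # 1) := M) refl M))
       two-steps : M * ((M - 1#) * y₀) ≡ (M - 1# - nat k) * ((M - nat k) * y)
       two-steps = trans (cong (M *_) (trans (cong (_* y₀) (sym natsB)) (trans ([1+n]*nCk (B (suc k)) k) (cong (λ z → (z - nat k) * nat (suc (B (suc k)) choose k)) natsB))))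
         (trans (solve 3 (λ M e y → M :* (e :* y) := e :* (M :* y)) refl M (M - 1# - nat k) (nat (suc (B (suc k)) choose k))) (cong ((M - 1# - nat k) *_) (trans (cong (_* nat (suc (B (suc k)) choose k)) (sym natssB)) (trans ([1+n]*nCk (suc (B (suc k))) k) (cong₂ _*_ (cong (_- nat k) natssB) (cong (λ z → nat (z choose k)) BB))))))
       M≡ : M ≡ - 1# - nat 2 * nat k
       M≡ = trans (solve 2 (λ n k → # 2 :* (n :- k) := # 2 :* n :- # 2 :* k) refl (nat n) (nat k)) (cong (_- nat 2 * nat k) 2n≡-1)
       final : x * ((M - nat 2 - nat k) * (nat 4 * b * y₀)) ≡ nat 27 * (nat k * nat k + nat k + g) * Dₖ k
       final = *-cancelˡ s≢0 (trans (cong (_* (x * ((M - nat 2 - nat k) * (nat 4 * b * y₀)))) (nat-suc k))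
         (trans (solve 5 (λ k x e b y → (# 1 :+ k) :* (x :* (e :* (# 4 :* b :* y))) := x :* e :* (:- ((# 2 :* b) :* ((:- # 2 :* (# 1 :+ k)) :* y)))) refl (nat k) x (M - nat 2 - nat k) b y₀)
         (trans (cong (λ t → x * (M - nat 2 - nat k) * (- (M * (t * y₀)))) (trans (solve 1 (λ k → (:- # 2) :* (# 1 :+ k) := (:- # 1 :- # 2 :* k) :- # 1) refl (nat k)) (cong (_- 1#) (sym M≡))))
         (trans (cong (λ t → x * (M - nat 2 - nat k) * (- t)) two-steps)
         (trans (cong (λ t → x * (t - nat 2 - nat k) * (- ((t - 1# - nat k) * ((t - nat k) * y)))) M≡)
         (trans (solve 3 (λ k x y → let t = :- # 1 :- # 2 :* k in x :* (t :- # 2 :- k) :* (:- ((t :- # 1 :- k) :* ((t :- k) :* y))) := (# 1 :+ k) :* ((# 27 :* (k :* k :+ k) :+ # 3 :* # 2) :* (x :* y))) refl (nat k) x y)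
         (cong₂ _*_ (sym (nat-suc k)) (cong (_* (x * y)) (trans (cong (λ t → nat 27 * (nat k * nat k + nat k) + nat 3 * t) (sym g≡)) (solve 2 (λ k g → # 27 :* (k :* k :+ k) :+ # 3 :* (# 9 :* g) := # 27 :* (k :* k :+ k :+ g)) refl (nat k) g))))))))))

     D≡ : ∀ k → k ℕ.≤ n → nat 4 ^ k * Dₖ k ≡ nat 27 ^ k * d k
     D≡ zero _ = cong (1# *_) (trans (cong₂ _*_ nat-1 nat-1) (trans (*-identityˡ 1#) (sym d-0)))
     D≡ (suc k) k<n = *-cancelˡ (x*y≢0 s≢0 s≢0) (trans (solve 4 (λ s f e D → s :* s :* (f :* e :* D) := e :* (f :* (s :* s :* D))) refl (nat (suc k)) (nat 4) (nat 4 ^ k) (Dₖ (suc k))) (trans (cong (nat 4 ^ k *_) (D-rec k k<n s≢0)) (trans (solve 3 (λ e q D → e :* (q :* D) := q :* (e :* D)) refl (nat 4 ^ k) (nat 27 * (nat k * nat k + nat k + g)) (Dₖ k)) (trans (cong (nat 27 * (nat k * nat k + nat k + g) *_) (D≡ k (<⇒≤ k<n))) (trans (solve 4 (λ t q e D → t :* q :* (e :* D) := t :* e :* (q :* D)) refl (nat 27) (nat k * nat k + nat k + g) (nat 27 ^ k) (d k)) (trans (cong (nat 27 * nat 27 ^ k *_) (sym (d-rec k))) (solve 3 (λ e s D → e :* (s :* s :* D) := s :* s :* (e :* D)) refl (nat 27 * nat 27 ^ k) (nat (suc k)) (d (suc k)))))))))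
       where
       s≢0 : nat (suc k) ≢ 0#
       s≢0 = nat≢0 (ℕ.s≤s ℕ.z≤n) (≤-<-trans k<n n<p)

     J : ℕ → F
     J k = Sum (λ x → x ^ (n ℕ.+ n ℕ.∸ k) * (1# - x) ^ B k)

     J-suc : ∀ k → suc k ℕ.≤ n → J (suc k) ≡ - ((- 1#) ^ suc k * nat (B (suc k) choose suc k))
     J-suc k k<n = trans (Sum-cong (λ x → cong (λ e → x ^ (e ℕ.∸ suc k) * (1# - x) ^ B (suc k)) (sym p-1))) (beta-sum (B (suc k)) (suc k) (subst (B (suc k) ℕ.<_) (sym p-1) (ℕₚ.+-mono-<-≤ (ℕₚ.∸-monoʳ-< {n} {suc k} {0} (ℕ.s≤s ℕ.z≤n) k<n) (m∸n≤m n (suc k)))) (subst (suc k ℕ.≤_) (sym p-1) (≤-trans k<n (m≤m+n n n))))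

     -- Outside the range of `beta-sum`: for k = 0 the exponent of 1 - x is p - 1. Both powers are
     -- indicator functions, and the sum misses x = 0 and x = 1.
     J-0 : J 0 ≡ - nat 2
     J-0 = trans (Sum-cong (λ x → trans (cong₂ _*_ (power x) (power (1# - x))) (pointwise x))) (trans (Sum-- (λ x → 1# - nat [ x ≟F 0# ]) (λ x → nat [ x ≟F 1# ])) (trans (cong₂ (λ a b → a - b) (trans (Sum-- (λ _ → 1#) (λ x → nat [ x ≟F 0# ])) (cong₂ (λ a b → a - b) Sum-1 (δ 0#))) (δ 1#)) (solve 0 (# 0 :- # 1 :- # 1 := :- # 2) refl)))
       where
       power : ∀ x → x ^ (n ℕ.+ n) ≡ 1# - nat [ x ≟F 0# ]
       power x = trans (cong (x ^_) (sym p-1)) (x^[p-1] x)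
       δ : ∀ a → Sum (λ x → nat [ x ≟F a ]) ≡ 1#
       δ a = trans (sym (nat-Sumℕ (λ x → [ x ≟F a ]))) (trans (cong nat (Sumℕ-δ a)) nat-1)
       pointwise : ∀ x → (1# - nat [ x ≟F 0# ]) * (1# - nat [ 1# - x ≟F 0# ]) ≡ 1# - nat [ x ≟F 0# ] - nat [ x ≟F 1# ]
       pointwise x = by (x ≟F 0#) (x ≟F 1#)
         where
         val : ∀ a b c {i j k} → i ≡ a → j ≡ b → k ≡ c → (1# - nat a) * (1# - nat b) ≡ 1# - nat a - nat c → (1# - nat i) * (1# - nat j) ≡ 1# - nat i - nat k
         val a b c refl refl refl e = e
         by : Dec (x ≡ 0#) → Dec (x ≡ 1#) → (1# - nat [ x ≟F 0# ]) * (1# - nat [ 1# - x ≟F 0# ]) ≡ 1# - nat [ x ≟F 0# ] - nat [ x ≟F 1# ]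
         by (yes a) _ = val 1 0 0 ([]-yes (x ≟F 0#) a) ([]-no (1# - x ≟F 0#) (λ e → 1≢0 (trans (x-y≡0⇒x≡y e) a))) ([]-no (x ≟F 1#) (λ e → 1≢0 (trans (sym e) a)))
           (trans (cong₂ (λ a b → (1# - a) * (1# - b)) nat-1 nat-0) (trans (solve 0 ((# 1 :- # 1) :* (# 1 :- # 0) := # 1 :- # 1 :- # 0) refl) (cong₂ (λ a b → 1# - a - b) (sym nat-1) (sym nat-0))))
         by (no a) (yes b) = val 0 1 1 ([]-no (x ≟F 0#) a) ([]-yes (1# - x ≟F 0#) (trans (cong (λ y → 1# - y) b) (-‿inverseʳ 1#))) ([]-yes (x ≟F 1#) b)
           (trans (cong₂ (λ a b → (1# - a) * (1# - b)) nat-0 nat-1) (trans (solve 0 ((# 1 :- # 0) :* (# 1 :- # 1) := # 1 :- # 0 :- # 1) refl) (cong₂ (λ a b → 1# - a - b) (sym nat-0) (sym nat-1))))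
         by (no a) (no b) = val 0 0 0 ([]-no (x ≟F 0#) a) ([]-no (1# - x ≟F 0#) (λ e → b (sym (x-y≡0⇒x≡y e)))) ([]-no (x ≟F 1#) b)
           (trans (cong₂ (λ a b → (1# - a) * (1# - b)) nat-0 nat-0) (trans (solve 0 ((# 1 :- # 0) :* (# 1 :- # 0) := # 1 :- # 0 :- # 0) refl) (cong₂ (λ a b → 1# - a - b) (sym nat-0) (sym nat-0))))

   -- The discriminant of xy² - x(1 - x)y + c, the equation in y of the points with given x.
   disc : F → F → F
   disc c x = x * (x * ((1# - x) * (1# - x)) - nat 4 * c)

   -- Binomial expansion in powers of -4c and summation over x reproduce the coefficients of ψ at
   -- 27c.
   character-sum : ∀ c → Sum (λ x → disc c x ^ n) ≡ - E.ev ψ (nat 27 * c) - 1#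
   character-sum c = trans (Sum-cong pointwise) (trans (Sums.∑-comm semiring {p} {suc n} (λ x k → s x (toℕ k))) (trans (sum-toℕ n (λ k → Sum (λ x → s x k))) (trans (Σ≤-cong n {λ k → Sum (λ x → s x k)} term-value) (trans (peel n) (cong (_- 1#) (trans (Σ≤-cong n {λ k → - (d k * (nat 27 * c) ^ k)} (λ k _ → solve 1 (λ y → :- y := (:- # 1) :* y) refl (d k * (nat 27 * c) ^ k))) (trans (sym (*-distribˡ-Σ≤ n (- 1#) (λ k → d k * (nat 27 * c) ^ k))) (trans (solve 1 (λ y → (:- # 1) :* y := :- y) refl (Σ≤ n (λ k → d k * (nat 27 * c) ^ k))) (cong (λ y → - y) (sym (ev-coeffs self n ψ (nat 27 * c) (Below-mono ψ (ℕ.s≤s I≤n) ψ-below))))))))))))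
     where
     I≤n : 2 ℕ.* m ℕ.+ ν ℕ.≤ n
     I≤n = ℕₚ.*-cancelʳ-≤ (2 ℕ.* m ℕ.+ ν) n 2 (≤-trans (ℕₚ.*-monoʳ-≤ (2 ℕ.* m ℕ.+ ν) {2} {3} (ℕ.s≤s (ℕ.s≤s ℕ.z≤n))) (≤-trans degree (≤-reflexive (trans p-1 (trans (cong (n ℕ.+_) (sym (ℕₚ.+-identityʳ n))) (ℕₚ.*-comm 2 n))))))
     -- The correction for k = 0, where `J 0` is -2 instead of the -1 that the general formula would
     -- give.
     δ₀ : ℕ → F
     δ₀ zero = - 1#
     δ₀ (suc _) = 0#
     peel : ∀ k → Σ≤ k (λ i → - (d i * (nat 27 * c) ^ i) + δ₀ i) ≡ Σ≤ k (λ i → - (d i * (nat 27 * c) ^ i)) - 1#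
     peel zero = refl
     peel (suc k) = trans (cong₂ _+_ (peel k) (+-identityʳ _)) (solve 2 (λ a b → a :- # 1 :+ b := a :+ b :- # 1) refl (Σ≤ k (λ i → - (d i * (nat 27 * c) ^ i))) (- (d (suc k) * (nat 27 * c) ^ suc k)))
     q : F
     q = - (nat 4 * c)
     s : F → ℕ → F
     s x k = nat (n choose k) * q ^ k * (x ^ n * (x * ((1# - x) * (1# - x))) ^ (n ℕ.∸ k))
     pointwise : ∀ x → disc c x ^ n ≡ Sums.sum semiring {suc n} (λ k → s x (toℕ k))
     pointwise x = trans (cong (λ y → (x * y) ^ n) (+-comm y q)) (trans (^-distrib-* x _ n) (trans (cong (x ^ n *_) (Binomial.theorem (CommutativeRing.commutativeSemiring 𝔽) n q y)) (trans (Sums.*-distribˡ-sum semiring {suc n} (x ^ n) (Binomial.binomialTerm (CommutativeRing.commutativeSemiring 𝔽) q y n)) (Sums.sum-cong-≗ semiring {suc n} (λ k → trans (cong (x ^ n *_) (×≈nat* (n choose toℕ k) _)) (solve 4 (λ a c e f → a :* (c :* (e :* f)) := c :* e :* (a :* f)) refl (x ^ n) (nat (n choose toℕ k)) (q ^ toℕ k) (y ^ (n ℕ.∸ toℕ k))))))))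
       where
       y : F
       y = x * ((1# - x) * (1# - x))
     factor-out : ∀ k → k ℕ.≤ n → Sum (λ x → s x k) ≡ nat (n choose k) * q ^ k * J k
     factor-out k k≤n = trans (Sum-* (nat (n choose k) * q ^ k) _) (cong (nat (n choose k) * q ^ k *_) (Sum-cong (λ x → trans (cong (x ^ n *_) (trans (^-distrib-* x ((1# - x) * (1# - x)) (n ℕ.∸ k)) (cong (x ^ (n ℕ.∸ k) *_) (trans (^-distrib-* (1# - x) (1# - x) (n ℕ.∸ k)) (sym (^-homo-* (1# - x) (n ℕ.∸ k) (n ℕ.∸ k))))))) (trans (sym (*-assoc _ _ _)) (cong (_* (1# - x) ^ B k) (trans (sym (^-homo-* x n (n ℕ.∸ k))) (cong (x ^_) (sym (ℕₚ.+-∸-assoc n k≤n)))))))))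
     term-value : ∀ k → k ℕ.≤ n → Sum (λ x → s x k) ≡ - (d k * (nat 27 * c) ^ k) + δ₀ k
     term-value zero k≤n = trans (factor-out 0 k≤n) (trans (cong₂ (λ a b → a * 1# * b) nat-1 J-0) (trans (solve 0 (# 1 :* # 1 :* (:- # 2) := :- (# 1 :* # 1) :+ (:- # 1)) refl) (cong (λ y → - (y * 1#) + - 1#) (sym d-0))))
     term-value (suc k) k≤n = trans (factor-out (suc k) k≤n) (trans (cong (nat (n choose suc k) * q ^ suc k *_) (J-suc k k≤n)) (trans (cong (λ y → nat (n choose suc k) * y * - (e * b)) (trans (cong (_^ suc k) (solve 1 (λ c → :- (# 4 :* c) := (:- # 1) :* (# 4 :* c)) refl c)) (trans (^-distrib-* (- 1#) (nat 4 * c) (suc k)) (cong (e *_) (^-distrib-* (nat 4) c (suc k))))))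
       (trans (solve 5 (λ a e f c b → a :* (e :* (f :* c)) :* (:- (e :* b)) := :- ((e :* e) :* (f :* (a :* b)) :* c)) refl (nat (n choose suc k)) e (nat 4 ^ suc k) (c ^ suc k) b)
       (trans (cong₂ (λ x y → - (x * y * c ^ suc k)) (trans (sym (^-distrib-* (- 1#) (- 1#) (suc k))) (trans (cong (_^ suc k) (solve 0 ((:- # 1) :* (:- # 1) := # 1) refl)) (1^n≈1 (suc k)))) (D≡ (suc k) k≤n))
       (trans (solve 3 (λ t d c → :- (# 1 :* (t :* d) :* c) := :- (d :* (t :* c)) :+ # 0) refl (nat 27 ^ suc k) (d (suc k)) (c ^ suc k)) (cong (λ y → - (d (suc k) * y) + 0#) (sym (^-distrib-* (nat 27) c (suc k)))))))))
       where
       e b : F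
       e = (- 1#) ^ suc k
       b = nat (B (suc k) choose suc k)

   root-count : ∀ a → nat (Sumℕ (λ t → [ t * t ≟F a ])) ≡ 1# + a ^ n × Sumℕ (λ t → [ t * t ≟F a ]) ℕ.≤ 2
   root-count a = by (a ≟F 0#)
     where
     Result : Set
     Result = nat (Sumℕ (λ t → [ t * t ≟F a ])) ≡ 1# + a ^ n × Sumℕ (λ t → [ t * t ≟F a ]) ℕ.≤ 2
     result : ∀ k → Sumℕ (λ t → [ t * t ≟F a ]) ≡ k → k ℕ.≤ 2 → nat k ≡ 1# + a ^ n → Result
     result k e le v = trans (cong nat e) v , subst (ℕ._≤ 2) (sym e) le
     by : Dec (a ≡ 0#) → Result
     by (yes a≡0) = result 1 (trans (Sumℕ-cong (λ t → same (t * t ≟F a) (t ≟F 0#) (λ e → [ (λ z → z) , (λ z → z) ]′ (x*y≡0 (trans e a≡0))) (λ z → trans (cong (_* t) z) (trans (zeroˡ t) (sym a≡0))))) (Sumℕ-δ 0#)) (ℕ.s≤s ℕ.z≤n) (trans nat-1 (sym (trans (cong (1# +_) (trans (cong (_^ n) a≡0) (0^ 0<n))) (+-identityʳ 1#))))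
       where
       same : ∀ {P Q : Set} (d : Dec P) (d' : Dec Q) → (P → Q) → (Q → P) → [ d ] ≡ [ d' ]
       same (yes x) d' f g = sym ([]-yes d' (f x))
       same (no x) d' f g = sym ([]-no d' (λ y → x (g y)))
     by (no a≢0) = [ square , non-square ]′ (x*y≡0 (trans (solve 1 (λ t → (t :- # 1) :* (t :+ # 1) := t :* t :- # 1) refl (a ^ n)) (trans (cong (_- 1#) (trans (sym (^-homo-* a n n)) (trans (cong (a ^_) (sym p-1)) (fermat′ a≢0)))) (-‿inverseʳ 1#))))
       where
       square : a ^ n - 1# ≡ 0# → Result
       square z = result 2 (trans (Sumℕ-cong pointwise) (trans (Sumℕ-+ (λ t → [ t ≟F r ]) (λ t → [ t ≟F - r ])) (cong₂ ℕ._+_ (Sumℕ-δ r) (Sumℕ-δ (- r))))) ≤-refl (trans (solve 0 (# 2 := # 1 :+ # 1) refl) (cong (1# +_) (sym a^n)))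
         where
         a^n : a ^ n ≡ 1#
         a^n = x-y≡0⇒x≡y z
         r : F
         r = proj₁ (euler a a^n)
         rr : r * r ≡ a
         rr = proj₂ (euler a a^n)
         r≢-r : r ≢ - r
         r≢-r e = a≢0 (trans (sym rr) (trans (cong (_* r) ([ (λ z → ⊥-elim (2≢0 z)) , (λ z → z) ]′ (x*y≡0 (trans (solve 1 (λ r → # 2 :* r := r :- (:- r)) refl r) (trans (cong (_- - r) e) (-‿inverseʳ (- r))))))) (zeroˡ r)))
         pointwise : ∀ t → [ t * t ≟F a ] ≡ [ t ≟F r ] ℕ.+ [ t ≟F - r ]
         pointwise t = cases (t ≟F r) (t ≟F - r)
           where
           cases : Dec (t ≡ r) → Dec (t ≡ - r) → [ t * t ≟F a ] ≡ [ t ≟F r ] ℕ.+ [ t ≟F - r ]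
           cases (yes x) _ = trans ([]-yes (t * t ≟F a) (trans (cong₂ _*_ x x) rr)) (sym (cong₂ ℕ._+_ ([]-yes (t ≟F r) x) ([]-no (t ≟F - r) (λ y → r≢-r (trans (sym x) y)))))
           cases (no x) (yes y) = trans ([]-yes (t * t ≟F a) (trans (cong₂ _*_ y y) (trans (solve 1 (λ r → (:- r) :* (:- r) := r :* r) refl r) rr))) (sym (cong₂ ℕ._+_ ([]-no (t ≟F r) x) ([]-yes (t ≟F - r) y)))
           cases (no x) (no y) = trans ([]-no (t * t ≟F a) (λ e → [ (λ z → x (x-y≡0⇒x≡y z)) , (λ z → y (x-y≡0⇒x≡y (trans (solve 2 (λ t r → t :- (:- r) := t :+ r) refl t r) z))) ]′ (x*y≡0 (trans (solve 2 (λ t r → (t :- r) :* (t :+ r) := t :* t :- r :* r) refl t r) (trans (cong₂ (λ a b → a - b) e rr) (-‿inverseʳ a)))))) (sym (cong₂ ℕ._+_ ([]-no (t ≟F r) x) ([]-no (t ≟F - r) y)))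
       non-square : a ^ n + 1# ≡ 0# → Result
       non-square z = result 0 (trans (Sumℕ-cong (λ t → []-no (t * t ≟F a) (nonsquare a a^n t))) Sumℕ-0) ℕ.z≤n (trans nat-0 (trans (sym z) (+-comm _ 1#)))
         where
         a^n : a ^ n ≡ - 1#
         a^n = trans (solve 1 (λ y → y := y :+ # 1 :- # 1) refl (a ^ n)) (trans (cong (_- 1#) z) (+-identityˡ _))
         Sumℕ-0 : Sumℕ (λ _ → 0) ≡ 0
         Sumℕ-0 = MonoidSums.sum-replicate-zero ℕₚ.+-0-commutativeMonoid p

   -- The points of the curve x y z = u/27, x + y + z = 1 are counted modulo p by the character sum, and exactly by the bounds on the rows x = const;
   -- the rotation (x, y, z) ↦ (y, z, x) acts on them without fixed points.
   supersingular⇒not-1mod3 : ∀ k → p ≡ suc (k ℕ.* 3) → ∀ u → u ≢ 0# → 1# - u ≢ 0# → E.ev ψ u ≡ 0# → ⊥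
   supersingular⇒not-1mod3 k pk u u≢0 1-u≢0 ψu = number (nat≡0⇒p∣ N₀+2)
     where
     c : F
     c = u * inv (nat 27)
     27c : nat 27 * c ≡ u
     27c = trans (solve 3 (λ a u i → a :* (u :* i) := u :* (a :* i)) refl (nat 27) u (inv (nat 27))) (trans (cong (u *_) (*-inv 27≢0)) (*-identityʳ u))
     c≢0 : c ≢ 0#
     c≢0 e = u≢0 (trans (sym 27c) (trans (cong (nat 27 *_) e) (zeroʳ _)))
     C₀ : F → F → F → ℕ
     C₀ x y z = [ x * (y * z) ≟F c ]
     N₀ : ℕ
     N₀ = Sum₃ C₀
     row : F → ℕ
     row x = Sumℕ (λ y → C₀ x y (1# - x - y))
     row-0 : row 0# ≡ 0
     row-0 = trans (Sumℕ-cong (λ y → []-no (0# * (y * (1# - 0# - y)) ≟F c) (λ e → c≢0 (trans (sym e) (zeroˡ _))))) (MonoidSums.sum-replicate-zero ℕₚ.+-0-commutativeMonoid p)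
     row-x : ∀ x → x ≢ 0# → row x ≡ Sumℕ (λ t → [ t * t ≟F disc c x ])
     row-x x x≢0 = trans (Sumℕ-cong pointwise) (sym (Sumℕ-perm σ τ στ τσ (λ t → [ t * t ≟F disc c x ])))
       where
       2x≢0 : nat 2 * x ≢ 0#
       2x≢0 = x*y≢0 2≢0 x≢0
       σ τ : F → F
       -- Completes the square in the equation of the row: σ(y)² - disc = 4x(c - xyz).
       σ y = nat 2 * x * y - x * (1# - x)
       τ t = inv (nat 2 * x) * (t + x * (1# - x))
       στ : ∀ t → σ (τ t) ≡ t
       στ t = trans (cong (_- x * (1# - x)) (trans (sym (*-assoc _ _ _)) (trans (cong (_* (t + x * (1# - x))) (*-inv 2x≢0)) (*-identityˡ _)))) (solve 2 (λ t q → t :+ q :- q := t) refl t (x * (1# - x)))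
       τσ : ∀ y → τ (σ y) ≡ y
       τσ y = trans (solve 4 (λ i a y q → i :* (a :* y :- q :+ q) := (a :* i) :* y) refl (inv (nat 2 * x)) (nat 2 * x) y (x * (1# - x))) (trans (cong (_* y) (*-inv 2x≢0)) (*-identityˡ y))
       key : ∀ y → σ y * σ y - disc c x ≡ nat 4 * x * (c - x * (y * (1# - x - y)))
       key y = solve 3 (λ x y c → let s = # 2 :* x :* y :- x :* (# 1 :- x) in s :* s :- x :* (x :* ((# 1 :- x) :* (# 1 :- x)) :- # 4 :* c) := # 4 :* x :* (c :- x :* (y :* (# 1 :- x :- y)))) refl x y c
       pointwise : ∀ y → C₀ x y (1# - x - y) ≡ [ σ y * σ y ≟F disc c x ]
       pointwise y = by (x * (y * (1# - x - y)) ≟F c)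
         where
         by : Dec (x * (y * (1# - x - y)) ≡ c) → C₀ x y (1# - x - y) ≡ [ σ y * σ y ≟F disc c x ]
         by (yes e) = trans ([]-yes (x * (y * (1# - x - y)) ≟F c) e) (sym ([]-yes (σ y * σ y ≟F disc c x) (x-y≡0⇒x≡y (trans (key y) (trans (cong (λ t → nat 4 * x * (c - t)) e) (trans (cong (nat 4 * x *_) (-‿inverseʳ c)) (zeroʳ _)))))))
         by (no e) = trans ([]-no (x * (y * (1# - x - y)) ≟F c) e) (sym ([]-no (σ y * σ y ≟F disc c x) (λ e' → [ x*y≢0 4≢0 x≢0 , (λ z → e (sym (x-y≡0⇒x≡y z))) ]′ (x*y≡0 (trans (sym (key y)) (trans (cong (_- disc c x) e') (-‿inverseʳ (disc c x))))))))
     -- The row x = 0 is empty and is given the weight 2. Thus every value is at most 2, and the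
     -- total is `N₀` + 2, the number divisible by p.
     S : F → ℕ
     S x = row x ℕ.+ ([ x ≟F 0# ] ℕ.+ [ x ≟F 0# ])
     local : ∀ x → S x ℕ.≤ 2 × nat (row x) ≡ 1# - nat [ x ≟F 0# ] + disc c x ^ n
     local x = by (x ≟F 0#)
       where
       by : Dec (x ≡ 0#) → S x ℕ.≤ 2 × nat (row x) ≡ 1# - nat [ x ≟F 0# ] + disc c x ^ n
       by (yes e) = ≤-reflexive (cong₂ (λ a b → a ℕ.+ (b ℕ.+ b)) row-x0 one) , trans (cong nat row-x0) (trans nat-0 (sym (trans (cong₂ (λ a b → 1# - nat a + b) one (trans (cong (_^ n) (trans (cong (λ x → disc c x) e) (zeroˡ _))) (0^ 0<n))) (trans (cong (λ a → 1# - a + 0#) nat-1) (solve 0 (# 1 :- # 1 :+ # 0 := # 0) refl)))))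
         where
         row-x0 = trans (cong row e) row-0
         one = []-yes (x ≟F 0#) e
       by (no ne) = subst (ℕ._≤ 2) (sym (trans (cong₂ (λ a b → a ℕ.+ (b ℕ.+ b)) (row-x x ne) none) (ℕₚ.+-identityʳ _))) (proj₂ (root-count (disc c x))) , trans (cong nat (row-x x ne)) (trans (proj₁ (root-count (disc c x))) (cong (_+ disc c x ^ n) (trans (solve 0 (# 1 := # 1 :- # 0) refl) (cong (λ a → 1# - a) (trans (sym nat-0) (cong nat (sym none)))))))
         where none = []-no (x ≟F 0#) ne
     Sum-S : Sumℕ S ≡ N₀ ℕ.+ 2
     Sum-S = trans (Sumℕ-+ row (λ x → [ x ≟F 0# ] ℕ.+ [ x ≟F 0# ])) (cong (N₀ ℕ.+_) (trans (Sumℕ-+ (λ x → [ x ≟F 0# ]) (λ x → [ x ≟F 0# ])) (cong₂ ℕ._+_ (Sumℕ-δ 0#) (Sumℕ-δ 0#))))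
     N₀≡-2 : nat N₀ ≡ - nat 2
     N₀≡-2 = trans (nat-Sumℕ row) (trans (Sum-cong (λ x → proj₂ (local x))) (trans (Sum-+ (λ x → 1# - nat [ x ≟F 0# ]) (λ x → disc c x ^ n)) (trans (cong₂ _+_ (trans (Sum-- (λ _ → 1#) (λ x → nat [ x ≟F 0# ])) (cong₂ (λ a b → a - b) Sum-1 (trans (sym (nat-Sumℕ (λ x → [ x ≟F 0# ]))) (trans (cong nat (Sumℕ-δ 0#)) nat-1)))) (trans (character-sum c) (cong (λ y → - y - 1#) (trans (cong (E.ev ψ) 27c) ψu)))) (solve 0 (# 0 :- # 1 :+ (:- # 0 :- # 1) := :- # 2) refl))))
     N₀+2 : nat (N₀ ℕ.+ 2) ≡ 0#
     N₀+2 = trans (nat-+ N₀ 2) (trans (cong (_+ nat 2) N₀≡-2) (solve 0 (:- # 2 :+ # 2 := # 0) refl))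
     rotate-C₀ : ∀ x y z → C₀ y z x ≡ C₀ x y z
     rotate-C₀ x y z = cong (λ a → [ a ≟F c ]) (solve 3 (λ x y z → y :* (z :* x) := x :* (y :* z)) refl x y z)
     weighted : (F → F → F → ℕ) → ℕ
     weighted w = Sum₃ (λ x y z → C₀ x y z ℕ.* w x y z)
     weighted-orbit : ∀ w → Sum₃ (λ x y z → C₀ x y z ℕ.* (w x y z ℕ.+ (w y z x ℕ.+ w z x y))) ≡ 3 ℕ.* weighted w
     weighted-orbit w = trans (Sum₃-cong (λ x y z _ → trans (ℕₚ.*-distribˡ-+ (C₀ x y z) (w x y z) _) (cong (C₀ x y z ℕ.* w x y z ℕ.+_) (trans (ℕₚ.*-distribˡ-+ (C₀ x y z) (w y z x) (w z x y)) (cong₂ (λ a b → a ℕ.* w y z x ℕ.+ b ℕ.* w z x y) (sym (rotate-C₀ x y z)) (trans (sym (rotate-C₀ x y z)) (sym (rotate-C₀ y z x)))))))) (Sum₃-orbit (λ x y z → C₀ x y z ℕ.* w x y z))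
     3∣N₀ : N₀ ≡ 3 ℕ.* weighted (λ x y z → pick (toℕ x ℕ.<? toℕ y) (toℕ z ℕ.<? toℕ x))
     3∣N₀ = trans (Sum₃-cong pointwise) (weighted-orbit (λ x y z → pick (toℕ x ℕ.<? toℕ y) (toℕ z ℕ.<? toℕ x)))
       where
       pointwise : ∀ x y z → x + y + z ≡ 1# → C₀ x y z ≡ C₀ x y z ℕ.* (pick (toℕ x ℕ.<? toℕ y) (toℕ z ℕ.<? toℕ x) ℕ.+ (pick (toℕ y ℕ.<? toℕ z) (toℕ x ℕ.<? toℕ y) ℕ.+ pick (toℕ z ℕ.<? toℕ x) (toℕ y ℕ.<? toℕ z)))
       pointwise x y z s = by (x * (y * z) ≟F c)
         where
         by : Dec (x * (y * z) ≡ c) → _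
         by (no ne) = trans zero' (sym (cong (ℕ._* _) zero'))
           where zero' = []-no (x * (y * z) ≟F c) ne
         by (yes e) = sym (trans (cong (C₀ x y z ℕ.*_) (pick-one (toℕ x) (toℕ y) (toℕ z) (λ (a , b) → not-all (Finₚ.toℕ-injective a) (Finₚ.toℕ-injective b)))) (ℕₚ.*-identityʳ _))
           where
           -- A fixed point x = y = z of the rotation gives u = 27x³ = (x + y + z)³ = 1.
           not-all : x ≡ y → y ≡ z → ⊥
           not-all refl refl = 1-u≢0 (trans (cong (λ y → 1# - y) (trans (sym 27c) (trans (cong (nat 27 *_) (sym e)) (trans (solve 1 (λ x → # 27 :* (x :* (x :* x)) := (x :+ x :+ x) :^ 3) refl x) (trans (cong (_^ 3) s) (1^n≈1 3)))))) (-‿inverseʳ 1#))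
     -- The multiple of p is at most 2p. It is positive, and it is not p because `N₀` = 3t would
     -- give p = 3t + 2; 2p remains.
     number : p ∣ N₀ ℕ.+ 2 → ⊥
     number (divides 0 e) = 1+n≢0 (trans (ℕₚ.+-comm 2 N₀) e)
     number (divides 1 e) = residues k (weighted (λ x y z → pick (toℕ x ℕ.<? toℕ y) (toℕ z ℕ.<? toℕ x))) (trans (cong (ℕ._+ 2) (sym 3∣N₀)) (trans e (trans (ℕₚ.+-identityʳ p) pk)))
       where
       residues : ∀ k t → 3 ℕ.* t ℕ.+ 2 ≢ suc (k ℕ.* 3)
       residues zero zero ()
       residues zero (suc t) e = 1+n≢0 (suc-injective (trans (sym (shift t)) e))
         where
         shift : ∀ t → 3 ℕ.* suc t ℕ.+ 2 ≡ suc (suc (suc (3 ℕ.* t ℕ.+ 2)))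
         shift t = cong (ℕ._+ 2) (ℕₚ.*-suc 3 t)
       residues (suc k) zero ()
       residues (suc k) (suc t) e = residues k t (suc-injective (suc-injective (suc-injective (trans (sym (cong (ℕ._+ 2) (ℕₚ.*-suc 3 t))) e))))
     -- Every row is now full, so the sum of x over all points is twice the sum of the field
     -- elements, namely 0. By rotation the same holds for y and z. As x + y + z = 1, `N₀` would be
     -- 0 modulo p, but it is -2.
     number (divides 2 e) = x*y≢0 2≢0 1≢0 (trans (solve 0 (# 2 :* # 1 := :- (:- # 2)) refl) (trans (cong (λ y → - y) (trans (sym N₀≡-2) (trans total (trans (cong (nat 3 *_) first-moment) (zeroʳ _))))) (solve 0 (:- # 0 := # 0) refl)))
       where
       full : ∀ x → S x ≡ 2
       full = Sumℕ-max 2 S (λ x → proj₁ (local x)) (trans Sum-S (trans e (trans (cong (p ℕ.+_) (ℕₚ.+-identityʳ p)) (sym (trans (Sumℕ-+ (λ _ → 1) (λ _ → 1)) (cong₂ ℕ._+_ Sumℕ-1 Sumℕ-1))))))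
       w : F → F → F → ℕ
       w x y z = toℕ x
       nat-Sum₃ : ∀ H → nat (Sum₃ H) ≡ Sum (λ x → Sum (λ y → nat (H x y (1# - x - y))))
       nat-Sum₃ H = trans (nat-Sumℕ _) (Sum-cong (λ x → nat-Sumℕ (λ y → H x y (1# - x - y))))
       first-moment : nat (weighted w) ≡ 0#
       first-moment = trans (nat-Sum₃ (λ x y z → C₀ x y z ℕ.* w x y z)) (trans (Sum-cong row-moment) (trans (Sum-* (nat 2) (_^ 1)) (trans (cong (nat 2 *_) (power-sum 1 (subst (1 ℕ.<_) (sym p-1) (+-mono-≤ 0<n 0<n)))) (zeroʳ _))))
         where
         row-value : ∀ x → x * nat (row x) ≡ nat 2 * x ^ 1
         row-value x = by (x ≟F 0#)
           where
           by : Dec (x ≡ 0#) → x * nat (row x) ≡ nat 2 * x ^ 1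
           by (yes z) = trans (cong (_* nat (row x)) z) (trans (zeroˡ _) (sym (trans (cong (λ x → nat 2 * x ^ 1) z) (solve 0 (# 2 :* # 0 :^ 1 := # 0) refl))))
           by (no ne) = trans (cong (λ r → x * nat r) (trans (sym (trans (cong (λ b → row x ℕ.+ (b ℕ.+ b)) ([]-no (x ≟F 0#) ne)) (ℕₚ.+-identityʳ _))) (full x))) (solve 1 (λ x → x :* # 2 := # 2 :* x :^ 1) refl x)
         row-moment : ∀ x → Sum (λ y → nat (C₀ x y (1# - x - y) ℕ.* toℕ x)) ≡ nat 2 * x ^ 1
         row-moment x = trans (Sum-cong (λ y → trans (nat-* (C₀ x y (1# - x - y)) (toℕ x)) (trans (cong (nat (C₀ x y (1# - x - y)) *_) (nat-toℕ x)) (*-comm _ x)))) (trans (Sum-* x (λ y → nat (C₀ x y (1# - x - y)))) (trans (cong (x *_) (sym (nat-Sumℕ (λ y → C₀ x y (1# - x - y))))) (row-value x)))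
       total : nat N₀ ≡ nat 3 * nat (weighted w)
       total = trans (nat-Sum₃ C₀) (trans (Sum-cong (λ x → Sum-cong (λ y → sym (pointwise x y (1# - x - y) (solve 2 (λ x y → x :+ y :+ (# 1 :- x :- y) := # 1) refl x y))))) (trans (sym (nat-Sum₃ (λ x y z → C₀ x y z ℕ.* (w x y z ℕ.+ (w y z x ℕ.+ w z x y))))) (trans (cong nat (weighted-orbit w)) (nat-* 3 (weighted w)))))
         where
         pointwise : ∀ x y z → x + y + z ≡ 1# → nat (C₀ x y z ℕ.* (toℕ x ℕ.+ (toℕ y ℕ.+ toℕ z))) ≡ nat (C₀ x y z)
         pointwise x y z s = trans (nat-* (C₀ x y z) _) (trans (cong (nat (C₀ x y z) *_) (trans (nat-+ (toℕ x) _) (trans (cong (nat (toℕ x) +_) (nat-+ (toℕ y) (toℕ z))) (trans (cong₂ _+_ (nat-toℕ x) (cong₂ _+_ (nat-toℕ y) (nat-toℕ z))) (trans (sym (+-assoc x y z)) s))))) (*-identityʳ _))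
     number (divides (suc (suc (suc q))) e) = <⇒≱ (ℕₚ.m<m+n (p ℕ.+ p) (<-trans (ℕ.s≤s ℕ.z≤n) 1<p)) (≤-trans (≤-trans (≤-trans (≤-reflexive (ℕₚ.+-assoc p p p)) (ℕₚ.+-monoʳ-≤ p (ℕₚ.+-monoʳ-≤ p (m≤m+n p (q ℕ.* p))))) (≤-reflexive (trans (sym e) (sym Sum-S)))) (≤-trans (Sumℕ-mono S (λ _ → 2) (λ x → proj₁ (local x))) (≤-reflexive (trans (Sumℕ-+ (λ _ → 1) (λ _ → 1)) (cong₂ ℕ._+_ Sumℕ-1 Sumℕ-1)))))

 -- Translation of the polynomials of the statement.

 modp≡% : ∀ x → modp p x ≡ x % p
 modp≡% x = go p
   where
   go : ∀ p .{{_ : NonZero p}} → modp p x ≡ x % p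
   go (suc q) = refl

 modp-cong : ∀ {a b} → nat a ≡ nat b → modp p a ≡ modp p b
 modp-cong {a} {b} e = trans (modp≡% a) (trans (ι-injective (trans (ι≡nat a) (trans e (sym (ι≡nat b))))) (sym (modp≡% b)))

 modp-injective : ∀ {a b} → modp p a ≡ modp p b → nat a ≡ nat b
 modp-injective {a} {b} e = trans (sym (ι≡nat a)) (trans (ι-cong (trans (sym (modp≡% a)) (trans e (modp≡% b)))) (ι≡nat b))

 nat-modp : ∀ a → nat (modp p a) ≡ nat a
 nat-modp a = modp-injective (trans (modp≡% _) (trans (cong (_% p) (modp≡% a)) (trans (DM.m%n%n≡m%n a p) (sym (modp≡% a)))))

 toPl : Poly → Pl
 toPl = map nat

 cf-toPl : ∀ f i → cf (toPl f) i ≡ nat (coeff f i)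
 cf-toPl [] i = sym nat-0
 cf-toPl (a ∷ f) zero = refl
 cf-toPl (a ∷ f) (suc i) = cf-toPl f i

 ≈⇒≋ : ∀ f g → f ≈[ p ] g → toPl f ≋ toPl g
 ≈⇒≋ f g e = coeffwise λ i → trans (cf-toPl f i) (trans (modp-injective (e i)) (sym (cf-toPl g i)))

 ≋⇒≈ : ∀ {f g} → toPl f ≋ toPl g → f ≈[ p ] g
 ≋⇒≈ {f} {g} e i = modp-cong (trans (sym (cf-toPl f i)) (trans (at e i) (cf-toPl g i)))

 toPl-addP : ∀ f g → toPl (addP f g) ≡ toPl f ⊕ toPl g
 toPl-addP [] g = refl
 toPl-addP (a ∷ f) [] = refl
 toPl-addP (a ∷ f) (b ∷ g) = cong₂ _∷_ (nat-+ a b) (toPl-addP f g)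

 toPl-scaleP : ∀ c f → toPl (scaleP c f) ≡ scl (nat c) (toPl f)
 toPl-scaleP c [] = refl
 toPl-scaleP c (a ∷ f) = cong₂ _∷_ (nat-* c a) (toPl-scaleP c f)

 toPl-mulP : ∀ f g → toPl (mulP f g) ≡ toPl f ⊗ toPl g
 toPl-mulP [] g = refl
 toPl-mulP (a ∷ f) g = trans (toPl-addP (scaleP a g) (0 ∷ mulP f g)) (cong₂ _⊕_ (toPl-scaleP a g) (cong₂ _∷_ nat-0 (toPl-mulP f g)))

 fromPl : Pl → Poly
 fromPl = map toℕ

 toPl-fromPl : ∀ f → toPl (fromPl f) ≡ f
 toPl-fromPl [] = refl
 toPl-fromPl (a ∷ f) = cong₂ _∷_ (nat-toℕ a) (toPl-fromPl f)

 toPl-1 : toPl oneP ≋ C 1#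
 toPl-1 = P.trans (∷≋ (nat 1) []) (P.trans (P.+-cong (C-cong nat-1) (P.zeroʳ X)) (P.+-identityʳ (C 1#)))

 -- Degrees and factorizations into irreducibles.

 HasDegree : Pl → ℕ → Set
 HasDegree f d = cf f d ≢ 0# × Below (suc d) f

 HasDegree-cong : ∀ {f g d} → f ≋ g → HasDegree f d → HasDegree g d
 HasDegree-cong {d = d} e (ne , b) = (λ z → ne (trans (at e d) z)) , Below-cong e b

 HasDegree-unique : ∀ f {d e} → HasDegree f d → HasDegree f e → d ≡ e
 HasDegree-unique f {d} {e} (ne , b) (ne' , b') = ≤-antisym (≮⇒≥ λ lt → ne (b' d lt)) (≮⇒≥ λ lt → ne' (b e lt))

 degree : ∀ f → f ≋ [] ⊎ ∃ (HasDegree f)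
 degree [] = inj₁ P.refl
 degree (a ∷ f) = step (degree f) (a ≟F 0#)
   where
   step : f ≋ [] ⊎ ∃ (HasDegree f) → Dec (a ≡ 0#) → a ∷ f ≋ [] ⊎ ∃ (HasDegree (a ∷ f))
   step (inj₂ (d , ne , b)) _ = inj₂ (suc d , ne , λ { (suc i) (ℕ.s≤s le) → b i le })
   step (inj₁ z) (yes a≡0) = inj₁ (coeffwise λ { zero → a≡0 ; (suc i) → at z i })
   step (inj₁ z) (no a≢0) = inj₂ (0 , a≢0 , λ { (suc i) _ → at z i })

 HasDegree-⊗ : ∀ f g {d e} → HasDegree f d → HasDegree g e → HasDegree (f ⊗ g) (d ℕ.+ e)
 HasDegree-⊗ f g {d} {e} (ne , b) (ne' , b') = (λ z → x*y≢0 ne ne' (trans (sym (top f d b)) z)) , Below-⊗ f g b b'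
   where
   top : ∀ f d → Below (suc d) f → cf (f ⊗ g) (d ℕ.+ e) ≡ cf f d * cf g e
   top [] d b = sym (zeroˡ _)
   top (a ∷ f) zero b = trans (cf-⊕ (scl a g) (0# ∷ f ⊗ g) e) (trans (cong₂ _+_ (cf-scl a g e) (rest e)) (+-identityʳ _))
     where
     rest : ∀ i → cf (0# ∷ f ⊗ g) i ≡ 0#
     rest zero = refl
     rest (suc i) = at (P.*-congʳ {g} {f} {[]} (coeffwise λ j → b (suc j) (ℕ.s≤s ℕ.z≤n))) i
   top (a ∷ f) (suc d) b = trans (cf-⊕ (scl a g) (0# ∷ f ⊗ g) (suc d ℕ.+ e)) (trans (cong₂ _+_ (trans (cf-scl a g (suc d ℕ.+ e)) (trans (cong (a *_) (b' (suc d ℕ.+ e) (ℕ.s≤s (m≤n+m e d)))) (zeroʳ a))) (top f d (λ j le → b (suc j) (ℕ.s≤s le)))) (+-identityˡ _))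

 HasDegree-C : ∀ {k} → k ≢ 0# → HasDegree (C k) 0
 HasDegree-C {k} k≢0 = (λ z → k≢0 (trans (sym (cf-C-0 k)) z)) , Below-C k

 opaque
   unfolding lin C X

   HasDegree-lin : ∀ a → HasDegree (lin a) 1
   HasDegree-lin a = 1≢0 , λ { (suc zero) (ℕ.s≤s ()) ; (suc (suc i)) _ → refl }

   HasDegree-X : HasDegree X 1
   HasDegree-X = 1≢0 , λ { (suc zero) (ℕ.s≤s ()) ; (suc (suc i)) _ → refl }

   linear : ∀ g → HasDegree g 1 → ∃ λ r → g ≋ C (cf g 1) ⊗ lin r
   linear g (ne , b) = r , coeffwise λ
     { zero → sym (trans (cf-C⊗ (cf g 1) (lin r) 0) (trans (solve 3 (λ a i c → a :* (:- (:- (i :* c))) := (a :* i) :* c) refl (cf g 1) (inv (cf g 1)) (cf g 0)) (trans (cong (_* cf g 0) (*-inv ne)) (*-identityˡ _))))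
     ; (suc zero) → sym (trans (cf-C⊗ (cf g 1) (lin r) 1) (*-identityʳ _))
     ; (suc (suc i)) → trans (b (suc (suc i)) (ℕ.s≤s (ℕ.s≤s ℕ.z≤n))) (sym (trans (cf-C⊗ (cf g 1) (lin r) (suc (suc i))) (zeroʳ _))) }
     where
     r : F
     r = - (inv (cf g 1) * cf g 0)

 HasDegree-^ : ∀ f {d} → HasDegree f d → ∀ n → HasDegree (f ^P n) (n ℕ.* d)
 HasDegree-^ f h zero = HasDegree-C 1≢0
 HasDegree-^ f h (suc n) = HasDegree-⊗ f (f ^P n) h (HasDegree-^ f h n)

 private
   modp-0 : modp p 0 ≡ 0
   modp-0 = trans (modp≡% 0) (DM.m<n⇒m%n≡m (ℕ.>-nonZero⁻¹ p))

   strip-0 : ∀ f → toPl f ≋ [] → stripP p f ≡ []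
   strip-0 [] z = refl
   strip-0 (a ∷ f) z rewrite strip-0 f (coeffwise λ i → at z (suc i)) | trans (modp-cong {a} {0} (trans (at z 0) (sym nat-0))) modp-0 = refl

   strip-degree : ∀ f {d} → HasDegree (toPl f) d → length (stripP p f) ≡ suc d
   strip-degree [] (ne , b) = ⊥-elim (ne refl)
   strip-degree (a ∷ f) {zero} (ne , b) rewrite strip-0 f (coeffwise λ i → b (suc i) (ℕ.s≤s ℕ.z≤n)) with modp p a in eq
   ... | zero = ⊥-elim (ne (trans (modp-injective (trans eq (sym modp-0))) nat-0))
   ... | suc _ = refl
   strip-degree (a ∷ f) {suc d} (ne , b) with stripP p f | strip-degree f {d} (ne , λ j le → b (suc j) (ℕ.s≤s le))
   ... | c ∷ g | e = cong suc e

 HasDegree⇒deg : ∀ f {d} → HasDegree (toPl f) d → deg p f ≡ d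
 HasDegree⇒deg f h = cong (ℕ._∸ 1) (strip-degree f h)

 deg⇒HasDegree : ∀ f → 1 ℕ.≤ deg p f → HasDegree (toPl f) (deg p f)
 deg⇒HasDegree f 1≤d with degree (toPl f)
 ... | inj₁ z rewrite strip-0 f z = ⊥-elim (<⇒≱ 1≤d ℕ.z≤n)
 ... | inj₂ (d , h) = subst (HasDegree (toPl f)) (sym (HasDegree⇒deg f h)) h

 private
   count-linear : ∀ g fs → deg p g ≡ 1 → linearCount p (g ∷ fs) ≡ suc (linearCount p fs)
   count-linear g fs e = cong length (Listₚ.filter-accept (λ g → deg p g ℕ.≟ 1) {x = g} {xs = fs} e)

   count-nonlinear : ∀ g fs → deg p g ≢ 1 → linearCount p (g ∷ fs) ≡ linearCount p fs
   count-nonlinear g fs e = cong length (Listₚ.filter-reject (λ g → deg p g ℕ.≟ 1) {x = g} {xs = fs} e)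

   -- A factor that is not linear adds a positive amount to the degree and nothing to the count, so
   -- equality forces every factor to be linear.
   all-linear : ∀ fs → All (λ g → 1 ℕ.≤ deg p g) fs →
     ∃ λ d → HasDegree (toPl (prodP fs)) d × linearCount p fs ℕ.≤ d × (d ≡ linearCount p fs → ∃ λ as → Splits (toPl (prodP fs)) as × length as ≡ d)
   all-linear [] [] = 0 , HasDegree-cong (P.sym toPl-1) (HasDegree-C 1≢0) , ℕ.z≤n , λ _ → [] , (1# , 1≢0 , P.trans toPl-1 (P.sym (P.*-identityˡ (C 1#)))) , refl
   all-linear (g ∷ fs) (1≤ ∷ rest) with all-linear fs rest
   ... | d , h , le , splits = e ℕ.+ d , HasDegree-cong (P.sym product) (HasDegree-⊗ (toPl g) (toPl (prodP fs)) hg h) , by (e ℕ.≟ 1)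
     where
     e = deg p g
     hg = deg⇒HasDegree g 1≤
     product : toPl (prodP (g ∷ fs)) ≋ toPl g ⊗ toPl (prodP fs)
     product = P.reflexive (toPl-mulP g (prodP fs))
     by : Dec (e ≡ 1) → linearCount p (g ∷ fs) ℕ.≤ e ℕ.+ d × (e ℕ.+ d ≡ linearCount p (g ∷ fs) → ∃ λ as → Splits (toPl (prodP (g ∷ fs))) as × length as ≡ e ℕ.+ d)
     by (no ne) = ≤-trans (≤-reflexive (count-nonlinear g fs ne)) (≤-trans le (m≤n+m d e)) , λ eq → ⊥-elim (<⇒≢ (≤-<-trans le (ℕₚ.m<n+m d 1≤)) (sym (trans eq (count-nonlinear g fs ne))))
     by (yes e≡1) = subst₂ ℕ._≤_ (sym (count-linear g fs e≡1)) (cong (ℕ._+ d) (sym e≡1)) (ℕ.s≤s le) , λ eq → add (splits (suc-injective (trans (cong (ℕ._+ d) (sym e≡1)) (trans eq (count-linear g fs e≡1)))))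
       where
       subst₂ = ≡.subst₂
       add : (∃ λ as → Splits (toPl (prodP fs)) as × length as ≡ d) → ∃ λ as → Splits (toPl (prodP (g ∷ fs))) as × length as ≡ e ℕ.+ d
       add (as , (k , k≢0 , s) , len) with linear (toPl g) (subst (HasDegree (toPl g)) e≡1 hg)
       ... | r , gr = r ∷ as , (c * k , x*y≢0 (proj₁ (subst (HasDegree (toPl g)) e≡1 hg)) k≢0 , P.trans product (P.trans (P.*-cong gr s) (P.trans (solveP 4 (λ c l k f → c :* l :* (k :* f) := (c :* k) :* (l :* f)) P.refl (C c) (lin r) (C k) (Π as)) (P.*-congʳ {lin r ⊗ Π as} (P.sym (C-* c k)))))) , trans (cong suc len) (cong (ℕ._+ d) (sym e≡1))
         where c = cf (toPl g) 1

 linear-factors⇒splits : ∀ f fs → IsFactorization p f fs → deg p f ≡ linearCount p fs → ∃ λ as → Splits (toPl f) as × HasDegree (toPl f) (length as)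
 linear-factors⇒splits f fs (irr , f≈) e with all-linear fs (All.map proj₁ irr)
 ... | d , h , _ , splits with splits (trans (sym (HasDegree⇒deg f (HasDegree-cong (P.sym (≈⇒≋ f (prodP fs) f≈)) h))) e)
 ... | as , (k , k≢0 , s) , len = as , (k , k≢0 , P.trans (≈⇒≋ f (prodP fs) f≈) s) , subst (HasDegree (toPl f)) (sym len) (HasDegree-cong (P.sym (≈⇒≋ f (prodP fs) f≈)) h)

 private
   -- Each linear factor X - x either supplies a root of `g` or divides `h` and is cancelled. If all
   -- were cancelled, `g` would divide a nonzero constant.
   root-of-factor : ∀ as {k} g h {d} → k ≢ 0# → C k ⊗ Π as ≋ g ⊗ h → 1 ℕ.≤ d → HasDegree g d → ∃ (Root g)
   root-of-factor [] {k} g h {d} k≢0 e 1≤d hg = by (degree h)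
     where
     hk : HasDegree (g ⊗ h) 0
     hk = HasDegree-cong (P.trans (P.sym (P.*-identityʳ (C k))) e) (HasDegree-C k≢0)
     by : h ≋ [] ⊎ ∃ (HasDegree h) → _
     by (inj₁ z) = ⊥-elim (proj₁ hk (trans (at (P.*-congˡ {g} z) 0) (at (P.zeroʳ g) 0)))
     by (inj₂ (d' , hh)) = ⊥-elim (<⇒≢ 1≤d (sym (ℕₚ.m+n≡0⇒m≡0 d (HasDegree-unique (g ⊗ h) (HasDegree-⊗ g h hg hh) hk))))
   root-of-factor (x ∷ as) {k} g h k≢0 e 1≤d hg = [ (λ z → x , z) , (λ z → root-of-factor as g (quo x h) k≢0 (cancel-lin-≋ x (C k ⊗ Π as) (g ⊗ quo x h) (P.trans (solveP 3 (λ l k f → l :* (k :* f) := k :* (l :* f)) P.refl (lin x) (C k) (Π as)) (P.trans e (P.trans (P.*-congˡ {g} (factor x h z)) (solveP 3 (λ g l q → g :* (l :* q) := l :* (g :* q)) P.refl g (lin x) (quo x h)))))) 1≤d hg) ]′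
     (x*y≡0 (trans (sym (E.ev-⊗ g h x)) (trans (sym (E.ev-cong x e)) (trans (E.ev-⊗ (C k) (Π (x ∷ as)) x) (trans (cong (E.ev (C k) x *_) (trans (E.ev-⊗ (lin x) (Π as) x) (trans (cong (_* E.ev (Π as) x) (lin-root x)) (zeroˡ _)))) (zeroʳ _))))))

   -- A root a splits the factor X - a off `g`, and irreducibility makes the cofactor constant. The
   -- quotient is carried back to natural number coefficients, because `Irreducible` speaks about
   -- these.
   irreducible-linear : ∀ as {k} g h → k ≢ 0# → C k ⊗ Π as ≋ toPl g ⊗ h → Irreducible p g → deg p g ≡ 1
   irreducible-linear as g h k≢0 e (1≤ , irr) with root-of-factor as (toPl g) h k≢0 e 1≤ (deg⇒HasDegree g 1≤)
   ... | a , z = by (irr (fromPl (lin a)) (fromPl q) (≋⇒≈ {g} (P.trans (factor a (toPl g) z) (P.reflexive (sym (trans (toPl-mulP (fromPl (lin a)) (fromPl q)) (cong₂ _⊗_ (toPl-fromPl (lin a)) (toPl-fromPl q))))))))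
     where
     hg = deg⇒HasDegree g 1≤
     d = deg p g
     q = quo a (toPl g)
     by : deg p (fromPl (lin a)) ≡ 0 ⊎ deg p (fromPl q) ≡ 0 → d ≡ 1
     by (inj₁ z') = ⊥-elim (1+n≢0 (trans (sym (HasDegree⇒deg (fromPl (lin a)) (subst (λ f → HasDegree f 1) (sym (toPl-fromPl (lin a))) (HasDegree-lin a)))) z'))
     by (inj₂ z') = by' (degree q)
       where
       by' : q ≋ [] ⊎ ∃ (HasDegree q) → d ≡ 1
       by' (inj₁ z″) = ⊥-elim (proj₁ hg (trans (at (factor a (toPl g) z) d) (trans (at (P.*-congˡ {lin a} z″) d) (at (P.zeroʳ (lin a)) d))))
       by' (inj₂ (d' , hq)) = trans (HasDegree-unique (toPl g) hg (HasDegree-cong (P.sym (factor a (toPl g) z)) (HasDegree-⊗ (lin a) q (HasDegree-lin a) hq))) (cong suc (trans (sym (HasDegree⇒deg (fromPl q) (subst (λ f → HasDegree f d') (sym (toPl-fromPl q)) hq))) z'))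

 splits⇒linear-factors : ∀ f as → Splits (toPl f) as → ∀ fs → IsFactorization p f fs → deg p f ≡ linearCount p fs
 splits⇒linear-factors f as (k , k≢0 , s) fs (irr , f≈) = trans (HasDegree⇒deg f (HasDegree-cong (P.sym (≈⇒≋ f (prodP fs) f≈)) (proj₂ counted))) (sym (proj₁ counted))
   where
   -- `h` collects the factors already treated, so that the next one still divides the split
   -- polynomial.
   go : ∀ fs h → C k ⊗ Π as ≋ h ⊗ toPl (prodP fs) → All (Irreducible p) fs → linearCount p fs ≡ length fs × HasDegree (toPl (prodP fs)) (length fs)
   go [] h e [] = refl , HasDegree-cong (P.sym toPl-1) (HasDegree-C 1≢0)
   go (g ∷ fs) h e (i ∷ is) = trans (count-linear g fs deg≡1) (cong suc (proj₁ rest)) , subst (λ f → HasDegree f (suc (length fs))) (sym (toPl-mulP g (prodP fs))) (HasDegree-⊗ (toPl g) (toPl (prodP fs)) (subst (HasDegree (toPl g)) deg≡1 (deg⇒HasDegree g (proj₁ i))) (proj₂ rest))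
     where
     P' = toPl (prodP fs)
     product : C k ⊗ Π as ≋ h ⊗ (toPl g ⊗ P')
     product = P.trans e (P.reflexive (cong (h ⊗_) (toPl-mulP g (prodP fs))))
     deg≡1 = irreducible-linear as g (h ⊗ P') k≢0 (P.trans product (solveP 3 (λ h g q → h :* (g :* q) := g :* (h :* q)) P.refl h (toPl g) P')) i
     rest = go fs (h ⊗ toPl g) (P.trans product (P.sym (P.*-assoc h (toPl g) P'))) is
   counted = go fs (C 1#) (P.trans (P.sym s) (P.trans (≈⇒≋ f (prodP fs) f≈) (P.sym (P.*-identityˡ _)))) irr

 -- Reduction of rational coefficients.

 int = NumeralsProofs.int 𝔽
 int-+ = NumeralsProofs.int-+ 𝔽
 int-* = NumeralsProofs.int-* 𝔽
 int-neg = NumeralsProofs.int-neg 𝔽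

 nat-^ : ∀ a k → nat (a ℕ.^ k) ≡ nat a ^ k
 nat-^ a zero = nat-1
 nat-^ a (suc k) = trans (nat-* a (a ℕ.^ k)) (cong (nat a *_) (nat-^ a k))

 int-pos : ∀ k → int (ℤ.+ k) ≡ nat k
 int-pos 0 = sym nat-0
 int-pos 1 = sym nat-1
 int-pos (suc (suc k)) = refl

 nat-modpℤ : ∀ z → nat (modpℤ p z) ≡ int z
 nat-modpℤ z = sym (trans (cong int (go p)) (trans (int-+ (ℤ.+ modpℤ p z) (proj₁ (quotient p) ℤ.* ℤ.+ p)) (trans (cong₂ _+_ (int-pos (modpℤ p z)) (trans (int-* (proj₁ (quotient p)) (ℤ.+ p)) (trans (cong (int (proj₁ (quotient p)) *_) (trans (int-pos p) nat-p)) (zeroʳ _)))) (+-identityʳ _))))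
   where
   quotient : ∀ p → .{{_ : NonZero p}} → ∃ λ q → z ≡ ℤ.+ modpℤ p z ℤ.+ q ℤ.* ℤ.+ p
   quotient (suc q) = z ℤDM./ℕ suc q , ℤDM.a≡a%ℕn+[a/ℕn]*n z (suc q)
   go : ∀ p → .{{_ : NonZero p}} → z ≡ ℤ.+ modpℤ p z ℤ.+ proj₁ (quotient p) ℤ.* ℤ.+ p
   go p = proj₂ (quotient p)

 -- q is p-integral and reduces to v modulo p.
 Reduces : ℚ → F → Set
 Reduces q v = nat (↧ₙ q) ≢ 0# × int (↥ q) ≡ v * nat (↧ₙ q)

 redℚ-value : ∀ q {v} → Reduces q v → nat (redℚ p q) ≡ v
 redℚ-value q {v} (D≢0 , N≡) = trans (nat-modp (modpℤ p (↥ q) ℕ.* invp p (↧ₙ q))) (trans (nat-* (modpℤ p (↥ q)) (invp p (↧ₙ q))) (trans (cong₂ _*_ (trans (nat-modpℤ (↥ q)) N≡) (trans (nat-modp (↧ₙ q ℕ.^ (p ℕ.∸ 2))) (nat-^ (↧ₙ q) (p ℕ.∸ 2)))) (trans (*-assoc v _ _) (trans (cong (v *_) (*-inv D≢0)) (*-identityʳ v)))))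

 -- The fraction is brought to lowest terms by a gcd that divides d and is therefore invertible
 -- modulo p; it cancels from both sides.
 Reduces-/ : ∀ i d .{{_ : NonZero d}} {v} → nat d ≢ 0# → int i ≡ v * nat d → Reduces (i ℚ./ d) v
 Reduces-/ i d {v} d≢0 e = D≢0 , *-cancelˡ g≢0 (trans (trans (*-comm _ _) (trans (sym (int-* (↥ (i ℚ./ d)) g)) (trans (cong int (ℚₚ.↥-/ i d)) e))) (trans (cong (v *_) (sym D*g)) (solve 3 (λ v D g → v :* (D :* g) := g :* (v :* D)) refl v (nat (↧ₙ (i ℚ./ d))) (int g))))
   where
   g = Data.Integer.GCD.gcd i (ℤ.+ d)
   D*g : nat (↧ₙ (i ℚ./ d)) * int g ≡ nat d
   D*g = trans (cong (_* int g) (sym (int-pos (↧ₙ (i ℚ./ d))))) (trans (sym (int-* (↧ (i ℚ./ d)) g)) (trans (cong int (ℚₚ.↧-/ i d)) (int-pos d)))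
   D≢0 : nat (↧ₙ (i ℚ./ d)) ≢ 0#
   D≢0 z = d≢0 (trans (sym D*g) (trans (cong (_* int g) z) (zeroˡ _)))
   g≢0 : int g ≢ 0#
   g≢0 z = d≢0 (trans (sym D*g) (trans (cong (nat (↧ₙ (i ℚ./ d)) *_) z) (zeroʳ _)))

 Reduces-* : ∀ q r {v w} → Reduces q v → Reduces r w → Reduces (q ℚ.* r) (v * w)
 Reduces-* q@record{} r@record{} {v} {w} (a , b) (c , d) = Reduces-/ (↥ q ℤ.* ↥ r) (↧ₙ q ℕ.* ↧ₙ r) (λ z → x*y≢0 a c (trans (sym (nat-* (↧ₙ q) (↧ₙ r))) z)) (trans (int-* (↥ q) (↥ r)) (trans (cong₂ _*_ b d) (trans (solve 4 (λ v a w c → v :* a :* (w :* c) := v :* w :* (a :* c)) refl v (nat (↧ₙ q)) w (nat (↧ₙ r))) (cong (v * w *_) (sym (nat-* (↧ₙ q) (↧ₙ r)))))))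

 Reduces-+ : ∀ q r {v w} → Reduces q v → Reduces r w → Reduces (q ℚ.+ r) (v + w)
 Reduces-+ q@record{} r@record{} {v} {w} (a , b) (c , d) = Reduces-/ (↥ q ℤ.* ↧ r ℤ.+ ↥ r ℤ.* ↧ q) (↧ₙ q ℕ.* ↧ₙ r) (λ z → x*y≢0 a c (trans (sym (nat-* (↧ₙ q) (↧ₙ r))) z)) (trans (int-+ (↥ q ℤ.* ↧ r) (↥ r ℤ.* ↧ q)) (trans (cong₂ _+_ (trans (int-* (↥ q) (↧ r)) (cong₂ _*_ b (int-pos (↧ₙ r)))) (trans (int-* (↥ r) (↧ q)) (cong₂ _*_ d (int-pos (↧ₙ q))))) (trans (solve 4 (λ v a w c → v :* a :* c :+ w :* c :* a := (v :+ w) :* (a :* c)) refl v (nat (↧ₙ q)) w (nat (↧ₙ r))) (cong ((v + w) *_) (sym (nat-* (↧ₙ q) (↧ₙ r)))))))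

 Reduces-neg : ∀ q {v} → Reduces q v → Reduces (ℚ.- q) (- v)
 Reduces-neg q {v} (a , b) = (λ z → a (trans (cong nat (sym denominators)) z)) , trans (cong int (ℚₚ.↥-neg q)) (trans (int-neg (↥ q)) (trans (cong (λ y → - y) b) (trans (solve 2 (λ v d → :- (v :* d) := (:- v) :* d) refl v (nat (↧ₙ q))) (cong (λ d → - v * nat d) (sym denominators)))))
   where
   denominators : ↧ₙ (ℚ.- q) ≡ ↧ₙ q
   denominators = ℤₚ.+-injective (ℚₚ.↧-neg q)

 Reduces-ℕ : ∀ k → Reduces (ℕtoℚ k) (nat k)
 Reduces-ℕ k = Reduces-/ (ℤ.+ k) 1 (λ z → 1≢0 (trans (sym nat-1) z)) (trans (int-pos k) (trans (sym (*-identityʳ _)) (cong (nat k *_) (sym nat-1))))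

 Reduces-recip : ∀ k → nat k ≢ 0# → Reduces (recipℕ k) (inv (nat k))
 Reduces-recip zero k≢0 = ⊥-elim (k≢0 nat-0)
 Reduces-recip (suc k) k≢0 = Reduces-/ (ℤ.+ 1) (suc k) k≢0 (sym (trans (*-comm _ _) (*-inv k≢0)))

 rising : F → ℕ → F
 rising a zero = 1#
 rising a (suc n) = rising a n * (a + nat n)

 Reduces-poch : ∀ q {v} → Reduces q v → ∀ n → Reduces (poch q n) (rising v n)
 Reduces-poch q r zero = (λ z → 1≢0 (trans (sym nat-1) z)) , trans (sym (*-identityʳ 1#)) (cong (1# *_) (sym nat-1))
 Reduces-poch q r (suc n) = Reduces-* (poch q n) (q ℚ.+ (ℤ.+ n ℚ./ 1)) (Reduces-poch q r n) (Reduces-+ q (ℤ.+ n ℚ./ 1) r (Reduces-ℕ n))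

 factorial≢0 : ∀ n → n ℕ.< p → nat (n !) ≢ 0#
 factorial≢0 zero _ z = 1≢0 (trans (sym nat-1) z)
 factorial≢0 (suc n) n<p z = x*y≢0 (nat≢0 (ℕ.s≤s ℕ.z≤n) n<p) (factorial≢0 n (<-trans (n<1+n n) n<p)) (trans (sym (nat-* (suc n) (n !))) z)

 module Coefficients (m c : ℕ) (β : ℚ) (b : F) (β-b : Reduces β b) (m<p : m ℕ.< p) where
   coefficient : ℕ → F
   coefficient n = rising (- nat m) n * rising b n * inv (nat (n ! ℕ.* n !)) * nat c ^ n

   private
     n!²≢0 : ∀ {n} → n ℕ.< p → nat (n ! ℕ.* n !) ≢ 0#
     n!²≢0 {n} n<p z = x*y≢0 (factorial≢0 n n<p) (factorial≢0 n n<p) (trans (sym (nat-* (n !) (n !))) z)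

   coefficient-red : ∀ n → n ℕ.≤ m → nat (redℚ p (hgCoeff m β n ℚ.* ℕtoℚ (c ℕ.^ n))) ≡ coefficient n
   coefficient-red n n≤m = redℚ-value (hgCoeff m β n ℚ.* ℕtoℚ (c ℕ.^ n)) (subst (λ k → Reduces (hgCoeff m β n ℚ.* ℕtoℚ (c ℕ.^ n)) (rising (- nat m) n * rising b n * inv (nat (n ! ℕ.* n !)) * k)) (nat-^ c n)
     (Reduces-* (hgCoeff m β n) (ℕtoℚ (c ℕ.^ n)) (Reduces-* (poch (ℚ.- ℕtoℚ m) n ℚ.* poch β n) (recipℕ (n ! ℕ.* n !)) (Reduces-* (poch (ℚ.- ℕtoℚ m) n) (poch β n) (Reduces-poch (ℚ.- ℕtoℚ m) (Reduces-neg (ℕtoℚ m) (Reduces-ℕ m)) n) (Reduces-poch β β-b n)) (Reduces-recip (n ! ℕ.* n !) (n!²≢0 (≤-<-trans n≤m m<p)))) (Reduces-ℕ (c ℕ.^ n))))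

   coefficient-0 : coefficient 0 ≡ 1#
   coefficient-0 = trans (cong (λ y → 1# * 1# * y * 1#) (trans (cong (_^ (p ℕ.∸ 2)) nat-1) (1^n≈1 (p ℕ.∸ 2)))) (solve 0 (# 1 :* # 1 :* # 1 :* # 1 := # 1) refl)

   coefficient-rec : ∀ n → n ℕ.< m → nat (suc n) * nat (suc n) * coefficient (suc n) ≡ nat c * ((nat n - nat m) * (nat n + b)) * coefficient n
   coefficient-rec n n<m = trans (solve 9 (λ s A B x i k K M N → s :* s :* (A :* ((:- M) :+ N) :* (B :* x) :* i :* (k :* K)) := (s :* s :* i) :* (A :* ((:- M) :+ N) :* (B :* x) :* (k :* K))) refl s A B (b + nat n) i' (nat c) (nat c ^ n) (nat m) (nat n))
     (trans (cong (_* (A * (- nat m + nat n) * (B * (b + nat n)) * (nat c * nat c ^ n))) ssi) (solve 8 (λ A B i k K M N b → i :* (A :* ((:- M) :+ N) :* (B :* (b :+ N)) :* (k :* K)) := k :* ((N :- M) :* (N :+ b)) :* (A :* B :* i :* K)) refl A B i (nat c) (nat c ^ n) (nat m) (nat n) b))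
     where
     s A B i i' : F
     s = nat (suc n)
     A = rising (- nat m) n
     B = rising b n
     i = inv (nat (n ! ℕ.* n !))
     i' = inv (nat (suc n ! ℕ.* suc n !))
     n<p : n ℕ.< p
     n<p = <-trans n<m m<p
     ssi : s * s * i' ≡ i
     ssi = *-cancelˡ (n!²≢0 n<p) (trans (trans (cong (_* (s * s * i')) (nat-* (n !) (n !))) (trans (solve 3 (λ f s i → f :* f :* (s :* s :* i) := (s :* f) :* (s :* f) :* i) refl (nat (n !)) s i') (trans (cong (_* i') (trans (cong₂ _*_ (sym (nat-* (suc n) (n !))) (sym (nat-* (suc n) (n !)))) (sym (nat-* (suc n !) (suc n !))))) (*-inv (n!²≢0 (≤-<-trans n<m m<p)))))) (sym (*-inv (n!²≢0 n<p))))

 -- The polynomials of the statement as members of the family.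

 toPl-powP : ∀ f n → toPl (powP f n) ≋ toPl f ^P n
 toPl-powP f zero = toPl-1
 toPl-powP f (suc n) = P.trans (P.reflexive (toPl-mulP f (powP f n))) (P.*-congˡ {toPl f} (toPl-powP f n))

 toPl-monomial : ∀ c k → toPl (monomial c k) ≋ C (nat c) ⊗ X ^P k
 toPl-monomial c k = P.trans (P.reflexive (cong toPl (monomial≡ c k))) (go k)
   where
   go : ∀ k → toPl (replicate k 0 ++ (c ∷ [])) ≋ C (nat c) ⊗ X ^P k
   go zero = P.trans (∷≋ (nat c) []) (P.trans (P.+-congˡ {C (nat c)} (P.zeroʳ X)) (P.trans (P.+-identityʳ (C (nat c))) (P.sym (P.*-identityʳ (C (nat c))))))
   go (suc k) = P.trans (∷≋ (nat 0) (toPl (replicate k 0 ++ (c ∷ [])))) (P.trans (P.+-cong (P.trans (C-cong nat-0) C-0) (P.*-congˡ {X} (go k))) (solveP 3 (λ x c y → x :* (c :* y) := c :* (x :* y)) P.refl X (C (nat c)) (X ^P k)))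

 toPl-XminusP : ∀ c → toPl (XminusP p c) ≋ lin (nat c)
 toPl-XminusP c = P.trans (∷≋ (nat (p ℕ.∸ modp p c)) (nat 1 ∷ [])) (P.trans (P.+-cong (P.trans (C-cong constant) (C-neg (nat c))) (P.trans (P.*-congˡ {X} toPl-1) (P.*-identityʳ X))) (P.trans (P.+-comm (⊝ C (nat c)) X) (P.sym (lin≋ (nat c)))))
   where
   constant : nat (p ℕ.∸ modp p c) ≡ - nat c
   constant = trans (nat-∸ (subst (ℕ._≤ p) (sym (modp≡% c)) (<⇒≤ (DM.m%n<n c p)))) (trans (cong₂ (λ a b → a - b) nat-p (nat-modp c)) (+-identityˡ _))

 toPl-Σ : ∀ k g → toPl (foldr addP [] (applyUpTo g (suc k))) ≋ PL.Σ≤ k (λ n → toPl (g n))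
 toPl-Σ zero g = P.trans (P.reflexive (toPl-addP (g 0) [])) (P.+-identityʳ _)
 toPl-Σ (suc k) g = P.trans (P.reflexive (toPl-addP (g 0) _)) (P.trans (P.+-congˡ {toPl (g 0)} (toPl-Σ k (λ n → g (suc n)))) (P.sym (shift k (λ n → toPl (g n)))))
   where
   shift : ∀ k t → PL.Σ≤ (suc k) t ≋ t 0 ⊕ PL.Σ≤ k (λ n → t (suc n))
   shift zero t = P.refl
   shift (suc k) t = P.trans (P.+-congʳ {t (suc (suc k))} (shift k t)) (P.+-assoc (t 0) (PL.Σ≤ k (λ n → t (suc n))) (t (suc (suc k))))

 -- From p = r + mK follows m = -r/K in the field, and b = B/K, g = G/K². The conditions on the
 -- parameters thereby become the equations `B+r` and `r*B` between small natural numbers. The level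
 -- has K = 8 for r = 2 and K = 6 for r = 3 in the sense of the overview; here `r` is the residue of
 -- p modulo K.
 module HypergeometricFamily (K r B G m ν ε c : ℕ) (β : ℚ) (b g : F)
   (p≡ : p ≡ r ℕ.+ m ℕ.* K) (0<r : 0 ℕ.< r) (0<B : 0 ℕ.< B) (B<K : B ℕ.< K) (K≢0 : nat K ≢ 0#) (κ≢0 : nat c ≢ 0#)
   (B+r : 2 ℕ.* (B ℕ.+ r) ≡ K ℕ.* (1 ℕ.+ 2 ℕ.* ν)) (r*B : 4 ℕ.* (r ℕ.* B) ≡ G ℕ.+ 2 ℕ.* ν ℕ.* (K ℕ.* K))
   (Kb : nat K * b ≡ nat B) (KKg : nat K * nat K * g ≡ nat G) (β-b : Reduces β b)
   (ν≤1 : ν ≡ 0 ⊎ ν ≡ 1) (ε≤1 : ε ≡ 0 ⊎ ε ≡ 1) where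
   private
     0<K : 0 ℕ.< K
     0<K = <-trans 0<B B<K

     m≤mK : m ℕ.≤ m ℕ.* K
     m≤mK = ℕₚ.m≤m*n m K {{ℕ.>-nonZero 0<K}}

     m<p : m ℕ.< p
     m<p = subst (m ℕ.<_) (sym p≡) (≤-<-trans m≤mK (ℕₚ.m<n+m (m ℕ.* K) 0<r))

     Km : nat K * nat m ≡ - nat r
     Km = trans (solve 2 (λ k r → k := r :+ k :- r) refl (nat K * nat m) (nat r)) (trans (cong (_- nat r) (trans (cong (nat r +_) (trans (*-comm (nat K) (nat m)) (sym (nat-* m K)))) (trans (sym (nat-+ r (m ℕ.* K))) (trans (cong nat (sym p≡)) nat-p)))) (+-identityˡ _))

     b-m : nat 2 * (b - nat m) ≡ 1# + nat 2 * nat ν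
     b-m = *-cancelˡ K≢0 (trans (solve 3 (λ K b m → K :* (# 2 :* (b :- m)) := # 2 :* (K :* b :- K :* m)) refl (nat K) b (nat m)) (trans (cong₂ (λ x y → nat 2 * (x - y)) Kb Km) (trans (solve 2 (λ B r → # 2 :* (B :- (:- r)) := # 2 :* (B :+ r)) refl (nat B) (nat r)) (trans (cong (nat 2 *_) (sym (nat-+ B r))) (trans (sym (nat-* 2 (B ℕ.+ r))) (trans (cong nat B+r) (trans (nat-* K _) (cong (nat K *_) (trans (nat-suc (2 ℕ.* ν)) (cong (1# +_) (nat-* 2 ν)))))))))))

     mb : - (nat 4 * (nat m * b)) ≡ g + nat 2 * nat ν
     mb = *-cancelˡ (x*y≢0 K≢0 K≢0) (trans (solve 3 (λ K m b → K :* K :* (:- (# 4 :* (m :* b))) := :- (# 4 :* ((K :* m) :* (K :* b)))) refl (nat K) (nat m) b) (trans (cong₂ (λ x y → - (nat 4 * (x * y))) Km Kb) (trans (solve 2 (λ r B → :- (# 4 :* ((:- r) :* B)) := # 4 :* (r :* B)) refl (nat r) (nat B))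
       (trans (cong (nat 4 *_) (sym (nat-* r B))) (trans (sym (nat-* 4 (r ℕ.* B))) (trans (cong nat r*B) (trans (nat-+ G _) (trans (cong₂ _+_ (sym KKg) (trans (nat-* (2 ℕ.* ν) (K ℕ.* K)) (cong₂ _*_ (nat-* 2 ν) (nat-* K K)))) (solve 3 (λ K g n → K :* K :* g :+ # 2 :* n :* (K :* K) := K :* K :* (g :+ # 2 :* n)) refl (nat K) g (nat ν))))))))))

     -- Equality would make kK + r - B divisible by p, but B < K ≤ kK and kK + r ≤ p place it
     -- strictly between 0 and p.
     at-0 : ∀ k → 0 ℕ.< k → k ℕ.≤ m → nat k ≢ nat m + b
     at-0 k 0<k k≤m e = nat≢0 (ℕₚ.m<n⇒0<n∸m B<) (<-≤-trans (ℕₚ.∸-monoʳ-< {k ℕ.* K ℕ.+ r} {B} {0} 0<B (<⇒≤ B<)) (subst (k ℕ.* K ℕ.+ r ℕ.≤_) (trans (ℕₚ.+-comm (m ℕ.* K) r) (sym p≡)) (ℕₚ.+-monoˡ-≤ r (ℕₚ.*-monoˡ-≤ K k≤m))))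
       (trans (nat-∸ (<⇒≤ B<)) (trans (cong (_- nat B) (trans (nat-+ (k ℕ.* K) r) (cong (_+ nat r) (trans (nat-* k K) (*-comm (nat k) (nat K)))))) (trans (cong (λ x → nat K * x + nat r - nat B) e) (trans (solve 5 (λ K m b r B → K :* (m :+ b) :+ r :- B := (K :* m) :+ (K :* b) :+ r :- B) refl (nat K) (nat m) b (nat r) (nat B)) (trans (cong₂ (λ x y → x + y + nat r - nat B) Km Kb) (solve 2 (λ r B → (:- r) :+ B :+ r :- B := # 0) refl (nat r) (nat B)))))))
       where
       B< : B ℕ.< k ℕ.* K ℕ.+ r
       B< = <-≤-trans B<K (≤-trans (ℕₚ.m≤n*m K k {{ℕ.>-nonZero 0<k}}) (m≤m+n (k ℕ.* K) r))

     -- Equality would make kK + r + B divisible by p, but this number is positive and, by B < K and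
     -- k < m, below p.
     at-κ : ∀ k → k ℕ.< m → nat k ≢ nat m - b
     at-κ k k<m e = nat≢0 {k ℕ.* K ℕ.+ r ℕ.+ B} (<-≤-trans 0<B (m≤n+m B (k ℕ.* K ℕ.+ r))) small (trans (nat-+ (k ℕ.* K ℕ.+ r) B) (trans (cong (_+ nat B) (trans (nat-+ (k ℕ.* K) r) (cong (_+ nat r) (trans (nat-* k K) (*-comm (nat k) (nat K)))))) (trans (cong (λ x → nat K * x + nat r + nat B) e) (trans (solve 5 (λ K m b r B → K :* (m :- b) :+ r :+ B := (K :* m) :- (K :* b) :+ r :+ B) refl (nat K) (nat m) b (nat r) (nat B)) (trans (cong₂ (λ x y → x - y + nat r + nat B) Km Kb) (solve 2 (λ r B → (:- r) :- B :+ r :+ B := # 0) refl (nat r) (nat B)))))))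
       where
       small : k ℕ.* K ℕ.+ r ℕ.+ B ℕ.< p
       small = <-≤-trans (ℕₚ.+-monoʳ-< (k ℕ.* K ℕ.+ r) B<K) (≤-trans (≤-reflexive (trans (ℕₚ.+-comm (k ℕ.* K ℕ.+ r) K) (trans (sym (ℕₚ.+-assoc K (k ℕ.* K) r)) (ℕₚ.+-comm (K ℕ.+ k ℕ.* K) r)))) (subst (r ℕ.+ (K ℕ.+ k ℕ.* K) ℕ.≤_) (sym p≡) (ℕₚ.+-monoʳ-≤ r (ℕₚ.*-monoˡ-≤ K k<m))))

   open Coefficients m c β b β-b m<p

   familyData : FamilyData
   familyData = record { m = m ; ν = ν ; ε = ε ; ν≤1 = ν≤1 ; ε≤1 = ε≤1 ; κ = nat c ; b = b ; g = g ; e = coefficient ; e-0 = coefficient-0 ; e-rec = coefficient-rec ; b-m = b-m ; mb = mb ; m<p = m<p ; κ≢0 = κ≢0 ; at-0 = at-0 ; at-κ = at-κ }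

   open Family familyData using (f; f₀)

   toPl-ssGeneric : toPl (ssGeneric p m ε ν c β) ≋ f
   toPl-ssGeneric = P.trans (P.reflexive (toPl-mulP (powP (XminusP p c) ν) _)) (P.*-cong (P.trans (toPl-powP (XminusP p c) ν) (Exp.^-congˡ P.semiring ν (toPl-XminusP c)))
     (P.trans (toPl-Σ m g') (P.trans (PL.Σ≤-cong m {λ n → toPl (g' n)} term-value) (P.sym (PL.*-distribˡ-Σ≤ m (X ^P ε) (λ n → C (coefficient n) ⊗ X ^P (m ℕ.∸ n)))))))
     where
     g' : ℕ → Poly
     g' n = monomial (redℚ p (hgCoeff m β n ℚ.* ℕtoℚ (c ℕ.^ n))) (m ℕ.+ ε ℕ.∸ n)
     term-value : ∀ n → n ℕ.≤ m → toPl (g' n) ≋ X ^P ε ⊗ (C (coefficient n) ⊗ X ^P (m ℕ.∸ n))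
     term-value n n≤m = P.trans (toPl-monomial (redℚ p (hgCoeff m β n ℚ.* ℕtoℚ (c ℕ.^ n))) (m ℕ.+ ε ℕ.∸ n)) (P.trans (P.*-cong (C-cong (coefficient-red n n≤m)) (P.trans (P.reflexive (cong (X ^P_) (trans (cong (ℕ._∸ n) (ℕₚ.+-comm m ε)) (ℕₚ.+-∸-assoc ε n≤m)))) (^P-homo-* X ε (m ℕ.∸ n)))) (solveP 3 (λ c x y → c :* (x :* y) := x :* (c :* y)) P.refl (C (coefficient n)) (X ^P ε) (X ^P (m ℕ.∸ n))))

   -- The coefficient with index 0 is 1 and belongs to X^m; all later terms of the series have
   -- smaller degree.
   f-degree : HasDegree f (m ℕ.+ ε ℕ.+ ν)
   f-degree = subst (HasDegree f) (trans (cong₂ (λ x y → x ℕ.+ (y ℕ.+ m)) (ℕₚ.*-identityʳ ν) (ℕₚ.*-identityʳ ε)) (trans (ℕₚ.+-comm ν (ε ℕ.+ m)) (cong (ℕ._+ ν) (ℕₚ.+-comm ε m)))) (HasDegree-⊗ (lin (nat c) ^P ν) (X ^P ε ⊗ f₀) (HasDegree-^ (lin (nat c)) (HasDegree-lin (nat c)) ν) (HasDegree-⊗ (X ^P ε) f₀ (HasDegree-^ X HasDegree-X ε) (partial m ≤-refl)))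
     where
     term : ℕ → Pl
     term n = C (coefficient n) ⊗ X ^P (m ℕ.∸ n)
     partial : ∀ k → k ℕ.≤ m → HasDegree (PL.Σ≤ k term) m
     partial zero _ = subst (HasDegree (term 0)) (ℕₚ.*-identityʳ m) (HasDegree-⊗ (C (coefficient 0)) (X ^P m) (HasDegree-C (λ z → 1≢0 (trans (sym coefficient-0) z))) (HasDegree-^ X HasDegree-X m))
     partial (suc k) k<m with partial k (<⇒≤ k<m)
     ... | ne , bl = (λ z → ne (trans (sym (trans (cf-⊕ (PL.Σ≤ k term) (term (suc k)) m) (trans (cong (cf (PL.Σ≤ k term) m +_) (below m ≤-refl)) (+-identityʳ _)))) z)) , Below-⊕ (PL.Σ≤ k term) (term (suc k)) bl (Below-mono (term (suc k)) (ℕₚ.n≤1+n m) below)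
       where
       below : Below m (term (suc k))
       below = Below-C⊗ (coefficient (suc k)) (X ^P (m ℕ.∸ suc k)) (Below-mono (X ^P (m ℕ.∸ suc k)) (≤-trans (ℕ.s≤s (≤-reflexive (ℕₚ.*-identityʳ (m ℕ.∸ suc k)))) (ℕₚ.∸-monoʳ-< {m} {suc k} {0} (ℕ.s≤s ℕ.z≤n) k<m)) (Below-^ X Below-X (m ℕ.∸ suc k)))

 -- Legendre symbols and the residue classes of p.

 legendre-square : ∀ a s → s * s ≡ nat a → halfOneMinusLegendre p a ≡ 0
 legendre-square a s e = cong (λ b → if b then 0 else 1) (Equivalence.to Data.Bool.Properties.T-≡ (Anyₚ.any⁺ (λ x → modp p (x ℕ.* x) ℕ.≡ᵇ modp p a) (Any.map (λ { refl → ℕₚ.≡⇒≡ᵇ _ _ (modp-cong (trans (nat-* (toℕ s) (toℕ s)) (trans (cong₂ _*_ (nat-toℕ s) (nat-toℕ s)) e))) }) (∈ₚ.∈-upTo⁺ (Finₚ.toℕ<n s)))))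

 legendre-nonsquare : ∀ a → (∀ s → s * s ≢ nat a) → halfOneMinusLegendre p a ≡ 1
 legendre-nonsquare a ne with isSquare p a in eq
 ... | false = refl
 ... | true with Any.satisfied (Anyₚ.any⁻ (λ x → modp p (x ℕ.* x) ℕ.≡ᵇ modp p a) (upTo p) (Equivalence.from Data.Bool.Properties.T-≡ eq))
 ... | x , t = ⊥-elim (ne (nat x) (trans (sym (nat-* x x)) (modp-injective (ℕₚ.≡ᵇ⇒≡ _ _ t))))

 module Legendre (n : ℕ) (p≡ : p ≡ suc (n ℕ.+ n)) where
   residue : ∀ a → a ℕ.≤ p → (- nat a) ^ n ≡ 1# → halfOneMinusLegendre p (p ℕ.∸ a) ≡ 0
   residue a a≤p e = legendre-square (p ℕ.∸ a) (proj₁ (OddPrime.euler n p≡ _ e)) (trans (proj₂ (OddPrime.euler n p≡ _ e)) (sym (trans (nat-∸ a≤p) (trans (cong (_- nat a) nat-p) (+-identityˡ _)))))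

   nonresidue : ∀ a → a ℕ.≤ p → (- nat a) ^ n ≡ - 1# → halfOneMinusLegendre p (p ℕ.∸ a) ≡ 1
   nonresidue a a≤p e = legendre-nonsquare (p ℕ.∸ a) (λ s ss → OddPrime.nonsquare n p≡ _ e s (trans ss (trans (nat-∸ a≤p) (trans (cong (_- nat a) nat-p) (+-identityˡ _)))))

 [-1]^even : ∀ {n} j → n ≡ j ℕ.+ j → (- 1#) ^ n ≡ 1#
 [-1]^even j e = trans (cong ((- 1#) ^_) e) (-1^ j)

 [-1]^odd : ∀ {n} j → n ≡ suc (j ℕ.+ j) → (- 1#) ^ n ≡ - 1#
 [-1]^odd j e = trans (cong ((- 1#) ^_) e) (trans (cong (- 1# *_) (-1^ j)) (*-identityʳ _))

 isSmall-5≤ : 5 ℕ.≤ p → isSmall p ≡ false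
 isSmall-5≤ = go p
   where
   go : ∀ p → 5 ℕ.≤ p → isSmall p ≡ false
   go _ (ℕ.s≤s (ℕ.s≤s (ℕ.s≤s (ℕ.s≤s (ℕ.s≤s _))))) = refl

 not-multiple : ∀ d → 1 ℕ.< d → d ℕ.< p → ∀ q → p ≢ q ℕ.* d
 not-multiple d 1<d d<p q e = [ (λ z → <⇒≢ 1<d (sym z)) , <⇒≢ d<p ]′ (prime⇒irreducible pp (divides q e))

 -- Keeps apart the exponents as the statement computes them from p and their values in a residue
 -- class, with which the family is instantiated.
 record Setup (ss : Poly) (m₀ ε₀ ν₀ : ℕ) : Set where
   field
     n : ℕ
     p≡ : p ≡ suc (n ℕ.+ n)
     data₀ : FamilyData
   open FamilyData data₀ public using (m; ε; ν; g)
   field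
     ss≋f : toPl ss ≋ Family.f data₀
     f-deg : HasDegree (Family.f data₀) (m ℕ.+ ε ℕ.+ ν)
     m≡ : m ≡ m₀
     ε≡ : ε ≡ ε₀
     ν≡ : ν ≡ ν₀

 module _ (5≤p : 5 ℕ.≤ p) where
   private
     2≢0 : nat 2 ≢ 0#
     2≢0 = nat≢0 (ℕ.s≤s ℕ.z≤n) (<-≤-trans (ℕ.s≤s (ℕ.s≤s (ℕ.s≤s ℕ.z≤n))) 5≤p)

     2^k≢0 : ∀ k {x} → nat 2 ^ k ≡ x → x ≢ 0#
     2^k≢0 k e z = x^n≢0 2≢0 k (trans e z)

     8≢0 : nat 8 ≢ 0#
     8≢0 = 2^k≢0 3 (solve 0 (# 2 :^ 3 := # 8) refl)

     4≢0 : nat 4 ≢ 0#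
     4≢0 = 2^k≢0 2 (solve 0 (# 2 :^ 2 := # 4) refl)

     16≢0 : nat 16 ≢ 0#
     16≢0 = 2^k≢0 4 (solve 0 (# 2 :^ 4 := # 16) refl)

     2<p : 2 ℕ.< p
     2<p = <-≤-trans (ℕ.s≤s (ℕ.s≤s (ℕ.s≤s ℕ.z≤n))) 5≤p

     3<p : 3 ℕ.< p
     3<p = <-≤-trans (ℕ.s≤s (ℕ.s≤s (ℕ.s≤s (ℕ.s≤s ℕ.z≤n)))) 5≤p

     1≤p : 1 ℕ.≤ p
     1≤p = ≤-trans (ℕ.s≤s ℕ.z≤n) 2<p

     *-inv-cancel : ∀ {x} y → x ≢ 0# → y ≡ y * inv x * x
     *-inv-cancel {x} y x≢0 = sym (trans (*-assoc y (inv x) x) (trans (cong (y *_) (trans (*-comm (inv x) x) (*-inv x≢0))) (*-identityʳ y)))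

   3≢0 : nat 3 ≢ 0#
   3≢0 = nat≢0 (ℕ.s≤s ℕ.z≤n) 3<p

   Setup₂ : Set
   Setup₂ = Σ (Setup (ss2 p) (m₂ p) (Defs.ε p) (Defs.ν p)) λ s → let open Setup s in
     nat 16 * g ≡ nat 3 × (2 ℕ.* m ℕ.+ ν) ℕ.* 2 ℕ.≤ n × ((∃ λ j → n ≡ j ℕ.+ j) ⊎ (∃ λ j → n ≡ suc (j ℕ.+ j)))

   Setup₃ : Set
   Setup₃ = Σ (Setup (ss3 p) (m₃ p) (Defs.δ p) (Defs.δ p)) λ s → let open Setup s in
     nat 9 * g ≡ nat 2 × (2 ℕ.* m ℕ.+ ν) ℕ.* 3 ℕ.≤ p ℕ.∸ 1 × ((∃ λ k → p ≡ suc (k ℕ.* 3)) ⊎ (∃ λ k → p ≡ suc (suc (k ℕ.* 3))))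

   private
     module ℕS = Data.Nat.Solver.+-*-Solver

     z₂ : ℕ → ℕ → ℤ
     z₂ ε ν = ℤ.+ ε ℤ.- ℤ.+ (2 ℕ.* ν)

     -- Here p = 2r' + 1 + 8m, and 3/8 - (ε - 2ν)/4 = B/8 with B = 3 - 2(ε - 2ν). The bound 2ν ≤ r'
     -- guarantees that the transformed polynomial fits below the exponent n.
     case₂ : ∀ r' B ν ε → let n = r' ℕ.+ m₂ p ℕ.* 4 in p ≡ suc (r' ℕ.+ r') ℕ.+ m₂ p ℕ.* 8 → Defs.ε p ≡ ε → Defs.ν p ≡ ν → ν ≡ 0 ⊎ ν ≡ 1 → ε ≡ 0 ⊎ ε ≡ 1 → 0 ℕ.< B → B ℕ.< 8 →
       2 ℕ.* (B ℕ.+ suc (r' ℕ.+ r')) ≡ 8 ℕ.* (1 ℕ.+ 2 ℕ.* ν) → 4 ℕ.* (suc (r' ℕ.+ r') ℕ.* B) ≡ 12 ℕ.+ 2 ℕ.* ν ℕ.* 64 → nat 3 - nat 2 * int (z₂ ε ν) ≡ nat B → ν ℕ.* 2 ℕ.≤ r' →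
       (p ≡ suc (n ℕ.+ n) → (∃ λ j → n ≡ j ℕ.+ j) ⊎ (∃ λ j → n ≡ suc (j ℕ.+ j))) → Setup₂
     case₂ r' B ν ε pr ε≡ ν≡ ν≤1 ε≤1 0<B B<8 B+r r*B 8b ν≤r parity = record
         { n = r' ℕ.+ m ℕ.* 4 ; p≡ = p≡ ; data₀ = familyData
         ; ss≋f = P.trans (P.reflexive (cong toPl (trans (cong (λ s → if s then XP else ssGeneric p m (Defs.ε p) (Defs.ν p) 256 (β₂ p)) (isSmall-5≤ 5≤p)) (cong₂ (λ ε ν → ssGeneric p m ε ν 256 (β₀ ε ν)) ε≡ ν≡)))) toPl-ssGeneric
         ; f-deg = f-degree ; m≡ = refl ; ε≡ = sym ε≡ ; ν≡ = sym ν≡ }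
       , trans (*-comm _ _) (sym (*-inv-cancel (nat 3) 16≢0))
       , ≤-trans (≤-reflexive (ℕS.solve 2 (λ m v → (ℕS.con 2 ℕS.:* m ℕS.:+ v) ℕS.:* ℕS.con 2 ℕS.:= v ℕS.:* ℕS.con 2 ℕS.:+ m ℕS.:* ℕS.con 4) refl m ν)) (ℕₚ.+-monoˡ-≤ (m ℕ.* 4) ν≤r)
       , parity p≡
       where
       m = m₂ p
       β₀ : ℕ → ℕ → ℚ
       β₀ ε ν = (ℤ.+ 3 ℚ./ 8) ℚ.- (z₂ ε ν ℚ./ 4)
       b g : F
       b = nat 3 * inv (nat 8) + - (int (z₂ ε ν) * inv (nat 4))
       g = nat 3 * inv (nat 16)
       p≡ : p ≡ suc (r' ℕ.+ m ℕ.* 4 ℕ.+ (r' ℕ.+ m ℕ.* 4))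
       p≡ = trans pr (ℕS.solve 2 (λ r m → ℕS.con 1 ℕS.:+ (r ℕS.:+ r) ℕS.:+ m ℕS.:* ℕS.con 8 ℕS.:= ℕS.con 1 ℕS.:+ (r ℕS.:+ m ℕS.:* ℕS.con 4 ℕS.:+ (r ℕS.:+ m ℕS.:* ℕS.con 4))) refl r' m)
       Kb : nat 8 * b ≡ nat B
       Kb = trans (solve 3 (λ i z j → # 8 :* (# 3 :* i :+ (:- (z :* j))) := # 3 :* i :* # 8 :- # 2 :* (z :* j :* # 4)) refl (inv (nat 8)) (int (z₂ ε ν)) (inv (nat 4))) (trans (cong₂ (λ x y → x - nat 2 * y) (sym (*-inv-cancel (nat 3) 8≢0)) (sym (*-inv-cancel (int (z₂ ε ν)) 4≢0))) 8b)
       KKg : nat 8 * nat 8 * g ≡ nat 12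
       KKg = trans (solve 1 (λ i → # 8 :* # 8 :* (# 3 :* i) := # 4 :* (# 3 :* i :* # 16)) refl (inv (nat 16))) (trans (cong (nat 4 *_) (sym (*-inv-cancel (nat 3) 16≢0))) (solve 0 (# 4 :* # 3 := # 12) refl))
       open HypergeometricFamily 8 (suc (r' ℕ.+ r')) B 12 m ν ε 256 (β₀ ε ν) b g pr (ℕ.s≤s ℕ.z≤n) 0<B B<8 8≢0 (2^k≢0 8 (solve 0 (# 2 :^ 8 := # 256) refl)) B+r r*B Kb KKg
         (Reduces-+ (ℤ.+ 3 ℚ./ 8) (ℚ.- (z₂ ε ν ℚ./ 4)) (Reduces-/ (ℤ.+ 3) 8 8≢0 (*-inv-cancel (nat 3) 8≢0)) (Reduces-neg (z₂ ε ν ℚ./ 4) (Reduces-/ (z₂ ε ν) 4 4≢0 (*-inv-cancel (int (z₂ ε ν)) 4≢0)))) ν≤1 ε≤1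

   setup₂ : Setup₂
   setup₂ = go (p % 8) (DM.m%n<n p 8) (DM.m≡m%n+[m/n]*n p 8)
     where
     m = m₂ p
     even : ∀ h → p ≢ h ℕ.+ h ℕ.+ m ℕ.* 8
     even h e = not-multiple 2 (ℕ.s≤s (ℕ.s≤s ℕ.z≤n)) 2<p (h ℕ.+ m ℕ.* 4) (trans e (ℕS.solve 2 (λ h m → h ℕS.:+ h ℕS.:+ m ℕS.:* ℕS.con 8 ℕS.:= (h ℕS.:+ m ℕS.:* ℕS.con 4) ℕS.:* ℕS.con 2) refl h m))
     odd≡ : ∀ r' → p ≡ suc (r' ℕ.+ r') ℕ.+ m ℕ.* 8 → p ≡ suc (r' ℕ.+ m ℕ.* 4 ℕ.+ (r' ℕ.+ m ℕ.* 4))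
     odd≡ r' e = trans e (ℕS.solve 2 (λ r m → ℕS.con 1 ℕS.:+ (r ℕS.:+ r) ℕS.:+ m ℕS.:* ℕS.con 8 ℕS.:= ℕS.con 1 ℕS.:+ (r ℕS.:+ m ℕS.:* ℕS.con 4 ℕS.:+ (r ℕS.:+ m ℕS.:* ℕS.con 4))) refl r' m)
     m*2 : m ℕ.* 2 ≡ m ℕ.+ m
     m*2 = ℕS.solve 1 (λ m → m ℕS.:* ℕS.con 2 ℕS.:= m ℕS.:+ m) refl m
     m*4 : ∀ r → r ℕ.+ r ℕ.+ m ℕ.* 4 ≡ r ℕ.+ m ℕ.* 2 ℕ.+ (r ℕ.+ m ℕ.* 2)
     m*4 r = ℕS.solve 2 (λ r m → r ℕS.:+ r ℕS.:+ m ℕS.:* ℕS.con 4 ℕS.:= r ℕS.:+ m ℕS.:* ℕS.con 2 ℕS.:+ (r ℕS.:+ m ℕS.:* ℕS.con 2)) refl r m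
     minus-1 : ∀ n {y} → (- 1#) ^ n ≡ y → (- nat 1) ^ n ≡ y
     minus-1 n e = trans (cong (λ x → (- x) ^ n) nat-1) e
     go : ∀ r → r ℕ.< 8 → p ≡ r ℕ.+ m ℕ.* 8 → Setup₂
     go 0 _ e = ⊥-elim (even 0 e)
     go 2 _ e = ⊥-elim (even 1 e)
     go 4 _ e = ⊥-elim (even 2 e)
     go 6 _ e = ⊥-elim (even 3 e)
     -- The symbol of -1 is (-1)^n, and that of -2 is (-1)^j for n = 2j or n = 2j + 1. Hence ε is
     -- the parity of n and ν that of [n/2].
     go 1 _ e = case₂ 0 3 0 0 e (Legendre.residue (m ℕ.* 4) (odd≡ 0 e) 1 1≤p (minus-1 (m ℕ.* 4) ([-1]^even (m ℕ.* 2) (m*4 0)))) (Legendre.residue (m ℕ.* 4) (odd≡ 0 e) 2 (<⇒≤ 2<p) (trans (OddPrime.[-2]^n-even (m ℕ.* 4) (odd≡ 0 e) (m ℕ.* 2) (m*4 0)) ([-1]^even m m*2))) (inj₁ refl) (inj₁ refl) (ℕ.s≤s ℕ.z≤n) (m≤m+n 4 4) refl refl (solve 0 (# 3 :- # 2 :* # 0 := # 3) refl) ℕ.z≤n (λ _ → inj₁ (m ℕ.* 2 , m*4 0))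
     go 3 _ e = case₂ 1 1 0 1 e (Legendre.nonresidue (1 ℕ.+ m ℕ.* 4) (odd≡ 1 e) 1 1≤p (minus-1 (1 ℕ.+ m ℕ.* 4) ([-1]^odd (m ℕ.* 2) (cong suc (m*4 0))))) (Legendre.residue (1 ℕ.+ m ℕ.* 4) (odd≡ 1 e) 2 (<⇒≤ 2<p) (trans (OddPrime.[-2]^n-odd (1 ℕ.+ m ℕ.* 4) (odd≡ 1 e) (m ℕ.* 2) (cong suc (m*4 0))) ([-1]^even m m*2))) (inj₁ refl) (inj₂ refl) (ℕ.s≤s ℕ.z≤n) (m≤m+n 2 6) refl refl (trans (solve 0 (# 3 :- # 2 :* # 1 := # 1) refl) (sym nat-1)) ℕ.z≤n (λ _ → inj₂ (m ℕ.* 2 , cong suc (m*4 0)))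
     go 5 _ e = case₂ 2 7 1 0 e (Legendre.residue (2 ℕ.+ m ℕ.* 4) (odd≡ 2 e) 1 1≤p (minus-1 (2 ℕ.+ m ℕ.* 4) ([-1]^even (1 ℕ.+ m ℕ.* 2) (m*4 1)))) (Legendre.nonresidue (2 ℕ.+ m ℕ.* 4) (odd≡ 2 e) 2 (<⇒≤ 2<p) (trans (OddPrime.[-2]^n-even (2 ℕ.+ m ℕ.* 4) (odd≡ 2 e) (1 ℕ.+ m ℕ.* 2) (m*4 1)) ([-1]^odd m (cong suc m*2)))) (inj₂ refl) (inj₁ refl) (ℕ.s≤s ℕ.z≤n) (m≤m+n 8 0) refl refl (solve 0 (# 3 :- # 2 :* (:- # 2) := # 7) refl) ≤-refl (λ _ → inj₁ (1 ℕ.+ m ℕ.* 2 , m*4 1))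
     go 7 _ e = case₂ 3 5 1 1 e (Legendre.nonresidue (3 ℕ.+ m ℕ.* 4) (odd≡ 3 e) 1 1≤p (minus-1 (3 ℕ.+ m ℕ.* 4) ([-1]^odd (1 ℕ.+ m ℕ.* 2) (cong suc (m*4 1))))) (Legendre.nonresidue (3 ℕ.+ m ℕ.* 4) (odd≡ 3 e) 2 (<⇒≤ 2<p) (trans (OddPrime.[-2]^n-odd (3 ℕ.+ m ℕ.* 4) (odd≡ 3 e) (1 ℕ.+ m ℕ.* 2) (cong suc (m*4 1))) ([-1]^odd m (cong suc m*2)))) (inj₂ refl) (inj₂ refl) (ℕ.s≤s ℕ.z≤n) (m≤m+n 6 2) refl refl (trans (cong (λ x → nat 3 - nat 2 * - x) nat-1) (solve 0 (# 3 :- # 2 :* (:- # 1) := # 5) refl)) (m≤m+n 2 1) (λ _ → inj₂ (1 ℕ.+ m ℕ.* 2 , cong suc (m*4 1)))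
     go (suc (suc (suc (suc (suc (suc (suc (suc r)))))))) lt e = ⊥-elim (<⇒≱ lt (m≤m+n 8 r))

   private
     -- Here p = 2r' + 1 + 6m, and (1 + δ)/3 = B/6 with B = 2 + 2δ. The exponent δ occurs both at X
     -- and at X - 108.
     case₃ : ∀ r' B δ → let n = r' ℕ.+ m₃ p ℕ.* 3 in p ≡ suc (r' ℕ.+ r') ℕ.+ m₃ p ℕ.* 6 → Defs.δ p ≡ δ → δ ≡ 0 ⊎ δ ≡ 1 → 0 ℕ.< B → B ℕ.< 6 →
       2 ℕ.* (B ℕ.+ suc (r' ℕ.+ r')) ≡ 6 ℕ.* (1 ℕ.+ 2 ℕ.* δ) → 4 ℕ.* (suc (r' ℕ.+ r') ℕ.* B) ≡ 8 ℕ.+ 2 ℕ.* δ ℕ.* 36 → 2 ℕ.+ 2 ℕ.* δ ≡ B → δ ℕ.* 3 ℕ.≤ r' ℕ.+ r' →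
       ((∃ λ k → p ≡ suc (k ℕ.* 3)) ⊎ (∃ λ k → p ≡ suc (suc (k ℕ.* 3)))) → Setup₃
     case₃ r' B δ pr δ≡ δ≤1 0<B B<6 B+r r*B 6b δ≤r mod3 = record
         { n = r' ℕ.+ m ℕ.* 3 ; p≡ = p≡ ; data₀ = familyData
         ; ss≋f = P.trans (P.reflexive (cong toPl (trans (cong (λ s → if s then XP else ssGeneric p m (Defs.δ p) (Defs.δ p) 108 (β₃ p)) (isSmall-5≤ 5≤p)) (cong (λ δ → ssGeneric p m δ δ 108 (β₀ δ)) δ≡)))) toPl-ssGeneric
         ; f-deg = f-degree ; m≡ = refl ; ε≡ = sym δ≡ ; ν≡ = sym δ≡ }
       , trans (*-comm _ _) (sym (*-inv-cancel (nat 2) 9≢0))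
       , subst (λ q → (2 ℕ.* m ℕ.+ δ) ℕ.* 3 ℕ.≤ q ℕ.∸ 1) (sym pr) (≤-trans (≤-reflexive (ℕS.solve 2 (λ m v → (ℕS.con 2 ℕS.:* m ℕS.:+ v) ℕS.:* ℕS.con 3 ℕS.:= v ℕS.:* ℕS.con 3 ℕS.:+ m ℕS.:* ℕS.con 6) refl m δ)) (ℕₚ.+-monoˡ-≤ (m ℕ.* 6) δ≤r))
       , mod3
       where
       m = m₃ p
       β₀ : ℕ → ℚ
       β₀ δ = (ℤ.+ 1 ℚ./ 3) ℚ.+ (ℤ.+ δ ℚ./ 3)
       b g : F
       b = inv (nat 3) + nat δ * inv (nat 3)
       g = nat 2 * inv (nat 9)
       9≢0 : nat 9 ≢ 0#
       9≢0 z = x*y≢0 3≢0 3≢0 (trans (solve 0 (# 3 :* # 3 := # 9) refl) z)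
       6≢0 : nat 6 ≢ 0#
       6≢0 z = x*y≢0 2≢0 3≢0 (trans (solve 0 (# 2 :* # 3 := # 6) refl) z)
       108≢0 : nat 108 ≢ 0#
       108≢0 z = x*y≢0 (x^n≢0 2≢0 2) (x^n≢0 3≢0 3) (trans (solve 0 (# 2 :^ 2 :* # 3 :^ 3 := # 108) refl) z)
       p≡ : p ≡ suc (r' ℕ.+ m ℕ.* 3 ℕ.+ (r' ℕ.+ m ℕ.* 3))
       p≡ = trans pr (ℕS.solve 2 (λ r m → ℕS.con 1 ℕS.:+ (r ℕS.:+ r) ℕS.:+ m ℕS.:* ℕS.con 6 ℕS.:= ℕS.con 1 ℕS.:+ (r ℕS.:+ m ℕS.:* ℕS.con 3 ℕS.:+ (r ℕS.:+ m ℕS.:* ℕS.con 3))) refl r' m)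
       Kb : nat 6 * b ≡ nat B
       Kb = trans (solve 2 (λ i d → # 6 :* (i :+ d :* i) := # 2 :* (# 1 :+ d) :* i :* # 3) refl (inv (nat 3)) (nat δ)) (trans (sym (*-inv-cancel (nat 2 * (1# + nat δ)) 3≢0)) (trans (solve 1 (λ d → # 2 :* (# 1 :+ d) := # 2 :+ # 2 :* d) refl (nat δ)) (trans (cong (nat 2 +_) (sym (nat-* 2 δ))) (trans (sym (nat-+ 2 (2 ℕ.* δ))) (cong nat 6b)))))
       KKg : nat 6 * nat 6 * g ≡ nat 8
       KKg = trans (solve 1 (λ i → # 6 :* # 6 :* (# 2 :* i) := # 4 :* (# 2 :* i :* # 9)) refl (inv (nat 9))) (trans (cong (nat 4 *_) (sym (*-inv-cancel (nat 2) 9≢0))) (solve 0 (# 4 :* # 2 := # 8) refl))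
       open HypergeometricFamily 6 (suc (r' ℕ.+ r')) B 8 m δ δ 108 (β₀ δ) b g pr (ℕ.s≤s ℕ.z≤n) 0<B B<6 6≢0 108≢0 B+r r*B Kb KKg
         (Reduces-+ (ℤ.+ 1 ℚ./ 3) (ℤ.+ δ ℚ./ 3) (Reduces-/ (ℤ.+ 1) 3 3≢0 (sym (trans (*-comm _ _) (*-inv 3≢0)))) (Reduces-/ (ℤ.+ δ) 3 3≢0 (trans (int-pos δ) (*-inv-cancel (nat δ) 3≢0)))) δ≤1 δ≤1

   setup₃ : Setup₃
   setup₃ = go (p % 6) (DM.m%n<n p 6) (DM.m≡m%n+[m/n]*n p 6)
     where
     m = m₃ p
     even : ∀ h → p ≢ h ℕ.* 2 ℕ.+ m ℕ.* 6
     even h e = not-multiple 2 (ℕ.s≤s (ℕ.s≤s ℕ.z≤n)) 2<p (h ℕ.+ m ℕ.* 3) (trans e (ℕS.solve 2 (λ h m → h ℕS.:* ℕS.con 2 ℕS.:+ m ℕS.:* ℕS.con 6 ℕS.:= (h ℕS.:+ m ℕS.:* ℕS.con 3) ℕS.:* ℕS.con 2) refl h m))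
     go : ∀ r → r ℕ.< 6 → p ≡ r ℕ.+ m ℕ.* 6 → Setup₃
     go 0 _ e = ⊥-elim (even 0 e)
     go 2 _ e = ⊥-elim (even 1 e)
     go 4 _ e = ⊥-elim (even 2 e)
     go 3 _ e = ⊥-elim (not-multiple 3 (ℕ.s≤s (ℕ.s≤s ℕ.z≤n)) 3<p (1 ℕ.+ m ℕ.* 2) (trans e (ℕS.solve 1 (λ m → ℕS.con 3 ℕS.:+ m ℕS.:* ℕS.con 6 ℕS.:= (ℕS.con 1 ℕS.:+ m ℕS.:* ℕS.con 2) ℕS.:* ℕS.con 3) refl m)))
     go 1 _ e = case₃ 0 2 0 e (Legendre.residue (m ℕ.* 3) odd≡ 3 (<⇒≤ 3<p) (OddPrime.[-3]^n-1mod3 (m ℕ.* 3) odd≡ (m ℕ.* 2) mod3)) (inj₁ refl) (ℕ.s≤s ℕ.z≤n) (m≤m+n 3 3) refl refl refl ℕ.z≤n (inj₁ (m ℕ.* 2 , mod3))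
       where
       odd≡ : p ≡ suc (m ℕ.* 3 ℕ.+ m ℕ.* 3)
       odd≡ = trans e (ℕS.solve 1 (λ m → ℕS.con 1 ℕS.:+ m ℕS.:* ℕS.con 6 ℕS.:= ℕS.con 1 ℕS.:+ (m ℕS.:* ℕS.con 3 ℕS.:+ m ℕS.:* ℕS.con 3)) refl m)
       mod3 : p ≡ suc (m ℕ.* 2 ℕ.* 3)
       mod3 = trans e (cong suc (sym (ℕₚ.*-assoc m 2 3)))
     go 5 _ e = case₃ 2 4 1 e (Legendre.nonresidue (2 ℕ.+ m ℕ.* 3) odd≡ 3 (<⇒≤ 3<p) (OddPrime.[-3]^n-2mod3 (2 ℕ.+ m ℕ.* 3) odd≡ (1 ℕ.+ m ℕ.* 2) mod3)) (inj₂ refl) (ℕ.s≤s ℕ.z≤n) (m≤m+n 5 1) refl refl refl (m≤m+n 3 1) (inj₂ (1 ℕ.+ m ℕ.* 2 , mod3))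
       where
       odd≡ : p ≡ suc (2 ℕ.+ m ℕ.* 3 ℕ.+ (2 ℕ.+ m ℕ.* 3))
       odd≡ = trans e (ℕS.solve 1 (λ m → ℕS.con 5 ℕS.:+ m ℕS.:* ℕS.con 6 ℕS.:= ℕS.con 1 ℕS.:+ (ℕS.con 2 ℕS.:+ m ℕS.:* ℕS.con 3 ℕS.:+ (ℕS.con 2 ℕS.:+ m ℕS.:* ℕS.con 3))) refl m)
       mod3 : p ≡ suc (suc ((1 ℕ.+ m ℕ.* 2) ℕ.* 3))
       mod3 = trans e (cong (5 ℕ.+_) (sym (ℕₚ.*-assoc m 2 3)))
     go (suc (suc (suc (suc (suc (suc r)))))) lt e = ⊥-elim (<⇒≱ lt (m≤m+n 6 r))

 -- Counting roots and splitting.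

 ev-evalMod : ∀ f x → nat (evalMod p f x) ≡ E.ev (toPl f) (nat x)
 ev-evalMod [] x = nat-0
 ev-evalMod (a ∷ f) x = trans (nat-modp (a ℕ.+ x ℕ.* evalMod p f x)) (trans (nat-+ a (x ℕ.* evalMod p f x)) (cong (nat a +_) (trans (nat-* x (evalMod p f x)) (cong (nat x *_) (ev-evalMod f x)))))

 private
   Unique-map : ∀ {xs : List ℕ} → All (ℕ._< p) xs → Unique xs → Unique (map nat xs)
   Unique-map [] [] = []
   Unique-map (b ∷ bs) (u ∷ us) = distinct b bs u ∷ Unique-map bs us
     where
     distinct : ∀ {x xs} → x ℕ.< p → All (ℕ._< p) xs → All (x ≢_) xs → All (nat x ≢_) (map nat xs)
     distinct x<p [] [] = []
     distinct x<p (b ∷ bs) (n ∷ ns) = (λ e → n (nat-injective x<p b e)) ∷ distinct x<p bs ns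

 module RootCount (f : Poly) where
   rootsF : List F
   rootsF = map nat (rootsMod p f)

   rootsF-unique : Unique rootsF
   rootsF-unique = Unique-map (All.tabulate (λ i → ∈ₚ.∈-upTo⁻ (proj₁ (∈ₚ.∈-filter⁻ (λ x → modp p (evalMod p f x) ℕ.≟ 0) {xs = upTo p} i)))) (Uniqueₚ.filter⁺ (λ x → modp p (evalMod p f x) ℕ.≟ 0) (Uniqueₚ.upTo⁺ p))

   rootsF-roots : All (Root (toPl f)) rootsF
   rootsF-roots = Allₚ.map⁺ (All.map (λ {x} e → trans (sym (ev-evalMod f x)) (trans (modp-injective (trans e (sym modp-0))) nat-0)) (all-filter (λ x → modp p (evalMod p f x) ℕ.≟ 0) (upTo p)))

   length-rootsF : length rootsF ≡ rootCount p f
   length-rootsF = Listₚ.length-map nat (rootsMod p f)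

   root∈rootsF : ∀ {a} → Root (toPl f) a → a ∈ rootsF
   root∈rootsF {a} r = subst (_∈ rootsF) (nat-toℕ a) (∈-map⁺ nat (∈-filter⁺ (λ x → modp p (evalMod p f x) ℕ.≟ 0) (∈ₚ.∈-upTo⁺ (Finₚ.toℕ<n a)) (trans (modp-cong (trans (ev-evalMod f (toℕ a)) (trans (cong (E.ev (toPl f)) (nat-toℕ a)) (trans r (sym nat-0))))) modp-0)))

   -- The product over the distinct roots divides the polynomial; with as many roots as the degree,
   -- the cofactor has degree 0.
   all-roots⇒splits : ∀ {d} → HasDegree (toPl f) d → length rootsF ≡ d → Splits (toPl f) rootsF
   all-roots⇒splits {d} hf len = by (degree h)
     where
     h = proj₁ (factor-roots (toPl f) rootsF-unique rootsF-roots)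
     f≋ = proj₂ (factor-roots (toPl f) rootsF-unique rootsF-roots)
     Π-degree : ∀ as → HasDegree (Π as) (length as)
     Π-degree [] = HasDegree-C 1≢0
     Π-degree (a ∷ as) = HasDegree-⊗ (lin a) (Π as) (HasDegree-lin a) (Π-degree as)
     by : h ≋ [] ⊎ ∃ (HasDegree h) → Splits (toPl f) rootsF
     by (inj₁ z) = ⊥-elim (proj₁ hf (trans (at f≋ d) (trans (at (P.*-congˡ {Π rootsF} z) d) (at (P.zeroʳ (Π rootsF)) d))))
     by (inj₂ (e , hh)) = cf h 0 , subst (λ i → cf h i ≢ 0#) e≡0 (proj₁ hh) , P.trans f≋ (P.trans (P.*-comm (Π rootsF) h) (P.*-congʳ {Π rootsF} {h} {C (cf h 0)} (coeffwise λ { zero → sym (cf-C-0 (cf h 0)) ; (suc i) → trans (proj₂ hh (suc i) (ℕ.s≤s (subst (ℕ._≤ i) (sym e≡0) ℕ.z≤n))) (sym (Below-C (cf h 0) (suc i) (ℕ.s≤s ℕ.z≤n))) })))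
       where
       e≡0 : e ≡ 0
       e≡0 = ℕₚ.+-cancelˡ-≡ (length rootsF) e 0 (trans (HasDegree-unique (toPl f) (HasDegree-cong (P.sym f≋) (HasDegree-⊗ (Π rootsF) h (Π-degree rootsF) hh)) hf) (trans (sym len) (sym (ℕₚ.+-identityʳ _))))

 module SetupConsequences {ss : Poly} {m₀ ε₀ ν₀ : ℕ} (setup : Setup ss m₀ ε₀ ν₀) where
   open Setup setup
   open FamilyData data₀ using (κ; ν≤1; ε≤1)
   open Family data₀
   open RootCount (map (modp p) ss)

   private
     reduce : ∀ f → toPl (map (modp p) f) ≡ toPl f
     reduce [] = refl
     reduce (a ∷ f) = cong₂ _∷_ (nat-modp a) (reduce f)

     total : m ℕ.+ ε ℕ.+ ν ≡ m₀ ℕ.+ ε₀ ℕ.+ ν₀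
     total = cong₂ ℕ._+_ (cong₂ ℕ._+_ m≡ ε≡) ν≡

     reduced≋f : toPl (map (modp p) ss) ≋ f
     reduced≋f = P.trans (P.reflexive (reduce ss)) ss≋f

   all-roots⇒linear : rootCount p (map (modp p) ss) ≡ m₀ ℕ.+ ε₀ ℕ.+ ν₀ → ∀ fs → IsFactorization p ss fs → deg p ss ≡ linearCount p fs
   all-roots⇒linear e = splits⇒linear-factors ss rootsF (subst (λ f → Splits f rootsF) (reduce ss) (all-roots⇒splits (HasDegree-cong (P.sym reduced≋f) f-deg) (trans length-rootsF (trans e (sym total)))))

   linear⇒splits : ∀ fs → IsFactorization p ss fs → deg p ss ≡ linearCount p fs → ∃ λ as → Splits f as × length as ≡ m ℕ.+ ε ℕ.+ ν
   linear⇒splits fs isf e with linear-factors⇒splits ss fs isf e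
   ... | as , (k , k≢0 , s) , h = as , (k , k≢0 , P.trans (P.sym ss≋f) s) , HasDegree-unique f (HasDegree-cong ss≋f h) f-deg

   -- This direction needs the simplicity of the roots: the m roots of `f₀` are distinct and differ
   -- from 0 and κ, so together with 0 for ε = 1 and κ for ν = 1 the number of distinct roots
   -- reaches the degree.
   linear⇒all-roots : ∀ fs → IsFactorization p ss fs → deg p ss ≡ linearCount p fs → rootCount p (map (modp p) ss) ≡ m₀ ℕ.+ ε₀ ℕ.+ ν₀
   linear⇒all-roots fs isf e = go (linear⇒splits fs isf e)
    where
    go : (∃ λ as → Splits f as × length as ≡ m ℕ.+ ε ℕ.+ ν) → rootCount p (map (modp p) ss) ≡ m₀ ℕ.+ ε₀ ℕ.+ ν₀
    go (as , splits , len) = trans (trans (sym length-rootsF) (≤-antisym upper lower)) total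
     where
     open SplitFamily as splits len
     upper : length rootsF ℕ.≤ m ℕ.+ ε ℕ.+ ν
     upper = ≮⇒≥ λ lt → proj₁ f-deg (at (Below-too-many-roots (suc (m ℕ.+ ε ℕ.+ ν)) f (proj₂ f-deg) rootsF-unique (All.map (λ {a} r → trans (E.ev-cong a (P.sym reduced≋f)) r) rootsF-roots) lt) (m ℕ.+ ε ℕ.+ ν))
     special : ∀ a → (E.ev f₀ a ≡ 0# ⊎ (a - κ) ^ ν ≡ 0# ⊎ a ^ ε ≡ 0#) → Root f a
     special a h = trans (ev-f self a) (by h)
       where
       by : E.ev f₀ a ≡ 0# ⊎ (a - κ) ^ ν ≡ 0# ⊎ a ^ ε ≡ 0# → (a - κ) ^ ν * (a ^ ε * E.ev f₀ a) ≡ 0#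
       by (inj₁ z) = trans (cong (λ y → (a - κ) ^ ν * (a ^ ε * y)) z) (trans (cong ((a - κ) ^ ν *_) (zeroʳ _)) (zeroʳ _))
       by (inj₂ (inj₁ z)) = trans (cong (_* (a ^ ε * E.ev f₀ a)) z) (zeroˡ _)
       by (inj₂ (inj₂ z)) = trans (cong (λ y → (a - κ) ^ ν * (y * E.ev f₀ a)) z) (trans (cong ((a - κ) ^ ν *_) (zeroˡ _)) (zeroʳ _))
     zero-root : ε ≡ 1 → Root f 0#
     zero-root e = special 0# (inj₂ (inj₂ (trans (cong (0# ^_) e) (zeroˡ _))))
     κ-root : ν ≡ 1 → Root f κ
     κ-root e = special κ (inj₂ (inj₁ (trans (cong ((κ - κ) ^_) e) (trans (cong (_* 1#) (-‿inverseʳ κ)) (zeroˡ _)))))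
     simple : All (Root f) roots
     simple = All.map (λ {a} z → special a (inj₁ z)) roots-are-roots
     bound : ∀ {us} → Unique us → All (Root f) us → length us ℕ.≤ length rootsF
     bound uniq rs = pigeonhole uniq (All.map (λ {a} r → root∈rootsF (trans (E.ev-cong a reduced≋f) r)) rs)
     lower : m ℕ.+ ε ℕ.+ ν ℕ.≤ length rootsF
     lower = by ν≤1 ε≤1 all-roots-unique
       where
       m+ : ∀ {e n k} → ε ≡ e → ν ≡ n → length roots ℕ.+ e ℕ.+ n ≡ k → m ℕ.+ ε ℕ.+ ν ≡ k
       m+ e n q = trans (cong₂ ℕ._+_ (cong₂ ℕ._+_ (sym length-roots) e) n) q
       by : ν ≡ 0 ⊎ ν ≡ 1 → ε ≡ 0 ⊎ ε ≡ 1 → Unique (κ ∷ 0# ∷ roots) → m ℕ.+ ε ℕ.+ ν ℕ.≤ length rootsF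
       by (inj₁ n) (inj₁ e) (_ ∷ (_ ∷ u)) = ≤-trans (≤-reflexive (m+ e n (trans (ℕₚ.+-identityʳ _) (ℕₚ.+-identityʳ _)))) (bound u simple)
       by (inj₁ n) (inj₂ e) (_ ∷ u) = ≤-trans (≤-reflexive (m+ e n (trans (ℕₚ.+-identityʳ _) (ℕₚ.+-comm _ 1)))) (bound u (zero-root e ∷ simple))
       by (inj₂ n) (inj₁ e) ((_ ∷ k) ∷ (_ ∷ u)) = ≤-trans (≤-reflexive (m+ e n (trans (ℕₚ.+-comm _ 1) (cong suc (ℕₚ.+-identityʳ _))))) (bound (k ∷ u) (κ-root n ∷ simple))
       by (inj₂ n) (inj₂ e) u = ≤-trans (≤-reflexive (m+ e n (trans (ℕₚ.+-comm _ 1) (cong suc (ℕₚ.+-comm _ 1))))) (bound u (κ-root n ∷ zero-root e ∷ simple))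

   small : ∀ order → Data.Bool.T (agrees order ss (m₀ ℕ.+ ε₀ ℕ.+ ν₀) p) → ∀ fs → IsFactorization p ss fs → (deg p ss ≡ linearCount p fs) ⇔ (p ∣ order)
   small order t fs isf = mk⇔
     (λ e → nat≡0⇒p∣ (trans (modp-injective (trans (ℕₚ.≡ᵇ⇒≡ _ _ (subst Data.Bool.T (sym agree) (ℕₚ.≡⇒≡ᵇ _ _ (linear⇒all-roots fs isf e)))) (sym modp-0))) nat-0))
     (λ d → all-roots⇒linear (ℕₚ.≡ᵇ⇒≡ _ _ (subst Data.Bool.T agree (ℕₚ.≡⇒≡ᵇ _ _ (trans (modp-cong (trans (p∣⇒nat≡0 d) (sym nat-0))) modp-0)))) fs isf)
     where
     agree : (modp p order ℕ.≡ᵇ 0) ≡ (rootCount p (map (modp p) ss) ℕ.≡ᵇ m₀ ℕ.+ ε₀ ℕ.+ ν₀)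
     agree = Decidable.toWitness {a? = (modp p order ℕ.≡ᵇ 0) Data.Bool.≟ (rootCount p (map (modp p) ss) ℕ.≡ᵇ m₀ ℕ.+ ε₀ ℕ.+ ν₀)}
       (subst (λ b → Data.Bool.T (not b ∨ Decidable.isYes ((modp p order ℕ.≡ᵇ 0) Data.Bool.≟ (rootCount p (map (modp p) ss) ℕ.≡ᵇ m₀ ℕ.+ ε₀ ℕ.+ ν₀)))) (Decidable.dec-true (prime? p) pp) t)

 -- Conclusion for all primes.

 large₂ : (5≤p : 5 ℕ.≤ p) → 88 ℕ.≤ p → ∀ fs → IsFactorization p (ss2 p) fs → deg p (ss2 p) ≢ linearCount p fs
 large₂ 5≤p 88≤p fs isf e = go (setup₂ 5≤p)
   where
   go : Setup₂ 5≤p → ⊥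
   go (s , g≡ , degree≤ , parity) = go′ (SetupConsequences.linear⇒splits s fs isf e)
     where
     open Setup s
     go′ : (∃ λ as → Splits (Family.f data₀) as × length as ≡ m ℕ.+ ε ℕ.+ ν) → ⊥
     go′ (as , splits , len) = Level₂.Conditions.contradiction₂ n p≡ data₀ g≡ degree≤ as splits len
       ([ (λ (j , n≡) → inj₂ (λ v v≢0 1-v²≢0 ψ≡0 → CharacterSum₂.supersingular⇒n-odd n p≡ data₀ g≡ degree≤ v v≢0 1-v²≢0 ψ≡0 j n≡)) , (λ (j , n≡) → inj₁ ([-1]^odd j n≡)) ]′ parity)
       -- 88 = 8 · 11: one root more than there are exceptional zeros.
       (subst (11 ℕ.≤_) (sym m≡) (DM./-monoˡ-≤ 8 88≤p))

 large₃ : (5≤p : 5 ℕ.≤ p) → 78 ℕ.≤ p → ∀ fs → IsFactorization p (ss3 p) fs → deg p (ss3 p) ≢ linearCount p fs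
 large₃ 5≤p 78≤p fs isf e = go (setup₃ 5≤p)
   where
   go : Setup₃ 5≤p → ⊥
   go (s , g≡ , degree≤ , mod3) = go′ (SetupConsequences.linear⇒splits s fs isf e)
     where
     open Setup s
     go′ : (∃ λ as → Splits (Family.f data₀) as × length as ≡ m ℕ.+ ε ℕ.+ ν) → ⊥
     go′ (as , splits , len) = Level₃.Conditions.contradiction₃ n p≡ (3≢0 5≤p) data₀ g≡ degree≤ mod3 as splits len
       -- 78 = 6 · 13: one root more than there are exceptional zeros.
       (CharacterSum₃.supersingular⇒not-1mod3 n p≡ (3≢0 5≤p) data₀ g≡ degree≤) (subst (13 ℕ.≤_) (sym m≡) (DM./-monoˡ-≤ 6 78≤p))

 XP-splits : Splits (toPl XP) (0# ∷ [])
 XP-splits = 1# , 1≢0 , P.trans (∷≋ (nat 0) (nat 1 ∷ [])) (P.trans (P.+-cong (P.trans (C-cong nat-0) C-0) (P.*-congˡ {X} toPl-1)) (P.trans (P.*-congʳ {C 1#} (P.sym (P.trans (lin≋ 0#) (P.trans (P.+-congˡ {X} (P.-‿cong C-0)) (P.+-identityʳ X))))) (P.sym (P.*-identityˡ (lin 0# ⊗ C 1#)))))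

 ∣-bound : ∀ {N} xs → All (λ a → 0 ℕ.< a × a ℕ.≤ N) xs → p ∣ foldr ℕ._*_ 1 xs → p ℕ.≤ N
 ∣-bound [] [] d = ⊥-elim (<⇒≱ 1<p (∣⇒≤ d))
 ∣-bound (a ∷ xs) ((0<a , a≤N) ∷ h) d = [ (λ d' → ≤-trans (∣⇒≤ {{ℕ.>-nonZero 0<a}} d') a≤N) , ∣-bound xs h ]′ (euclidsLemma a (foldr ℕ._*_ 1 xs) pp d)

 prime<5 : p ℕ.< 5 → p ≡ 2 ⊎ p ≡ 3
 prime<5 = go p refl
   where
   go : ∀ q → p ≡ q → q ℕ.< 5 → p ≡ 2 ⊎ p ≡ 3
   go 0 e _ = ⊥-elim (<⇒≱ 1<p (≤-trans (≤-reflexive e) ℕ.z≤n))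
   go 1 e _ = ⊥-elim (<⇒≢ 1<p (sym e))
   go 2 e _ = inj₁ e
   go 3 e _ = inj₂ e
   go 4 e _ = ⊥-elim (not-multiple 2 (ℕ.s≤s (ℕ.s≤s ℕ.z≤n)) (subst (2 ℕ.<_) (sym e) (ℕ.s≤s (ℕ.s≤s (ℕ.s≤s ℕ.z≤n)))) 2 e)
   go (suc (suc (suc (suc (suc q))))) _ lt = ⊥-elim (<⇒≱ lt (m≤m+n 5 q))

 -- For p = 2 and p = 3 both sides hold: the polynomial X is linear, and the order is divisible by 2
 -- and by 3.
 tiny : ∀ ss order → (isSmall p ≡ true → ss ≡ XP) → order % 2 ≡ 0 → order % 3 ≡ 0 → p ℕ.< 5 → ∀ fs → IsFactorization p ss fs → (deg p ss ≡ linearCount p fs) ⇔ (p ∣ order)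
 tiny ss order ss≡ 2∣ 3∣ p<5 fs isf = mk⇔ (λ _ → p∣order) (λ _ → subst (λ f → ∀ fs → IsFactorization p f fs → deg p f ≡ linearCount p fs) (sym (ss≡ isSmall≡)) (splits⇒linear-factors XP (0# ∷ []) XP-splits) fs isf)
   where
   p∣order : p ∣ order
   p∣order = [ (λ e → subst (_∣ order) (sym e) (m%n≡0⇒n∣m order 2 2∣)) , (λ e → subst (_∣ order) (sym e) (m%n≡0⇒n∣m order 3 3∣)) ]′ (prime<5 p<5)
   isSmall≡ : isSmall p ≡ true
   isSmall≡ = [ cong isSmall , cong isSmall ]′ (prime<5 p<5)

 in-range : ∀ {P : ℕ → Set} k → All (λ i → P (5 ℕ.+ i)) (upTo k) → 5 ℕ.≤ p → p ℕ.< 5 ℕ.+ k → P p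
 in-range {P} k h 5≤p p<5+k = subst P (m+[n∸m]≡n 5≤p) (All.lookup h (∈ₚ.∈-upTo⁺ (ℕₚ.+-cancelˡ-< 5 (p ℕ.∸ 5) k (subst (ℕ._< 5 ℕ.+ k) (sym (m+[n∸m]≡n 5≤p)) p<5+k))))

 baby-monster : ∀ fs → IsFactorization p (ss2 p) fs → (deg p (ss2 p) ≡ linearCount p fs) ⇔ (p ∣ orderBabyMonster)
 baby-monster fs isf = by (p ℕ.<? 5) (p ℕ.<? 88)
   where
   by : Dec (p ℕ.< 5) → Dec (p ℕ.< 88) → (deg p (ss2 p) ≡ linearCount p fs) ⇔ (p ∣ orderBabyMonster)
   by (yes p<5) _ = tiny (ss2 p) orderBabyMonster (cong (λ b → if b then XP else ssGeneric p (m₂ p) (Defs.ε p) (Defs.ν p) 256 (β₂ p))) refl refl p<5 fs isf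
   by (no p≮5) (yes p<88) = SetupConsequences.small (proj₁ (setup₂ (≮⇒≥ p≮5))) orderBabyMonster (in-range {λ p → Data.Bool.T (agrees₂ p)} 83 range₂ (≮⇒≥ p≮5) p<88) fs isf
   by (no p≮5) (no p≮88) = mk⇔ (λ e → ⊥-elim (large₂ (≮⇒≥ p≮5) (≮⇒≥ p≮88) fs isf e)) (λ d → ⊥-elim (p≮88 (≤-<-trans (∣-bound babyMonsterFactors babyMonsterFactors≤47 d) (m≤m+n 48 40))))

 fischer : ∀ fs → IsFactorization p (ss3 p) fs → (deg p (ss3 p) ≡ linearCount p fs) ⇔ (p ∣ orderFi24')
 fischer fs isf = by (p ℕ.<? 5) (p ℕ.<? 78)
   where
   by : Dec (p ℕ.< 5) → Dec (p ℕ.< 78) → (deg p (ss3 p) ≡ linearCount p fs) ⇔ (p ∣ orderFi24')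
   by (yes p<5) _ = tiny (ss3 p) orderFi24' (cong (λ b → if b then XP else ssGeneric p (m₃ p) (Defs.δ p) (Defs.δ p) 108 (β₃ p))) refl refl p<5 fs isf
   by (no p≮5) (yes p<78) = SetupConsequences.small (proj₁ (setup₃ (≮⇒≥ p≮5))) orderFi24' (in-range {λ p → Data.Bool.T (agrees₃ p)} 73 range₃ (≮⇒≥ p≮5) p<78) fs isf
   by (no p≮5) (no p≮78) = mk⇔ (λ e → ⊥-elim (large₃ (≮⇒≥ p≮5) (≮⇒≥ p≮78) fs isf e)) (λ d → ⊥-elim (p≮78 (≤-<-trans (∣-bound fischerFactors fischerFactors≤29 d) (m≤m+n 30 48))))

theorem1p6 : (p : ℕ) → Prime p →
    ((fs : List Poly) → IsFactorization p (ss2 p) fs →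
    ((deg p (ss2 p) ≡ linearCount p fs) ⇔ (p ∣ orderBabyMonster)))
    ×
    ((fs : List Poly) → IsFactorization p (ss3 p) fs →
    ((deg p (ss3 p) ≡ linearCount p fs) ⇔ (p ∣ orderFi24')))
theorem1p6 p pp = Main.baby-monster p pp , Main.fischer p pp
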